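{- For every fixed pair of distinct real weights $a,b$, there is an algorithm that, given an $n$-vertex tree $T$, decides whether $T$ admits a proper $\{a,b\}$-edge-weighting and, if so, constructs one, in $O(n)$ time using $O(n)$ space.
   Context: All graphs are finite and simple; the one-vertex tree is allowed. An $\{a,b\}$-edge-weighting of a graph $G$ is a map $\omega:E(G)\to\{a,b\}$; it induces the weighted degree $s_\omega(v)=\sum_{e\ni v}\omega(e)$ at each vertex $v$, and it is proper if $s_\omega(u)\neq s_\omega(v)$ for every edge $uv$ of $G$. Computational model: the bounds hold on a word RAM with word size $\Theta(\log n)$. The weights $a$ and $b$ are fixed constants (not part of the input), so the algorithm and the constants in the $O$-notation may depend on $a,b$. Weighted degrees are represented as follows. If $a$ and $b$ are linearly independent over $\mathbb{Q}$, the weighted degree of a vertex is represented by the ordered pair consisting of the numbers of its incident edges of weights $a$ and $b$. Otherwise, write $(a,b)=c(p,q)$ for a nonzero real number $c$ and fixed coprime integers $p,q$, and represent the weighted degree $xa+yb$ by the integer $px+qy$. Equality of represented values is equivalent to equality of weighted degrees, and each represented value uses $O(\log n)$ bits. -}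

module Defs where

open import Algebra.Bundles using (CommutativeMonoid)
import Algebra.Properties.CommutativeSemigroup as CommutativeSemigroupProperties
open import Data.Bool.Base using (Bool; true; false; if_then_else_)
open import Data.Fin.Base using (Fin; toℕ)
import Data.Fin.Properties as Fin
open import Data.List.Base using (List; []; _∷_; _∷ʳ_; length; map; foldr; filter; concatMap; allFin)
open import Data.List.Relation.Unary.Linked using (Linked)
open import Data.List.Relation.Unary.Unique.Propositional using (Unique)
open import Data.Maybe.Base using (Maybe; just; nothing; fromMaybe)
open import Data.Nat.Base using (ℕ; zero; suc; _+_; _*_; _∸_; _^_; _⊔_; _≤_; _<_; _<ᵇ_; _≡ᵇ_; NonZero)
import Data.Nat.DivMod as ℕ
import Data.Nat.Properties as ℕ
open import Data.Product.Base using (Σ; ∃; ∃-syntax; _×_; _,_; proj₁; proj₂; swap)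
open import Data.Rational.Base as ℚ using (ℚ; 0ℚ; ½; ∣_∣)
import Data.Rational.Properties as ℚ
open import Data.Sum.Base using (_⊎_; inj₁; inj₂)
open import Data.Unit.Base using (⊤)
open import Data.Vec.Functional using (Vector; updateAt)
open import Function.Base using (const)
open import Relation.Binary.Construct.Closure.ReflexiveTransitive using (Star)
open import Relation.Binary.PropositionalEquality using (_≡_; _≢_; refl; sym; trans; cong; cong₂; subst)
open import Relation.Nullary using (¬_; Dec)
open import Relation.Nullary.Decidable using (_⊎-dec_)

-- Real numbers: Cauchy sequences of rationals, compared by _≈_.  Only the
-- additive structure is needed to speak of weighted degrees.

record ℝ : Set where
  constructor mkℝ
  field
    seq    : ℕ → ℚ
    cauchy : ∀ ε → 0ℚ ℚ.< ε →
             ∃[ N ] (∀ m n → N ≤ m → N ≤ n → ∣ seq m ℚ.- seq n ∣ ℚ.< ε)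

open ℝ public

infix 4 _≈_ _≉_

_≈_ : ℝ → ℝ → Set
x ≈ y = ∀ ε → 0ℚ ℚ.< ε → ∃[ N ] (∀ n → N ≤ n → ∣ seq x n ℚ.- seq y n ∣ ℚ.< ε)

_≉_ : ℝ → ℝ → Set
x ≉ y = ¬ (x ≈ y)

0ℝ : ℝ
0ℝ = mkℝ (const 0ℚ) (λ ε 0<ε → 0 , λ _ _ _ _ → 0<ε)

private
  open CommutativeSemigroupProperties
    (CommutativeMonoid.commutativeSemigroup ℚ.+-0-commutativeMonoid) using (interchange)

  half-positive : ∀ {ε} → 0ℚ ℚ.< ε → 0ℚ ℚ.< ½ ℚ.* ε
  half-positive {ε} 0<ε =
    subst (ℚ._< ½ ℚ.* ε) (ℚ.*-zeroʳ ½) (ℚ.*-monoʳ-<-pos ½ 0<ε)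

  halves : ∀ ε → ½ ℚ.* ε ℚ.+ ½ ℚ.* ε ≡ ε
  halves ε = trans (sym (ℚ.*-distribʳ-+ ε ½ ½)) (ℚ.*-identityˡ ε)

  difference-of-sums : ∀ p q r s →
    (p ℚ.+ q) ℚ.- (r ℚ.+ s) ≡ (p ℚ.- r) ℚ.+ (q ℚ.- s)
  difference-of-sums p q r s =
    trans (cong (p ℚ.+ q ℚ.+_) (ℚ.neg-distrib-+ r s))
          (interchange p q (ℚ.- r) (ℚ.- s))

infixl 6 _⊕_

_⊕_ : ℝ → ℝ → ℝ
x ⊕ y = mkℝ (λ n → seq x n ℚ.+ seq y n) λ ε 0<ε →
  let (M , x-close) = cauchy x (½ ℚ.* ε) (half-positive 0<ε)
      (N , y-close) = cauchy y (½ ℚ.* ε) (half-positive 0<ε)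
  in  M ⊔ N , λ m n M⊔N≤m M⊔N≤n →
        ℚ.≤-<-trans
          (subst (λ d → ∣ d ∣ ℚ.≤ ∣ seq x m ℚ.- seq x n ∣ ℚ.+ ∣ seq y m ℚ.- seq y n ∣)
            (sym (difference-of-sums (seq x m) (seq y m) (seq x n) (seq y n)))
            (ℚ.∣p+q∣≤∣p∣+∣q∣ (seq x m ℚ.- seq x n) (seq y m ℚ.- seq y n)))
          (subst (∣ seq x m ℚ.- seq x n ∣ ℚ.+ ∣ seq y m ℚ.- seq y n ∣ ℚ.<_)
            (halves ε)
            (ℚ.+-mono-<
              (x-close m n (ℕ.m⊔n≤o⇒m≤o M N M⊔N≤m) (ℕ.m⊔n≤o⇒m≤o M N M⊔N≤n))
              (y-close m n (ℕ.m⊔n≤o⇒n≤o M N M⊔N≤m) (ℕ.m⊔n≤o⇒n≤o M N M⊔N≤n))))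

-- Finite simple graphs on the vertex set Fin n.  The edges are listed in an
-- arbitrary order, and each unordered edge is listed once, in an arbitrary
-- orientation; so a Graph is also an edge-list presentation of a graph.

record Graph (n : ℕ) : Set where
  field
    size     : ℕ
    ends     : Fin size → Fin n × Fin n
    loopless : ∀ e → proj₁ (ends e) ≢ proj₂ (ends e)
    simple   : ∀ e f → ends e ≡ ends f ⊎ ends e ≡ swap (ends f) → e ≡ f

  Edge : Set
  Edge = Fin size

  Adjacent : Fin n → Fin n → Set
  Adjacent u v = ∃[ e ] (ends e ≡ (u , v) ⊎ ends e ≡ (v , u))

  Incident : Fin n → Edge → Set
  Incident v e = v ≡ proj₁ (ends e) ⊎ v ≡ proj₂ (ends e)

  incident? : ∀ v e → Dec (Incident v e)
  incident? v e = (v Fin.≟ proj₁ (ends e)) ⊎-dec (v Fin.≟ proj₂ (ends e))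

  Connected : Set
  Connected = ∀ u v → Star Adjacent u v

  -- A cycle visits v and then, in order, the vertices of vs, all distinct and
  -- at least three in total, before returning to v.
  IsCycle : Fin n → List (Fin n) → Set
  IsCycle v vs = 2 ≤ length vs × Unique (v ∷ vs) × Linked Adjacent (v ∷ vs ∷ʳ v)

  Acyclic : Set
  Acyclic = ∀ v vs → ¬ IsCycle v vs

  IsTree : Set
  IsTree = NonZero n × Connected × Acyclic

open Graph public

-- The subset {a , b} of ℝ, closed under _≈_.
⟨_,_⟩ : ℝ → ℝ → Set
⟨ a , b ⟩ = ∃[ x ] (x ≈ a ⊎ x ≈ b)

module _ {n : ℕ} (a b : ℝ) (G : Graph n) where

  EdgeWeighting : Set
  EdgeWeighting = Edge G → ⟨ a , b ⟩

  weightedDegree : EdgeWeighting → Fin n → ℝ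
  weightedDegree ω v =
    foldr _⊕_ 0ℝ (map (λ e → proj₁ (ω e)) (filter (incident? G v) (allFin (size G))))

  Proper : EdgeWeighting → Set
  Proper ω = ∀ u v → Adjacent G u v → weightedDegree ω u ≉ weightedDegree ω v

-- Word RAM with w-bit words.  Values are unsigned and arithmetic is modulo
-- 2 ^ w, so integers of either sign are available in two's complement.

Word : ℕ → Set
Word w = Fin (2 ^ w)

word : ∀ w → ℕ → Word w
word w x = ℕ._mod_ x (2 ^ w) ⦃ ℕ.m^n≢0 2 w ⦄

data Op : Set where
  add sub mul quot rem : Op

-- Subtraction wraps around; division by zero gives 0.
evalOp : ∀ w → Op → Word w → Word w → Word w
evalOp w add  x y = word w (toℕ x + toℕ y)
evalOp w sub  x y = word w (toℕ x + (2 ^ w ∸ toℕ y))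
evalOp w mul  x y = word w (toℕ x * toℕ y)
evalOp w quot x y with toℕ y
... | zero      = word w 0
... | d@(suc _) = word w (toℕ x ℕ./ d)
evalOp w rem  x y with toℕ y
... | zero      = word w 0
... | d@(suc _) = word w (toℕ x ℕ.% d)

data Instr (r : ℕ) : Set where
  set   : (d : Fin r) (c : ℕ) → Instr r
  arith : (o : Op) (d x y : Fin r) → Instr r
  load  : (d p : Fin r) → Instr r
  store : (p x : Fin r) → Instr r
  jump  : (ℓ : ℕ) → Instr r
  jlt   : (x y : Fin r) (ℓ : ℕ) → Instr r
  jeq   : (x y : Fin r) (ℓ : ℕ) → Instr r

record Program : Set where
  constructor program
  field
    registers : ℕ
    code      : List (Instr registers)

open Program public

record State (w r : ℕ) : Set where
  constructor state
  field
    pc  : ℕ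
    reg : Vector (Word w) r
    mem : Vector (Word w) (2 ^ w)

open State public

_[_]:=_ : ∀ {A : Set} {n} → Vector A n → Fin n → A → Vector A n
xs [ i ]:= x = updateAt xs i (const x)

exec : ∀ {w r} → Instr r → State w r → State w r
exec {w} (set d c)       (state i ρ μ) = state (suc i) (ρ [ d ]:= word w c) μ
exec {w} (arith o d x y) (state i ρ μ) = state (suc i) (ρ [ d ]:= evalOp w o (ρ x) (ρ y)) μ
exec     (load d p)      (state i ρ μ) = state (suc i) (ρ [ d ]:= μ (ρ p)) μ
exec     (store p x)     (state i ρ μ) = state (suc i) ρ (μ [ ρ p ]:= ρ x)
exec     (jump ℓ)        (state i ρ μ) = state ℓ ρ μ
exec     (jlt x y ℓ)     (state i ρ μ) =
  state (if toℕ (ρ x) <ᵇ toℕ (ρ y) then ℓ else suc i) ρ μ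
exec     (jeq x y ℓ)     (state i ρ μ) =
  state (if toℕ (ρ x) ≡ᵇ toℕ (ρ y) then ℓ else suc i) ρ μ

AccessesBelow : ∀ {w r} → ℕ → Instr r → State w r → Set
AccessesBelow S (load d p)  s = toℕ (reg s p) < S
AccessesBelow S (store p x) s = toℕ (reg s p) < S
AccessesBelow S _           s = ⊤

nth : ∀ {A : Set} → List A → ℕ → Maybe A
nth []       _       = nothing
nth (x ∷ _)  zero    = just x
nth (_ ∷ xs) (suc i) = nth xs i

-- Run P S t s s′: started in s, the program P halts in s′ after exactly t steps,
-- accessing only memory cells with address below S.  The registers, whose number
-- is a constant of the program, are not counted in S.  A program halts when the
-- program counter leaves the code.
data Run {w : ℕ} (P : Program) (S : ℕ) :
         ℕ → State w (registers P) → State w (registers P) → Set where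
  halt : ∀ {s} → nth (code P) (pc s) ≡ nothing → Run P S 0 s s
  step : ∀ {t s s′} {i : Instr (registers P)} →
         nth (code P) (pc s) ≡ just i →
         AccessesBelow S i s →
         Run P S t (exec i s) s′ →
         Run P S (suc t) s s′

-- The input occupies the first 2 + 2 · size G memory cells; all other cells and
-- all registers are initially 0.
input : ∀ {n} → Graph n → List ℕ
input {n} G = n ∷ size G ∷
  concatMap (λ e → toℕ (proj₁ (ends G e)) ∷ toℕ (proj₂ (ends G e)) ∷ []) (allFin (size G))

initial : ∀ {n} w r → Graph n → State w r
initial w r G = state 0 (const (word w 0)) λ i → word w (fromMaybe 0 (nth (input G) (toℕ i)))

encode : ∀ a b → ⟨ a , b ⟩ → ℕ
encode a b (_ , inj₁ _) = 0
encode a b (_ , inj₂ _) = 1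

-- Cell 0 holds the answer (1 for yes, 0 for no); after a positive answer, cell
-- 1 + e tells whether the edge e receives the weight a or the weight b.
CorrectOutput : ∀ {n} (a b : ℝ) (G : Graph n) {w r : ℕ} → State w r → Set
CorrectOutput a b G {w} s =
    (mem s (word w 0) ≡ word w 1 ×
      Σ (EdgeWeighting a b G) λ ω → Proper a b G ω ×
        (∀ e → mem s (word w (1 + toℕ e)) ≡ word w (encode a b (ω e))))
  ⊎ (mem s (word w 0) ≡ word w 0 × ¬ Σ (EdgeWeighting a b G) (Proper a b G))

{-# OPTIONS --safe #-}
module Submission where

-- Whether two weighted degrees agree is an integer question: excluded middle tells
-- whether a, b are dependent over ℚ, and either way a vertex of degree d with J edges
-- of weight b gets the key 2 + P (d ∸ J) + Q J + R (n ∸ J), such that degrees are equal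
-- iff the keys and the values r d are. The tree is peeled leaf by leaf; a vertex that
-- carries its degree and the sum of its edge numbers knows its last edge without any
-- adjacency list. Bottom up, the edge above v with a given weight either works for no,
-- for every, or for every but one key of the parent, so one code per weight suffices;
-- v only counts the codes of its children and tries each J ≤ d. Top down, a feasible J
-- is chosen and weights are handed out. The program is written in a structured language
-- with word-sized variables and arrays, whose compilation to the RAM is simulated step
-- by step.

open import Data.Product.Base using (Σ; ∃; ∃-syntax; _×_; _,_; proj₁; proj₂)
open import Data.Sum.Base using (_⊎_; inj₁; inj₂)
open import Data.Unit.Base using (⊤; tt)
open import Function.Base using (_∘_; case_of_; const)
open import Relation.Binary.PropositionalEquality
open import Relation.Nullary using (¬_; Dec; yes; no; does; contradiction)

private

  module StructuredPrograms where

    open import Defs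
    open import Data.Bool.Base using (Bool; true; false; if_then_else_; T)
    open import Data.Fin.Base using (Fin; zero; suc; toℕ; fromℕ<; _↑ˡ_; _↑ʳ_; splitAt)
    open import Data.Fin.Properties using () renaming (_≟_ to _≟ᶠ_)
    open import Data.Fin.Properties using (toℕ<n; toℕ-injective; toℕ-fromℕ<; splitAt-↑ˡ; splitAt-↑ʳ; ↑ˡ-injective; ↑ʳ-injective; fromℕ<-injective)
    open import Data.List.Base using (List; []; _∷_; _++_; length)
    open import Data.Maybe.Base using (just; nothing)
    open import Data.Nat.Base
    open import Data.Nat.DivMod using (m<n⇒m%n≡m; [m+n]%n≡m%n; _%_)
    open import Data.Nat.Properties
    open import Data.Vec.Functional.Properties using (updateAt-updates; updateAt-minimal)
    open import Relation.Binary.Definitions using (tri<; tri≈; tri>)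

    b2n : Bool → ℕ
    b2n false = 0
    b2n true  = 1

    eqn ltn : ℕ → ℕ → ℕ
    eqn x y = b2n (x ≡ᵇ y)
    ltn x y = b2n (x <ᵇ y)

    choose : ℕ → ℕ → ℕ → ℕ
    choose zero    x y = y
    choose (suc _) x y = x

    upd : (ℕ → ℕ) → ℕ → ℕ → ℕ → ℕ
    upd f i z j = if i ≡ᵇ j then z else f j

    _=ᶠ_ : ∀ {m n} → Fin m → Fin n → Bool
    zero  =ᶠ zero  = true
    zero  =ᶠ suc _ = false
    suc _ =ᶠ zero  = false
    suc i =ᶠ suc j = i =ᶠ j

    =ᶠ-refl : ∀ {n} (i : Fin n) → (i =ᶠ i) ≡ true
    =ᶠ-refl zero    = refl
    =ᶠ-refl (suc i) = =ᶠ-refl i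

    =ᶠ-≢ : ∀ {n} {i j : Fin n} → i ≢ j → (i =ᶠ j) ≡ false
    =ᶠ-≢ {i = zero}  {zero}  p = contradiction refl p
    =ᶠ-≢ {i = zero}  {suc j} p = refl
    =ᶠ-≢ {i = suc i} {zero}  p = refl
    =ᶠ-≢ {i = suc i} {suc j} p = =ᶠ-≢ (p ∘ cong suc)

    ≡ᵇ-refl : ∀ i → (i ≡ᵇ i) ≡ true
    ≡ᵇ-refl zero    = refl
    ≡ᵇ-refl (suc i) = ≡ᵇ-refl i

    ≡ᵇ-≢ : ∀ i j → i ≢ j → (i ≡ᵇ j) ≡ false
    ≡ᵇ-≢ zero    zero    p = contradiction refl p
    ≡ᵇ-≢ zero    (suc j) p = refl
    ≡ᵇ-≢ (suc i) zero    p = refl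
    ≡ᵇ-≢ (suc i) (suc j) p = ≡ᵇ-≢ i j (p ∘ cong suc)

    data Bin : Set where
      plus minus times less equal : Bin

    sem : Bin → ℕ → ℕ → ℕ
    sem plus  x y = x + y
    sem minus x y = x ∸ y
    sem times x y = x * y
    sem less  x y = ltn x y
    sem equal x y = eqn x y

    #v #a : ℕ
    #v = 30
    #a = 18

    Var Arr : Set
    Var = Fin #v
    Arr = Fin #a

    data Exp : ℕ → Set where
      con : ∀ {d} (c : ℕ) {_ : T (c <ᵇ 8)} → Exp d
      big : ∀ {d} → ℕ → Exp d
      var : ∀ {d} → Var → Exp d
      get : ∀ {d} → Arr → Exp d → Exp d
      bin : ∀ {d} → Bin → Exp (suc d) → Exp d → Exp (suc d)
      sel : ∀ {d} → Exp (suc (suc d)) → Exp (suc d) → Exp d → Exp (suc (suc d))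

    infix 4 _≔_ _⟦_⟧≔_
    data Stm : Set where
      _≔_    : Var → Exp 7 → Stm
      _⟦_⟧≔_ : Arr → Exp 7 → Exp 6 → Stm

    infixr 3 _⨟_
    data Cmd : Set where
      block  : List Stm → Cmd
      _⨟_    : Cmd → Cmd → Cmd
      branch : Exp 7 → Cmd → Cmd → Cmd
      loop   : Exp 7 → Cmd → Cmd

    record St : Set where
      constructor ⟨_∣_⟩
      field
        vr : Var → ℕ
        ar : Arr → ℕ → ℕ
    open St public

    ev : ∀ {d} → Exp d → St → ℕ
    ev (con c)       σ = c
    ev (big c)       σ = c
    ev (var v)       σ = vr σ v
    ev (get k e)     σ = ar σ k (ev e σ)
    ev (bin o e f)   σ = sem o (ev e σ) (ev f σ)
    ev (sel c e f)   σ = choose (ev c σ) (ev e σ) (ev f σ)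

    run₁ : Stm → St → St
    run₁ (v ≔ e)        σ = ⟨ (λ u → if v =ᶠ u then ev e σ else vr σ u) ∣ ar σ ⟩
    run₁ (k ⟦ e ⟧≔ f) σ = ⟨ vr σ ∣ (λ l j → if k =ᶠ l then upd (ar σ k) (ev e σ) (ev f σ) j else ar σ l j) ⟩

    run : List Stm → St → St
    run []       σ = σ
    run (b ∷ bs) σ = run bs (run₁ b σ)

    costE : ∀ {d} → Exp d → ℕ
    costE (con _)         = 1
    costE (big _)         = 1
    costE (var _)         = 2
    costE (get _ e)       = costE e + 4
    costE (bin plus e f)  = costE e + (costE f + 1)
    costE (bin times e f) = costE e + (costE f + 1)
    costE (bin _ e f)     = costE e + (costE f + 3)
    costE (sel c e f)     = costE c + (costE e + (costE f + 4))

    cost₁ : Stm → ℕ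
    cost₁ (v ≔ e)      = costE e + 2
    cost₁ (k ⟦ e ⟧≔ f) = costE e + (3 + (costE f + 1))

    costB : List Stm → ℕ
    costB []       = 0
    costB (b ∷ bs) = cost₁ b + costB bs

    -- Side conditions under which the word RAM computes as the natural numbers
    -- do, in continuation-passing style so that they form a flat product.
    module Semantics (M st : ℕ) where

      OkBin : Bin → ℕ → ℕ → Set → Set
      OkBin plus  x y X = x + y < M × X
      OkBin times x y X = x * y < M × X
      OkBin _     x y X = X

      Ok : ∀ {d} → Exp d → St → Set → Set
      Ok (con _)     σ X = X
      Ok (big c)     σ X = c < M × X
      Ok (var _)     σ X = X
      Ok (get k e)   σ X = Ok e σ (ev e σ < st × X)
      Ok (bin o e f) σ X = Ok e σ (Ok f σ (OkBin o (ev e σ) (ev f σ) X))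
      Ok (sel c e f) σ X = Ok c σ (Ok e σ (Ok f σ X))

      Ok₁ : Stm → St → Set → Set
      Ok₁ (v ≔ e)      σ X = Ok e σ X
      Ok₁ (k ⟦ e ⟧≔ f) σ X = Ok e σ (ev e σ < st × Ok f σ X)

      OkB : List Stm → St → Set → Set
      OkB []       σ X = X
      OkB (b ∷ bs) σ X = Ok₁ b σ (OkB bs (run₁ b σ) X)

      data Exec : Cmd → St → ℕ → St → Set where
        blk : ∀ {bs σ} → OkB bs σ ⊤ → Exec (block bs) σ (costB bs) (run bs σ)
        sq  : ∀ {c₁ c₂ σ₁ σ₂ σ₃ t₁ t₂} → Exec c₁ σ₁ t₁ σ₂ → Exec c₂ σ₂ t₂ σ₃ →
              Exec (c₁ ⨟ c₂) σ₁ (t₁ + t₂) σ₃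
        brT : ∀ {e c₁ c₂ σ σ′ t} → Ok e σ ⊤ → ev e σ ≢ 0 → Exec c₁ σ t σ′ →
              Exec (branch e c₁ c₂) σ (costE e + (2 + (t + 1))) σ′
        brF : ∀ {e c₁ c₂ σ σ′ t} → Ok e σ ⊤ → ev e σ ≡ 0 → Exec c₂ σ t σ′ →
              Exec (branch e c₁ c₂) σ (costE e + (2 + t)) σ′
        lpT : ∀ {e c σ₁ σ₂ σ₃ t₁ t₂} → Ok e σ₁ ⊤ → ev e σ₁ ≢ 0 → Exec c σ₁ t₁ σ₂ →
              Exec (loop e c) σ₂ t₂ σ₃ → Exec (loop e c) σ₁ (costE e + (2 + (t₁ + (1 + t₂)))) σ₃
        lpF : ∀ {e c σ} → Ok e σ ⊤ → ev e σ ≡ 0 → Exec (loop e c) σ (costE e + 2) σ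

    #r : ℕ
    #r = 2 + (8 + #v)

    pattern scr = zero
    pattern str = suc zero

    tmp : (d : ℕ) → .(d < 8) → Fin #r
    tmp d p = suc (suc (fromℕ< {d} {8} p ↑ˡ #v))

    vreg : Var → Fin #r
    vreg v = suc (suc (8 ↑ʳ v))

    codeBin : Bin → (a b : Fin #r) → ℕ → List (Instr #r)
    codeBin plus  a b o = arith add a a b ∷ []
    codeBin times a b o = arith mul a a b ∷ []
    codeBin minus a b o = jlt a b (3 + o) ∷ arith sub a a b ∷ jump (5 + o) ∷ set a 0 ∷ jump (5 + o) ∷ []
    codeBin less  a b o = jlt a b (3 + o) ∷ set a 0 ∷ jump (5 + o) ∷ set a 1 ∷ jump (5 + o) ∷ []
    codeBin equal a b o = jeq a b (3 + o) ∷ set a 0 ∷ jump (5 + o) ∷ set a 1 ∷ jump (5 + o) ∷ []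

    endBin : Bin → ℕ → ℕ
    endBin plus  o = suc o
    endBin times o = suc o
    endBin _     o = 5 + o

    endE : ∀ {d} → Exp d → ℕ → ℕ
    endE (con _)     o = suc o
    endE (big _)     o = suc o
    endE (var _)     o = 2 + o
    endE (get k e)   o = 4 + endE e o
    endE (bin q e f) o = endBin q (endE f (endE e o))
    endE (sel c e f) o = 6 + endE f (endE e (endE c o))

    codeE : ∀ {d} → Exp d → .(d < 8) → ℕ → List (Instr #r)
    codeE {d} (con c)   p o = set (tmp d p) c ∷ []
    codeE {d} (big c)   p o = set (tmp d p) c ∷ []
    codeE {d} (var v)   p o = set scr 0 ∷ arith add (tmp d p) (vreg v) scr ∷ []
    codeE {d} (get k e) p o = codeE e p o ++
      set scr (toℕ k) ∷ arith mul scr scr str ∷ arith add (tmp d p) (tmp d p) scr ∷ load (tmp d p) (tmp d p) ∷ []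
    codeE {suc d} (bin q e f) p o = codeE e p o ++ codeE f (<⇒≤ p) (endE e o) ++
      codeBin q (tmp (suc d) p) (tmp d (<⇒≤ p)) (endE f (endE e o))
    codeE {suc (suc d)} (sel c e f) p o =
      codeE c p o ++ codeE e (<⇒≤ p) (endE c o) ++ codeE f (<⇒≤ (<⇒≤ p)) (endE e (endE c o)) ++
      set scr 0 ∷ jeq a scr (4 + q) ∷ arith add a (tmp (suc d) (<⇒≤ p)) scr ∷ jump (6 + q) ∷
        arith add a (tmp d (<⇒≤ (<⇒≤ p))) scr ∷ jump (6 + q) ∷ []
      where q = endE f (endE e (endE c o))
            a = tmp (suc (suc d)) p

    p6 : 6 < 8
    p6 = s≤s (s≤s (s≤s (s≤s (s≤s (s≤s (s≤s z≤n))))))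
    p7 : 7 < 8
    p7 = ≤-refl

    end₁ : Stm → ℕ → ℕ
    end₁ (v ≔ e)      o = 2 + endE e o
    end₁ (k ⟦ e ⟧≔ f) o = suc (endE f (3 + endE e o))

    code₁ : Stm → ℕ → List (Instr #r)
    code₁ (v ≔ e) o = codeE e p7 o ++ set scr 0 ∷ arith add (vreg v) (tmp 7 p7) scr ∷ []
    code₁ (k ⟦ e ⟧≔ f) o = codeE e p7 o ++
      (set scr (toℕ k) ∷ arith mul scr scr str ∷ arith add (tmp 7 p7) (tmp 7 p7) scr ∷ []) ++
      codeE f p6 (3 + endE e o) ++ store (tmp 7 p7) (tmp 6 p6) ∷ []

    endB : List Stm → ℕ → ℕ
    endB []       o = o
    endB (b ∷ bs) o = endB bs (end₁ b o)

    codeB : List Stm → ℕ → List (Instr #r)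
    codeB []       o = []
    codeB (b ∷ bs) o = code₁ b o ++ codeB bs (end₁ b o)

    endC : Cmd → ℕ → ℕ
    endC (block bs)      o = endB bs o
    endC (c ⨟ d)        o = endC d (endC c o)
    endC (branch e c d) o = endC d (suc (endC c (2 + endE e o)))
    endC (loop e c)     o = suc (endC c (2 + endE e o))

    codeC : Cmd → ℕ → List (Instr #r)
    codeC (block bs)     o = codeB bs o
    codeC (c ⨟ d)        o = codeC c o ++ codeC d (endC c o)
    codeC (branch e c d) o = codeE e p7 o ++
      (set scr 0 ∷ jeq (tmp 7 p7) scr (suc m) ∷ []) ++
      codeC c (2 + endE e o) ++ jump (endC d (suc m)) ∷ codeC d (suc m)
      where m = endC c (2 + endE e o)
    codeC (loop e c) o = codeE e p7 o ++
      (set scr 0 ∷ jeq (tmp 7 p7) scr (suc m) ∷ []) ++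
      codeC c (2 + endE e o) ++ jump o ∷ []
      where m = endC c (2 + endE e o)

    module Simulation
      (w st S : ℕ) (C : List (Instr #r))
      (8≤M : 8 ≤ 2 ^ w) (cells<M : #a * st ≤ 2 ^ w) (cells<S : #a * st ≤ S) where

      private
        P : Program
        P = program #r C

        M : ℕ
        M = 2 ^ w

        Conf : Set
        Conf = State w #r

      open Semantics M st

      toℕ-word : ∀ {x} → x < M → toℕ (word w x) ≡ x
      toℕ-word x<M = trans (toℕ-fromℕ< _) (m<n⇒m%n≡m ⦃ m^n≢0 2 w ⦄ x<M)

      data Steps : ℕ → Conf → Conf → Set where
        []  : ∀ {s} → Steps 0 s s
        one : ∀ {t s s′ i} → nth C (pc s) ≡ just i → AccessesBelow S i s →
              Steps t (exec i s) s′ → Steps (suc t) s s′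

      infixr 5 _▹_
      _▹_ : ∀ {t u s s′ s″} → Steps t s s′ → Steps u s′ s″ → Steps (t + u) s s″
      []          ▹ q = q
      one a b p   ▹ q = one a b (p ▹ q)

      steps⇒run : ∀ {t s s′} → Steps t s s′ → nth C (pc s′) ≡ nothing → Run P S t s s′
      steps⇒run []          h = halt h
      steps⇒run (one a b p) h = step a b (steps⇒run p h)

      At : ℕ → List (Instr #r) → Set
      At o []       = ⊤
      At o (i ∷ is) = nth C o ≡ just i × At (suc o) is

      At-++ : ∀ o is js → At o (is ++ js) → At o is × At (length is + o) js
      At-++ o []       js a       = tt , a
      At-++ o (i ∷ is) js (h , a) with At-++ (suc o) is js a
      ... | a₁ , a₂ = (h , a₁) , subst (λ q → At q js) (+-suc (length is) o) a₂

      at-++ : ∀ {o o′} is {js} → length is + o ≡ o′ → At o (is ++ js) → At o is × At o′ js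
      at-++ {o} is {js} refl a = At-++ o is js a

      len : ∀ {X : Set} (is js : List X) {o o′ o″ : ℕ} → length is + o ≡ o′ → length js + o′ ≡ o″ → length (is ++ js) + o ≡ o″
      len []       js refl q = q
      len (i ∷ is) js {o} {o′} p q = trans (sym (+-suc (length (is ++ js)) o)) (len is js (trans (+-suc (length is) o) p) q)

      pre : ∀ m {l o o′ : ℕ} → l + (m + o) ≡ o′ → m + (l + o) ≡ o′
      pre m {l} {o} p = trans (trans (sym (+-assoc m l o)) (trans (cong (_+ o) (+-comm m l)) (+-assoc l m o))) p

      lenBin : ∀ q a b o → length (codeBin q a b o) + o ≡ endBin q o
      lenBin plus  a b o = refl
      lenBin minus a b o = refl
      lenBin times a b o = refl
      lenBin less  a b o = refl
      lenBin equal a b o = refl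

      lenE : ∀ {d} (e : Exp d) .(p : d < 8) o → length (codeE e p o) + o ≡ endE e o
      lenE (con c)   p o = refl
      lenE (big c)   p o = refl
      lenE (var v)   p o = refl
      lenE (get k e) p o = len (codeE e p o) _ (lenE e p o) refl
      lenE (bin q e f) p o = len (codeE e p o) _ (lenE e p o)
        (len (codeE f (<⇒≤ p) (endE e o)) _ (lenE f (<⇒≤ p) _) (lenBin q _ _ _))
      lenE (sel c e f) p o = len (codeE c p o) _ (lenE c p o)
        (len (codeE e (<⇒≤ p) (endE c o)) _ (lenE e (<⇒≤ p) _)
          (len (codeE f (<⇒≤ (<⇒≤ p)) (endE e (endE c o))) _ (lenE f (<⇒≤ (<⇒≤ p)) _) refl))

      len₁ : ∀ b o → length (code₁ b o) + o ≡ end₁ b o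
      len₁ (v ≔ e) o = len (codeE e p7 o) _ (lenE e p7 o) refl
      len₁ (k ⟦ e ⟧≔ f) o = len (codeE e p7 o) _ (lenE e p7 o)
        (pre 3 (len (codeE f p6 _) _ (lenE f p6 _) refl))

      lenB : ∀ bs o → length (codeB bs o) + o ≡ endB bs o
      lenB []       o = refl
      lenB (b ∷ bs) o = len (code₁ b o) _ (len₁ b o) (lenB bs _)

      lenC : ∀ c o → length (codeC c o) + o ≡ endC c o
      lenC (block bs) o = lenB bs o
      lenC (c ⨟ d)    o = len (codeC c o) _ (lenC c o) (lenC d _)
      lenC (branch e c d) o = len (codeE e p7 o) _ (lenE e p7 o)
        (pre 2 (len (codeC c (2 + endE e o)) _ (lenC c _) (pre 1 (lenC d _))))
      lenC (loop e c) o = len (codeE e p7 o) _ (lenE e p7 o)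
        (pre 2 (len (codeC c (2 + endE e o)) _ (lenC c _) refl))

      record Rel (σ : St) (s : Conf) : Set where
        constructor rel
        field
          vars  : ∀ v → toℕ (reg s (vreg v)) ≡ vr σ v
          base  : toℕ (reg s str) ≡ st
          cells : ∀ (i : Word w) (k : Arr) x → x < st → toℕ i ≡ toℕ k * st + x → toℕ (mem s i) ≡ ar σ k x
      open Rel public

      Free : Fin #r → Set
      Free r = r ≢ str × (∀ v → r ≢ vreg v)

      suc-inj² : ∀ {n} {i j : Fin n} → _≡_ {A = Fin (2 + n)} (suc (suc i)) (suc (suc j)) → i ≡ j
      suc-inj² refl = refl

      tmp-free : ∀ d .(p : d < 8) → Free (tmp d p)
      tmp-free d p = (λ ()) , λ v eq → case trans (sym (splitAt-↑ˡ 8 (fromℕ< p) #v)) (trans (cong (splitAt 8) (suc-inj² eq)) (splitAt-↑ʳ 8 #v v)) of λ ()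

      scr-free : Free scr
      scr-free = (λ ()) , λ v ()

      tmp-≢ : ∀ {d d′} .(p : d < 8) .(p′ : d′ < 8) → d ≢ d′ → tmp d p ≢ tmp d′ p′
      tmp-≢ p p′ d≢d′ eq = d≢d′ (fromℕ<-injective _ _ p p′ (↑ˡ-injective #v _ _ (suc-inj² eq)))

      vreg-inj : ∀ {u v} → vreg u ≡ vreg v → u ≡ v
      vreg-inj {u} {v} eq = ↑ʳ-injective 8 u v (suc-inj² eq)

      here : ∀ (ρ : Fin #r → Word w) r {x} → (ρ [ r ]:= x) r ≡ x
      here ρ r = updateAt-updates r ρ

      there : ∀ (ρ : Fin #r → Word w) {r r′} {x} → r ≢ r′ → (ρ [ r ]:= x) r′ ≡ ρ r′
      there ρ {r} {r′} r≢r′ = updateAt-minimal r′ r ρ (r≢r′ ∘ sym)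

      relW : ∀ {σ s r x q} → Free r → Rel σ s → Rel σ (state q (reg s [ r ]:= x) (mem s))
      relW {s = s} (f , g) (rel v b c) =
        rel (λ u → trans (cong toℕ (there (reg s) (g u))) (v u)) (trans (cong toℕ (there (reg s) f)) b) c

      relS : ∀ {σ s x} → Rel σ s → Rel σ (state (pc s) (reg s [ scr ]:= x) (mem s))
      relS {s = s} = relW {q = pc s} scr-free

      record Evald {d} (e : Exp d) (p : d < 8) (o : ℕ) (σ : St) (s : Conf) : Set where
        constructor evald
        field
          {fin}  : Conf
          path   : Steps (costE e) s fin
          pcEnd  : pc fin ≡ endE e o
          relEnd : Rel σ fin
          value  : toℕ (reg fin (tmp d p)) ≡ ev e σ
          keep   : ∀ d′ (p′ : d′ < 8) → d < d′ → reg fin (tmp d′ p′) ≡ reg s (tmp d′ p′)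

      record BinDone q (a b : Fin #r) (x y : ℕ) (o : ℕ) (σ : St) (s : Conf) : Set where
        constructor binDone
        field
          {fin}  : Conf
          {time} : ℕ
          path   : Steps time s fin
          timeEq : ∀ {d} (e : Exp (suc d)) f → costE e + (costE f + time) ≡ costE (bin q e f)
          pcEnd  : pc fin ≡ endBin q o
          relEnd : Rel σ fin
          value  : toℕ (reg fin a) ≡ sem q x y
          keep   : ∀ r → a ≢ r → reg fin r ≡ reg s r

      0<M : 0 < M
      0<M = <-≤-trans z<s 8≤M
      1<M : 1 < M
      1<M = <-≤-trans (s<s z<s) 8≤M

      sub-word : ∀ (x y : Word w) → toℕ y ≤ toℕ x → toℕ (evalOp w sub x y) ≡ toℕ x ∸ toℕ y
      sub-word x y y≤x = trans (toℕ-fromℕ< _) (trans (cong (λ z → _%_ z M ⦃ m^n≢0 2 w ⦄) eq)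
          (trans ([m+n]%n≡m%n (toℕ x ∸ toℕ y) M ⦃ m^n≢0 2 w ⦄)
            (m<n⇒m%n≡m ⦃ m^n≢0 2 w ⦄ (≤-<-trans (m∸n≤m (toℕ x) (toℕ y)) (toℕ<n x)))))
        where
        eq : toℕ x + (M ∸ toℕ y) ≡ toℕ x ∸ toℕ y + M
        eq = trans (sym (+-∸-assoc (toℕ x) (<⇒≤ (toℕ<n y)))) (trans (cong (_∸ toℕ y) (+-comm (toℕ x) M))
          (trans (+-∸-assoc M y≤x) (+-comm M _)))

      <ᵇ-false : ∀ {x y} → (x <ᵇ y) ≡ false → y ≤ x
      <ᵇ-false {x} {y} eq with x <? y
      ... | yes x<y = contradiction (<⇒<ᵇ x<y) (subst (¬_ ∘ T) (sym eq) (λ b → b))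
      ... | no  x≮y = ≮⇒≥ x≮y

      <ᵇ-true : ∀ {x y} → (x <ᵇ y) ≡ true → x < y
      <ᵇ-true {x} {y} eq = <ᵇ⇒< x y (subst T (sym eq) tt)

      record Writes (i : Instr #r) (a : Fin #r) (z : Word w) (ρ : Fin #r → Word w) (μ : Word w → Word w) : Set where
        constructor writes
        field
          access : ∀ (s : Conf) → AccessesBelow S i s
          effect : ∀ q → exec {w} i (state q ρ μ) ≡ state (suc q) (ρ [ a ]:= z) μ

      fork : ∀ {o a i₁ i₂ z₁ z₂ ρ μ} b → nth C (suc o) ≡ just i₁ → nth C (2 + o) ≡ just (jump (5 + o)) →
        nth C (3 + o) ≡ just i₂ → nth C (4 + o) ≡ just (jump (5 + o)) →
        Writes i₁ a z₁ ρ μ → Writes i₂ a z₂ ρ μ →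
        Steps 2 (state (if b then 3 + o else suc o) ρ μ) (state (5 + o) (ρ [ a ]:= (if b then z₂ else z₁)) μ)
      fork false h₁ h₂ h₃ h₄ (writes a e) _ = one h₁ (a _) (subst (λ s → Steps 1 s _) (sym (e _)) (one h₂ tt []))
      fork true  h₁ h₂ h₃ h₄ _ (writes a e) = one h₃ (a _) (subst (λ s → Steps 1 s _) (sym (e _)) (one h₄ tt []))

      if-word : ∀ b → toℕ (if b then word w 1 else word w 0) ≡ b2n b
      if-word false = toℕ-word 0<M
      if-word true  = toℕ-word 1<M

      if-monus : ∀ (x y : Word w) {b} → (toℕ x <ᵇ toℕ y) ≡ b →
        toℕ (if b then word w 0 else evalOp w sub x y) ≡ toℕ x ∸ toℕ y
      if-monus x y {true}  eq = trans (toℕ-word 0<M) (sym (m≤n⇒m∸n≡0 (<⇒≤ (<ᵇ-true {toℕ x} {toℕ y} eq))))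
      if-monus x y {false} eq = sub-word x y (<ᵇ-false {toℕ x} {toℕ y} eq)

      binOK : ∀ q {a b o X σ s x y} → At o (codeBin q a b o) → pc s ≡ o → Rel σ s → Free a →
        toℕ (reg s a) ≡ x → toℕ (reg s b) ≡ y → OkBin q x y X → X × BinDone q a b x y o σ s
      binOK plus {a} {s = s} (h , _) refl R f refl refl (ok , X) =
        X , binDone (one h tt []) (λ e f → refl) refl (relW f R)
          (trans (cong toℕ (here (reg s) a)) (toℕ-word ok)) (λ r ne → there (reg s) ne)
      binOK times {a} {s = s} (h , _) refl R f refl refl (ok , X) =
        X , binDone (one h tt []) (λ e f → refl) refl (relW f R)
          (trans (cong toℕ (here (reg s) a)) (toℕ-word ok)) (λ r ne → there (reg s) ne)
      binOK minus {a} {s = s} (h₀ , h₁ , h₂ , h₃ , h₄ , _) refl R f refl refl X =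
        X , binDone (one h₀ tt (fork {a = a} _ h₁ h₂ h₃ h₄ (writes (λ _ → tt) (λ _ → refl)) (writes (λ _ → tt) (λ _ → refl)))) (λ e f → refl) refl (relW f R)
          (trans (cong toℕ (here (reg s) a)) (if-monus (reg s a) (reg s _) refl)) (λ r ne → there (reg s) ne)
      binOK less {a} {s = s} (h₀ , h₁ , h₂ , h₃ , h₄ , _) refl R f refl refl X =
        X , binDone (one h₀ tt (fork {a = a} _ h₁ h₂ h₃ h₄ (writes (λ _ → tt) (λ _ → refl)) (writes (λ _ → tt) (λ _ → refl)))) (λ e f → refl) refl (relW f R)
          (trans (cong toℕ (here (reg s) a)) (if-word _)) (λ r ne → there (reg s) ne)
      binOK equal {a} {s = s} (h₀ , h₁ , h₂ , h₃ , h₄ , _) refl R f refl refl X =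
        X , binDone (one h₀ tt (fork {a = a} _ h₁ h₂ h₃ h₄ (writes (λ _ → tt) (λ _ → refl)) (writes (λ _ → tt) (λ _ → refl)))) (λ e f → refl) refl (relW f R)
          (trans (cong toℕ (here (reg s) a)) (if-word _)) (λ r ne → there (reg s) ne)

      at-E : ∀ {d} (e : Exp d) .(p : d < 8) {o js} → At o (codeE e p o ++ js) → At o (codeE e p o) × At (endE e o) js
      at-E e p {o} = at-++ (codeE e p o) (lenE e p o)

      strideOK : ∀ {k : Arr} {x a s o σ} → x < st → At o (set scr (toℕ k) ∷ arith mul scr scr str ∷ arith add a a scr ∷ []) →
        pc s ≡ o → Rel σ s → Free a → scr ≢ a → toℕ (reg s a) ≡ x →
        ∃[ s′ ] Steps 3 s s′ × pc s′ ≡ 3 + o × Rel σ s′ × toℕ (reg s′ a) ≡ toℕ k * st + x × (toℕ k * st + x < #a * st) ×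
          (∀ r → scr ≢ r → a ≢ r → reg s′ r ≡ reg s r)
      strideOK {k} {x} {a} {s} {σ = σ} x<st (h₀ , h₁ , h₂ , _) refl R f scr≢a refl =
        _ , one h₀ tt (one h₁ tt (one h₂ tt [])) , refl , relW f (relS (relS R)) , val , cell ,
          λ r n₁ n₂ → trans (there ρ₂ n₂) (trans (there ρ₁ n₁) (there (reg s) n₁))
        where
        ρ₁ = reg s [ scr ]:= word w (toℕ k)
        ρ₂ = ρ₁ [ scr ]:= evalOp w mul (ρ₁ scr) (ρ₁ str)
        cell : toℕ k * st + x < #a * st
        cell = <-≤-trans (+-monoʳ-< (toℕ k * st) x<st) (≤-trans (≤-reflexive (+-comm (toℕ k * st) st)) (*-monoˡ-≤ st (toℕ<n k)))
        k<M : toℕ k < M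
        k<M = <-≤-trans (≤-<-trans (m≤m*n (toℕ k) st ⦃ >-nonZero (≤-<-trans z≤n x<st) ⦄) (≤-<-trans (m≤m+n _ x) cell)) cells<M
        v₁ : toℕ (ρ₁ scr) ≡ toℕ k
        v₁ = trans (cong toℕ (here (reg s) scr)) (toℕ-word k<M)
        v₂ : toℕ (ρ₂ scr) ≡ toℕ k * st
        v₂ = trans (cong toℕ (here ρ₁ scr)) (trans (cong (λ z → toℕ (word w z)) (cong₂ _*_ v₁ (base R)))
               (toℕ-word (<-≤-trans (≤-<-trans (m≤m+n _ x) cell) cells<M)))
        val : toℕ ((ρ₂ [ a ]:= word w (toℕ (ρ₂ a) + toℕ (ρ₂ scr))) a) ≡ toℕ k * st + x
        val = trans (cong toℕ (here ρ₂ a)) (trans (cong (λ z → toℕ (word w z))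
                (trans (cong₂ _+_ (cong toℕ (trans (there ρ₁ scr≢a) (there (reg s) scr≢a))) v₂) (+-comm x _)))
                (toℕ-word (<-≤-trans cell cells<M)))

      copyOK : ∀ {a b s o σ} → At o (set scr 0 ∷ arith add a b scr ∷ []) → pc s ≡ o → Rel σ s → scr ≢ b →
        Σ (Word w) λ z → Steps 2 s (state (2 + o) ((reg s [ scr ]:= word w 0) [ a ]:= z) (mem s)) × toℕ z ≡ toℕ (reg s b)
      copyOK {b = b} {s} (h₀ , h₁ , _) refl R scr≢b = _ , one h₀ tt (one h₁ tt []) ,
        trans (cong (λ z → toℕ (word w z)) (trans (cong₂ _+_ (cong toℕ (there (reg s) scr≢b)) (trans (cong toℕ (here (reg s) scr)) (toℕ-word 0<M))) (+-identityʳ _)))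
              (toℕ-word (toℕ<n (reg s b)))

      evalOK : ∀ {d} (e : Exp d) (p : d < 8) {o X σ s} → At o (codeE e p o) → pc s ≡ o → Rel σ s → Ok e σ X →
        X × Evald e p o σ s
      evalOK {d} (con c {c<8}) p {s = s} (h , _) refl R X =
        X , evald (one h tt []) refl (relW (tmp-free d p) R)
          (trans (cong toℕ (here (reg s) (tmp d p))) (toℕ-word (<-≤-trans (<ᵇ⇒< c 8 c<8) 8≤M)))
          (λ d′ p′ l → there (reg s) (tmp-≢ p p′ (<⇒≢ l)))
      evalOK {d} (big c) p {s = s} (h , _) refl R (ok , X) =
        X , evald (one h tt []) refl (relW (tmp-free d p) R)
          (trans (cong toℕ (here (reg s) (tmp d p))) (toℕ-word ok))
          (λ d′ p′ l → there (reg s) (tmp-≢ p p′ (<⇒≢ l)))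
      evalOK {d} (var v) p {s = s} a q R X with copyOK a q R (λ ())
      ... | z , path , eq =
        X , evald path refl (relW (tmp-free d p) (relS R))
          (trans (cong toℕ (here (reg s [ scr ]:= word w 0) (tmp d p))) (trans eq (vars R v)))
          (λ d′ p′ l → there (reg s [ scr ]:= word w 0) (tmp-≢ p p′ (<⇒≢ l)))
      evalOK {d} (get k e) p {o} {σ = σ} {s} a q R ok with at-E e p a
      ... | a₁ , (b₀ , b₁ , b₂ , b₃ , _) with evalOK e p a₁ q R ok
      ... | (x<st , X) , evald {s₁} p₁ q₁ R₁ v₁ k₁ with strideOK x<st (b₀ , b₁ , b₂ , tt) q₁ R₁ (tmp-free d p) (λ ()) v₁
      ... | s₂ , p₂ , q₂ , R₂ , v₂ , c₂ , k₂ =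
        X , evald (p₁ ▹ (p₂ ▹ one (subst (λ z → nth C z ≡ just (load (tmp d p) (tmp d p))) (sym q₂) b₃) (subst (_< S) (sym v₂) (<-≤-trans c₂ cells<S)) []))
          (cong suc q₂) (relW (tmp-free d p) R₂)
          (trans (cong toℕ (here (reg s₂) (tmp d p))) (cells R₂ _ k _ x<st v₂))
          (λ d′ p′ l → trans (there (reg s₂) (tmp-≢ p p′ (<⇒≢ l))) (trans (k₂ _ (λ ()) (tmp-≢ p p′ (<⇒≢ l))) (k₁ d′ p′ l)))
      evalOK {suc d} (bin b e f) p a q R ok with at-E e p a
      ... | a₁ , a′ with at-E f (<⇒≤ p) a′
      ... | a₂ , a₃ with evalOK e p a₁ q R ok
      ... | ok₁ , evald p₁ q₁ R₁ v₁ k₁ with evalOK f (<⇒≤ p) a₂ q₁ R₁ ok₁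
      ... | ok₂ , evald p₂ q₂ R₂ v₂ k₂
        with binOK b a₃ q₂ R₂ (tmp-free (suc d) p) (trans (cong toℕ (k₂ (suc d) p ≤-refl)) v₁) v₂ ok₂
      ... | X , binDone p₃ t₃ q₃ R₃ v₃ k₃ =
        X , evald (subst (λ t → Steps t _ _) (t₃ e f) (p₁ ▹ (p₂ ▹ p₃))) q₃ R₃ v₃
          (λ d′ p′ l → trans (k₃ _ (tmp-≢ p p′ (<⇒≢ l))) (trans (k₂ d′ p′ (<⇒≤ l)) (k₁ d′ p′ l)))
      evalOK {suc (suc d)} (sel c e f) p {o} {X} {σ} {s} a q R ok with at-E c p a
      ... | a₁ , a′ with at-E e (<⇒≤ p) a′
      ... | a₂ , a″ with at-E f (<⇒≤ (<⇒≤ p)) a″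
      ... | a₃ , (h₀ , h₁ , h₂ , h₃ , h₄ , h₅ , _) with evalOK c p a₁ q R ok
      ... | ok₁ , evald p₁ q₁ R₁ v₁ k₁ with evalOK e (<⇒≤ p) a₂ q₁ R₁ ok₁
      ... | ok₂ , evald p₂ q₂ R₂ v₂ k₂ with evalOK f (<⇒≤ (<⇒≤ p)) a₃ q₂ R₂ ok₂
      ... | X , evald {s₃} p₃ refl R₃ v₃ k₃ =
        X , evald {fin = state _ (ρ [ A ]:= z) (mem s₃)} (p₁ ▹ (p₂ ▹ (p₃ ▹ one h₀ tt (one h₁ tt
              (fork {a = A} _ h₂ h₃ h₄ h₅ (writes (λ _ → tt) (λ _ → refl)) (writes (λ _ → tt) (λ _ → refl)))))))
          refl (relW (tmp-free _ p) (relS R₃)) val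
          (λ d′ p′ l → trans (there ρ (tmp-≢ p p′ (<⇒≢ l)))
             (trans (k₃ d′ p′ (<⇒≤ (<⇒≤ l))) (trans (k₂ d′ p′ (<⇒≤ l)) (k₁ d′ p′ l))))
        where
        A B₁ B₂ : Fin #r
        A  = tmp (suc (suc d)) p
        B₁ = tmp (suc d) (<⇒≤ p)
        B₂ = tmp d (<⇒≤ (<⇒≤ p))
        ρ : Fin #r → Word w
        ρ = reg s₃ [ scr ]:= word w 0
        z : Word w
        z = if toℕ (ρ A) ≡ᵇ toℕ (ρ scr) then word w (toℕ (ρ B₂) + toℕ (ρ scr)) else word w (toℕ (ρ B₁) + toℕ (ρ scr))
        zero≡ : toℕ (ρ scr) ≡ 0
        zero≡ = trans (cong toℕ (here (reg s₃) scr)) (toℕ-word 0<M)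
        unreg : ∀ {r x} → scr ≢ r → toℕ (reg s₃ r) ≡ x → toℕ (word w (toℕ (ρ r) + toℕ (ρ scr))) ≡ x
        unreg {r} n refl = trans (cong (λ y → toℕ (word w y)) (trans (cong₂ _+_ (cong toℕ (there (reg s₃) n)) zero≡) (+-identityʳ _)))
          (toℕ-word (toℕ<n (reg s₃ r)))
        pick : ∀ x {y y′} → toℕ y ≡ ev f σ → toℕ y′ ≡ ev e σ →
          toℕ (if x ≡ᵇ 0 then y else y′) ≡ choose x (ev e σ) (ev f σ)
        pick zero    h h′ = h
        pick (suc x) h h′ = h′
        val : toℕ ((ρ [ A ]:= z) A) ≡ choose (ev c σ) (ev e σ) (ev f σ)
        val = trans (cong toℕ (here ρ A)) (trans
          (cong₂ (λ x y → toℕ (if x ≡ᵇ y then word w (toℕ (ρ B₂) + toℕ (ρ scr)) else word w (toℕ (ρ B₁) + toℕ (ρ scr))))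
            (trans (cong toℕ (trans (k₃ _ p (s≤s (n≤1+n d))) (k₂ _ p ≤-refl))) v₁) zero≡)
          (pick (ev c σ) (unreg (λ ()) v₃) (unreg (λ ()) (trans (cong toℕ (k₃ _ (<⇒≤ p) ≤-refl)) v₂))))

      earlier-cell : ∀ {i j u v} → i < j → u < st → i * st + u < j * st + v
      earlier-cell {i} {j} i<j u<st = <-≤-trans (+-monoʳ-< (i * st) u<st)
        (≤-trans (≤-reflexive (+-comm (i * st) st)) (≤-trans (*-monoˡ-≤ st i<j) (m≤m+n _ _)))

      cell-unique : ∀ (k l : Arr) {x y} → x < st → y < st → toℕ k * st + x ≡ toℕ l * st + y → k ≡ l × x ≡ y
      cell-unique k l {x} {y} x<st y<st eq with <-cmp (toℕ k) (toℕ l)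
      ... | tri< k<l _ _ = contradiction eq (<⇒≢ (earlier-cell k<l x<st))
      ... | tri> _ _ l<k = contradiction (sym eq) (<⇒≢ (earlier-cell l<k y<st))
      ... | tri≈ _ k≡l _ with toℕ-injective k≡l
      ... | refl = refl , +-cancelˡ-≡ (toℕ k * st) x y eq

      record Done (t : ℕ) (o : ℕ) (σ : St) (s : Conf) : Set where
        constructor done
        field
          {fin}  : Conf
          path   : Steps t s fin
          pcEnd  : pc fin ≡ o
          relEnd : Rel σ fin

      stmOK : ∀ b {o X σ s} → At o (code₁ b o) → pc s ≡ o → Rel σ s → Ok₁ b σ X → X × Done (cost₁ b) (end₁ b o) (run₁ b σ) s
      stmOK (v ≔ e) {σ = σ} {s} a q R ok with at-E e p7 a
      ... | a₁ , a₂ with evalOK e p7 a₁ q R ok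
      ... | X , evald {s₁} p₁ q₁ R₁ v₁ k₁ with copyOK a₂ q₁ R₁ (λ ())
      ... | z , p₂ , z≡ = X , done (p₁ ▹ p₂) refl (rel vars′ (base R₁) (cells R₁))
        where
        ρ : Fin #r → Word w
        ρ = reg s₁ [ scr ]:= word w 0
        vars′ : ∀ u → toℕ ((ρ [ vreg v ]:= z) (vreg u)) ≡ vr (run₁ (v ≔ e) σ) u
        vars′ u with vreg v ≟ᶠ vreg u
        ... | no n rewrite =ᶠ-≢ {i = v} {u} (λ eq → n (cong vreg eq)) = trans (cong toℕ (there ρ n)) (vars R₁ u)
        ... | yes eq with vreg-inj eq
        ... | refl rewrite =ᶠ-refl v = trans (cong toℕ (here ρ (vreg v))) (trans z≡ v₁)
      stmOK (k ⟦ e ⟧≔ f) {o} {σ = σ} {s} a q R ok with at-E e p7 a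
      ... | a₁ , (b₀ , b₁ , b₂ , a′) with at-E f p6 a′
      ... | a₂ , (b₃ , _) with evalOK e p7 a₁ q R ok
      ... | (x<st , ok₁) , evald {s₁} p₁ q₁ R₁ v₁ k₁ with strideOK x<st (b₀ , b₁ , b₂ , tt) q₁ R₁ (tmp-free 7 p7) (λ ()) v₁
      ... | s₂ , p₂ , q₂ , R₂ , v₂ , c₂ , k₂ with evalOK f p6 a₂ q₂ R₂ ok₁
      ... | X , evald {s₃} p₃ refl R₃ v₃ k₃ = X ,
        done (p₁ ▹ (p₂ ▹ (p₃ ▹ one b₃ (subst (_< S) (sym addr) (<-≤-trans c₂ cells<S)) []))) refl (rel (vars R₃) (base R₃) cells′)
        where
        A : Word w
        A = reg s₃ (tmp 7 p7)
        addr : toℕ A ≡ toℕ k * st + ev e σ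
        addr = trans (cong toℕ (k₃ 7 p7 ≤-refl)) v₂
        cells′ : ∀ (i : Word w) (l : Arr) x → x < st → toℕ i ≡ toℕ l * st + x →
          toℕ ((mem s₃ [ A ]:= reg s₃ (tmp 6 p6)) i) ≡ ar (run₁ (k ⟦ e ⟧≔ f) σ) l x
        cells′ i l x x<st′ i≡ with A ≟ᶠ i
        ... | yes refl with cell-unique k l x<st x<st′ (trans (sym addr) i≡)
        ... | refl , refl rewrite =ᶠ-refl k | ≡ᵇ-refl (ev e σ) = trans (cong toℕ (updateAt-updates A (mem s₃))) v₃
        cells′ i l x x<st′ i≡ | no n = trans (cong toℕ (updateAt-minimal i A (mem s₃) (n ∘ sym))) (trans (cells R₃ i l x x<st′ i≡) same)
          where
          same : ar σ l x ≡ ar (run₁ (k ⟦ e ⟧≔ f) σ) l x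
          same with k ≟ᶠ l
          ... | no k≢l rewrite =ᶠ-≢ k≢l = refl
          ... | yes refl rewrite =ᶠ-refl k with ev e σ ≟ x
          ... | no e≢x rewrite ≡ᵇ-≢ _ _ e≢x = refl
          ... | yes refl = contradiction (toℕ-injective (trans addr (sym i≡))) n

      blockOK : ∀ bs {o X σ s} → At o (codeB bs o) → pc s ≡ o → Rel σ s → OkB bs σ X → X × Done (costB bs) (endB bs o) (run bs σ) s
      blockOK []       a q R X = X , done [] q R
      blockOK (b ∷ bs) {o} a q R ok with at-++ (code₁ b o) (len₁ b o) a
      ... | a₁ , a₂ with stmOK b a₁ q R ok
      ... | ok₁ , done p₁ q₁ R₁ with blockOK bs a₂ q₁ R₁ ok₁
      ... | X , done p₂ q₂ R₂ = X , done (p₁ ▹ p₂) q₂ R₂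

      testOK : ∀ {m o σ s} → At o (set scr 0 ∷ jeq (tmp 7 p7) scr m ∷ []) → pc s ≡ o → Rel σ s →
        Done 2 (if toℕ (reg s (tmp 7 p7)) ≡ᵇ 0 then m else 2 + o) σ s
      testOK {m} {o} {s = s} (h₀ , h₁ , _) refl R = done (one h₀ tt (one h₁ tt []))
        (cong (λ z → if toℕ (reg s (tmp 7 p7)) ≡ᵇ z then m else 2 + o) (trans (cong toℕ (here (reg s) scr)) (toℕ-word 0<M))) (relW scr-free R)

      if-≢0 : ∀ {x y} {A : Set} {a b : A} → x ≡ y → y ≢ 0 → (if x ≡ᵇ 0 then a else b) ≡ b
      if-≢0 {zero}  refl n = contradiction refl n
      if-≢0 {suc x} refl n = refl

      if-≡0 : ∀ {x y} {A : Set} {a b : A} → x ≡ y → y ≡ 0 → (if x ≡ᵇ 0 then a else b) ≡ a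
      if-≡0 refl refl = refl

      jumpOK : ∀ {m o σ s} → nth C o ≡ just (jump m) → pc s ≡ o → Rel σ s → Done 1 m σ s
      jumpOK h refl R = done (one h tt []) refl (rel (vars R) (base R) (cells R))

      simulate : ∀ {c σ t σ′} → Exec c σ t σ′ → ∀ {o s} → At o (codeC c o) → pc s ≡ o → Rel σ s → Done t (endC c o) σ′ s
      simulate (blk {bs} ok) a q R = proj₂ (blockOK bs a q R ok)
      simulate (sq {c₁} x y) {o} a q R with at-++ (codeC c₁ o) (lenC c₁ o) a
      ... | a₁ , a₂ with simulate x a₁ q R
      ... | done p₁ q₁ R₁ with simulate y a₂ q₁ R₁
      ... | done p₂ q₂ R₂ = done (p₁ ▹ p₂) q₂ R₂
      simulate (brT {e} {c₁} ok e≢0 x) a q R with at-E e p7 a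
      ... | a₁ , (b₀ , b₁ , a₂) with at-++ (codeC c₁ _) (lenC c₁ _) a₂
      ... | a₃ , (b₂ , _) with evalOK e p7 a₁ q R ok
      ... | _ , evald p₁ q₁ R₁ v₁ _ with testOK (b₀ , b₁ , tt) q₁ R₁
      ... | done p₂ q₂ R₂ with simulate x a₃ (trans q₂ (if-≢0 v₁ e≢0)) R₂
      ... | done p₃ q₃ R₃ with jumpOK b₂ q₃ R₃
      ... | done p₄ q₄ R₄ = done (p₁ ▹ (p₂ ▹ (p₃ ▹ p₄))) q₄ R₄
      simulate (brF {e} {c₁} ok e≡0 x) a q R with at-E e p7 a
      ... | a₁ , (b₀ , b₁ , a₂) with at-++ (codeC c₁ _) (lenC c₁ _) a₂
      ... | _ , (_ , a₃) with evalOK e p7 a₁ q R ok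
      ... | _ , evald p₁ q₁ R₁ v₁ _ with testOK (b₀ , b₁ , tt) q₁ R₁
      ... | done p₂ q₂ R₂ with simulate x a₃ (trans q₂ (if-≡0 v₁ e≡0)) R₂
      ... | done p₃ q₃ R₃ = done (p₁ ▹ (p₂ ▹ p₃)) q₃ R₃
      simulate (lpT {e} {c} ok e≢0 x y) a q R with at-E e p7 a
      ... | a₁ , (b₀ , b₁ , a₂) with at-++ (codeC c _) (lenC c _) a₂
      ... | a₃ , (b₂ , _) with evalOK e p7 a₁ q R ok
      ... | _ , evald p₁ q₁ R₁ v₁ _ with testOK (b₀ , b₁ , tt) q₁ R₁
      ... | done p₂ q₂ R₂ with simulate x a₃ (trans q₂ (if-≢0 v₁ e≢0)) R₂
      ... | done p₃ q₃ R₃ with jumpOK b₂ q₃ R₃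
      ... | done p₄ q₄ R₄ with simulate y a q₄ R₄
      ... | done p₅ q₅ R₅ = done (p₁ ▹ (p₂ ▹ (p₃ ▹ (p₄ ▹ p₅)))) q₅ R₅
      simulate (lpF {e} ok e≡0) a q R with at-E e p7 a
      ... | a₁ , (b₀ , b₁ , _) with evalOK e p7 a₁ q R ok
      ... | _ , evald p₁ q₁ R₁ v₁ _ with testOK (b₀ , b₁ , tt) q₁ R₁
      ... | done p₂ q₂ R₂ = done (p₁ ▹ p₂) (trans q₂ (if-≡0 v₁ e≡0)) R₂

  module ProgramLogic where

    open import Defs
    open StructuredPrograms
    open import Data.Bool.Base using (Bool; false; T; not; _∨_)
    open import Data.Fin.Base using (zero; suc)
    open import Data.List.Base using (List; []; _∷_)
    open import Data.Nat.Base
    open import Data.Nat.Properties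

    sumTo : ℕ → (ℕ → ℕ) → ℕ
    sumTo zero    f = 0
    sumTo (suc n) f = sumTo n f + f n

    sumOver : {X : Set} → List X → (X → ℕ) → ℕ
    sumOver []       f = 0
    sumOver (x ∷ xs) f = f x + sumOver xs f

    setsV₁ : Stm → Var → Bool
    setsV₁ (v ≔ _)      u = v =ᶠ u
    setsV₁ (_ ⟦ _ ⟧≔ _) u = false

    setsA₁ : Stm → Arr → Bool
    setsA₁ (_ ≔ _)      l = false
    setsA₁ (k ⟦ _ ⟧≔ _) l = k =ᶠ l

    setsV : Cmd → Var → Bool
    setsV (block [])       u = false
    setsV (block (b ∷ bs)) u = setsV₁ b u ∨ setsV (block bs) u
    setsV (c ⨟ d)          u = setsV c u ∨ setsV d u
    setsV (branch _ c d)   u = setsV c u ∨ setsV d u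
    setsV (loop _ c)       u = setsV c u

    setsA : Cmd → Arr → Bool
    setsA (block [])       l = false
    setsA (block (b ∷ bs)) l = setsA₁ b l ∨ setsA (block bs) l
    setsA (c ⨟ d)          l = setsA c l ∨ setsA d l
    setsA (branch _ c d)   l = setsA c l ∨ setsA d l
    setsA (loop _ c)       l = setsA c l

    module Triples (M st : ℕ) where
      open Semantics M st public

      record Frame (c : Cmd) (σ σ′ : St) : Set where
        field
          keepV : ∀ v → {T (not (setsV c v))} → vr σ′ v ≡ vr σ v
          keepA : ∀ k → {T (not (setsA c k))} → ∀ i → ar σ′ k i ≡ ar σ k i
      open Frame public

      private
        ∨-l : ∀ a b → T (not (a ∨ b)) → T (not a)
        ∨-l false b p = tt
        ∨-r : ∀ a b → T (not (a ∨ b)) → T (not b)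
        ∨-r false b p = p

      frame-refl : ∀ {c σ} → Frame c σ σ
      frame-refl = record { keepV = λ _ → refl ; keepA = λ _ _ → refl }

      frame-trans : ∀ {c σ₁ σ₂ σ₃} → Frame c σ₁ σ₂ → Frame c σ₂ σ₃ → Frame c σ₁ σ₃
      frame-trans f g = record { keepV = λ v {p} → trans (keepV g v {p}) (keepV f v {p})
                               ; keepA = λ k {p} i → trans (keepA g k {p} i) (keepA f k {p} i) }

      frame-seq : ∀ {c d σ₁ σ₂ σ₃} → Frame c σ₁ σ₂ → Frame d σ₂ σ₃ → Frame (c ⨟ d) σ₁ σ₃
      frame-seq {c} {d} f g = record
        { keepV = λ v {p} → trans (keepV g v {∨-r (setsV c v) _ p}) (keepV f v {∨-l (setsV c v) _ p})
        ; keepA = λ k {p} i → trans (keepA g k {∨-r (setsA c k) _ p} i) (keepA f k {∨-l (setsA c k) _ p} i) }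

      frame-run : ∀ bs σ → Frame (block bs) σ (run bs σ)
      frame-run []       σ = frame-refl
      frame-run (b ∷ bs) σ = record
        { keepV = λ v {p} → trans (keepV (frame-run bs (run₁ b σ)) v {∨-r (setsV₁ b v) _ p}) (v₁ b v (∨-l (setsV₁ b v) _ p))
        ; keepA = λ k {p} i → trans (keepA (frame-run bs (run₁ b σ)) k {∨-r (setsA₁ b k) _ p} i) (a₁ b k (∨-l (setsA₁ b k) _ p) i) }
        where
        v₁ : ∀ b v → T (not (setsV₁ b v)) → vr (run₁ b σ) v ≡ vr σ v
        v₁ (u ≔ e) v p with u =ᶠ v
        ... | false = refl
        v₁ (k ⟦ e ⟧≔ f) v p = refl
        a₁ : ∀ b k → T (not (setsA₁ b k)) → ∀ i → ar (run₁ b σ) k i ≡ ar σ k i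
        a₁ (u ≔ e) k p i = refl
        a₁ (l ⟦ e ⟧≔ f) k p i with l =ᶠ k
        ... | false = refl

      frame : ∀ {c σ t σ′} → Exec c σ t σ′ → Frame c σ σ′
      frame (blk {bs} {σ} _) = frame-run bs σ
      frame (sq x y) = frame-seq (frame x) (frame y)
      frame (brT {e} {c} {d} _ _ x) = record
        { keepV = λ v {p} → keepV (frame x) v {∨-l (setsV c v) _ p}
        ; keepA = λ k {p} → keepA (frame x) k {∨-l (setsA c k) _ p} }
      frame (brF {e} {c} {d} _ _ x) = record
        { keepV = λ v {p} → keepV (frame x) v {∨-r (setsV c v) _ p}
        ; keepA = λ k {p} → keepA (frame x) k {∨-r (setsA c k) _ p} }
      frame (lpT {e} {c} _ _ x y) = record
        { keepV = λ v {p} → trans (keepV (frame y) v {p}) (keepV (frame x) v {p})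
        ; keepA = λ k {p} i → trans (keepA (frame y) k {p} i) (keepA (frame x) k {p} i) }
      frame (lpF _ _) = frame-refl

      record Tri (c : Cmd) (σ : St) (B : ℕ) (Q : St → Set) : Set where
        constructor tri
        field
          {fin}  : St
          {time} : ℕ
          exec′  : Exec c σ time fin
          bound  : time ≤ B
          post   : Q fin
      open Tri public

      triB : ∀ {bs σ Q} → OkB bs σ ⊤ → Q (run bs σ) → Tri (block bs) σ (costB bs) Q
      triB ok q = tri (blk ok) ≤-refl q

      infixr 4 _thenT_
      _thenT_ : ∀ {c d σ B B′ Q Q′} → Tri c σ B Q → (∀ σ′ → Frame c σ σ′ → Q σ′ → Tri d σ′ B′ Q′) → Tri (c ⨟ d) σ (B + B′) Q′
      tri x b q thenT k with k _ (frame x) q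
      ... | tri y b′ q′ = tri (sq x y) (+-mono-≤ b b′) q′

      weaken : ∀ {c σ B B′ Q Q′} → B ≤ B′ → (∀ {σ′} → Frame c σ σ′ → Q σ′ → Q′ σ′) → Tri c σ B Q → Tri c σ B′ Q′
      weaken le f (tri x b q) = tri x (≤-trans b le) (f (frame x) q)

      record Iter (e : Exp 7) (c : Cmd) (σ : St) (B : ℕ) (Q : St → Set) : Set where
        constructor iter
        field
          guardOk : Ok e σ ⊤
          guard   : ev e σ ≢ 0
          body    : Tri c σ B Q

      overhead : Exp 7 → ℕ
      overhead e = costE e + 3

      record Exit (e : Exp 7) (σ : St) : Set where
        constructor exit
        field
          guardOk : Ok e σ ⊤
          guard   : ev e σ ≡ 0

      exit-loop : ∀ {e c σ Q} → Exit e σ → Q σ → Tri (loop e c) σ (overhead e) Q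
      exit-loop {e} (exit ok g) q = tri (lpF ok g) (+-monoʳ-≤ (costE e) (n≤1+n 2)) q

      iterate : ∀ {e c σ B B′ Q Q′} → Iter e c σ B Q → (∀ σ′ → Frame c σ σ′ → Q σ′ → Tri (loop e c) σ′ B′ Q′) →
                Tri (loop e c) σ (B + overhead e + B′) Q′
      iterate {e} (iter ok g (tri x b q)) k with k _ (frame x) q
      ... | tri {time = t′} y b′ q′ = tri (lpT ok g x y) (≤-trans (≤-reflexive arr) (+-mono-≤ (+-monoˡ-≤ (overhead e) b) b′)) q′
        where
        open ≡-Reasoning
        arr : ∀ {t} → costE e + (2 + (t + (1 + t′))) ≡ t + (costE e + 3) + t′
        arr {t} = begin
          costE e + (2 + (t + (1 + t′))) ≡⟨ cong (λ z → costE e + (2 + z)) (+-suc t t′) ⟩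
          costE e + (3 + (t + t′))       ≡⟨ +-assoc (costE e) 3 (t + t′) ⟨
          costE e + 3 + (t + t′)         ≡⟨ +-assoc (costE e + 3) t t′ ⟨
          costE e + 3 + t + t′           ≡⟨ cong (_+ t′) (+-comm (costE e + 3) t) ⟩
          t + (costE e + 3) + t′         ∎

      listLoop : ∀ {X : Set} {e c} {σ₀} (τ : X → ℕ) (I : List X → St → Set) →
        (∀ x xs σ → Frame c σ₀ σ → I (x ∷ xs) σ → Iter e c σ (τ x) (I xs)) →
        (∀ σ → Frame c σ₀ σ → I [] σ → Exit e σ) →
        ∀ xs σ → Frame c σ₀ σ → I xs σ → Tri (loop e c) σ (sumOver xs (λ x → τ x + overhead e) + overhead e) (I [])
      listLoop τ I bd end []       σ f i = exit-loop (end σ f i) i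
      listLoop {e = e} τ I bd end (x ∷ xs) σ f i = weaken (≤-reflexive (sym (+-assoc (τ x + overhead e) _ _))) (λ _ q → q)
        (iterate (bd x xs σ f i) λ σ′ f′ i′ → listLoop τ I bd end xs σ′ (frame-trans f f′) i′)

      private
        sumFrom : ℕ → ℕ → (ℕ → ℕ) → ℕ
        sumFrom zero    i f = 0
        sumFrom (suc k) i f = f i + sumFrom k (suc i) f

        sumFrom-sumTo : ∀ k i f → sumTo i f + sumFrom k i f ≡ sumTo (i + k) f
        sumFrom-sumTo zero    i f = trans (+-identityʳ _) (cong (λ j → sumTo j f) (sym (+-identityʳ i)))
        sumFrom-sumTo (suc k) i f = trans (sym (+-assoc (sumTo i f) (f i) _))
          (trans (sumFrom-sumTo k (suc i) f) (cong (λ j → sumTo j f) (sym (+-suc i k))))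

        count : ∀ {e c} {σ₀} (N : ℕ) (τ : ℕ → ℕ) (I : ℕ → St → Set) →
          (∀ i σ → i < N → Frame c σ₀ σ → I i σ → Iter e c σ (τ i) (I (suc i))) →
          (∀ σ → Frame c σ₀ σ → I N σ → Exit e σ) →
          ∀ k i σ → i + k ≡ N → Frame c σ₀ σ → I i σ →
          Tri (loop e c) σ (sumFrom k i (λ j → τ j + overhead e) + overhead e) (I N)
        count N τ I bd end zero i σ eq f q with trans (sym (+-identityʳ i)) eq
        ... | refl = exit-loop (end σ f q) q
        count {e} N τ I bd end (suc k) i σ eq f q =
          weaken (≤-reflexive (sym (+-assoc (τ i + overhead e) _ _))) (λ _ q′ → q′)
            (iterate (bd i σ (≤-trans (s≤s (m≤m+n i k)) (≤-reflexive (trans (sym (+-suc i k)) eq))) f q)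
              λ σ′ f′ q′ → count N τ I bd end k (suc i) σ′ (trans (sym (+-suc i k)) eq) (frame-trans f f′) q′)

      upLoop : ∀ {e c} {σ} (N : ℕ) (τ : ℕ → ℕ) (I : ℕ → St → Set) →
        (∀ i σ′ → i < N → Frame c σ σ′ → I i σ′ → Iter e c σ′ (τ i) (I (suc i))) →
        (∀ σ′ → Frame c σ σ′ → I N σ′ → Exit e σ′) →
        I 0 σ → Tri (loop e c) σ (sumTo N (λ j → τ j + overhead e) + overhead e) (I N)
      upLoop {e} N τ I bd end q = weaken (≤-reflexive (cong (_+ overhead e) (sumFrom-sumTo N 0 _))) (λ _ q′ → q′)
        (count N τ I bd end N 0 _ refl frame-refl q)

  module Sums where

    open StructuredPrograms using (b2n; eqn; ltn; choose; upd; ≡ᵇ-refl; ≡ᵇ-≢)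
    open ProgramLogic using (sumTo; sumOver)
    open import Data.Bool.Base using (true; false; T)
    open import Data.List.Base using (List; []; _∷_; length)
    open import Data.List.Membership.Propositional using (_∈_)
    open import Data.List.Relation.Unary.Any using (here; there)
    open import Data.Nat.Base
    open import Data.Nat.Properties
    open import Algebra.Properties.CommutativeSemigroup +-commutativeSemigroup using () renaming (interchange to +-interchange; xy∙z≈xz∙y to +-swapʳ) public

    eqn-refl : ∀ x → eqn x x ≡ 1
    eqn-refl x = cong b2n (≡ᵇ-refl x)

    eqn-≢ : ∀ {x y} → x ≢ y → eqn x y ≡ 0
    eqn-≢ n = cong b2n (≡ᵇ-≢ _ _ n)

    eqn-≢0 : ∀ {x y} → eqn x y ≢ 0 → x ≡ y
    eqn-≢0 {x} {y} n with x ≟ y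
    ... | yes eq = eq
    ... | no  ne = contradiction (eqn-≢ ne) n

    eqn-≡0 : ∀ {x y} → eqn x y ≡ 0 → x ≢ y
    eqn-≡0 {x} z refl = contradiction (trans (sym (eqn-refl x)) z) λ ()

    ltn-< : ∀ {x y} → x < y → ltn x y ≡ 1
    ltn-< {x} {y} l with x <ᵇ y | <⇒<ᵇ l
    ... | true | _ = refl

    ltn-≢0 : ∀ {x y} → ltn x y ≢ 0 → x < y
    ltn-≢0 {x} {y} n with x <ᵇ y in eq
    ... | true  = <ᵇ⇒< x y (subst T (sym eq) tt)
    ... | false = contradiction refl n

    ltn-≥ : ∀ {x y} → y ≤ x → ltn x y ≡ 0
    ltn-≥ {x} {y} l with ltn x y in eq
    ... | zero  = refl
    ... | suc _ = contradiction (ltn-≢0 {x} {y} (λ z → case trans (sym eq) z of λ ())) (≤⇒≯ l)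

    b2n≤1 : ∀ b → b2n b ≤ 1
    b2n≤1 false = z≤n
    b2n≤1 true  = ≤-refl

    *-≢0 : ∀ {x y} → x * y ≢ 0 → x ≢ 0 × y ≢ 0
    *-≢0 {x} {y} n = (λ { refl → n refl }) , λ { refl → n (*-zeroʳ x) }

    *≢0 : ∀ {x y} → x ≢ 0 → y ≢ 0 → x * y ≢ 0
    *≢0 {x} {y} p q eq with m*n≡0⇒m≡0∨n≡0 x eq
    ... | inj₁ e = p e
    ... | inj₂ e = q e

    ≡0⊎≡1 : ∀ {x} → x ≤ 1 → x ≡ 0 ⊎ x ≡ 1
    ≡0⊎≡1 z≤n = inj₁ refl
    ≡0⊎≡1 (s≤s z≤n) = inj₂ refl

    choose-≡0 : ∀ {c x y} → c ≡ 0 → choose c x y ≡ y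
    choose-≡0 refl = refl

    choose-≢0 : ∀ {c x y} → c ≢ 0 → choose c x y ≡ x
    choose-≢0 {zero}  n = contradiction refl n
    choose-≢0 {suc c} n = refl

    upd-same : ∀ f i z → upd f i z i ≡ z
    upd-same f i z rewrite ≡ᵇ-refl i = refl

    upd-other : ∀ f {i j} z → i ≢ j → upd f i z j ≡ f j
    upd-other f z n rewrite ≡ᵇ-≢ _ _ n = refl

    upd-at : ∀ f {i j z} → i ≡ j → upd f i z j ≡ z
    upd-at f {i} refl = upd-same f i _

    upd-off : ∀ f {i j z} → i ≢ j → upd f i z j ≡ f j
    upd-off f n = upd-other f _ n

    upd-add : ∀ f i a j → upd f i (f i + a) j ≡ f j + eqn i j * a
    upd-add f i a j with i ≟ j
    ... | yes refl rewrite upd-same f i (f i + a) | eqn-refl i = cong (f i +_) (sym (+-identityʳ a))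
    ... | no n rewrite upd-other f (f i + a) n | eqn-≢ n = sym (+-identityʳ _)

    upd-sub : ∀ f i a j → upd f i (f i ∸ a) j ≡ f j ∸ eqn i j * a
    upd-sub f i a j with i ≟ j
    ... | yes refl rewrite upd-same f i (f i ∸ a) | eqn-refl i = cong (f i ∸_) (sym (+-identityʳ a))
    ... | no n rewrite upd-other f (f i ∸ a) n | eqn-≢ n = refl

    by-equality : ∀ {P : Set} (k l : ℕ) → (k ≡ l → P) → (k ≢ l → P) → P
    by-equality k l f g = case k ≟ l of λ { (yes p) → f p ; (no p) → g p }

    sumTo-cong : ∀ n {f g} → (∀ i → i < n → f i ≡ g i) → sumTo n f ≡ sumTo n g
    sumTo-cong zero    h = refl
    sumTo-cong (suc n) h = cong₂ _+_ (sumTo-cong n λ i l → h i (m<n⇒m<1+n l)) (h n ≤-refl)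

    sumTo-mono : ∀ n {f g} → (∀ i → i < n → f i ≤ g i) → sumTo n f ≤ sumTo n g
    sumTo-mono zero    h = z≤n
    sumTo-mono (suc n) h = +-mono-≤ (sumTo-mono n λ i l → h i (m<n⇒m<1+n l)) (h n ≤-refl)

    sumTo-+ : ∀ n f g → sumTo n (λ i → f i + g i) ≡ sumTo n f + sumTo n g
    sumTo-+ zero    f g = refl
    sumTo-+ (suc n) f g = trans (cong (_+ (f n + g n)) (sumTo-+ n f g)) (+-interchange (sumTo n f) (sumTo n g) (f n) (g n))

    sumTo-* : ∀ n c f → sumTo n (λ i → c * f i) ≡ c * sumTo n f
    sumTo-* zero    c f = sym (*-zeroʳ c)
    sumTo-* (suc n) c f = trans (cong (_+ c * f n) (sumTo-* n c f)) (sym (*-distribˡ-+ c (sumTo n f) (f n)))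

    sumTo-const : ∀ n c → sumTo n (λ _ → c) ≡ n * c
    sumTo-const zero    c = refl
    sumTo-const (suc n) c = trans (cong (_+ c) (sumTo-const n c)) (+-comm (n * c) c)

    sumTo-zero : ∀ n {f} → (∀ i → i < n → f i ≡ 0) → sumTo n f ≡ 0
    sumTo-zero n h = trans (sumTo-cong n h) (trans (sumTo-const n 0) (*-zeroʳ n))

    sumTo-swap : ∀ m n (f : ℕ → ℕ → ℕ) → sumTo m (λ i → sumTo n (f i)) ≡ sumTo n (λ j → sumTo m (λ i → f i j))
    sumTo-swap zero    n f = sym (sumTo-zero n λ _ _ → refl)
    sumTo-swap (suc m) n f = trans (cong (_+ sumTo n (f m)) (sumTo-swap m n f)) (sym (sumTo-+ n _ (f m)))

    term≤sumTo : ∀ n f {i} → i < n → f i ≤ sumTo n f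
    term≤sumTo (suc n) f {i} l with i ≟ n
    ... | yes refl = m≤n+m (f n) _
    ... | no  i≢n  = ≤-trans (term≤sumTo n f (≤∧≢⇒< (s≤s⁻¹ l) i≢n)) (m≤m+n _ (f n))

    sumTo-≡0 : ∀ n f → sumTo n f ≡ 0 → ∀ i → i < n → f i ≡ 0
    sumTo-≡0 n f z i l = n≤0⇒n≡0 (≤-trans (term≤sumTo n f l) (≤-reflexive z))

    sumTo-strict : ∀ n {f g} → (∀ i → i < n → f i ≤ g i) → ∀ {i} → i < n → f i < g i → sumTo n f < sumTo n g
    sumTo-strict (suc n) h {i} l s with i ≟ n
    ... | yes refl = +-mono-≤-< (sumTo-mono n λ j q → h j (m<n⇒m<1+n q)) s
    ... | no  i≢n  = +-mono-<-≤ (sumTo-strict n (λ j q → h j (m<n⇒m<1+n q)) (≤∧≢⇒< (s≤s⁻¹ l) i≢n) s) (h n ≤-refl)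

    sumTo-single : ∀ n {f e} → e < n → (∀ i → i < n → i ≢ e → f i ≡ 0) → sumTo n f ≡ f e
    sumTo-single (suc n) {f} {e} l h with e ≟ n
    ... | yes refl = cong (_+ f n) (sumTo-zero n λ i q → h i (m<n⇒m<1+n q) (<⇒≢ q))
    ... | no  e≢n  = trans (cong₂ _+_ (sumTo-single n (≤∧≢⇒< (s≤s⁻¹ l) e≢n) λ i q → h i (m<n⇒m<1+n q)) (h n ≤-refl (e≢n ∘ sym))) (+-identityʳ _)

    find : ∀ n (f : ℕ → ℕ) → (∃[ i ] i < n × f i ≢ 0) ⊎ (∀ i → i < n → f i ≡ 0)
    find zero    f = inj₂ λ i ()
    find (suc n) f with f n ≟ 0 | find n f
    ... | no  p | _ = inj₁ (n , ≤-refl , p)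
    ... | yes p | inj₁ (i , l , q) = inj₁ (i , m<n⇒m<1+n l , q)
    ... | yes p | inj₂ q = inj₂ λ i l → case i ≟ n of λ { (yes refl) → p ; (no i≢n) → q i (≤∧≢⇒< (s≤s⁻¹ l) i≢n) }

    sumTo-≡1 : ∀ n f → sumTo n f ≡ 1 → ∃[ e ] e < n × f e ≡ 1 × (∀ i → i < n → i ≢ e → f i ≡ 0)
    sumTo-≡1 (suc n) f eq with f n in fn
    ... | zero with sumTo-≡1 n f (trans (sym (+-identityʳ _)) eq)
    ...   | e , l , fe , h = e , m<n⇒m<1+n l , fe , λ i q i≢e → case i ≟ n of λ
              { (yes refl) → fn ; (no i≢n) → h i (≤∧≢⇒< (s≤s⁻¹ q) i≢n) i≢e }
    sumTo-≡1 (suc n) f eq | suc k with m+n≡0⇒m≡0 (sumTo n f) (suc-injective (trans (sym (+-suc (sumTo n f) k)) eq)) | m+n≡0⇒n≡0 (sumTo n f) (suc-injective (trans (sym (+-suc (sumTo n f) k)) eq))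
    ... | z | refl = n , ≤-refl , fn , λ i q i≢n → sumTo-≡0 n f z i (≤∧≢⇒< (s≤s⁻¹ q) i≢n)

    sumTo-upd : ∀ n (r g : ℕ → ℕ) {e} → e < n → sumTo n (λ i → upd r e 0 i * g i) + r e * g e ≡ sumTo n (λ i → r i * g i)
    sumTo-upd (suc n) r g {e} l with e ≟ n
    ... | yes refl = cong₂ _+_ (trans (cong (λ z → sumTo n (λ i → upd r n 0 i * g i) + z * g n) (upd-same r n 0))
            (trans (+-identityʳ _) (sumTo-cong n λ i q → cong (_* g i) (upd-other r 0 (<⇒≢ q ∘ sym))))) refl
    ... | no e≢n = trans (+-swapʳ (sumTo n (λ i → upd r e 0 i * g i)) (upd r e 0 n * g n) (r e * g e))
            (cong₂ _+_ (sumTo-upd n r g (≤∧≢⇒< (s≤s⁻¹ l) e≢n)) (cong (_* g n) (upd-other r 0 e≢n)))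

    sumOver-cong : ∀ {X : Set} (xs : List X) {f g} → (∀ {x} → x ∈ xs → f x ≡ g x) → sumOver xs f ≡ sumOver xs g
    sumOver-cong []       h = refl
    sumOver-cong (x ∷ xs) h = cong₂ _+_ (h (here refl)) (sumOver-cong xs (h ∘ there))

    sumOver-mono : ∀ {X : Set} (xs : List X) {f g} → (∀ {x} → x ∈ xs → f x ≤ g x) → sumOver xs f ≤ sumOver xs g
    sumOver-mono []       h = z≤n
    sumOver-mono (x ∷ xs) h = +-mono-≤ (h (here refl)) (sumOver-mono xs (h ∘ there))

    sumOver-+ : ∀ {X : Set} (xs : List X) f g → sumOver xs (λ x → f x + g x) ≡ sumOver xs f + sumOver xs g
    sumOver-+ []       f g = refl
    sumOver-+ (x ∷ xs) f g = trans (cong (f x + g x +_) (sumOver-+ xs f g)) (+-interchange (f x) (g x) _ _)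

    sumOver-const : ∀ {X : Set} (xs : List X) c → sumOver xs (λ _ → c) ≡ length xs * c
    sumOver-const []       c = refl
    sumOver-const (x ∷ xs) c = cong (c +_) (sumOver-const xs c)

    sumOver-length : ∀ {X : Set} (xs : List X) {f} → (∀ {x} → x ∈ xs → f x ≤ 1) → sumOver xs f ≤ length xs
    sumOver-length xs h = ≤-trans (sumOver-mono xs h) (≤-reflexive (trans (sumOver-const xs 1) (*-identityʳ _)))

    -- The code of a set of numbers ≥ 2 (or 0), read one element at a time:
    -- 1 for the empty set, z for {z}, and 0 if there are several elements.
    scan : (f z : ℕ → ℕ) → ℕ → ℕ
    scan f z zero    = 1
    scan f z (suc J) = choose (f J) (choose (eqn (scan f z J) 1) (z J) (choose (eqn (scan f z J) (z J)) (z J) 0)) (scan f z J)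

    scan-cong : ∀ {f g z} N → (∀ J → f J ≡ g J) → scan f z N ≡ scan g z N
    scan-cong zero    h = refl
    scan-cong {z = z} (suc N) h =
      cong₂ (λ a c → choose a (choose (eqn c 1) (z N) (choose (eqn c (z N)) (z N) 0)) c) (h N) (scan-cong N h)

    module _ (f z : ℕ → ℕ) (z≢1 : ∀ J → z J ≢ 1) where

      private
        new : ℕ → ℕ → ℕ
        new c y = choose (eqn c 1) y (choose (eqn c y) y 0)

        new-cases : ∀ c y → new c y ≡ y ⊎ new c y ≡ 0
        new-cases c y with eqn c 1
        ... | suc _ = inj₁ refl
        ... | zero with eqn c y
        ...   | suc _ = inj₁ refl
        ...   | zero  = inj₂ refl

      scan-found : ∀ {J N} → J < N → f J ≢ 0 → scan f z N ≡ z J ⊎ scan f z N ≡ 0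
      scan-found {J} {suc N} l fJ with J ≟ N
      ... | yes refl rewrite choose-≢0 {f J} {new (scan f z J) (z J)} {scan f z J} fJ = new-cases (scan f z J) (z J)
      ... | no  J≢N with scan-found (≤∧≢⇒< (s≤s⁻¹ l) J≢N) fJ | f N
      ...   | r | zero = r
      ...   | inj₂ r | suc _ rewrite r with z N
      ...     | zero  = inj₂ refl
      ...     | suc _ = inj₂ refl
      scan-found {J} {suc N} l fJ | no J≢N | inj₁ r | suc _ rewrite r | eqn-≢ (z≢1 J) with z J ≟ z N
      ... | yes eq rewrite eq | eqn-refl (z N) = inj₁ refl
      ... | no  ne rewrite eqn-≢ ne = inj₂ refl

      scan-pick : ∀ {t} N → t ≢ 0 → scan f z N ≢ 1 → scan f z N ≢ t → ∃[ J ] J < N × f J ≢ 0 × z J ≢ t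
      scan-pick zero t≢0 n₁ nt = contradiction refl n₁
      scan-pick {t} (suc N) t≢0 n₁ nt with f N in fN
      ... | zero with scan-pick N t≢0 n₁ nt
      ...   | J , l , p , q = J , m<n⇒m<1+n l , p , q
      scan-pick {t} (suc N) t≢0 n₁ nt | suc _ with z N ≟ t
      ... | no  ne = N , ≤-refl , (λ e → case trans (sym fN) e of λ ()) , ne
      ... | yes refl with scan f z N ≟ 1
      ...   | yes e rewrite e = contradiction refl nt
      ...   | no  n₁′ with scan f z N ≟ z N
      ...     | yes e rewrite e | eqn-≢ (z≢1 N) | eqn-refl (z N) = contradiction refl nt
      ...     | no  nt′ with scan-pick N t≢0 n₁′ nt′
      ...       | J , l , p , q = J , m<n⇒m<1+n l , p , q

  module ForestDP where

    open StructuredPrograms using (b2n; eqn; ltn; choose; upd; ≡ᵇ-refl; ≡ᵇ-≢)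
    open ProgramLogic using (sumTo; sumOver)
    open Sums
    open import Data.List.Base using (List; length)
    open import Data.List.Membership.Propositional using (_∈_)
    open import Data.Nat.Base
    open import Data.Nat.Properties

    cnt : (ℕ → ℕ) → List ℕ → ℕ → ℕ
    cnt f ks x = sumOver ks (λ k → eqn (f k) x)

    clash : (ℕ → ℕ) → ℕ → ℕ → ℕ
    clash f s k = eqn (f k) 1 + eqn (f k) s

    cnt-clash : ∀ f s ks → cnt f ks 1 + cnt f ks s ≡ sumOver ks (clash f s)
    cnt-clash f s ks = sym (sumOver-+ ks _ _)

    clash≤1 : ∀ f {s} k → s ≢ 1 → clash f s k ≤ 1
    clash≤1 f {s} k s≢1 with f k ≟ 1
    ... | yes e rewrite e | eqn-≢ (s≢1 ∘ sym) = ≤-refl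
    ... | no  n rewrite eqn-≢ n = b2n≤1 _

    clash-≡0 : ∀ f s {k} → f k ≢ 1 → f k ≢ s → clash f s k ≡ 0
    clash-≡0 f s p q = cong₂ _+_ (eqn-≢ p) (eqn-≢ q)

    clash-0 : ∀ f s {k} → clash f s k ≡ 0 → f k ≢ 1 × f k ≢ s
    clash-0 f s {k} z = eqn-≡0 (m+n≡0⇒m≡0 (eqn (f k) 1) z) , eqn-≡0 (m+n≡0⇒n≡0 (eqn (f k) 1) z)

    2≤⇒≢0 : ∀ {x} → 2 ≤ x → x ≢ 0
    2≤⇒≢0 () refl

    2≤⇒≢1 : ∀ {x} → 2 ≤ x → x ≢ 1
    2≤⇒≢1 (s≤s ()) refl

    feasible : (na nb nz h d o J : ℕ) → ℕ
    feasible na nb nz h d o J = eqn nz 0 * (ltn (na + h * o) (J + 1) * ltn (nb + h * (1 ∸ o) + J) (d + 1))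

    feasible-≢0 : ∀ {na nb nz h d o J} → feasible na nb nz h d o J ≢ 0 → nz ≡ 0 × na + h * o ≤ J × nb + h * (1 ∸ o) + J ≤ d
    feasible-≢0 {na} {nb} {nz} {h} {d} {o} {J} f with *-≢0 {eqn nz 0} f
    ... | a , b with *-≢0 {ltn (na + h * o) (J + 1)} b
    ... | c , e = eqn-≢0 a , s≤s⁻¹ (≤-trans (ltn-≢0 c) (≤-reflexive (+-comm J 1))) , s≤s⁻¹ (≤-trans (ltn-≢0 e) (≤-reflexive (+-comm d 1)))

    ≢0-feasible : ∀ {na nb nz h d o J} → nz ≡ 0 → na + h * o ≤ J → nb + h * (1 ∸ o) + J ≤ d → feasible na nb nz h d o J ≢ 0
    ≢0-feasible {d = d} {J = J} refl p q
      rewrite ltn-< (≤-trans (s≤s p) (≤-reflexive (+-comm 1 J))) | ltn-< (≤-trans (s≤s q) (≤-reflexive (+-comm 1 _))) = λ ()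

    module DP (κ : ℕ → ℕ → ℕ) (2≤κ : ∀ v J → 2 ≤ κ v J) (hp d same : ℕ → ℕ)
              (hp≤1 : ∀ v → hp v ≤ 1) (same≤1 : ∀ v → same v ≤ 1) (kids : ℕ → List ℕ) where

      ζ : ℕ → ℕ → ℕ
      ζ v J = same v * κ v J

      ζ≢1 : ∀ v J → ζ v J ≢ 1
      ζ≢1 v J with ≡0⊎≡1 (same≤1 v)
      ... | inj₁ e rewrite e = λ ()
      ... | inj₂ e rewrite e = 2≤⇒≢1 (≤-trans (2≤κ v J) (≤-reflexive (sym (+-identityʳ _))))

      num : (ℕ → ℕ) → ℕ → ℕ → ℕ
      num f v s = cnt f (kids v) 1 + cnt f (kids v) s

      feas : (A B Z : ℕ → ℕ) → ℕ → ℕ → ℕ → ℕ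
      feas A B Z v o J = feasible (num A v (κ v J)) (num B v (κ v J)) (num Z v (κ v J)) (hp v) (d v) o J

      any : (A B Z : ℕ → ℕ) → ℕ → ℕ → ℕ
      any A B Z v J = feas A B Z v 0 J + feas A B Z v 1 J

      record Spec (A B Z : ℕ → ℕ) (v : ℕ) : Set where
        field
          specA : A v ≡ scan (feas A B Z v 0) (ζ v) (d v + 1)
          specB : B v ≡ scan (feas A B Z v 1) (ζ v) (d v + 1)
          specZ : Z v ≡ scan (any A B Z v) (ζ v) (d v + 1)
      open Spec

      num-cong : ∀ {f g v s} → (∀ {k} → k ∈ kids v → f k ≡ g k) → num f v s ≡ num g v s
      num-cong {v = v} h = cong₂ _+_ (sumOver-cong (kids v) λ m → cong (λ z → eqn z _) (h m)) (sumOver-cong (kids v) λ m → cong (λ z → eqn z _) (h m))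

      feas-cong : ∀ {A B Z A′ B′ Z′ v} → (∀ {k} → k ∈ kids v → A k ≡ A′ k × B k ≡ B′ k × Z k ≡ Z′ k) →
        ∀ o J → feas A B Z v o J ≡ feas A′ B′ Z′ v o J
      feas-cong {A} {B} {Z} {v = v} h o J
        rewrite num-cong {A} {v = v} {κ v J} (λ m → proj₁ (h m))
              | num-cong {B} {v = v} {κ v J} (λ m → proj₁ (proj₂ (h m)))
              | num-cong {Z} {v = v} {κ v J} (λ m → proj₂ (proj₂ (h m))) = refl

      spec-cong : ∀ {A B Z A′ B′ Z′ v} → (∀ {k} → k ∈ kids v → A k ≡ A′ k × B k ≡ B′ k × Z k ≡ Z′ k) →
        A v ≡ A′ v × B v ≡ B′ v × Z v ≡ Z′ v → Spec A B Z v → Spec A′ B′ Z′ v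
      spec-cong {v = v} h (a , b , z) s = record
        { specA = trans (sym a) (trans (specA s) (scan-cong (d v + 1) (feas-cong h 0)))
        ; specB = trans (sym b) (trans (specB s) (scan-cong (d v + 1) (feas-cong h 1)))
        ; specZ = trans (sym z) (trans (specZ s) (scan-cong (d v + 1) λ J → cong₂ _+_ (feas-cong h 0 J) (feas-cong h 1 J))) }

      module Solve (A B Z : ℕ → ℕ) where

        code : ℕ → ℕ → ℕ
        code o v = choose o (B v) (A v)

        found : ∀ {v o J} → o ≤ 1 → Spec A B Z v → J ≤ d v → feas A B Z v o J ≢ 0 →
          (code o v ≡ ζ v J ⊎ code o v ≡ 0) × (Z v ≡ ζ v J ⊎ Z v ≡ 0)
        found {v} {o} {J} o≤1 s J≤d f = c o≤1 f , subst (λ c → c ≡ ζ v J ⊎ c ≡ 0) (sym (specZ s)) (scan-found _ (ζ v) (ζ≢1 v) J< (z o≤1 f))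
          where
          J< : J < d v + 1
          J< = ≤-trans (s≤s J≤d) (≤-reflexive (+-comm 1 (d v)))
          c : ∀ {o} → o ≤ 1 → feas A B Z v o J ≢ 0 → code o v ≡ ζ v J ⊎ code o v ≡ 0
          c z≤n       f = subst (λ c → c ≡ ζ v J ⊎ c ≡ 0) (sym (specA s)) (scan-found _ (ζ v) (ζ≢1 v) J< f)
          c (s≤s z≤n) f = subst (λ c → c ≡ ζ v J ⊎ c ≡ 0) (sym (specB s)) (scan-found _ (ζ v) (ζ≢1 v) J< f)
          z : ∀ {o} → o ≤ 1 → feas A B Z v o J ≢ 0 → any A B Z v J ≢ 0
          z z≤n       f e = f (m+n≡0⇒m≡0 _ e)
          z (s≤s z≤n) f e = f (m+n≡0⇒n≡0 (feas A B Z v 0 J) e)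

        pick : ∀ {v o t} → o ≤ 1 → Spec A B Z v → t ≢ 0 → code o v ≢ 1 → code o v ≢ t →
          ∃[ J ] J ≤ d v × feas A B Z v o J ≢ 0 × ζ v J ≢ t
        pick {v} z≤n s t≢0 n₁ nt with scan-pick _ (ζ v) (ζ≢1 v) (d v + 1) t≢0 (n₁ ∘ trans (specA s)) (nt ∘ trans (specA s))
        ... | J , l , p , q = J , s≤s⁻¹ (≤-trans l (≤-reflexive (+-comm (d v) 1))) , p , q
        pick {v} (s≤s z≤n) s t≢0 n₁ nt with scan-pick _ (ζ v) (ζ≢1 v) (d v + 1) t≢0 (n₁ ∘ trans (specB s)) (nt ∘ trans (specB s))
        ... | J , l , p , q = J , s≤s⁻¹ (≤-trans l (≤-reflexive (+-comm (d v) 1))) , p , q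

        pickZ : ∀ {v t} → Spec A B Z v → t ≢ 0 → Z v ≢ 1 → Z v ≢ t →
          ∃[ o ] ∃[ J ] o ≤ 1 × J ≤ d v × feas A B Z v o J ≢ 0 × ζ v J ≢ t
        pickZ {v} s t≢0 n₁ nt with scan-pick _ (ζ v) (ζ≢1 v) (d v + 1) t≢0 (n₁ ∘ trans (specZ s)) (nt ∘ trans (specZ s))
        ... | J , l , p , q with feas A B Z v 0 J ≟ 0
        ...   | no  f = 0 , J , z≤n , s≤s⁻¹ (≤-trans l (≤-reflexive (+-comm (d v) 1))) , f , q
        ...   | yes f = 1 , J , ≤-refl , s≤s⁻¹ (≤-trans l (≤-reflexive (+-comm (d v) 1))) , (λ f′ → p (cong₂ _+_ f f′)) , q

        allowed : ∀ {v o J t} → o ≤ 1 → Spec A B Z v → J ≤ d v → feas A B Z v o J ≢ 0 → t ≢ 0 → ζ v J ≢ t →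
          code o v ≢ 1 × code o v ≢ t × Z v ≢ 1 × Z v ≢ t
        allowed {v} {o} {J} {t} o≤1 s J≤d f t≢0 n with found o≤1 s J≤d f
        ... | c , z = h₁ c , ht c , h₁ z , ht z
          where
          h₁ : ∀ {c} → c ≡ ζ v J ⊎ c ≡ 0 → c ≢ 1
          h₁ (inj₁ e) e′ = ζ≢1 v J (trans (sym e) e′)
          h₁ (inj₂ e) e′ = contradiction (trans (sym e) e′) λ ()
          ht : ∀ {c} → c ≡ ζ v J ⊎ c ≡ 0 → c ≢ t
          ht (inj₁ e) e′ = n (trans (sym e) e′)
          ht (inj₂ e) e′ = t≢0 (trans (sym e′) e)

        clash-either : ∀ {v s} → Spec A B Z v → s ≢ 0 → clash Z s v ≡ 0 → clash A s v ≡ 0 ⊎ clash B s v ≡ 0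
        clash-either {v} {s} sp s≢0 z with clash-0 Z s z
        ... | n₁ , nt with pickZ sp s≢0 n₁ nt
        ... | o , J , o≤1 , J≤d , f , q with allowed o≤1 sp J≤d f s≢0 q
        clash-either {v} {s} sp s≢0 z | n₁ , nt | _ , J , z≤n , _ | c₁ , ct , _ = inj₁ (clash-≡0 A s c₁ ct)
        clash-either {v} {s} sp s≢0 z | n₁ , nt | _ , J , s≤s z≤n , _ | c₁ , ct , _ = inj₂ (clash-≡0 B s c₁ ct)

        -- The number of heavy edges at v when every vertex k with a parent is joined
        -- to it by a heavy (b k = 1) or light (b k = 0) edge.
        heavy : (ℕ → ℕ) → ℕ → ℕ
        heavy b v = sumOver (kids v) b + hp v * b v

        module Complete (n : ℕ) (rk : ℕ → ℕ)
          (kid<n : ∀ {v k} → v < n → k ∈ kids v → k < n)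
          (rk-kid : ∀ {v k} → v < n → k ∈ kids v → rk k < rk v)
          (degree : ∀ {v} → v < n → d v ≡ length (kids v) + hp v)
          (specs : ∀ {v} → v < n → Spec A B Z v)
          (b : ℕ → ℕ) (b≤1 : ∀ k → b k ≤ 1)
          (proper : ∀ {v k} → v < n → k ∈ kids v → ζ k (heavy b k) ≢ κ v (heavy b v)) where

          heavy≤d : ∀ {v} → v < n → heavy b v ≤ d v
          heavy≤d {v} l = ≤-trans (+-mono-≤ (sumOver-length (kids v) λ {k} _ → b≤1 k)
            (≤-trans (*-monoʳ-≤ (hp v) (b≤1 v)) (≤-reflexive (*-identityʳ _)))) (≤-reflexive (sym (degree l)))

          private
            go : ∀ r {v} → rk v < r → v < n → feas A B Z v (b v) (heavy b v) ≢ 0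
            go (suc r) {v} rk<r v<n = ≢0-feasible {num A v s} {num B v s} {num Z v s} {hp v} {d v} {b v} nz≡0 na≤ nb≤
              where
              s = κ v (heavy b v)
              s≢0 : s ≢ 0
              s≢0 = 2≤⇒≢0 (2≤κ v _)
              s≢1 : s ≢ 1
              s≢1 = 2≤⇒≢1 (2≤κ v _)
              kid : ∀ {k} → k ∈ kids v → code (b k) k ≢ 1 × code (b k) k ≢ s × Z k ≢ 1 × Z k ≢ s
              kid {k} k∈ = allowed (b≤1 k) (specs k<n) (heavy≤d k<n) (go r (<-≤-trans (rk-kid v<n k∈) (s≤s⁻¹ rk<r)) k<n) s≢0 (proper v<n k∈)
                where k<n = kid<n v<n k∈
              A≤ : ∀ {k} → k ∈ kids v → clash A s k ≤ b k
              A≤ {k} k∈ with b k | b≤1 k | kid k∈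
              ... | zero | _ | c₁ , ct , _ = ≤-reflexive (clash-≡0 A s c₁ ct)
              ... | suc _ | s≤s z≤n | _ = clash≤1 A k s≢1
              B≤ : ∀ {k} → k ∈ kids v → clash B s k + b k ≤ 1
              B≤ {k} k∈ with b k | b≤1 k | kid k∈
              ... | zero | _ | _ = ≤-trans (≤-reflexive (+-identityʳ _)) (clash≤1 B k s≢1)
              ... | suc _ | s≤s z≤n | c₁ , ct , _ = ≤-reflexive (cong (_+ 1) (clash-≡0 B s c₁ ct))
              nz≡0 : num Z v s ≡ 0
              nz≡0 = trans (cnt-clash Z s (kids v)) (trans (sumOver-cong (kids v) λ k∈ → let _ , _ , z₁ , zt = kid k∈ in clash-≡0 Z s z₁ zt)
                (trans (sumOver-const (kids v) 0) (*-zeroʳ (length (kids v)))))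
              na≤ : num A v s + hp v * b v ≤ heavy b v
              na≤ = +-monoˡ-≤ (hp v * b v) (≤-trans (≤-reflexive (cnt-clash A s (kids v))) (sumOver-mono (kids v) A≤))
              split : hp v * (1 ∸ b v) + hp v * b v ≡ hp v
              split = trans (sym (*-distribˡ-+ (hp v) (1 ∸ b v) (b v))) (trans (cong (hp v *_) (m∸n+n≡m (b≤1 v))) (*-identityʳ _))
              nb≤ : num B v s + hp v * (1 ∸ b v) + heavy b v ≤ d v
              nb≤ = begin
                num B v s + hp v * (1 ∸ b v) + (sumOver (kids v) b + hp v * b v)   ≡⟨ interchange′ (num B v s) _ _ _ ⟩
                num B v s + sumOver (kids v) b + (hp v * (1 ∸ b v) + hp v * b v)   ≡⟨ cong₂ _+_ (trans (cong (_+ sumOver (kids v) b) (cnt-clash B s (kids v))) (sym (sumOver-+ (kids v) (clash B s) b))) split ⟩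
                sumOver (kids v) (λ k → clash B s k + b k) + hp v                  ≤⟨ +-monoˡ-≤ (hp v) (sumOver-length (kids v) B≤) ⟩
                length (kids v) + hp v                                             ≡⟨ degree v<n ⟨
                d v                                                                ∎
                where open ≤-Reasoning
                      interchange′ : ∀ a b c e → a + b + (c + e) ≡ a + c + (b + e)
                      interchange′ a b c e = +-interchange a b c e

          feasible-all : ∀ {v} → v < n → feas A B Z v (b v) (heavy b v) ≢ 0
          feasible-all {v} = go (suc (rk v)) ≤-refl

          Z≢1 : ∀ {v} → v < n → Z v ≢ 1
          Z≢1 {v} l with found (b≤1 v) (specs l) (heavy≤d l) (feasible-all l)
          ... | _ , inj₁ e = ζ≢1 v _ ∘ trans (sym e)
          ... | _ , inj₂ e = λ e′ → contradiction (trans (sym e) e′) λ ()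

  module Algorithm where

    open StructuredPrograms
    open ProgramLogic
    open import Data.Fin.Base using (zero; suc)
    open import Data.List.Base using (List; []; _∷_)
    open import Data.Nat.Base

    pattern vN = zero
    pattern vM = suc vN
    pattern vE = suc vM
    pattern vX = suc vE
    pattern vY = suc vX
    pattern vI = suc vY
    pattern vU = suc vI
    pattern vP = suc vU
    pattern vC = suc vP
    pattern vV = suc vC
    pattern vK = suc vV
    pattern vD = suc vK
    pattern vJ = suc vD
    pattern vS = suc vJ
    pattern vNA = suc vS
    pattern vNB = suc vNA
    pattern vNZ = suc vNB
    pattern vH = suc vNZ
    pattern vZ = suc vH
    pattern vFA = suc vZ
    pattern vFB = suc vFA
    pattern vCA = suc vFB
    pattern vCB = suc vCA
    pattern vCZ = suc vCB
    pattern vAns = suc vCZ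
    pattern vO = suc vAns
    pattern vForb = suc vO
    pattern vBS = suc vForb
    pattern vBQ = suc vBS
    pattern vW = suc vBQ

    pattern IO = zero
    pattern Deg = suc IO
    pattern D₀ = suc Deg
    pattern Es = suc D₀
    pattern Hp = suc Es
    pattern Pe = suc Hp
    pattern Ord = suc Pe
    pattern Head = suc Ord
    pattern Next = suc Head
    pattern Same = suc Next
    pattern aA = suc Same
    pattern aB = suc aA
    pattern aZ = suc aB
    pattern TA = suc aZ
    pattern TB = suc TA
    pattern TZ = suc TB
    pattern Opt = suc TZ
    pattern Forb = suc Opt

    infixl 7 _⊗_
    infixl 6 _⊞_ _⊟_
    _⊞_ _⊟_ _⊗_ : ∀ {d} → Exp (suc d) → Exp d → Exp (suc d)
    _⊞_ = bin plus
    _⊟_ = bin minus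
    _⊗_ = bin times

    lt eq : ∀ {d} → Exp (suc d) → Exp d → Exp (suc d)
    lt = bin less
    eq = bin equal

    read : List Stm
    read = (vN ≔ get IO (con 0)) ∷ (vM ≔ get IO (con 1)) ∷ []

    endX endY : ∀ {d} → Exp (2 + d)
    endX = get IO (con 2 ⊞ (var vE ⊞ var vE))
    endY = get IO (con 3 ⊞ (var vE ⊞ var vE))

    countBody : List Stm
    countBody =
      (vX ≔ endX) ∷ (vY ≔ endY) ∷
      (Deg ⟦ var vX ⟧≔ get Deg (var vX) ⊞ con 1) ∷ (Deg ⟦ var vY ⟧≔ get Deg (var vY) ⊞ con 1) ∷
      (D₀ ⟦ var vX ⟧≔ get D₀ (var vX) ⊞ con 1) ∷ (D₀ ⟦ var vY ⟧≔ get D₀ (var vY) ⊞ con 1) ∷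
      (Es ⟦ var vX ⟧≔ get Es (var vX) ⊞ var vE) ∷ (Es ⟦ var vY ⟧≔ get Es (var vY) ⊞ var vE) ∷
      (vE ≔ var vE ⊞ con 1) ∷ []

    count : Cmd
    count = loop (lt (var vE) (var vM)) (block countBody)

    module Weights (P Q R r : ℕ) where

      locate prune : List Stm
      locate = (vE ≔ get Es (var vU)) ∷ (vX ≔ endX) ∷ (vY ≔ endY) ∷ (vP ≔ (var vX ⊞ var vY) ⊟ var vU) ∷ []
      prune =
        (Deg ⟦ var vX ⟧≔ get Deg (var vX) ⊟ con 1) ∷ (Deg ⟦ var vY ⟧≔ get Deg (var vY) ⊟ con 1) ∷
        (Es ⟦ var vX ⟧≔ get Es (var vX) ⊟ var vE) ∷ (Es ⟦ var vY ⟧≔ get Es (var vY) ⊟ var vE) ∷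
        (Hp ⟦ var vU ⟧≔ con 1) ∷ (Pe ⟦ var vU ⟧≔ var vE) ∷
        (Ord ⟦ var vC ⟧≔ var vU) ∷ (vC ≔ var vC ⊞ con 1) ∷
        (Next ⟦ var vU ⟧≔ get Head (var vP)) ∷ (Head ⟦ var vP ⟧≔ var vU ⊞ con 1) ∷
        (Same ⟦ var vU ⟧≔ eq (big r ⊗ get D₀ (var vU)) (big r ⊗ get D₀ (var vP))) ∷
        (vU ≔ var vP) ∷ []

      advance : List Stm
      advance = (vI ≔ var vI ⊞ con 1) ∷ (vU ≔ var vI) ∷ []

      strip : Cmd
      strip = loop (lt (var vI) (var vN)) (branch (eq (get Deg (var vU)) (con 1)) (block locate ⨟ block prune) (block advance))

      rootsBody : List Stm
      rootsBody = (Ord ⟦ var vC ⟧≔ var vV) ∷ (vC ≔ var vC ⊞ (con 1 ⊟ get Hp (var vV))) ∷ (vV ≔ var vV ⊞ con 1) ∷ []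

      roots : Cmd
      roots = loop (lt (var vV) (var vN)) (block rootsBody)

      fillBody clearBody : List Stm
      fillBody =
        (vK ≔ var vK ⊟ con 1) ∷
        (TA ⟦ get aA (var vK) ⟧≔ get TA (get aA (var vK)) ⊞ con 1) ∷
        (TB ⟦ get aB (var vK) ⟧≔ get TB (get aB (var vK)) ⊞ con 1) ∷
        (TZ ⟦ get aZ (var vK) ⟧≔ get TZ (get aZ (var vK)) ⊞ con 1) ∷
        (vK ≔ get Next (var vK)) ∷ []
      clearBody =
        (vK ≔ var vK ⊟ con 1) ∷
        (TA ⟦ get aA (var vK) ⟧≔ con 0) ∷ (TB ⟦ get aB (var vK) ⟧≔ con 0) ∷ (TZ ⟦ get aZ (var vK) ⟧≔ con 0) ∷
        (vK ≔ get Next (var vK)) ∷ []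

      fill clear : Cmd
      fill  = loop (var vK) (block fillBody)
      clear = loop (var vK) (block clearBody)

      probe : List Stm
      probe =
        (vS ≔ con 2 ⊞ big P ⊗ (var vD ⊟ var vJ) ⊞ big Q ⊗ var vJ ⊞ big R ⊗ (var vN ⊟ var vJ)) ∷
        (vNA ≔ get TA (con 1) ⊞ get TA (var vS)) ∷
        (vNB ≔ get TB (con 1) ⊞ get TB (var vS)) ∷
        (vNZ ≔ get TZ (con 1) ⊞ get TZ (var vS)) ∷ []

      feasE : ∀ {d} → (∀ {d} → Exp d) → Exp (5 + d)
      feasE o = eq (var vNZ) (con 0) ⊗
        (lt (var vNA ⊞ var vH ⊗ o) (var vJ ⊞ con 1) ⊗ lt (var vNB ⊞ var vH ⊗ (con 1 ⊟ o) ⊞ var vJ) (var vD ⊞ con 1))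

      merge : Exp 7 → Var → Stm
      merge f c = c ≔ sel f (sel (eq (var c) (con 1)) (var vZ) (sel (eq (var c) (var vZ)) (var vZ) (con 0))) (var c)

      decide : List Stm
      decide =
        (vFA ≔ feasE (con 0)) ∷ (vFB ≔ feasE (con 1)) ∷ (vZ ≔ var vW ⊗ var vS) ∷
        merge (var vFA) vCA ∷ merge (var vFB) vCB ∷ merge (var vFA ⊞ var vFB) vCZ ∷
        (vJ ≔ var vJ ⊞ con 1) ∷ []

      tryJ : ∀ {d} → Exp (2 + d)
      tryJ = lt (var vJ) (var vD ⊞ con 1)

      up₁ up₂ up₃ up₄ : List Stm
      up₁ = (vU ≔ get Ord (var vI)) ∷ (vK ≔ get Head (var vU)) ∷ []
      up₂ = (vD ≔ get D₀ (var vU)) ∷ (vH ≔ get Hp (var vU)) ∷ (vW ≔ get Same (var vU)) ∷ (vJ ≔ con 0) ∷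
            (vCA ≔ con 1) ∷ (vCB ≔ con 1) ∷ (vCZ ≔ con 1) ∷ []
      up₃ = (vK ≔ get Head (var vU)) ∷ []
      up₄ = (aA ⟦ var vU ⟧≔ var vCA) ∷ (aB ⟦ var vU ⟧≔ var vCB) ∷ (aZ ⟦ var vU ⟧≔ var vCZ) ∷
            (vAns ≔ sel (eq (var vCZ) (con 1)) (con 0) (var vAns)) ∷ (vI ≔ var vI ⊞ con 1) ∷ []

      upScan upBody up : Cmd
      upScan = loop tryJ (block probe ⨟ block decide)
      upBody = block up₁ ⨟ fill ⨟ block up₂ ⨟ upScan ⨟ block up₃ ⨟ clear ⨟ block up₄
      up = loop (lt (var vI) (var vC)) upBody

      choice : List Stm
      choice =
        (vFA ≔ feasE (var vO) ⊗ (con 1 ⊟ eq (var vS) (var vForb))) ∷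
        (vBQ ≔ sel (var vFA) (var vJ ⊟ (var vNA ⊞ var vH ⊗ var vO)) (var vBQ)) ∷
        (vBS ≔ sel (var vFA) (var vS) (var vBS)) ∷
        (vJ ≔ var vJ ⊞ con 1) ∷ []

      down₁ down₂ : List Stm
      down₁ = (vI ≔ var vI ⊟ con 1) ∷ (vU ≔ get Ord (var vI)) ∷ (vK ≔ get Head (var vU)) ∷ []
      down₂ = (vD ≔ get D₀ (var vU)) ∷ (vH ≔ get Hp (var vU)) ∷ (vJ ≔ con 0) ∷
              (vO ≔ get Opt (var vU)) ∷ (vForb ≔ get Forb (var vU)) ∷ (vBS ≔ con 0) ∷ (vBQ ≔ con 0) ∷ []

      assignBody : List Stm
      assignBody =
        (vK ≔ var vK ⊟ con 1) ∷
        (vFA ≔ eq (get aA (var vK)) (con 1) ⊞ eq (get aA (var vK)) (var vBS)) ∷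
        (vFB ≔ eq (get aB (var vK)) (con 1) ⊞ eq (get aB (var vK)) (var vBS)) ∷
        (vO ≔ sel (var vFA) (con 1) (sel (var vFB) (con 0) (lt (con 0) (var vBQ)))) ∷
        (vBQ ≔ sel (var vFA) (var vBQ) (sel (var vFB) (var vBQ) (var vBQ ⊟ con 1))) ∷
        (Opt ⟦ var vK ⟧≔ var vO) ∷
        (Forb ⟦ var vK ⟧≔ get Same (var vK) ⊗ var vBS) ∷
        (IO ⟦ con 1 ⊞ get Pe (var vK) ⟧≔ var vO) ∷
        (vK ≔ get Next (var vK)) ∷ []

      downScan assign downBody down : Cmd
      downScan = loop tryJ (block probe ⨟ block choice)
      assign = loop (var vK) (block assignBody)
      downBody = block down₁ ⨟ fill ⨟ block down₂ ⨟ downScan ⨟ block up₃ ⨟ clear ⨟ block up₃ ⨟ assign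
      down = loop (lt (con 0) (var vI)) downBody

      prep₂ prep₃ prep₄ prep₅ : List Stm
      prep₂ = (vI ≔ con 0) ∷ (vU ≔ con 0) ∷ (vC ≔ con 0) ∷ []
      prep₃ = (vV ≔ con 0) ∷ []
      prep₄ = (vI ≔ con 0) ∷ (vAns ≔ con 1) ∷ []
      prep₅ = (vI ≔ sel (var vAns) (var vC) (con 0)) ∷ []

      algorithm : Cmd
      algorithm =
        block read ⨟ count ⨟ block prep₂ ⨟ strip ⨟ block prep₃ ⨟ roots ⨟
        block prep₄ ⨟ up ⨟ block prep₅ ⨟ down ⨟ block ((IO ⟦ con 0 ⟧≔ var vAns) ∷ [])

      over : Exp 7 → ℕ
      over e = costE e + 3

      fillC clearC assignC upScanC downScanC upC downC countC stripC rootsC upAll downAll allC : ℕ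
      fillC   = 1 * (costB fillBody + over (var vK)) + over (var vK)
      clearC  = 1 * (costB clearBody + over (var vK)) + over (var vK)
      assignC = 1 * (costB assignBody + over (var vK)) + over (var vK)
      upScanC   = 1 * (costB probe + costB decide + over tryJ) + over tryJ
      downScanC = 1 * (costB probe + costB choice + over tryJ) + over tryJ
      upC     = costB up₁ + (fillC + (costB up₂ + (upScanC + (costB up₃ + (clearC + costB up₄)))))
      downC   = costB down₁ + (fillC + (costB down₂ + (downScanC + (costB up₃ + (clearC + (costB up₃ + assignC))))))
      countC  = 1 * (costB countBody + over (lt (var vE) (var vM))) + over (lt (var vE) (var vM))
      stripC  = 2 * (costE {7} (eq (get Deg (var vU)) (con 1)) + (3 + (costB locate + costB prune + costB advance)) + over (lt (var vI) (var vN))) + over (lt (var vI) (var vN))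
      rootsC  = 1 * (costB rootsBody + over (lt (var vV) (var vN))) + over (lt (var vV) (var vN))
      upAll   = (upC + over (lt (var vI) (var vC))) * 4 + over (lt (var vI) (var vC))
      downAll = (downC + over (lt (con 0) (var vI))) * 4 + over (lt (con 0) (var vI))
      allC    = costB read + (countC + (costB prep₂ + (stripC + (costB prep₃ + (rootsC + (costB prep₄ + (upAll + (costB prep₅ + (downAll + costB ((IO ⟦ con 0 ⟧≔ var vAns) ∷ []))))))))))

  module AlgorithmCorrectness where

    open StructuredPrograms
    open ProgramLogic
    open Sums
    open ForestDP
    open Algorithm
    open import Data.Bool.Base using (if_then_else_)
    open import Data.Empty using (⊥)
    open import Data.List.Base using (List; []; _∷_; length; downFrom)
    open import Data.List.Membership.Propositional using (_∈_; _∉_)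
    open import Data.List.Relation.Unary.All using (lookup; tabulate)
    open import Data.List.Relation.Unary.Any using (here; there)
    open import Data.List.Relation.Unary.AllPairs using ([]; _∷_)
    open import Data.List.Relation.Unary.Unique.Propositional using (Unique)
    open import Data.Nat.Base
    open import Data.Nat.Properties
    open import Data.List.Membership.DecPropositional _≟_ using (_∈?_)
    open import Data.Nat.Solver using (module +-*-Solver)

    -- A linked list of numbers: links point to k as suc k, and 0 is the end.
    Linked : (ℕ → ℕ) → ℕ → List ℕ → Set
    Linked next h []       = h ≡ 0
    Linked next h (k ∷ ks) = h ≡ suc k × Linked next (next k) ks

    Linked-cong : ∀ {f g} → (∀ x → f x ≡ g x) → ∀ ks {h} → Linked f h ks → Linked g h ks
    Linked-cong e []       l = l
    Linked-cong {f} {g} e (k ∷ ks) (p , l) = p , subst (λ h → Linked g h ks) (e k) (Linked-cong e ks l)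

    incidence : (X Y : ℕ → ℕ) → ℕ → ℕ → ℕ
    incidence X Y v e = eqn (X e) v + eqn (Y e) v

    -- A forest with edges X e – Y e for e < m: hp v tells whether v has a parent,
    -- pe v is the edge to it, and ord lists the vertices, children before parents.
    record Forest (n m r : ℕ) (X Y : ℕ → ℕ) : Set where
      field
        d hp same head next ord pe rk par : ℕ → ℕ
        kids     : ℕ → List ℕ
        c        : ℕ
        hp≤1     : ∀ v → hp v ≤ 1
        same≤1   : ∀ v → same v ≤ 1
        d≤n      : ∀ v → d v ≤ n
        degree   : ∀ v → d v ≡ length (kids v) + hp v
        linked   : ∀ v → Linked next (head v) (kids v)
        unique   : ∀ v → Unique (kids v)
        kid<n    : ∀ {v k} → k ∈ kids v → k < n
        kid-hp   : ∀ {v k} → k ∈ kids v → hp k ≡ 1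
        kid-par  : ∀ {v k} → k ∈ kids v → par k ≡ v
        kid-same : ∀ {v k} → k ∈ kids v → same k ≡ eqn (r * d k) (r * d v)
        kid-edge : ∀ {v k} → k ∈ kids v → pe k < m × ((X (pe k) ≡ k × Y (pe k) ≡ v) ⊎ (X (pe k) ≡ v × Y (pe k) ≡ k))
        parent   : ∀ {v} → v < n → hp v ≢ 0 → v ∈ kids (par v) × par v < n
        cover    : ∀ {e} → e < m → ∃[ v ] ∃[ k ] v < n × k ∈ kids v × pe k ≡ e
        count-β  : ∀ (β : ℕ → ℕ) v → sumTo m (λ e → incidence X Y v e * β e) ≡ sumOver (kids v) (β ∘ pe) + hp v * β (pe v)
        c≤       : c ≤ n + n
        ord<n    : ∀ {i} → i < c → ord i < n
        rk-ord   : ∀ {i} → i < c → rk (ord i) ≡ i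
        ord-rk   : ∀ {v} → v < n → rk v < c × ord (rk v) ≡ v
        rk-kid   : ∀ {v k} → v < n → k ∈ kids v → rk k < rk v

    record StaticFor {n m r X Y} (F : Forest n m r X Y) (σ : St) : Set where
      open Forest F
      field
        n≡    : vr σ vN ≡ n
        c≡    : vr σ vC ≡ c
        d≡    : ∀ v → ar σ D₀ v ≡ d v
        hp≡   : ∀ v → ar σ Hp v ≡ hp v
        same≡ : ∀ v → ar σ Same v ≡ same v
        head≡ : ∀ v → ar σ Head v ≡ head v
        next≡ : ∀ v → ar σ Next v ≡ next v
        ord≡  : ∀ v → ar σ Ord v ≡ ord v
        pe≡   : ∀ v → ar σ Pe v ≡ pe v

    record Assigned (fa fb q X L o q′ : ℕ) : Set where
      field
        bit     : o ≤ 1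
        light   : o ≡ 0 → fa ≡ 0
        heavier : o ≡ 1 → fb ≡ 0
        balance : o + q′ ≡ fa + q
        slack   : q′ + X ≤ L

    assigned : ∀ {fa fb q X L} → fa ≤ 1 → fb ≤ 1 → fa ≡ 0 ⊎ fb ≡ 0 → X ≤ L → q + (fa + fb + X) ≤ suc L →
      Assigned fa fb q X L (choose fa 1 (choose fb 0 (ltn 0 q))) (choose fa q (choose fb q (q ∸ 1)))
    assigned {zero} {zero} {zero} a b e x≤ h = record { bit = z≤n ; light = λ _ → refl ; heavier = λ () ; balance = refl ; slack = x≤ }
    assigned {zero} {zero} {suc q} a b e x≤ h = record { bit = ≤-refl ; light = λ () ; heavier = λ _ → refl ; balance = refl ; slack = s≤s⁻¹ h }
    assigned {zero} {suc zero} {q} {X} a b e x≤ h = record { bit = z≤n ; light = λ _ → refl ; heavier = λ () ; balance = refl ; slack = s≤s⁻¹ (≤-trans (≤-reflexive (sym (+-suc q X))) h) }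
    assigned {suc zero} {zero} {q} {X} a b e x≤ h = record { bit = ≤-refl ; light = λ () ; heavier = λ _ → refl ; balance = refl ; slack = s≤s⁻¹ (≤-trans (≤-reflexive (sym (+-suc q X))) h) }
    assigned {suc zero} {suc _} a b (inj₁ ())
    assigned {suc zero} {suc _} a b (inj₂ ())
    assigned {suc (suc _)} (s≤s ())
    assigned {zero} {suc (suc _)} a (s≤s ())

    one-zero : ∀ {a b} → a ≤ 1 → b ≤ 1 → a ≡ 0 ⊎ b ≡ 0 → a + b ≤ 1
    one-zero p q (inj₁ refl) = q
    one-zero p q (inj₂ refl) = ≤-trans (≤-reflexive (+-identityʳ _)) p

    uniq-tail : ∀ {x} {xs : List ℕ} → Unique (x ∷ xs) → Unique xs
    uniq-tail (_ ∷ u) = u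

    head∉ : ∀ {x} {xs : List ℕ} → Unique (x ∷ xs) → x ∉ xs
    head∉ (a ∷ _) x∈ = lookup a x∈ refl

    ∈-∷ : ∀ {P : ℕ → Set} {k ks} → P k → (∀ {j} → j ∈ ks → P j) → ∀ {j} → j ∈ k ∷ ks → P j
    ∈-∷ p f (here refl) = p
    ∈-∷ p f (there q)   = f q

    suc≢0 : ∀ {k} → suc k ≢ 0
    suc≢0 ()

    move-head : ∀ {j k : ℕ} {xs ys} → j ∈ xs ⊎ j ∈ k ∷ ys → j ∈ k ∷ xs ⊎ j ∈ ys
    move-head (inj₁ p)         = inj₁ (there p)
    move-head (inj₂ (here e))  = inj₁ (here e)
    move-head (inj₂ (there q)) = inj₂ q

    sumOver-≡0 : ∀ (xs : List ℕ) {f x} → sumOver xs f ≡ 0 → x ∈ xs → f x ≡ 0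
    sumOver-≡0 (x ∷ xs) {f} e (here refl) = m+n≡0⇒m≡0 (f x) e
    sumOver-≡0 (x ∷ xs) {f} e (there p)   = sumOver-≡0 xs (m+n≡0⇒n≡0 (f x) e) p

    room-left : ∀ {na nb h o J d} l → o ≤ 1 → na + h * o ≤ J → nb + h * (1 ∸ o) + J ≤ d → d ≡ l + h →
      J ∸ (na + h * o) + (na + nb) ≤ l
    room-left {na} {nb} {h} {o} {J} l o≤1 p q refl = +-cancelʳ-≤ h _ l (≤-trans (≤-reflexive sums-agree) q)
      where
      r = J ∸ (na + h * o)
      open ≡-Reasoning
      sums-agree : r + (na + nb) + h ≡ nb + h * (1 ∸ o) + J
      sums-agree = begin
        r + (na + nb) + h                       ≡⟨ cong (r + (na + nb) +_) (trans (cong (h *_) (m∸n+n≡m o≤1)) (*-identityʳ h)) ⟨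
        r + (na + nb) + h * ((1 ∸ o) + o)       ≡⟨ cong (r + (na + nb) +_) (*-distribˡ-+ h (1 ∸ o) o) ⟩
        r + (na + nb) + (h * (1 ∸ o) + h * o)   ≡⟨ solve 5 (λ r a b x y → r :+ (a :+ b) :+ (x :+ y) := b :+ x :+ (r :+ (a :+ y))) refl r na nb (h * (1 ∸ o)) (h * o) ⟩
        nb + h * (1 ∸ o) + (r + (na + h * o))   ≡⟨ cong (nb + h * (1 ∸ o) +_) (m∸n+n≡m p) ⟩
        nb + h * (1 ∸ o) + J                    ∎
        where open +-*-Solver

    separate : ∀ {a x s} → a ≤ 1 → x ≢ 0 → a * x ≢ s → x ≢ a * s
    separate z≤n p q = p
    separate {x = x} {s} (s≤s z≤n) p q e = q (trans (*-identityˡ x) (trans e (*-identityˡ s)))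

    by-cases : ∀ {P : Set} k (ks : List ℕ) → (k ∈ ks → P) → (k ∉ ks → P) → P
    by-cases k ks f g = case k ∈? ks of λ { (yes p) → f p ; (no p) → g p }

    updL : (ℕ → List ℕ) → ℕ → ℕ → ℕ → List ℕ
    updL f p u v = if p ≡ᵇ v then u ∷ f v else f v

    updL-same : ∀ f p u → updL f p u p ≡ u ∷ f p
    updL-same f p u rewrite ≡ᵇ-refl p = refl

    updL-other : ∀ f {p u v} → p ≢ v → updL f p u v ≡ f v
    updL-other f n rewrite ≡ᵇ-≢ _ _ n = refl

    updL-∈ : ∀ f p u v {k} → k ∈ updL f p u v → (v ≡ p × k ≡ u) ⊎ k ∈ f v
    updL-∈ f p u v k∈ with p ≟ v
    ... | no n = inj₂ (subst (_ ∈_) (updL-other f n) k∈)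
    ... | yes refl with subst (_ ∈_) (updL-same f p u) k∈
    ... | here e = inj₁ (refl , e)
    ... | there q = inj₂ q

    ∈-updL : ∀ f p u v {k} → k ∈ f v → k ∈ updL f p u v
    ∈-updL f p u v k∈ with p ≟ v
    ... | no n = subst (_ ∈_) (sym (updL-other f n)) k∈
    ... | yes refl = subst (_ ∈_) (sym (updL-same f p u)) (there k∈)

    Linked-upd : ∀ next u z ks {h} → u ∉ ks → Linked next h ks → Linked (upd next u z) h ks
    Linked-upd next u z []       u∉ l = l
    Linked-upd next u z (k ∷ ks) u∉ (e , l) = e ,
      subst (λ h → Linked (upd next u z) h ks) (sym (upd-other next z (u∉ ∘ here))) (Linked-upd next u z ks (u∉ ∘ there) l)

    m*n≡1 : ∀ {a b} → a * b ≡ 1 → a ≡ 1 × b ≡ 1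
    m*n≡1 {a} {b} e = m*n≡1⇒m≡1 a b e , m*n≡1⇒n≡1 a b e

    bump₂ : ∀ f x y a v → upd (upd f x (f x + a)) y (upd f x (f x + a) y + a) v ≡ f v + (eqn x v + eqn y v) * a
    bump₂ f x y a v = trans (upd-add (upd f x (f x + a)) y a v) (trans (cong (_+ eqn y v * a) (upd-add f x a v))
      (trans (+-assoc (f v) (eqn x v * a) (eqn y v * a)) (cong (f v +_) (sym (*-distribʳ-+ a (eqn x v) (eqn y v))))))

    drop₂ : ∀ f x y a v → upd (upd f x (f x ∸ a)) y (upd f x (f x ∸ a) y ∸ a) v ≡ f v ∸ (eqn x v + eqn y v) * a
    drop₂ f x y a v = trans (upd-sub (upd f x (f x ∸ a)) y a v) (trans (cong (_∸ eqn y v * a) (upd-sub f x a v))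
      (trans (∸-+-assoc (f v) (eqn x v * a) (eqn y v * a)) (cong (f v ∸_) (sym (*-distribʳ-+ a (eqn x v) (eqn y v))))))

    upd-cong : ∀ {f g i j a b} → (∀ x → f x ≡ g x) → i ≡ j → a ≡ b → ∀ v → upd f i a v ≡ upd g j b v
    upd-cong {f} {g} {i} h refl refl v = by-equality i v (λ { refl → trans (upd-same f i _) (sym (upd-same g i _)) })
      λ ne → trans (upd-other f _ ne) (trans (h v) (sym (upd-other g _ ne)))

    sum≤ : ∀ a b s {x y} → x ≤ a * s → y ≤ b * s → x + y ≤ (a + b) * s
    sum≤ a b s p q = ≤-trans (+-mono-≤ p q) (≤-reflexive (sym (*-distribʳ-+ s a b)))

    seven≤ : ∀ a b c d e f g s {t u v w x y z} → t ≤ a * s → u ≤ b * s → v ≤ c * s → w ≤ d * s → x ≤ e * s → y ≤ f * s → z ≤ g * s →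
      t + (u + (v + (w + (x + (y + z))))) ≤ (a + (b + (c + (d + (e + (f + g)))))) * s
    seven≤ a b c d e f g s p q r t u v w =
      sum≤ a _ s p (sum≤ b _ s q (sum≤ c _ s r (sum≤ d _ s t (sum≤ e _ s u (sum≤ f g s v w)))))

    eleven≤ : ∀ a b c d e f g h i j k s {a′ b′ c′ d′ e′ f′ g′ h′ i′ j′ k′} → a′ ≤ a * s → b′ ≤ b * s → c′ ≤ c * s → d′ ≤ d * s → e′ ≤ e * s → f′ ≤ f * s →
      g′ ≤ g * s → h′ ≤ h * s → i′ ≤ i * s → j′ ≤ j * s → k′ ≤ k * s →
      a′ + (b′ + (c′ + (d′ + (e′ + (f′ + (g′ + (h′ + (i′ + (j′ + k′))))))))) ≤ (a + (b + (c + (d + (e + (f + (g + (h + (i + (j + k)))))))))) * s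
    eleven≤ a b c d e f g h i j k s pa pb pc pd pe pf pg ph pi pj pk =
      seven≤ a b c d e f _ s pa pb pc pd pe pf (sum≤ g _ s pg (sum≤ h _ s ph (sum≤ i _ s pi (sum≤ j k s pj pk))))

    const≤* : ∀ x {s} → 1 ≤ s → x ≤ x * s
    const≤* x p = ≤-trans (≤-reflexive (sym (*-identityʳ x))) (*-monoʳ-≤ x p)

    times≤ : ∀ x {k t s} → k ≤ t * s → k * x ≤ t * x * s
    times≤ x {k} {t} {s} p = ≤-trans (*-monoˡ-≤ x p) (≤-reflexive (trans (*-assoc t s x) (trans (cong (t *_) (*-comm s x)) (sym (*-assoc t x s)))))

    sumOver-downFrom : ∀ k f → sumOver (downFrom k) f ≡ sumTo k f
    sumOver-downFrom zero    f = refl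
    sumOver-downFrom (suc k) f = trans (cong (f k +_) (sumOver-downFrom k f)) (+-comm (f k) (sumTo k f))

    sumTo-once : ∀ k f ρ → (∀ i → i < k → f i ≤ 1) → (∀ i → i < k → f i ≢ 0 → i ≡ ρ) → sumTo k f ≤ 1
    sumTo-once zero    f ρ b h = z≤n
    sumTo-once (suc k) f ρ b h with f k in eq
    ... | zero  = ≤-trans (≤-reflexive (+-identityʳ _)) (sumTo-once k f ρ (λ i l → b i (m<n⇒m<1+n l)) (λ i l → h i (m<n⇒m<1+n l)))
    ... | suc z = ≤-trans (≤-reflexive (cong (_+ suc z) (sumTo-zero k λ i l → by-equality (f i) 0 (λ e → e)
        λ ne → contradiction (trans (h i (m<n⇒m<1+n l) ne) (sym (h k ≤-refl (λ e → contradiction (trans (sym eq) e) λ ())))) (<⇒≢ l)))) (≤-trans (≤-reflexive (sym eq)) (b k ≤-refl))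

    module Graphs (n m r : ℕ) (X Y : ℕ → ℕ) (X<n : ∀ {e} → e < m → X e < n) (Y<n : ∀ {e} → e < m → Y e < n) (X≢Y : ∀ {e} → e < m → X e ≢ Y e) where

      inc : ℕ → ℕ → ℕ
      inc = incidence X Y

      deg₀ : ℕ → ℕ
      deg₀ v = sumTo m (inc v)

      Ends : ℕ → ℕ → ℕ → Set
      Ends e u v = (X e ≡ u × Y e ≡ v) ⊎ (X e ≡ v × Y e ≡ u)

      inc-end : ∀ {e u v} → e < m → Ends e u v → inc u e ≡ 1
      inc-end {e} l (inj₁ (refl , _)) = cong₂ _+_ (eqn-refl (X e)) (eqn-≢ (X≢Y l ∘ sym))
      inc-end {e} l (inj₂ (_ , refl)) = cong₂ _+_ (eqn-≢ (X≢Y l)) (eqn-refl (Y e))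

      inc-off : ∀ {e u v w} → Ends e u v → w ≢ u → w ≢ v → inc w e ≡ 0
      inc-off (inj₁ (refl , refl)) p q = cong₂ _+_ (eqn-≢ (p ∘ sym)) (eqn-≢ (q ∘ sym))
      inc-off (inj₂ (refl , refl)) p q = cong₂ _+_ (eqn-≢ (q ∘ sym)) (eqn-≢ (p ∘ sym))

      other-end : ∀ {e u} → e < m → inc u e ≢ 0 → Ends e u (X e + Y e ∸ u)
      other-end {e} {u} l i = by-equality (X e) u
        (λ { refl → inj₁ (refl , sym (m+n∸m≡n (X e) (Y e))) })
        (λ ne → by-equality (Y e) u (λ { refl → inj₂ (sym (m+n∸n≡m (X e) (Y e)) , refl) })
          λ ne′ → contradiction (cong₂ _+_ (eqn-≢ ne) (eqn-≢ ne′)) i)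

      ends-swap : ∀ {e u v} → Ends e u v → Ends e v u
      ends-swap (inj₁ (a , b)) = inj₂ (a , b)
      ends-swap (inj₂ (a , b)) = inj₁ (a , b)

      ends-≢ : ∀ {e u v} → e < m → Ends e u v → u ≢ v
      ends-≢ l (inj₁ (refl , refl)) = X≢Y l
      ends-≢ l (inj₂ (refl , refl)) = X≢Y l ∘ sym

      ends-< : ∀ {e u v} → e < m → Ends e u v → u < n
      ends-< l (inj₁ (refl , refl)) = X<n l
      ends-< l (inj₂ (refl , refl)) = Y<n l

      remDeg : (ℕ → ℕ) → ℕ → ℕ
      remDeg R v = sumTo m (λ e → R e * inc v e)

      record Leaf (R : ℕ → ℕ) (u e : ℕ) : Set where
        field
          e<m  : e < m
          R≡1  : R e ≡ 1
          inc≡1 : inc u e ≡ 1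
          only : ∀ (g : ℕ → ℕ) → sumTo m (λ i → R i * (inc u i * g i)) ≡ g e

      leaf : ∀ R {u} → remDeg R u ≡ 1 → ∃[ e ] Leaf R u e
      leaf R {u} one with sumTo-≡1 m (λ e → R e * inc u e) one
      ... | e , l , p , z with m*n≡1 {R e} p
      ... | R1 , i1 = e , record
        { e<m = l ; R≡1 = R1 ; inc≡1 = i1
        ; only = λ g → trans (sumTo-single m {e = e} l λ i i< ne → trans (sym (*-assoc (R i) (inc u i) (g i))) (cong (_* g i) (z i i< ne)))
            (trans (cong₂ (λ a b → a * (b * g e)) R1 i1) (trans (+-identityʳ _) (+-identityʳ _))) }

    record Setting : Set where
      field
        M st P Q R r n m : ℕ
        X Y     : ℕ → ℕ
        9≤st    : 9 ≤ st
        room    : 32 * (st * st) ≤ M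
        P<st    : P < st
        Q<st    : Q < st
        R<st    : R < st
        r<st    : r < st
        keys    : 2 + P * n + Q * n + R * n < st
        io<st   : 4 + (n + n + (n + n)) < st
        X<n     : ∀ {e} → e < m → X e < n
        Y<n     : ∀ {e} → e < m → Y e < n
        X≢Y     : ∀ {e} → e < m → X e ≢ Y e
        1≤n     : 1 ≤ n
        m≤n     : m ≤ n
        no-leaf : ∀ (S : ℕ → ℕ) → (∀ e → S e ≤ 1) → (∀ v → v < n → sumTo m (λ e → S e * incidence X Y v e) ≢ 1) → ∀ e → e < m → S e ≡ 0

    module Verification (setting : Setting) where
      open Setting setting
      open Weights P Q R r
      open Triples M st
      open Graphs n m r X Y X<n Y<n X≢Y

      instance
        st≢0 : NonZero st
        st≢0 = >-nonZero (<-≤-trans z<s 9≤st)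

      0<st : 0 < st
      0<st = <-≤-trans z<s 9≤st

      fitsˣ : ∀ {x y} → x < st → y < st → x * y < M
      fitsˣ p q = <-≤-trans (*-mono-< p q) (≤-trans (m≤n*m (st * st) 32) room)

      fits : ∀ {x} → x ≤ 32 * st → x < M
      fits {x} l = <-≤-trans (≤-<-trans l (*-monoʳ-< 32 st<)) room
        where st< : st < st * st
              st< = subst (_< st * st) (*-identityʳ st) (*-monoʳ-< st (<-≤-trans (s<s z<s) 9≤st))

      sum₂ : ∀ {x y} → x ≤ st → y ≤ st → x + y ≤ 32 * st
      sum₂ p q = +-mono-≤ p (≤-trans q (m≤n*m st 31))

      sum₃ : ∀ {x y z} → x ≤ st → y ≤ st → z ≤ st → x + y + z ≤ 32 * st
      sum₃ {x} {y} {z} p q s = ≤-trans (≤-reflexive (+-assoc x y z)) (+-mono-≤ p (+-mono-≤ q (≤-trans s (m≤n*m st 30))))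

      const≤ : ∀ {x} → x ≤ 9 → x ≤ st
      const≤ l = ≤-trans l 9≤st

      tally : ∀ (T : ℕ → ℕ) {a a′ c q} x → a ≡ a′ → T x + (eqn a′ x + c) ≡ q → upd T a (T a + 1) x + c ≡ q
      tally T {a} {c = c} x refl h = trans (cong (_+ c) (trans (upd-add T a 1 x) (cong (T x +_) (*-identityʳ _)))) (trans (+-assoc (T x) _ c) h)

      cnt≤ : ∀ f ks x → cnt f ks x ≤ length ks
      cnt≤ f ks x = sumOver-length ks λ _ → b2n≤1 _

      record Small (A B Z : ℕ → ℕ) (ks : List ℕ) : Set where
        field
          kids< : ∀ {k} → k ∈ ks → k < st
          smallA : ∀ k → A k < st
          smallB : ∀ k → B k < st
          smallZ : ∀ k → Z k < st
          short : length ks < st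
      open Small

      record Tallied (A B Z : ℕ → ℕ) (σ : St) (rem ks : List ℕ) : Set where
        field
          tallyA : ∀ x → ar σ TA x + cnt A rem x ≡ cnt A ks x
          tallyB : ∀ x → ar σ TB x + cnt B rem x ≡ cnt B ks x
          tallyZ : ∀ x → ar σ TZ x + cnt Z rem x ≡ cnt Z ks x
      open Tallied

      module _ (σ : St) (ks : List ℕ) (sm : Small (ar σ aA) (ar σ aB) (ar σ aZ) ks) where
        private
          A B Z : ℕ → ℕ
          A = ar σ aA
          B = ar σ aB
          Z = ar σ aZ

          FillInv : List ℕ → St → Set
          FillInv rem σ′ = Linked (ar σ Next) (vr σ′ vK) rem × (∀ {k} → k ∈ rem → k ∈ ks) × Tallied A B Z σ′ rem ks

          step-fill : ∀ k rem σ′ → Frame (block fillBody) σ σ′ → FillInv (k ∷ rem) σ′ → Iter (var vK) (block fillBody) σ′ (costB fillBody) (FillInv rem)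
          step-fill k rem σ′ F ((link , links) , sub , t) = iter tt (λ e → case trans (sym link) e of λ ())
            (triB (k<st , lA , k<st , lA , roomFor TA A (tallyA t) ,
                   k<st , lB , k<st , lB , roomFor TB B (tallyB t) ,
                   k<st , lZ , k<st , lZ , roomFor TZ Z (tallyZ t) , k<st , tt)
              ( subst (λ h → Linked (ar σ Next) h rem) (sym (trans (keepA F Next _) (cong (ar σ Next) k≡))) links
              , sub ∘ there
              , record { tallyA = λ x → tally (ar σ′ TA) x (trans (keepA F aA _) (cong A k≡)) (tallyA t x)
                       ; tallyB = λ x → tally (ar σ′ TB) x (trans (keepA F aB _) (cong B k≡)) (tallyB t x)
                       ; tallyZ = λ x → tally (ar σ′ TZ) x (trans (keepA F aZ _) (cong Z k≡)) (tallyZ t x) } ))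
            where
            k≡ : vr σ′ vK ∸ 1 ≡ k
            k≡ = cong (_∸ 1) link
            k<st : vr σ′ vK ∸ 1 < st
            k<st = subst (_< st) (sym k≡) (kids< sm (sub (here refl)))
            lA : ar σ′ aA (vr σ′ vK ∸ 1) < st
            lA = subst (_< st) (sym (keepA F aA _)) (smallA sm _)
            lB : ar σ′ aB (vr σ′ vK ∸ 1) < st
            lB = subst (_< st) (sym (keepA F aB _)) (smallB sm _)
            lZ : ar σ′ aZ (vr σ′ vK ∸ 1) < st
            lZ = subst (_< st) (sym (keepA F aZ _)) (smallZ sm _)
            roomFor : ∀ (T : Arr) f {c : ℕ → ℕ} → (∀ x → ar σ′ T x + c x ≡ cnt f ks x) → ∀ {x} → ar σ′ T x + 1 < M
            roomFor T f h {x} = fits (sum₂ (≤-trans (m≤m+n _ _) (≤-trans (≤-reflexive (h x)) (≤-trans (cnt≤ f ks x) (<⇒≤ (short sm))))) (const≤ (s≤s z≤n)))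

        fillT : Linked (ar σ Next) (vr σ vK) ks → (∀ x → ar σ TA x ≡ 0) → (∀ x → ar σ TB x ≡ 0) → (∀ x → ar σ TZ x ≡ 0) →
          Tri fill σ (sumOver ks (λ _ → costB fillBody + overhead (var vK)) + overhead (var vK))
            (λ σ′ → (∀ x → ar σ′ TA x ≡ cnt A ks x) × (∀ x → ar σ′ TB x ≡ cnt B ks x) × (∀ x → ar σ′ TZ x ≡ cnt Z ks x))
        fillT link zA zB zZ = weaken ≤-refl
          (λ _ (_ , _ , t) → (λ x → trans (sym (+-identityʳ _)) (tallyA t x)) , (λ x → trans (sym (+-identityʳ _)) (tallyB t x)) , (λ x → trans (sym (+-identityʳ _)) (tallyZ t x)))
          (listLoop (λ _ → costB fillBody) FillInv step-fill (λ σ′ _ (l , _) → exit tt l) ks σ frame-refl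
            (link , (λ m → m) , record { tallyA = λ x → cong (_+ cnt A ks x) (zA x) ; tallyB = λ x → cong (_+ cnt B ks x) (zB x) ; tallyZ = λ x → cong (_+ cnt Z ks x) (zZ x) }))

        private
          Cleared : List ℕ → St → Set
          Cleared rem σ′ = (∀ x → cnt A rem x ≡ 0 → ar σ′ TA x ≡ 0) × (∀ x → cnt B rem x ≡ 0 → ar σ′ TB x ≡ 0) × (∀ x → cnt Z rem x ≡ 0 → ar σ′ TZ x ≡ 0)

          ClearInv : List ℕ → St → Set
          ClearInv rem σ′ = Linked (ar σ Next) (vr σ′ vK) rem × (∀ {k} → k ∈ rem → k ∈ ks) × Cleared rem σ′

          wipe : ∀ (T f : ℕ → ℕ) rem {a k} → a ≡ f k → (∀ x → cnt f (k ∷ rem) x ≡ 0 → T x ≡ 0) → ∀ x → cnt f rem x ≡ 0 → upd T a 0 x ≡ 0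
          wipe T f rem {k = k} refl h x z with f k ≟ x
          ... | yes refl = upd-same T (f k) 0
          ... | no  n    = trans (upd-other T 0 n) (h x (cong₂ _+_ (eqn-≢ n) z))

          step-clear : ∀ k rem σ′ → Frame (block clearBody) σ σ′ → ClearInv (k ∷ rem) σ′ → Iter (var vK) (block clearBody) σ′ (costB clearBody) (ClearInv rem)
          step-clear k rem σ′ F ((link , links) , sub , a , b , z) = iter tt (λ e → case trans (sym link) e of λ ())
            (triB (k<st , subst (_< st) (sym (keepA F aA _)) (smallA sm _) , k<st , subst (_< st) (sym (keepA F aB _)) (smallB sm _) ,
                   k<st , subst (_< st) (sym (keepA F aZ _)) (smallZ sm _) , k<st , tt)
              ( subst (λ h → Linked (ar σ Next) h rem) (sym (trans (keepA F Next _) (cong (ar σ Next) k≡))) links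
              , sub ∘ there
              , wipe (ar σ′ TA) A rem (trans (keepA F aA _) (cong A k≡)) a
              , wipe (ar σ′ TB) B rem (trans (keepA F aB _) (cong B k≡)) b
              , wipe (ar σ′ TZ) Z rem (trans (keepA F aZ _) (cong Z k≡)) z ))
            where
            k≡ : vr σ′ vK ∸ 1 ≡ k
            k≡ = cong (_∸ 1) link
            k<st : vr σ′ vK ∸ 1 < st
            k<st = subst (_< st) (sym k≡) (kids< sm (sub (here refl)))

        clearT : Linked (ar σ Next) (vr σ vK) ks → (∀ x → ar σ TA x ≡ cnt A ks x) → (∀ x → ar σ TB x ≡ cnt B ks x) → (∀ x → ar σ TZ x ≡ cnt Z ks x) →
          Tri clear σ (sumOver ks (λ _ → costB clearBody + overhead (var vK)) + overhead (var vK))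
            (λ σ′ → (∀ x → ar σ′ TA x ≡ 0) × (∀ x → ar σ′ TB x ≡ 0) × (∀ x → ar σ′ TZ x ≡ 0))
        clearT link tA tB tZ = weaken ≤-refl
          (λ _ (_ , _ , a , b , z) → (λ x → a x refl) , (λ x → b x refl) , (λ x → z x refl))
          (listLoop (λ _ → costB clearBody) ClearInv step-clear (λ σ′ _ (l , _) → exit tt l) ks σ frame-refl
            (link , (λ m → m) , (λ x e → trans (tA x) e) , (λ x e → trans (tB x) e) , (λ x e → trans (tZ x) e)))

      key : ℕ → ℕ → ℕ → ℕ
      key n d J = 2 + P * (d ∸ J) + Q * J + R * (n ∸ J)

      scan-step : ∀ (f z : ℕ → ℕ) J {f′ z′ c} → f′ ≡ f J → z′ ≡ z J → c ≡ scan f z J →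
        choose f′ (choose (eqn c 1) z′ (choose (eqn c z′) z′ 0)) c ≡ scan f z (suc J)
      scan-step f z J refl refl refl = refl

      feasible-cong : ∀ {na nb nz h d o J na′ nb′ nz′ h′ d′ o′ J′} → na ≡ na′ → nb ≡ nb′ → nz ≡ nz′ → h ≡ h′ → d ≡ d′ → o ≡ o′ → J ≡ J′ →
        feasible na nb nz h d o J ≡ feasible na′ nb′ nz′ h′ d′ o′ J′
      feasible-cong refl refl refl refl refl refl refl = refl

      feasible≤1 : ∀ na nb nz h d o J → feasible na nb nz h d o J ≤ 1
      feasible≤1 na nb nz h d o J = *-mono-≤ (b2n≤1 (nz ≡ᵇ 0)) (*-mono-≤ (b2n≤1 (na + h * o <ᵇ J + 1)) (b2n≤1 (nb + h * (1 ∸ o) + J <ᵇ d + 1)))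

      FeasOk : (na nb nz h d o J : ℕ) → Set → Set
      FeasOk na nb nz h d o J X = h * o < M × na + h * o < M × J + 1 < M × h * (1 ∸ o) < M × nb + h * (1 ∸ o) < M × nb + h * (1 ∸ o) + J < M ×
        d + 1 < M × ltn (na + h * o) (J + 1) * ltn (nb + h * (1 ∸ o) + J) (d + 1) < M × feasible na nb nz h d o J < M × X

      feasOk : ∀ {na nb nz h d o J X} → h ≤ 1 → o ≤ 1 → na ≤ st → nb ≤ st → d ≤ st → J ≤ st → X → FeasOk na nb nz h d o J X
      feasOk {na} {nb} {nz} {h} {d} {o} {J} h≤1 o≤1 na≤ nb≤ d≤ J≤ x =
        small ho≤ , fits (sum₂ na≤ (≤-trans ho≤ 1≤st)) , fits (sum₂ J≤ 1≤st) , small ho′≤ , fits (sum₂ nb≤ (≤-trans ho′≤ 1≤st)) ,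
        fits (sum₃ nb≤ (≤-trans ho′≤ 1≤st) J≤) , fits (sum₂ d≤ 1≤st) ,
        small (*-mono-≤ (b2n≤1 (na + h * o <ᵇ J + 1)) (b2n≤1 (nb + h * (1 ∸ o) + J <ᵇ d + 1))) , small (feasible≤1 na nb nz h d o J) , x
        where
        1≤st : 1 ≤ st
        1≤st = const≤ (s≤s z≤n)
        small : ∀ {x} → x ≤ 1 → x < M
        small l = fits (≤-trans l (≤-trans 1≤st (m≤n*m st 32)))
        ho≤ : h * o ≤ 1
        ho≤ = *-mono-≤ h≤1 o≤1
        ho′≤ : h * (1 ∸ o) ≤ 1
        ho′≤ = *-mono-≤ h≤1 (m∸n≤m 1 o)

      record ScanPre (σ : St) : Set where
        field
          d≤n   : vr σ vD ≤ vr σ vN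
          h≤1   : vr σ vH ≤ 1
          N<st  : vr σ vN < st
          keysN : 2 + P * vr σ vN + Q * vr σ vN + R * vr σ vN < st
          tA<   : ∀ x → ar σ TA x + ar σ TA x ≤ st
          tB<   : ∀ x → ar σ TB x + ar σ TB x ≤ st
          tZ<   : ∀ x → ar σ TZ x + ar σ TZ x ≤ st

      half-sum : ∀ x y → x + x ≤ st → y + y ≤ st → x + y ≤ st
      half-sum x y p q with ≤-total x y
      ... | inj₁ x≤y = ≤-trans (+-monoˡ-≤ y x≤y) q
      ... | inj₂ y≤x = ≤-trans (+-monoʳ-≤ x y≤x) p

      module Scan (σ : St) (pre : ScanPre σ) where
        open ScanPre pre

        K : ℕ → ℕ
        K J = key (vr σ vN) (vr σ vD) J

        tot : (T : Arr) → ℕ → ℕ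
        tot T J = ar σ T 1 + ar σ T (K J)

        feasS : ℕ → ℕ → ℕ
        feasS o J = feasible (tot TA J) (tot TB J) (tot TZ J) (vr σ vH) (vr σ vD) o J

        K<st : ∀ {J} → J ≤ vr σ vD → K J < st
        K<st {J} l = ≤-<-trans (+-mono-≤ (+-mono-≤ (+-monoʳ-≤ 2 (*-monoʳ-≤ P (≤-trans (m∸n≤m (vr σ vD) J) d≤n)))
          (*-monoʳ-≤ Q (≤-trans l d≤n))) (*-monoʳ-≤ R (m∸n≤m (vr σ vN) J))) keysN

        record Probed (J : ℕ) (σ′ : St) : Set where
          field
            s≡  : vr σ′ vS ≡ K J
            na≡ : vr σ′ vNA ≡ tot TA J
            nb≡ : vr σ′ vNB ≡ tot TB J
            nz≡ : vr σ′ vNZ ≡ tot TZ J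
            J≡  : vr σ′ vJ ≡ J
            h≡  : vr σ′ vH ≡ vr σ vH
            d≡  : vr σ′ vD ≡ vr σ vD
            w≡  : vr σ′ vW ≡ vr σ vW

        na≤ : ∀ J → tot TA J ≤ st
        na≤ J = half-sum (ar σ TA 1) (ar σ TA (K J)) (tA< 1) (tA< (K J))
        nb≤ : ∀ J → tot TB J ≤ st
        nb≤ J = half-sum (ar σ TB 1) (ar σ TB (K J)) (tB< 1) (tB< (K J))

        probeT : ∀ {J σ′} → J ≤ vr σ vD → vr σ′ vJ ≡ J → vr σ′ vN ≡ vr σ vN → vr σ′ vD ≡ vr σ vD →
          (∀ x → ar σ′ TA x ≡ ar σ TA x) → (∀ x → ar σ′ TB x ≡ ar σ TB x) → (∀ x → ar σ′ TZ x ≡ ar σ TZ x) →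
          vr σ′ vH ≡ vr σ vH → vr σ′ vW ≡ vr σ vW → Tri (block probe) σ′ (costB probe) (Probed J)
        probeT {J} {σ′} l refl n≡ d≡ a≡ b≡ z≡ h≡ w≡ = triB
          ( inM P<st , part (≤-trans (m≤n+m p′ 2) (≤-trans (m≤m+n (2 + p′) q′) (m≤m+n (2 + p′ + q′) r′))) , part (≤-trans (m≤m+n (2 + p′) q′) (m≤m+n (2 + p′ + q′) r′))
          , inM Q<st , part (≤-trans (m≤n+m q′ (2 + p′)) (m≤m+n (2 + p′ + q′) r′)) , part (m≤m+n (2 + p′ + q′) r′)
          , inM R<st , part (m≤n+m r′ (2 + p′ + q′)) , part ≤-refl
          , 1<st , s<st , tab a≡ tA< , 1<st , s<st , tab b≡ tB< , 1<st , s<st , tab z≡ tZ< , tt )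
          record { s≡ = s≡′ ; na≡ = tots a≡ ; nb≡ = tots b≡ ; nz≡ = tots z≡ ; J≡ = refl ; h≡ = h≡ ; d≡ = d≡ ; w≡ = w≡ }
          where
          inM : ∀ {x} → x < st → x < M
          inM l = fits (≤-trans (<⇒≤ l) (m≤n*m st 32))
          p′ = P * (vr σ′ vD ∸ vr σ′ vJ)
          q′ = Q * vr σ′ vJ
          r′ = R * (vr σ′ vN ∸ vr σ′ vJ)
          s′ : ℕ
          s′ = key (vr σ′ vN) (vr σ′ vD) (vr σ′ vJ)
          s≡′ : s′ ≡ K (vr σ′ vJ)
          s≡′ = cong₂ (λ a b → key a b (vr σ′ vJ)) n≡ d≡
          s<st : s′ < st
          s<st = subst (_< st) (sym s≡′) (K<st l)
          part : ∀ {x} → x ≤ s′ → x < M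
          part q = inM (≤-<-trans q s<st)
          1<st : 1 < st
          1<st = const≤ (s≤s (s≤s z≤n))
          tab : ∀ {f g : ℕ → ℕ} → (∀ x → f x ≡ g x) → (∀ x → g x + g x ≤ st) → ∀ {x y} → f x + f y < M
          tab {f} {g} e b {x} {y} = fits (≤-trans (≤-reflexive (cong₂ _+_ (e x) (e y))) (≤-trans (half-sum (g x) (g y) (b x) (b y)) (m≤n*m st 32)))
          tots : ∀ {f g : ℕ → ℕ} → (∀ x → f x ≡ g x) → f 1 + f s′ ≡ g 1 + g (K (vr σ′ vJ))
          tots {f} {g} e = cong₂ _+_ (e 1) (trans (e s′) (cong g s≡′))

        feas≡ : ∀ {J σ₁} → Probed J σ₁ → ∀ {o o′} → o ≡ o′ →
          feasible (vr σ₁ vNA) (vr σ₁ vNB) (vr σ₁ vNZ) (vr σ₁ vH) (vr σ₁ vD) o (vr σ₁ vJ) ≡ feasS o′ J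
        feas≡ p e = feasible-cong na≡ nb≡ nz≡ h≡ d≡ e J≡
          where open Probed p

        feasOk′ : ∀ {J σ₁ X} → Probed J σ₁ → J ≤ vr σ vD → ∀ {o} → o ≤ 1 → X →
          FeasOk (vr σ₁ vNA) (vr σ₁ vNB) (vr σ₁ vNZ) (vr σ₁ vH) (vr σ₁ vD) o (vr σ₁ vJ) X
        feasOk′ {J} {σ₁} p l o≤1 = feasOk {nz = vr σ₁ vNZ} (subst (_≤ 1) (sym h≡) h≤1) o≤1 (subst (_≤ st) (sym na≡) (na≤ J)) (subst (_≤ st) (sym nb≡) (nb≤ J))
          (subst (_≤ st) (sym d≡) d≤st) (subst (_≤ st) (sym J≡) (≤-trans l d≤st))
          where open Probed p
                d≤st = ≤-trans d≤n (<⇒≤ N<st)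

        J+1<M : ∀ {J} → J ≤ vr σ vD → J + 1 < M
        J+1<M l = fits (sum₂ (≤-trans l (≤-trans d≤n (<⇒≤ N<st))) (const≤ (s≤s z≤n)))

        J<d+1 : ∀ {J} → J < vr σ vD + 1 → J ≤ vr σ vD
        J<d+1 l = s≤s⁻¹ (≤-trans l (≤-reflexive (+-comm (vr σ vD) 1)))

        tryOk : ∀ {J} σ′ → J < vr σ vD + 1 → vr σ′ vJ ≡ J → vr σ′ vD ≡ vr σ vD → ev (tryJ {5}) σ′ ≢ 0
        tryOk {J} σ′ l e e′ z = contradiction (trans (sym (trans (cong₂ (λ a b → ltn a (b + 1)) e e′) (ltn-< l))) z) λ ()

        ζS : ℕ → ℕ
        ζS J = vr σ vW * K J

        anyS : ℕ → ℕ
        anyS J = feasS 0 J + feasS 1 J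

        UpInv : ℕ → St → Set
        UpInv J σ′ = vr σ′ vJ ≡ J × vr σ′ vCA ≡ scan (feasS 0) ζS J × vr σ′ vCB ≡ scan (feasS 1) ζS J × vr σ′ vCZ ≡ scan anyS ζS J

        upScanCost : ℕ → ℕ
        upScanCost d = sumTo (d + 1) (λ _ → costB probe + costB decide + overhead tryJ) + overhead tryJ

        upScanT : vr σ vW ≤ 1 → vr σ vJ ≡ 0 → vr σ vCA ≡ 1 → vr σ vCB ≡ 1 → vr σ vCZ ≡ 1 →
          Tri upScan σ (upScanCost (vr σ vD)) (UpInv (vr σ vD + 1))
        upScanT w≤1 eJ eA eB eZ = upLoop (vr σ vD + 1) (λ _ → costB probe + costB decide) UpInv bd
          (λ σ′ F (e , _) → exit (subst (λ z → z + 1 < M) (sym (keepV F vD)) (J+1<M ≤-refl) , tt) (ltn-≥ (≤-reflexive (trans (cong (_+ 1) (keepV F vD)) (sym e)))))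
          (eJ , eA , eB , eZ)
          where
          bd : ∀ J σ′ → J < vr σ vD + 1 → Frame (block probe ⨟ block decide) σ σ′ → UpInv J σ′ →
            Iter tryJ (block probe ⨟ block decide) σ′ (costB probe + costB decide) (UpInv (suc J))
          bd J σ′ l F (e , iA , iB , iZ) = iter (subst (λ z → z + 1 < M) (sym (keepV F vD)) (J+1<M ≤-refl) , tt) (tryOk σ′ l e (keepV F vD))
            (probeT (J<d+1 l) e (keepV F vN) (keepV F vD) (keepA F TA) (keepA F TB) (keepA F TZ) (keepV F vH) (keepV F vW) thenT λ σ₁ F₁ pr →
              let open Probed pr
                  fa = feas≡ pr refl
                  fb = feas≡ pr refl
                  ζ≡ = cong₂ _*_ w≡ s≡
              in triB (feasOk′ pr (J<d+1 l) z≤n (feasOk′ pr (J<d+1 l) ≤-refl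
                   ( fitsˣ (subst (_< st) (sym w≡) (≤-<-trans w≤1 (const≤ (s≤s (s≤s z≤n))))) (subst (_< st) (sym s≡) (K<st (J<d+1 l)))
                   , fits (sum₂ (≤-trans (feasible≤1 (vr σ₁ vNA) (vr σ₁ vNB) (vr σ₁ vNZ) (vr σ₁ vH) (vr σ₁ vD) 0 (vr σ₁ vJ)) (const≤ (s≤s z≤n)))
                                (≤-trans (feasible≤1 (vr σ₁ vNA) (vr σ₁ vNB) (vr σ₁ vNZ) (vr σ₁ vH) (vr σ₁ vD) 1 (vr σ₁ vJ)) (const≤ (s≤s z≤n))))
                   , subst (λ z → z + 1 < M) (sym J≡) (J+1<M (J<d+1 l)) , tt)))
                 ( trans (cong (_+ 1) J≡) (+-comm J 1)
                 , scan-step (feasS 0) ζS J fa ζ≡ (trans (keepV F₁ vCA) iA)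
                 , scan-step (feasS 1) ζS J fb ζ≡ (trans (keepV F₁ vCB) iB)
                 , scan-step anyS ζS J (cong₂ _+_ fa fb) ζ≡ (trans (keepV F₁ vCZ) iZ)))

        Good : ℕ → Set
        Good J = feasS (vr σ vO) J ≢ 0 × K J ≢ vr σ vForb

        Chosen : St → ℕ → Set
        Chosen σ′ J = Good J × vr σ′ vBS ≡ K J × vr σ′ vBQ ≡ J ∸ (tot TA J + vr σ vH * vr σ vO)

        DownInv : ℕ → St → Set
        DownInv J σ′ = vr σ′ vJ ≡ J × ((∀ I → I < J → ¬ Good I) ⊎ (∃[ I ] I < J × Chosen σ′ I))

        downScanT : vr σ vJ ≡ 0 → vr σ vO ≤ 1 → (∃[ J ] J ≤ vr σ vD × Good J) →
          Tri downScan σ (sumTo (vr σ vD + 1) (λ _ → costB probe + costB choice + overhead tryJ) + overhead tryJ)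
            (λ σ′ → ∃[ J ] J ≤ vr σ vD × Chosen σ′ J)
        downScanT eJ o≤1 (J₀ , J₀≤d , good) = weaken ≤-refl
          (λ { _ (_ , inj₁ none) → contradiction good (none J₀ (≤-trans (s≤s J₀≤d) (≤-reflexive (+-comm 1 (vr σ vD))))) ; _ (_ , inj₂ (I , l , c)) → I , J<d+1 l , c })
          (upLoop (vr σ vD + 1) (λ _ → costB probe + costB choice) DownInv bd
            (λ σ′ F (e , _) → exit (subst (λ z → z + 1 < M) (sym (keepV F vD)) (J+1<M ≤-refl) , tt) (ltn-≥ (≤-reflexive (trans (cong (_+ 1) (keepV F vD)) (sym e)))))
            (eJ , inj₁ λ I ()))
          where
          o : ℕ
          o = vr σ vO
          test : ℕ → ℕ
          test J = feasS o J * (1 ∸ eqn (K J) (vr σ vForb))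
          test-good : ∀ {J} → test J ≢ 0 → Good J
          test-good {J} t = proj₁ (*-≢0 {feasS o J} t) , λ e → proj₂ (*-≢0 {feasS o J} t) (cong (1 ∸_) (trans (cong (eqn (K J)) (sym e)) (eqn-refl (K J))))
          good-test : ∀ {J} → Good J → test J ≢ 0
          good-test (f , ne) = *≢0 f (λ z → contradiction (trans (sym (cong (1 ∸_) (eqn-≢ ne))) z) λ ())
          bd : ∀ J σ′ → J < vr σ vD + 1 → Frame (block probe ⨟ block choice) σ σ′ → DownInv J σ′ →
            Iter tryJ (block probe ⨟ block choice) σ′ (costB probe + costB choice) (DownInv (suc J))
          bd J σ′ l F (e , inv) = iter (subst (λ z → z + 1 < M) (sym (keepV F vD)) (J+1<M ≤-refl) , tt) (tryOk σ′ l e (keepV F vD))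
            (probeT (J<d+1 l) e (keepV F vN) (keepV F vD) (keepA F TA) (keepA F TB) (keepA F TZ) (keepV F vH) (keepV F vW) thenT λ σ₁ F₁ pr → go σ₁ F₁ pr)
            where
            go : ∀ σ₁ → Frame (block probe) σ′ σ₁ → Probed J σ₁ → Tri (block choice) σ₁ (costB choice) (DownInv (suc J))
            go σ₁ F₁ pr = triB
              (feasOk′ pr (J<d+1 l) (subst (_≤ 1) (sym o≡) o≤1)
                ( fits (≤-trans (*-mono-≤ (feasible≤1 (vr σ₁ vNA) (vr σ₁ vNB) (vr σ₁ vNZ) (vr σ₁ vH) (vr σ₁ vD) (vr σ₁ vO) (vr σ₁ vJ)) (m∸n≤m 1 (eqn (vr σ₁ vS) (vr σ₁ vForb)))) (≤-trans (const≤ (s≤s z≤n)) (m≤n*m st 32)))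
                , fits (≤-trans ho≤ (≤-trans (const≤ (s≤s z≤n)) (m≤n*m st 32)))
                , fits (sum₂ (subst (_≤ st) (sym na≡) (na≤ J)) (≤-trans ho≤ (const≤ (s≤s z≤n))))
                , subst (λ z → z + 1 < M) (sym J≡) (J+1<M (J<d+1 l)) , tt))
              (trans (cong (_+ 1) J≡) (+-comm J 1) , next inv)
              where
              open Probed pr
              o≡ : vr σ₁ vO ≡ o
              o≡ = trans (keepV F₁ vO) (keepV F vO)
              ho≤ : vr σ₁ vH * vr σ₁ vO ≤ 1
              ho≤ = *-mono-≤ (subst (_≤ 1) (sym h≡) h≤1) (subst (_≤ 1) (sym o≡) o≤1)
              t≡ : ev {7} (feasE (var vO) ⊗ (con 1 ⊟ eq (var vS) (var vForb))) σ₁ ≡ test J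
              t≡ = cong₂ (λ a b → a * (1 ∸ b)) (feas≡ pr o≡) (cong₂ eqn s≡ (trans (keepV F₁ vForb) (keepV F vForb)))
              q≡ : vr σ₁ vJ ∸ (vr σ₁ vNA + vr σ₁ vH * vr σ₁ vO) ≡ J ∸ (tot TA J + vr σ vH * o)
              q≡ = cong₂ _∸_ J≡ (cong₂ _+_ na≡ (cong₂ _*_ h≡ o≡))
              next : (∀ I → I < J → ¬ Good I) ⊎ (∃[ I ] I < J × Chosen σ′ I) →
                     (∀ I → I < suc J → ¬ Good I) ⊎ (∃[ I ] I < suc J × Chosen (run choice σ₁) I)
              next inv with test J ≟ 0
              ... | no t≢0 = inj₂ (J , ≤-refl , test-good t≢0 ,
                      trans (choose-≢0 (t≢0 ∘ trans (sym t≡))) s≡ , trans (choose-≢0 (t≢0 ∘ trans (sym t≡))) q≡)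
              next (inj₁ none) | yes t≡0 = inj₁ λ I I<sJ g → case m≤n⇒m<n∨m≡n (s≤s⁻¹ I<sJ) of λ
                { (inj₁ I<J) → none I I<J g ; (inj₂ refl) → good-test g t≡0 }
              next (inj₂ (I , I<J , g , a , b)) | yes t≡0 = inj₂ (I , m<n⇒m<1+n I<J , g ,
                trans (choose-≡0 (trans t≡ t≡0)) (trans (keepV F₁ vBS) a) , trans (choose-≡0 (trans t≡ t≡0)) (trans (keepV F₁ vBQ) b))

      record Elim (R : ℕ → ℕ) (kids : ℕ → List ℕ) (par rk : ℕ → ℕ) (σ : St) : Set where
        hp : ℕ → ℕ
        hp = ar σ Hp
        pe : ℕ → ℕ
        pe = ar σ Pe
        ord : ℕ → ℕ
        ord = ar σ Ord
        same : ℕ → ℕ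
        same = ar σ Same
        c : ℕ
        c = vr σ vC
        field
          R≤1    : ∀ e → R e ≤ 1
          deg    : ∀ v → ar σ Deg v ≡ remDeg R v
          es     : ∀ v → ar σ Es v ≡ sumTo m (λ e → R e * (inc v e * e))
          hp≤1   : ∀ v → hp v ≤ 1
          same≤1 : ∀ v → same v ≤ 1
          gone   : ∀ {v} → hp v ≡ 1 → remDeg R v ≡ 0
          split  : ∀ β v → sumTo m (λ e → inc v e * β e) ≡ sumTo m (λ e → R e * (inc v e * β e)) + (sumOver (kids v) (β ∘ pe) + hp v * β (pe v))
          linked : ∀ v → Linked (ar σ Next) (ar σ Head v) (kids v)
          unique : ∀ v → Unique (kids v)
          kid-hp : ∀ {v k} → k ∈ kids v → hp k ≡ 1
          kid-par : ∀ {v k} → k ∈ kids v → par k ≡ v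
          kid-edge : ∀ {v k} → k ∈ kids v → pe k < m × Ends (pe k) k v
          kid-same : ∀ {v k} → k ∈ kids v → same k ≡ eqn (r * deg₀ k) (r * deg₀ v)
          parent : ∀ {v} → hp v ≢ 0 → v ∈ kids (par v)
          cover  : ∀ {e} → e < m → R e ≡ 0 → ∃[ v ] ∃[ k ] k ∈ kids v × pe k ≡ e
          size≡  : c + sumTo m R ≡ m
          ord-hp : ∀ {i} → i < c → hp (ord i) ≡ 1
          rk-ord : ∀ {i} → i < c → rk (ord i) ≡ i
          ord-rk : ∀ {v} → hp v ≡ 1 → rk v < c × ord (rk v) ≡ v
          rk-kid : ∀ {v k} → hp v ≡ 1 → k ∈ kids v → rk k < rk v

      record Pruned (u e p : ℕ) (σ σ′ : St) : Set where
        field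
          deg≡  : ∀ v → ar σ′ Deg v ≡ ar σ Deg v ∸ inc v e
          es≡   : ∀ v → ar σ′ Es v ≡ ar σ Es v ∸ inc v e * e
          hp≡   : ∀ v → ar σ′ Hp v ≡ upd (ar σ Hp) u 1 v
          pe≡   : ∀ v → ar σ′ Pe v ≡ upd (ar σ Pe) u e v
          ord≡  : ∀ v → ar σ′ Ord v ≡ upd (ar σ Ord) (vr σ vC) u v
          next≡ : ∀ v → ar σ′ Next v ≡ upd (ar σ Next) u (ar σ Head p) v
          head≡ : ∀ v → ar σ′ Head v ≡ upd (ar σ Head) p (suc u) v
          same≡ : ∀ v → ar σ′ Same v ≡ upd (ar σ Same) u (eqn (r * deg₀ u) (r * deg₀ p)) v
          c≡    : vr σ′ vC ≡ suc (vr σ vC)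

      module Prune {R kids par rk σ σ′} (E : Elim R kids par rk σ) (u e p : ℕ) (L : Leaf R u e) (en : Ends e u p)
                   (one : remDeg R u ≡ 1) (pr : Pruned u e p σ σ′) where
        open Elim E
        open Leaf L
        open Pruned pr

        R′ : ℕ → ℕ
        R′ = upd R e 0
        kids′ : ℕ → List ℕ
        kids′ = updL kids p u
        par′ rk′ : ℕ → ℕ
        par′ = upd par u p
        rk′ = upd rk u c

        private
          inc-p : inc p e ≡ 1
          inc-p = inc-end e<m (ends-swap en)
          u≢p : u ≢ p
          u≢p = ends-≢ e<m en

          remove : ∀ (g : ℕ → ℕ) → sumTo m (λ i → R i * g i) ≡ sumTo m (λ i → R′ i * g i) + g e
          remove g = trans (sym (sumTo-upd m R g e<m)) (cong (sumTo m (λ i → R′ i * g i) +_) (trans (cong (_* g e) R≡1) (*-identityˡ (g e))))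

          removed : ∀ (g : ℕ → ℕ) {x} → x ≡ sumTo m (λ i → R i * g i) → x ∸ g e ≡ sumTo m (λ i → R′ i * g i)
          removed g refl = trans (cong (_∸ g e) (remove g)) (m+n∸n≡m _ (g e))

          not-gone : ∀ {v} → hp v ≤ 1 → (hp v ≡ 1 → remDeg R v ≡ 0) → inc v e ≡ 1 → hp v ≡ 0
          not-gone {v} l g i = case ≡0⊎≡1 l of λ
            { (inj₁ z) → z
            ; (inj₂ o) → contradiction (trans (sym (cong₂ _*_ R≡1 i)) (sumTo-≡0 m _ (g o) e e<m)) λ () }

          hp-u : hp u ≡ 0
          hp-u = not-gone (hp≤1 u) gone inc≡1
          hp-p : hp p ≡ 0
          hp-p = not-gone (hp≤1 p) gone inc-p

          kid≢u : ∀ {v k} → k ∈ kids v → k ≢ u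
          kid≢u k∈ refl = contradiction (trans (sym (kid-hp k∈)) hp-u) λ ()

          hp1≢u : ∀ {v} → hp v ≡ 1 → v ≢ u
          hp1≢u h refl = contradiction (trans (sym h) hp-u) λ ()

          hp-off : ∀ {v} → v ≢ u → ar σ′ Hp v ≡ hp v
          hp-off n = trans (hp≡ _) (upd-other hp 1 (n ∘ sym))
          hp-on : ar σ′ Hp u ≡ 1
          hp-on = trans (hp≡ u) (upd-same hp u 1)
          pe-off : ∀ {v} → v ≢ u → ar σ′ Pe v ≡ pe v
          pe-off n = trans (pe≡ _) (upd-other pe e (n ∘ sym))
          pe-on : ar σ′ Pe u ≡ e
          pe-on = trans (pe≡ u) (upd-same pe u e)
          rk-off : ∀ {v} → v ≢ u → rk′ v ≡ rk v
          rk-off n = upd-other rk c (n ∘ sym)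
          rk-on : rk′ u ≡ c
          rk-on = upd-same rk u c
          ord-off : ∀ {i} → i < c → ar σ′ Ord i ≡ ord i
          ord-off l = trans (ord≡ _) (upd-other ord u (<⇒≢ l ∘ sym))
          ord-on : ar σ′ Ord c ≡ u
          ord-on = trans (ord≡ c) (upd-same ord c u)

          bounded : ∀ {i} → i < vr σ′ vC → i ≡ c ⊎ i < c
          bounded {i} l = case m≤n⇒m<n∨m≡n (s≤s⁻¹ (≤-trans l (≤-reflexive c≡))) of λ { (inj₁ q) → inj₂ q ; (inj₂ q) → inj₁ q }

          ∈-new : ∀ {v k} {P : Set} → k ∈ kids′ v → (v ≡ p → k ≡ u → P) → (k ∈ kids v → k ≢ u → P) → P
          ∈-new {v} k∈ f g = case updL-∈ kids p u v k∈ of λ { (inj₁ (a , b)) → f a b ; (inj₂ q) → g q (kid≢u q) }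

          linked′ : ∀ v → Linked (ar σ′ Next) (ar σ′ Head v) (kids′ v)
          linked′ v = Linked-cong (sym ∘ next≡) (kids′ v) (subst (λ h → Linked (upd (ar σ Next) u (ar σ Head p)) h (kids′ v)) (sym (head≡ v)) (by-equality p v
            (λ { refl → subst₂ (Linked _) (sym (upd-same (ar σ Head) p (suc u))) (sym (updL-same kids p u))
                   (refl , subst (λ h → Linked (upd (ar σ Next) u (ar σ Head p)) h (kids p)) (sym (upd-same (ar σ Next) u (ar σ Head p))) (old p)) })
            (λ ne → subst₂ (Linked _) (sym (upd-other (ar σ Head) (suc u) ne)) (sym (updL-other kids ne)) (old v))))
            where
            old : ∀ w → Linked (upd (ar σ Next) u (ar σ Head p)) (ar σ Head w) (kids w)
            old w = Linked-upd (ar σ Next) u _ (kids w) (λ u∈ → kid≢u u∈ refl) (linked w)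

          split′ : ∀ β v → sumTo m (λ i → inc v i * β i) ≡ sumTo m (λ i → R′ i * (inc v i * β i)) + (sumOver (kids′ v) (β ∘ ar σ′ Pe) + ar σ′ Hp v * β (ar σ′ Pe v))
          split′ β v = trans (split β v) (trans (cong (_+ (K v + hp v * β (pe v))) (remove (λ i → inc v i * β i))) (trans (+-assoc (sumTo m (λ i → R′ i * (inc v i * β i))) (inc v e * β e) (K v + hp v * β (pe v))) (cong (sumTo m (λ i → R′ i * (inc v i * β i)) +_)
            (by-equality v u
              (λ { refl → begin
                 inc u e * β e + (K u + hp u * β (pe u)) ≡⟨ cong₂ (λ a b → a * β e + (K u + b * β (pe u))) inc≡1 hp-u ⟩
                 1 * β e + (K u + 0)                     ≡⟨ cong₂ _+_ (*-identityˡ (β e)) (+-identityʳ (K u)) ⟩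
                 β e + K u                               ≡⟨ +-comm (β e) (K u) ⟩
                 K u + β e                               ≡⟨ cong (K u +_) (*-identityˡ (β e)) ⟨
                 K u + 1 * β e                           ≡⟨ cong₂ (λ a b → a + b * β e) (trans (K≡ u) (cong (λ ks → sumOver ks (β ∘ ar σ′ Pe)) (sym (updL-other kids (u≢p ∘ sym))))) (sym hp-on) ⟩
                 sumOver (kids′ u) (β ∘ ar σ′ Pe) + ar σ′ Hp u * β e ≡⟨ cong (λ z → sumOver (kids′ u) (β ∘ ar σ′ Pe) + ar σ′ Hp u * β z) (sym pe-on) ⟩
                 sumOver (kids′ u) (β ∘ ar σ′ Pe) + ar σ′ Hp u * β (ar σ′ Pe u) ∎ })
              (λ v≢u → trans (by-equality v p
                (λ { refl → begin
                   inc p e * β e + (K p + hp p * β (pe p)) ≡⟨ cong (λ a → a * β e + (K p + hp p * β (pe p))) inc-p ⟩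
                   1 * β e + (K p + hp p * β (pe p))       ≡⟨ +-assoc (1 * β e) (K p) _ ⟨
                   1 * β e + K p + hp p * β (pe p)         ≡⟨ cong (_+ hp p * β (pe p)) (cong₂ _+_ (trans (*-identityˡ (β e)) (cong β (sym pe-on))) (K≡ p)) ⟩
                   sumOver (u ∷ kids p) (β ∘ ar σ′ Pe) + hp p * β (pe p) ≡⟨ cong (λ ks → sumOver ks (β ∘ ar σ′ Pe) + hp p * β (pe p)) (sym (updL-same kids p u)) ⟩
                   sumOver (kids′ p) (β ∘ ar σ′ Pe) + hp p * β (pe p) ∎ })
                (λ v≢p → begin
                   inc v e * β e + (K v + hp v * β (pe v)) ≡⟨ cong (λ a → a * β e + (K v + hp v * β (pe v))) (inc-off en v≢u v≢p) ⟩
                   K v + hp v * β (pe v)                   ≡⟨ cong (_+ hp v * β (pe v)) (trans (K≡ v) (cong (λ ks → sumOver ks (β ∘ ar σ′ Pe)) (sym (updL-other kids (v≢p ∘ sym))))) ⟩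
                   sumOver (kids′ v) (β ∘ ar σ′ Pe) + hp v * β (pe v) ∎))
                (cong₂ (λ a b → sumOver (kids′ v) (β ∘ ar σ′ Pe) + a * β b) (sym (hp-off v≢u)) (sym (pe-off v≢u))))))))
            where
            open ≡-Reasoning
            K : ℕ → ℕ
            K w = sumOver (kids w) (β ∘ pe)
            K≡ : ∀ w → K w ≡ sumOver (kids w) (β ∘ ar σ′ Pe)
            K≡ w = sumOver-cong (kids w) λ k∈ → cong β (sym (pe-off (kid≢u k∈)))

        pruned : Elim R′ kids′ par′ rk′ σ′
        pruned = record
          { R≤1 = λ i → by-equality e i (λ { refl → ≤-trans (≤-reflexive (upd-same R e 0)) z≤n }) (λ ne → ≤-trans (≤-reflexive (upd-other R 0 ne)) (R≤1 i))
          ; deg = λ v → trans (deg≡ v) (removed (inc v) (deg v))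
          ; es = λ v → trans (es≡ v) (removed (λ i → inc v i * i) (es v))
          ; hp≤1 = λ v → by-equality v u (λ { refl → ≤-reflexive hp-on }) (λ ne → ≤-trans (≤-reflexive (hp-off ne)) (hp≤1 v))
          ; same≤1 = λ v → by-equality v u (λ { refl → ≤-trans (≤-reflexive (trans (same≡ u) (upd-same same u _))) (b2n≤1 _) }) (λ ne → ≤-trans (≤-reflexive (trans (same≡ v) (upd-other same _ (ne ∘ sym)))) (same≤1 v))
          ; gone = λ {v} h → by-equality v u (λ { refl → trans (sym (removed (inc u) refl)) (cong₂ _∸_ one inc≡1) })
                     (λ ne → m+n≡0⇒m≡0 (remDeg R′ v) (trans (sym (remove (inc v))) (gone (trans (sym (hp-off ne)) h))))
          ; split = split′
          ; linked = linked′
          ; unique = λ v → by-equality p v (λ { refl → subst Unique (sym (updL-same kids p u)) (tabulate (λ {k} k∈ e → kid≢u k∈ (sym e)) ∷ unique p) }) (λ ne → subst Unique (sym (updL-other kids ne)) (unique v))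
          ; kid-hp = λ k∈ → ∈-new k∈ (λ _ → λ { refl → hp-on }) (λ q ne → trans (hp-off ne) (kid-hp q))
          ; kid-par = λ k∈ → ∈-new k∈ (λ { refl refl → upd-same par u p }) (λ q ne → trans (upd-other par p (ne ∘ sym)) (kid-par q))
          ; kid-edge = λ {v} {k} k∈ → ∈-new k∈ (λ { refl refl → subst (λ z → z < m × Ends z u p) (sym pe-on) (e<m , en) })
                         (λ q ne → subst (λ z → z < m × Ends z k v) (sym (pe-off ne)) (kid-edge q))
          ; kid-same = λ k∈ → ∈-new k∈ (λ { refl refl → trans (same≡ u) (upd-same same u _) }) (λ q ne → trans (same≡ _) (trans (upd-other same _ (ne ∘ sym)) (kid-same q)))
          ; parent = λ {v} h → by-equality v u
              (λ { refl → subst (λ z → u ∈ kids′ z) (sym (upd-same par u p)) (subst (u ∈_) (sym (updL-same kids p u)) (here refl)) })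
              (λ ne → subst (λ z → v ∈ kids′ z) (sym (upd-other par p (ne ∘ sym))) (∈-updL kids p u (par v) (parent (λ z → h (trans (hp-off ne) z)))))
          ; cover = λ {i} l z → by-equality e i (λ { refl → p , u , subst (u ∈_) (sym (updL-same kids p u)) (here refl) , pe-on })
              (λ ne → let v , k , k∈ , e≡ = cover l (trans (sym (upd-other R 0 ne)) z) in v , k , ∈-updL kids p u v k∈ , trans (pe-off (kid≢u k∈)) e≡)
          ; size≡ = trans (cong (_+ sumTo m R′) c≡) (trans (sym (+-suc c _)) (trans (cong (c +_) (sym size-step)) size≡))
          ; ord-hp = λ l → case bounded l of λ { (inj₁ refl) → trans (cong (ar σ′ Hp) ord-on) hp-on ; (inj₂ q) → trans (cong (ar σ′ Hp) (ord-off q)) (trans (hp-off (hp1≢u (ord-hp q))) (ord-hp q)) }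
          ; rk-ord = λ l → case bounded l of λ { (inj₁ refl) → trans (cong rk′ ord-on) rk-on ; (inj₂ q) → trans (cong rk′ (ord-off q)) (trans (rk-off (hp1≢u (ord-hp q))) (rk-ord q)) }
          ; ord-rk = λ {v} h → by-equality v u (λ { refl → subst (λ z → z < vr σ′ vC × ar σ′ Ord z ≡ u) (sym rk-on) (≤-reflexive (sym c≡) , ord-on) })
              (λ ne → let l , o = ord-rk (trans (sym (hp-off ne)) h) in subst (λ z → z < vr σ′ vC × ar σ′ Ord z ≡ v) (sym (rk-off ne)) (<-≤-trans (m<n⇒m<1+n l) (≤-reflexive (sym c≡)) , trans (ord-off l) o))
          ; rk-kid = λ {v} h k∈ → by-equality v u
              (λ { refl → ∈-new k∈ (λ e _ → contradiction e u≢p) (λ q ne → subst₂ _<_ (sym (rk-off ne)) (sym rk-on) (proj₁ (ord-rk (kid-hp q)))) })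
              (λ v≢u → let h′ = trans (sym (hp-off v≢u)) h in ∈-new k∈ (λ { refl → contradiction (trans (sym h′) hp-p) λ () })
                 (λ q ne → subst₂ _<_ (sym (rk-off ne)) (sym (rk-off v≢u)) (rk-kid h′ q))) }
          where
          size-step : sumTo m R ≡ suc (sumTo m R′)
          size-step = trans (sumTo-cong m λ i _ → sym (*-identityʳ (R i))) (trans (remove (λ _ → 1)) (trans (+-comm _ 1) (cong suc (sumTo-cong m λ i _ → *-identityʳ (R′ i)))))

      4n<st : n + n + (n + n) < st
      4n<st = ≤-<-trans (m≤n+m _ 4) io<st
      2n<st : n + n < st
      2n<st = ≤-<-trans (m≤m+n (n + n) (n + n)) 4n<st
      n<st : n < st
      n<st = ≤-<-trans (m≤m+n n n) 2n<st
      m<st : m < st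
      m<st = ≤-<-trans m≤n n<st

      inM : ∀ {x} → x < st → x < M
      inM l = fits (≤-trans (<⇒≤ l) (m≤n*m st 32))

      edge-index : ∀ {e} → e < m → 3 + (e + e) < st
      edge-index l = ≤-<-trans (+-mono-≤ (n≤1+n 3) (≤-trans (+-mono-≤ (≤-trans (<⇒≤ l) m≤n) (≤-trans (<⇒≤ l) m≤n)) (m≤m+n (n + n) (n + n)))) io<st

      inc≤2 : ∀ v e → inc v e ≤ 2
      inc≤2 v e = +-mono-≤ (b2n≤1 (X e ≡ᵇ v)) (b2n≤1 (Y e ≡ᵇ v))

      partial-deg : ∀ {i} v → i ≤ m → sumTo i (inc v) ≤ st
      partial-deg {i} v l = ≤-trans (sumTo-mono i λ e _ → inc≤2 v e) (≤-trans (≤-reflexive (sumTo-const i 2))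
        (≤-trans (*-monoˡ-≤ 2 (≤-trans l m≤n)) (≤-trans (≤-reflexive (trans (*-comm n 2) (cong (n +_) (+-identityʳ n)))) (<⇒≤ 2n<st))))

      partial-es : ∀ {i} v → i ≤ m → sumTo i (λ e → inc v e * e) ≤ st * st
      partial-es {i} v l = ≤-trans (sumTo-mono i λ e e< → *-mono-≤ (inc≤2 v e) (<⇒≤ (<-≤-trans e< l))) (≤-trans (≤-reflexive (sumTo-const i (2 * m)))
        (*-mono-≤ (≤-trans l (<⇒≤ m<st)) (≤-trans (≤-reflexive (cong (m +_) (+-identityʳ m))) (≤-trans (+-mono-≤ m≤n m≤n) (<⇒≤ 2n<st)))))

      fits² : ∀ {x y z} → x ≤ st * st → y ≤ st → z ≤ st → x + y + z < M
      fits² {x} {y} {z} p q s = <-≤-trans (s≤s (≤-trans (+-mono-≤ (+-mono-≤ p (≤-trans q st≤)) (≤-trans s st≤)) (≤-reflexive 3sq)))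
        (≤-trans (≤-trans (s≤s (+-monoʳ-≤ (st * st) (≤-reflexive refl))) four) room)
        where
        S = st * st
        st≤ : st ≤ S
        st≤ = m≤m*n st st
        3sq : S + S + S ≡ S + (S + S)
        3sq = +-assoc S S S
        1≤S : 1 ≤ S
        1≤S = ≤-trans (const≤ (s≤s z≤n)) st≤
        four : suc (S + (S + S)) ≤ 32 * S
        four = ≤-trans (+-monoˡ-≤ (S + (S + S)) 1≤S) (+-monoʳ-≤ S (+-monoʳ-≤ S (+-monoʳ-≤ S (m≤m+n S (28 * S)))) )

      module Count (σ : St) (m≡ : vr σ vM ≡ m) (x≡ : ∀ e → ar σ IO (2 + (e + e)) ≡ X e) (y≡ : ∀ e → ar σ IO (3 + (e + e)) ≡ Y e)
                   (e≡ : vr σ vE ≡ 0) (z₁ : ∀ v → ar σ Deg v ≡ 0) (z₂ : ∀ v → ar σ D₀ v ≡ 0) (z₃ : ∀ v → ar σ Es v ≡ 0) where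

        Counted : ℕ → St → Set
        Counted i σ′ = vr σ′ vE ≡ i × (∀ v → ar σ′ Deg v ≡ sumTo i (inc v)) × (∀ v → ar σ′ D₀ v ≡ sumTo i (inc v)) × (∀ v → ar σ′ Es v ≡ sumTo i (λ e → inc v e * e))

        step-count : ∀ i σ′ → i < m → Frame (block countBody) σ σ′ → Counted i σ′ → Iter (lt (var vE) (var vM)) (block countBody) σ′ (costB countBody) (Counted (suc i))
        step-count i σ′ i<m F (refl , dg , d0 , es) = iter tt (λ z → contradiction (trans (sym (trans (cong (ltn i) (trans (keepV F vM) m≡)) (ltn-< i<m))) z) λ ())
          (triB ( inM (≤-<-trans (m≤n+m _ 3) ix) , inM (≤-<-trans (n≤1+n _) ix) , ≤-<-trans (n≤1+n _) ix
                , inM (≤-<-trans (m≤n+m _ 3) ix) , inM ix , ix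
                , x<st , x<st , one (ar σ′ Deg) dg x , y<st , y<st , two (ar σ′ Deg) dg
                , x<st , x<st , one (ar σ′ D₀) d0 x , y<st , y<st , two (ar σ′ D₀) d0
                , x<st , x<st , subst (_< M) (+-identityʳ _) (fits² (es≤ x) (<⇒≤ i<st) z≤n) , y<st , y<st
                , subst (λ z → z + i < M) (sym (upd-add (ar σ′ Es) x i y)) (fits² (es≤ y) (≤-trans (*-monoˡ-≤ i (b2n≤1 (x ≡ᵇ y))) (≤-trans (≤-reflexive (+-identityʳ i)) (<⇒≤ i<st))) (<⇒≤ i<st))
                , fits (sum₂ (<⇒≤ i<st) (const≤ (s≤s z≤n))) , tt )
            ( +-comm i 1
            , (λ v → trans (bump₂ (ar σ′ Deg) x y 1 v) (cong₂ _+_ (dg v) (trans (*-identityʳ _) (ends v))))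
            , (λ v → trans (bump₂ (ar σ′ D₀) x y 1 v) (cong₂ _+_ (d0 v) (trans (*-identityʳ _) (ends v))))
            , (λ v → trans (bump₂ (ar σ′ Es) x y i v) (cong₂ _+_ (es v) (cong (_* i) (ends v)))) ))
          where
          x y : ℕ
          x = ar σ′ IO (2 + (i + i))
          y = ar σ′ IO (3 + (i + i))
          x≡′ : x ≡ X i
          x≡′ = trans (keepA F IO _) (x≡ i)
          y≡′ : y ≡ Y i
          y≡′ = trans (keepA F IO _) (y≡ i)
          ends : ∀ v → eqn x v + eqn y v ≡ inc v i
          ends v = cong₂ (λ a b → eqn a v + eqn b v) x≡′ y≡′
          ix : 3 + (i + i) < st
          ix = edge-index i<m
          i<st : i < st
          i<st = <-trans i<m m<st
          x<st : x < st
          x<st = subst (_< st) (sym x≡′) (<-trans (X<n i<m) n<st)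
          y<st : y < st
          y<st = subst (_< st) (sym y≡′) (<-trans (Y<n i<m) n<st)
          es≤ : ∀ v → ar σ′ Es v ≤ st * st
          es≤ v = ≤-trans (≤-reflexive (es v)) (partial-es v (<⇒≤ i<m))
          one : ∀ (f : ℕ → ℕ) → (∀ v → f v ≡ sumTo i (inc v)) → ∀ v → f v + 1 < M
          one f h v = fits (sum₂ (≤-trans (≤-reflexive (h v)) (partial-deg v (<⇒≤ i<m))) (const≤ (s≤s z≤n)))
          two : ∀ (f : ℕ → ℕ) → (∀ v → f v ≡ sumTo i (inc v)) → upd f x (f x + 1) y + 1 < M
          two f h = subst (λ z → z + 1 < M) (sym (upd-add f x 1 y)) (fits (sum₃ (≤-trans (≤-reflexive (h y)) (partial-deg y (<⇒≤ i<m)))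
            (≤-trans (≤-reflexive (*-identityʳ _)) (≤-trans (b2n≤1 (x ≡ᵇ y)) (const≤ (s≤s z≤n)))) (const≤ (s≤s z≤n))))

        countT : Tri count σ (sumTo m (λ _ → costB countBody + overhead (lt (var vE) (var vM))) + overhead (lt (var vE) (var vM))) (Counted m)
        countT = upLoop m (λ _ → costB countBody) Counted step-count
          (λ σ′ F (e , _) → exit tt (trans (cong₂ ltn e (trans (keepV F vM) m≡)) (ltn-≥ (≤-refl {m}))))
          (e≡ , z₁ , z₂ , z₃)

      module Strip (σ : St) (n≡ : vr σ vN ≡ n) (x≡ : ∀ e → ar σ IO (2 + (e + e)) ≡ X e) (y≡ : ∀ e → ar σ IO (3 + (e + e)) ≡ Y e)
                   (d0 : ∀ v → ar σ D₀ v ≡ deg₀ v) where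

        Position : St → Set
        Position σ′ = (vr σ′ vI < n × vr σ′ vU < n) ⊎ (vr σ′ vI ≡ n × vr σ′ vU ≡ n)

        record Stripped (t : ℕ) (σ′ : St) : Set where
          constructor stripped
          field
            {S par rk} : ℕ → ℕ
            {kids}     : ℕ → List ℕ
            elim  : Elim S kids par rk σ′
            time≡ : t + sumTo m S ≡ vr σ′ vI + m
            where′ : Position σ′
            clean : ∀ {v} → v ≤ vr σ′ vI → v < n → v ≢ vr σ′ vU → remDeg S v ≢ 1

        stripCost : ℕ
        stripCost = costE {7} (eq (get Deg (var vU)) (con 1)) + (3 + (costB locate + costB prune + costB advance))

        body : Cmd
        body = branch (eq (get Deg (var vU)) (con 1)) (block locate ⨟ block prune) (block advance)

        guardE : Exp 7
        guardE = lt (var vI) (var vN)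

        module PruneStep (t : ℕ) (σ′ : St) (F : Frame body σ σ′) (u<n : vr σ′ vU < n) (i<n : vr σ′ vI < n) (inv : Stripped t σ′)
                         (one : ar σ′ Deg (vr σ′ vU) ≡ 1) where
          open Stripped inv
          open Elim elim using (c)
          u : ℕ
          u = vr σ′ vU
          one′ : remDeg S u ≡ 1
          one′ = trans (sym (Elim.deg elim u)) one
          e : ℕ
          e = proj₁ (leaf S one′)
          L : Leaf S u e
          L = proj₂ (leaf S one′)
          open Leaf L
          p : ℕ
          p = X e + Y e ∸ u
          en : Ends e u p
          en = other-end e<m λ z → contradiction (trans (sym inc≡1) z) λ ()
          e′ x y p′ : ℕ
          e′ = ar σ′ Es u
          x = ar σ′ IO (2 + (e′ + e′))
          y = ar σ′ IO (3 + (e′ + e′))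
          p′ = x + y ∸ u
          e≡ : e′ ≡ e
          e≡ = trans (Elim.es elim u) (only (λ i → i))
          x≡′ : x ≡ X e
          x≡′ = trans (keepA F IO _) (trans (cong (λ z → ar σ IO (2 + (z + z))) e≡) (x≡ e))
          y≡′ : y ≡ Y e
          y≡′ = trans (keepA F IO _) (trans (cong (λ z → ar σ IO (3 + (z + z))) e≡) (y≡ e))
          p≡ : p′ ≡ p
          p≡ = cong₂ (λ a b → a + b ∸ u) x≡′ y≡′
          d≡ : ∀ v → ar σ′ D₀ v ≡ deg₀ v
          d≡ v = trans (keepA F D₀ v) (d0 v)
          u<st : u < st
          u<st = <-trans u<n n<st
          p<n : p < n
          p<n = ends-< e<m (ends-swap en)
          x<st : x < st
          x<st = subst (_< st) (sym x≡′) (<-trans (X<n e<m) n<st)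
          y<st : y < st
          y<st = subst (_< st) (sym y≡′) (<-trans (Y<n e<m) n<st)
          ix : 3 + (e′ + e′) < st
          ix = subst (λ z → 3 + (z + z) < st) (sym e≡) (edge-index e<m)
          c≤m : c ≤ m
          c≤m = ≤-trans (m≤m+n c _) (≤-reflexive (Elim.size≡ elim))
          ends : ∀ v → eqn x v + eqn y v ≡ inc v e
          ends v = cong₂ (λ a b → eqn a v + eqn b v) x≡′ y≡′

          Located : St → Set
          Located σ₁ = vr σ₁ vE ≡ e × vr σ₁ vX ≡ x × vr σ₁ vY ≡ y × vr σ₁ vP ≡ p

          locateT : Tri (block locate) σ′ (costB locate) Located
          locateT = triB ( u<st , inM (≤-<-trans (m≤n+m (e′ + e′) 3) ix) , inM (≤-<-trans (n≤1+n (2 + (e′ + e′))) ix) , ≤-<-trans (n≤1+n (2 + (e′ + e′))) ix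
                         , inM (≤-<-trans (m≤n+m (e′ + e′) 3) ix) , inM ix , ix , fits (sum₂ (<⇒≤ x<st) (<⇒≤ y<st)) , tt )
            (e≡ , refl , refl , p≡)

          module _ (σ₁ : St) (F₁ : Frame (block locate) σ′ σ₁) (loc : Located σ₁) where
            private
              e₁ = proj₁ loc
              x₁ = proj₁ (proj₂ loc)
              y₁ = proj₁ (proj₂ (proj₂ loc))
              p₁ = proj₂ (proj₂ (proj₂ loc))
              u₁ : vr σ₁ vU ≡ u
              u₁ = keepV F₁ vU
              c₁ : vr σ₁ vC ≡ c
              c₁ = keepV F₁ vC
              u₁<st : vr σ₁ vU < st
              u₁<st = subst (_< st) (sym u₁) u<st
              x₁<st : vr σ₁ vX < st
              x₁<st = subst (_< st) (sym x₁) x<st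
              y₁<st : vr σ₁ vY < st
              y₁<st = subst (_< st) (sym y₁) y<st
              p₁<st : vr σ₁ vP < st
              p₁<st = subst (_< st) (sym p₁) (<-trans p<n n<st)
              c₁≤m : vr σ₁ vC ≤ m
              c₁≤m = subst (_≤ m) (sym c₁) c≤m
              d₁ : ∀ v → ar σ₁ D₀ v ≡ deg₀ v
              d₁ v = trans (keepA F₁ D₀ v) (d≡ v)
              rd : ∀ v → r * ar σ₁ D₀ v < M
              rd v = <-≤-trans (s≤s (*-monoʳ-≤ r (≤-trans (≤-reflexive (d₁ v)) (partial-deg v ≤-refl)))) (≤-trans (*-monoˡ-< st r<st) (≤-trans (m≤n*m (st * st) 32) room))
              at-ends : ∀ v → eqn (vr σ₁ vX) v + eqn (vr σ₁ vY) v ≡ inc v e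
              at-ends v = trans (cong₂ (λ a b → eqn a v + eqn b v) x₁ y₁) (ends v)

            ok : OkB prune σ₁ ⊤
            ok = x₁<st , x₁<st , y₁<st , y₁<st , x₁<st , x₁<st , y₁<st , y₁<st , u₁<st , u₁<st
               , ≤-<-trans c₁≤m m<st , fits (sum₂ (≤-trans c₁≤m (<⇒≤ m<st)) (const≤ (s≤s z≤n)))
               , u₁<st , p₁<st , p₁<st , fits (sum₂ (<⇒≤ u₁<st) (const≤ (s≤s z≤n)))
               , u₁<st , inM r<st , u₁<st , rd (vr σ₁ vU) , inM r<st , p₁<st , rd (vr σ₁ vP) , tt

            σ″ : St
            σ″ = run prune σ₁

            pr : Pruned u e p σ′ σ″
            pr = record
              { deg≡ = λ v → trans (drop₂ (ar σ₁ Deg) (vr σ₁ vX) (vr σ₁ vY) 1 v) (cong₂ _∸_ (keepA F₁ Deg v) (trans (*-identityʳ _) (at-ends v)))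
              ; es≡ = λ v → trans (drop₂ (ar σ₁ Es) (vr σ₁ vX) (vr σ₁ vY) (vr σ₁ vE) v) (cong₂ _∸_ (keepA F₁ Es v) (cong₂ _*_ (at-ends v) e₁))
              ; hp≡ = λ v → upd-cong (keepA F₁ Hp) u₁ refl v
              ; pe≡ = λ v → upd-cong (keepA F₁ Pe) u₁ e₁ v
              ; ord≡ = λ v → upd-cong (keepA F₁ Ord) c₁ u₁ v
              ; next≡ = λ v → upd-cong (keepA F₁ Next) u₁ (trans (keepA F₁ Head _) (cong (ar σ′ Head) p₁)) v
              ; head≡ = λ v → upd-cong (keepA F₁ Head) p₁ (trans (+-comm _ 1) (cong suc u₁)) v
              ; same≡ = λ v → upd-cong (keepA F₁ Same) u₁ (cong₂ (λ a b → eqn (r * a) (r * b)) (trans (d₁ _) (cong deg₀ u₁)) (trans (d₁ _) (cong deg₀ p₁))) v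
              ; c≡ = trans (+-comm (vr σ₁ vC) 1) (cong suc c₁) }

          module _ (σ″ : St) (pr : Pruned u e p σ′ σ″) (u≡ : vr σ″ vU ≡ p) (i≡ : vr σ″ vI ≡ vr σ′ vI) where
           R′ : ℕ → ℕ
           R′ = upd S e 0

           pruned : Elim R′ (updL kids p u) (upd par u p) (upd rk u c) σ″
           pruned = Prune.pruned elim u e p L en one′ pr

           size-step : sumTo m S ≡ suc (sumTo m R′)
           size-step = +-cancelˡ-≡ c _ _ (trans (Elim.size≡ elim) (trans (sym (Elim.size≡ pruned)) (trans (cong (_+ sumTo m R′) (Pruned.c≡ pr)) (sym (+-suc c (sumTo m R′))))))

           still-clean : ∀ {v} → v ≢ p → remDeg S v ≢ 1 ⊎ v ≡ u → remDeg R′ v ≢ 1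
           still-clean {v} v≢p (inj₂ refl) eq = contradiction (trans (sym (Elim.gone pruned (trans (Pruned.hp≡ pr u) (upd-same (ar σ′ Hp) u 1)))) eq) λ ()
           still-clean {v} v≢p (inj₁ h) = by-equality v u (λ { refl → λ _ → h one′ }) λ v≢u eq → h (trans (sym
             (trans (sym (Elim.deg pruned v)) (trans (Pruned.deg≡ pr v) (trans (cong (ar σ′ Deg v ∸_) (inc-off en v≢u v≢p)) (Elim.deg elim v))))) eq)

           result : Stripped (suc t) σ″
           result = stripped pruned
             (trans (sym (+-suc t (sumTo m R′))) (trans (cong (t +_) (sym size-step)) (trans time≡ (cong (_+ m) (sym i≡)))))
             (inj₁ (subst (_< n) (sym i≡) i<n , subst (_< n) (sym u≡) p<n))
             λ {v} v≤ v<n v≢ → still-clean (λ e → v≢ (trans e (sym u≡))) (by-equality v u inj₂ λ v≢u → inj₁ (clean (≤-trans v≤ (≤-reflexive i≡)) v<n v≢u))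

          pruneT : Tri (block locate ⨟ block prune) σ′ (costB locate + costB prune) (Stripped (suc t))
          pruneT = locateT thenT λ σ₁ F₁ loc → triB (ok σ₁ F₁ loc) (result _ (pr σ₁ F₁ loc) (proj₂ (proj₂ (proj₂ loc))) (keepV F₁ vI))

        advanceStep : ∀ t σ′ → vr σ′ vU < n → vr σ′ vI < n → Stripped t σ′ → ar σ′ Deg (vr σ′ vU) ≢ 1 → Stripped (suc t) (run advance σ′)
        advanceStep t σ′ u<n i<n inv ne = stripped elim′
            (trans (cong suc time≡) (cong (_+ m) (+-comm 1 (vr σ′ vI))))
            (case m≤n⇒m<n∨m≡n i<n of λ
              { (inj₁ l) → inj₁ (≤-trans (≤-reflexive (cong suc (+-comm (vr σ′ vI) 1))) l , ≤-trans (≤-reflexive (cong suc (+-comm (vr σ′ vI) 1))) l)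
              ; (inj₂ e) → inj₂ (trans (+-comm (vr σ′ vI) 1) e , trans (+-comm (vr σ′ vI) 1) e) })
            λ {v} v≤ v<n v≢ → by-equality v (vr σ′ vU) (λ { refl → λ q → ne (trans (Elim.deg elim v) q) })
               λ v≢u → clean (s≤s⁻¹ (≤-trans (≤∧≢⇒< v≤ v≢) (≤-reflexive (+-comm (vr σ′ vI) 1)))) v<n v≢u
          where
          open Stripped inv
          elim′ : Elim S kids par rk (run advance σ′)
          elim′ = record { Elim elim }

        step-strip : ∀ t σ′ → t < n + m → Frame body σ σ′ → Stripped t σ′ → Iter guardE body σ′ stripCost (Stripped (suc t))
        step-strip t σ′ l F inv = iter tt (λ z → contradiction (trans (sym (trans (cong (ltn (vr σ′ vI)) (trans (keepV F vN) n≡)) (ltn-< i<n))) z) λ ())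
          (by-equality (ar σ′ Deg (vr σ′ vU)) 1
            (λ e → take-branch (λ z → contradiction (trans (sym (trans (cong (λ a → eqn a 1) e) refl)) z) λ ()) (PruneStep.pruneT t σ′ F u<n i<n inv e))
            (λ ne → tri (brF (u<st , tt) (eqn-≢ ne) (blk (fits (sum₂ (<⇒≤ (<-trans i<n n<st)) (const≤ (s≤s z≤n))) , tt)))
                     (+-monoʳ-≤ (costE {7} (eq (get Deg (var vU)) (con 1))) (+-mono-≤ (n≤1+n 2) (m≤n+m (costB advance) (costB locate + costB prune))))
                     (advanceStep t σ′ u<n i<n inv ne)))
          where
          open Stripped inv
          done-early : vr σ′ vI ≡ n → vr σ′ vU ≡ n → t ≡ n + m
          done-early i≡ u≡ = trans (sym (+-identityʳ t)) (trans (cong (t +_) (sym zero-size)) (trans time≡ (cong (_+ m) i≡)))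
            where
            zero-size : sumTo m S ≡ 0
            zero-size = sumTo-zero m (no-leaf S (Elim.R≤1 elim) λ v v<n → clean (≤-trans (<⇒≤ v<n) (≤-reflexive (sym i≡))) v<n (<⇒≢ (<-≤-trans v<n (≤-reflexive (sym u≡)))))
          pos : vr σ′ vI < n × vr σ′ vU < n
          pos = case where′ of λ { (inj₁ q) → q ; (inj₂ (a , b)) → contradiction (done-early a b) (<⇒≢ l) }
          i<n : vr σ′ vI < n
          i<n = proj₁ pos
          u<n : vr σ′ vU < n
          u<n = proj₂ pos
          u<st : vr σ′ vU < st
          u<st = <-trans u<n n<st
          take-branch : ev {7} (eq (get Deg (var vU)) (con 1)) σ′ ≢ 0 → Tri (block locate ⨟ block prune) σ′ (costB locate + costB prune) (Stripped (suc t)) → Tri body σ′ stripCost (Stripped (suc t))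
          take-branch g (tri {time = k} ex le q) = tri (brT (u<st , tt) g ex)
            (+-monoʳ-≤ (costE {7} (eq (get Deg (var vU)) (con 1))) (≤-trans (≤-reflexive (cong (2 +_) (+-comm k 1))) (+-monoʳ-≤ 3 (≤-trans le (m≤m+n _ (costB advance)))))) q

        at-end : ∀ σ′ → Stripped (n + m) σ′ → vr σ′ vI ≡ n × vr σ′ vU ≡ n
        at-end σ′ inv = case where′ of λ
          { (inj₂ q) → q
          ; (inj₁ (i<n , _)) → contradiction (≤-trans (m≤m+n (n + m) (sumTo m S)) (≤-reflexive time≡)) (<⇒≱ (+-monoˡ-< m i<n)) }
          where open Stripped inv

        stripT : (∀ v → ar σ Deg v ≡ deg₀ v) → (∀ v → ar σ Es v ≡ sumTo m (λ e → inc v e * e)) → (∀ v → ar σ Hp v ≡ 0) → (∀ v → ar σ Same v ≡ 0) →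
          (∀ v → ar σ Head v ≡ 0) → vr σ vC ≡ 0 → vr σ vI ≡ 0 → vr σ vU ≡ 0 →
          Tri strip σ (sumTo (n + m) (λ _ → stripCost + overhead guardE) + overhead guardE) (Stripped (n + m))
        stripT dg es h0 s0 hd c0 i0 u0 = upLoop (n + m) (λ _ → stripCost) Stripped step-strip
          (λ σ′ F inv → exit tt (trans (cong₂ ltn (proj₁ (at-end σ′ inv)) (trans (keepV F vN) n≡)) (ltn-≥ (≤-refl {n}))))
          (stripped {S = λ _ → 1} {par = λ _ → 0} {rk = λ _ → 0} {kids = λ _ → []} start
            (trans (trans (sumTo-const m 1) (*-identityʳ m)) (cong (_+ m) (sym i0)))
            (inj₁ (subst (_< n) (sym i0) 1≤n , subst (_< n) (sym u0) 1≤n))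
            λ v≤ _ v≢ → contradiction (trans (n≤0⇒n≡0 (≤-trans v≤ (≤-reflexive i0))) (sym u0)) v≢)
          where
          start : Elim (λ _ → 1) (λ _ → []) (λ _ → 0) (λ _ → 0) σ
          start = record
            { R≤1 = λ _ → ≤-refl
            ; deg = λ v → trans (dg v) (sumTo-cong m λ e _ → sym (*-identityˡ (inc v e)))
            ; es = λ v → trans (es v) (sumTo-cong m λ e _ → sym (*-identityˡ (inc v e * e)))
            ; hp≤1 = λ v → ≤-trans (≤-reflexive (h0 v)) z≤n ; same≤1 = λ v → ≤-trans (≤-reflexive (s0 v)) z≤n
            ; gone = λ {v} h → contradiction (trans (sym (h0 v)) h) λ ()
            ; split = λ β v → trans (sumTo-cong m λ e _ → sym (*-identityˡ (inc v e * β e))) (sym (trans (cong (sumTo m (λ e → 1 * (inc v e * β e)) +_) (cong (_* β (ar σ Pe v)) (h0 v))) (+-identityʳ _)))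
            ; linked = hd ; unique = λ _ → []
            ; kid-hp = λ () ; kid-par = λ () ; kid-edge = λ () ; kid-same = λ ()
            ; parent = λ {v} h → contradiction (h0 v) h ; cover = λ _ ()
            ; size≡ = trans (cong (_+ sumTo m (λ _ → 1)) c0) (trans (sumTo-const m 1) (*-identityʳ m))
            ; ord-hp = λ l → contradiction (≤-trans l (≤-reflexive c0)) λ () ; rk-ord = λ l → contradiction (≤-trans l (≤-reflexive c0)) λ ()
            ; ord-rk = λ {v} h → contradiction (trans (sym (h0 v)) h) λ () ; rk-kid = λ _ () }

      module Roots (σ : St) (n≡ : vr σ vN ≡ n) (d0 : ∀ v → ar σ D₀ v ≡ deg₀ v) {S par rk₀ : ℕ → ℕ} {kids : ℕ → List ℕ}
                   (E : Elim S kids par rk₀ σ) (S≡0 : ∀ e → e < m → S e ≡ 0) where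
        open Elim E using (hp; pe; same; hp≤1; same≤1; kid-hp; kid-edge)

        Placed : ℕ → ℕ → Set
        Placed j w = hp w ≡ 1 ⊎ w < j

        record RootsInv (j : ℕ) (σ′ : St) : Set where
          field
            rk     : ℕ → ℕ
            v≡     : vr σ′ vV ≡ j
            c≤     : vr σ′ vC ≤ m + j
            placed : ∀ {i} → i < vr σ′ vC → ar σ′ Ord i < n × Placed j (ar σ′ Ord i)
            rk-ord : ∀ {i} → i < vr σ′ vC → rk (ar σ′ Ord i) ≡ i
            ord-rk : ∀ {w} → w < n → Placed j w → rk w < vr σ′ vC × ar σ′ Ord (rk w) ≡ w
            rk-kid : ∀ {w k} → w < n → Placed j w → k ∈ kids w → rk k < rk w

        hp1<n : ∀ {v} → hp v ≡ 1 → v < n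
        hp1<n h = let l , en = kid-edge (Elim.parent E λ z → contradiction (trans (sym h) z) λ ()) in ends-< l en

        start : vr σ vV ≡ 0 → RootsInv 0 σ
        start v0 = record
          { rk = rk₀ ; v≡ = v0 ; c≤ = ≤-trans (≤-trans (m≤m+n _ (sumTo m S)) (≤-reflexive (Elim.size≡ E))) (m≤m+n m 0)
          ; placed = λ l → hp1<n (Elim.ord-hp E l) , inj₁ (Elim.ord-hp E l)
          ; rk-ord = Elim.rk-ord E
          ; ord-rk = λ { _ (inj₁ h) → Elim.ord-rk E h ; _ (inj₂ ()) }
          ; rk-kid = λ { _ (inj₁ h) → Elim.rk-kid E h ; _ (inj₂ ()) } }

        widen : ∀ {j w} → Placed j w → Placed (suc j) w
        widen (inj₁ h) = inj₁ h
        widen (inj₂ l) = inj₂ (m<n⇒m<1+n l)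

        narrow : ∀ {j w} → w ≢ j → Placed (suc j) w → Placed j w
        narrow n (inj₁ h) = inj₁ h
        narrow n (inj₂ l) = inj₂ (≤∧≢⇒< (s≤s⁻¹ l) n)

        record Rooted (j : ℕ) (σ′ σ″ : St) : Set where
          field
            v≡   : vr σ″ vV ≡ suc j
            c≡   : vr σ″ vC ≡ vr σ′ vC + (1 ∸ hp j)
            ord≡ : ∀ i → ar σ″ Ord i ≡ upd (ar σ′ Ord) (vr σ′ vC) j i

        skip : ∀ {j σ′ σ″} → hp j ≡ 1 → RootsInv j σ′ → Rooted j σ′ σ″ → RootsInv (suc j) σ″
        skip {j} {σ′} {σ″} h inv rt = record
          { rk = rk ; v≡ = Rooted.v≡ rt ; c≤ = ≤-trans (≤-reflexive c′) (≤-trans c≤ (+-monoʳ-≤ m (n≤1+n j)))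
          ; placed = λ l → subst (λ z → z < n × Placed (suc j) z) (sym (old (shrink l))) (proj₁ (placed (shrink l)) , widen (proj₂ (placed (shrink l))))
          ; rk-ord = λ l → trans (cong rk (old (shrink l))) (rk-ord (shrink l))
          ; ord-rk = λ w< p → let l , o = ord-rk w< (kept p) in ≤-trans l (≤-reflexive (sym c′)) , trans (old l) o
          ; rk-kid = λ w< p → rk-kid w< (kept p) }
          where
          open RootsInv inv
          c′ : vr σ″ vC ≡ vr σ′ vC
          c′ = trans (Rooted.c≡ rt) (trans (cong (λ z → vr σ′ vC + (1 ∸ z)) h) (+-identityʳ _))
          shrink : ∀ {i} → i < vr σ″ vC → i < vr σ′ vC
          shrink l = ≤-trans l (≤-reflexive c′)
          old : ∀ {i} → i < vr σ′ vC → ar σ″ Ord i ≡ ar σ′ Ord i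
          old l = trans (Rooted.ord≡ rt _) (upd-other (ar σ′ Ord) j (<⇒≢ l ∘ sym))
          kept : ∀ {w} → Placed (suc j) w → Placed j w
          kept {w} p = by-equality w j (λ { refl → inj₁ h }) (λ ne → narrow ne p)

        place : ∀ {j σ′ σ″} → j < n → hp j ≡ 0 → RootsInv j σ′ → Rooted j σ′ σ″ → RootsInv (suc j) σ″
        place {j} {σ′} {σ″} j<n h inv rt = record
          { rk = rk′ ; v≡ = Rooted.v≡ rt ; c≤ = ≤-trans (≤-reflexive c′) (≤-trans (s≤s c≤) (≤-reflexive (sym (+-suc m j))))
          ; placed = λ l → split l (λ { refl → subst (λ z → z < n × Placed (suc j) z) (sym new) (j<n , inj₂ ≤-refl) })
                       (λ q → subst (λ z → z < n × Placed (suc j) z) (sym (old q)) (proj₁ (placed q) , widen (proj₂ (placed q))))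
          ; rk-ord = λ l → split l (λ { refl → trans (cong rk′ new) rk-on }) (λ q → trans (cong rk′ (old q)) (trans (rk-off (placed≢j (proj₂ (placed q)))) (rk-ord q)))
          ; ord-rk = λ {w} w< p → by-equality w j
              (λ { refl → subst (λ z → z < vr σ″ vC × ar σ″ Ord z ≡ j) (sym rk-on) (≤-reflexive (sym c′) , new) })
              (λ ne → let l , o = ord-rk w< (narrow ne p) in subst (λ z → z < vr σ″ vC × ar σ″ Ord z ≡ w) (sym (rk-off ne)) (≤-trans (m<n⇒m<1+n l) (≤-reflexive (sym c′)) , trans (old l) o))
          ; rk-kid = λ {w} {k} w< p k∈ → subst₂ _<_ (sym (rk-off (kid≢j k∈))) refl (by-equality w j
              (λ { refl → ≤-trans (proj₁ (ord-rk (hp1<n (kid-hp k∈)) (inj₁ (kid-hp k∈)))) (≤-reflexive (sym rk-on)) })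
              (λ ne → ≤-trans (rk-kid w< (narrow ne p) k∈) (≤-reflexive (sym (rk-off ne))))) }
          where
          open RootsInv inv
          rk′ : ℕ → ℕ
          rk′ = upd rk j (vr σ′ vC)
          rk-on : rk′ j ≡ vr σ′ vC
          rk-on = upd-same rk j _
          rk-off : ∀ {w} → w ≢ j → rk′ w ≡ rk w
          rk-off ne = upd-other rk _ (ne ∘ sym)
          kid≢j : ∀ {w k} → k ∈ kids w → k ≢ j
          kid≢j k∈ refl = contradiction (trans (sym (kid-hp k∈)) h) λ ()
          placed≢j : ∀ {w} → Placed j w → w ≢ j
          placed≢j (inj₁ h′) refl = contradiction (trans (sym h′) h) λ ()
          placed≢j (inj₂ l) = <⇒≢ l
          c′ : vr σ″ vC ≡ suc (vr σ′ vC)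
          c′ = trans (Rooted.c≡ rt) (trans (cong (λ z → vr σ′ vC + (1 ∸ z)) h) (+-comm _ 1))
          split : ∀ {i} {A : Set} → i < vr σ″ vC → (i ≡ vr σ′ vC → A) → (i < vr σ′ vC → A) → A
          split l f g = case m≤n⇒m<n∨m≡n (s≤s⁻¹ (≤-trans l (≤-reflexive c′))) of λ { (inj₁ q) → g q ; (inj₂ e) → f e }
          old : ∀ {i} → i < vr σ′ vC → ar σ″ Ord i ≡ ar σ′ Ord i
          old l = trans (Rooted.ord≡ rt _) (upd-other (ar σ′ Ord) j (<⇒≢ l ∘ sym))
          new : ar σ″ Ord (vr σ′ vC) ≡ j
          new = trans (Rooted.ord≡ rt _) (upd-same (ar σ′ Ord) _ j)

        guardE : Exp 7
        guardE = lt (var vV) (var vN)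

        step-roots : ∀ j σ′ → j < n → Frame (block rootsBody) σ σ′ → RootsInv j σ′ → Iter guardE (block rootsBody) σ′ (costB rootsBody) (RootsInv (suc j))
        step-roots j σ′ j<n F inv = iter tt (λ z → contradiction (trans (sym (trans (cong₂ ltn v≡ (trans (keepV F vN) n≡)) (ltn-< j<n))) z) λ ())
          (triB ( ≤-<-trans c≤st m+j< , v<st , fits (sum₂ (≤-trans c≤st (<⇒≤ m+j<)) (≤-trans (m∸n≤m 1 (ar σ′ Hp (vr σ′ vV))) (const≤ (s≤s z≤n))))
                , fits (sum₂ (<⇒≤ v<st) (const≤ (s≤s z≤n))) , tt )
            (by-equality (hp j) 0 (λ h → place j<n h inv rooted) (λ h → skip (≤-antisym (hp≤1 j) (n≢0⇒n>0 h)) inv rooted)))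
          where
          open RootsInv inv
          c≤st : vr σ′ vC ≤ m + j
          c≤st = c≤
          m+j< : m + j < st
          m+j< = ≤-<-trans (+-mono-≤ m≤n (<⇒≤ j<n)) 2n<st
          v<st : vr σ′ vV < st
          v<st = subst (_< st) (sym v≡) (≤-<-trans (≤-trans (<⇒≤ j<n) (m≤m+n n n)) 2n<st)
          rooted : Rooted j σ′ (run rootsBody σ′)
          rooted = record
            { v≡ = trans (cong (_+ 1) v≡) (+-comm j 1)
            ; c≡ = cong (λ z → vr σ′ vC + (1 ∸ z)) (trans (keepA F Hp _) (cong hp v≡))
            ; ord≡ = λ i → cong (λ z → upd (ar σ′ Ord) (vr σ′ vC) z i) v≡ }

        inc≤1 : ∀ {e} v → e < m → inc v e ≤ 1
        inc≤1 {e} v l = by-equality (X e) v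
          (λ { refl → ≤-reflexive (inc-end l (inj₁ (refl , refl))) })
          (λ ne → ≤-trans (≤-reflexive (cong (_+ eqn (Y e) v) (eqn-≢ ne))) (b2n≤1 (Y e ≡ᵇ v)))

        count-β : ∀ (β : ℕ → ℕ) v → sumTo m (λ e → inc v e * β e) ≡ sumOver (kids v) (β ∘ pe) + hp v * β (pe v)
        count-β β v = trans (Elim.split E β v) (cong (_+ (sumOver (kids v) (β ∘ pe) + hp v * β (pe v))) (sumTo-zero m λ e l → cong (_* (inc v e * β e)) (S≡0 e l)))

        forest : ∀ {σ′} → Frame (block rootsBody) σ σ′ → RootsInv n σ′ → Σ (Forest n m r X Y) λ F → StaticFor F σ′
        forest {σ′} F inv = record
          { d = deg₀ ; hp = hp ; same = same ; head = ar σ Head ; next = ar σ Next ; ord = ar σ′ Ord ; pe = pe ; rk = rk ; par = par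
          ; kids = kids ; c = vr σ′ vC ; hp≤1 = hp≤1 ; same≤1 = same≤1
          ; d≤n = λ v → ≤-trans (sumTo-mono m λ e l → inc≤1 v l) (≤-trans (≤-reflexive (trans (sumTo-const m 1) (*-identityʳ m))) m≤n)
          ; degree = λ v → trans (sumTo-cong m λ e _ → sym (*-identityʳ (inc v e))) (trans (count-β (λ _ → 1) v)
              (cong₂ _+_ (trans (sumOver-const (kids v) 1) (*-identityʳ _)) (*-identityʳ (hp v))))
          ; linked = Elim.linked E ; unique = Elim.unique E
          ; kid<n = λ k∈ → let l , en = kid-edge k∈ in ends-< l en
          ; kid-hp = kid-hp ; kid-par = Elim.kid-par E ; kid-same = Elim.kid-same E ; kid-edge = kid-edge
          ; parent = λ v< h → let k∈ = Elim.parent E h ; l , en = kid-edge k∈ in k∈ , ends-< l (ends-swap en)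
          ; cover = λ l → let v , k , k∈ , e≡ = Elim.cover E l (S≡0 _ l) ; l′ , en = kid-edge k∈ in v , k , ends-< l′ (ends-swap en) , k∈ , e≡
          ; count-β = count-β
          ; c≤ = ≤-trans c≤ (+-monoˡ-≤ n m≤n)
          ; ord<n = λ l → proj₁ (placed l)
          ; rk-ord = rk-ord
          ; ord-rk = λ l → ord-rk l (inj₂ l)
          ; rk-kid = λ l → rk-kid l (inj₂ l) }
          , record
          { n≡ = trans (keepV F vN) n≡ ; c≡ = refl ; d≡ = λ v → trans (keepA F D₀ v) (d0 v) ; hp≡ = keepA F Hp ; same≡ = keepA F Same
          ; head≡ = keepA F Head ; next≡ = keepA F Next ; ord≡ = λ _ → refl ; pe≡ = keepA F Pe }
          where open RootsInv inv

        rootsT : vr σ vV ≡ 0 → Tri roots σ (sumTo n (λ _ → costB rootsBody + overhead guardE) + overhead guardE) (λ σ′ → Σ (Forest n m r X Y) λ F → StaticFor F σ′)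
        rootsT v0 = weaken ≤-refl (λ F inv → forest record { keepV = λ v {p} → keepV F v {p} ; keepA = λ k {p} → keepA F k {p} } inv)
          (upLoop n (λ _ → costB rootsBody) RootsInv step-roots
            (λ σ′ F inv → exit tt (trans (cong₂ ltn (RootsInv.v≡ inv) (trans (keepV F vN) n≡)) (ltn-≥ (≤-refl {n})))) (start v0))

      heavyAt : (ℕ → ℕ) → ℕ → ℕ
      heavyAt β v = sumTo m (λ e → inc v e * β e)

      Clash : (ℕ → ℕ) → ℕ → ℕ → Set
      Clash β u v = r * deg₀ u ≡ r * deg₀ v × key n (deg₀ u) (heavyAt β u) ≡ key n (deg₀ v) (heavyAt β v)

      ProperN : (ℕ → ℕ) → Set
      ProperN β = ∀ e → e < m → ¬ Clash β (X e) (Y e)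

      Answer : St → Set
      Answer σ = (ar σ IO 0 ≡ 1 × (∀ e → e < m → ar σ IO (1 + e) ≤ 1) × ProperN (λ e → ar σ IO (1 + e)))
               ⊎ (ar σ IO 0 ≡ 0 × (∀ β → (∀ e → β e ≤ 1) → ¬ ProperN β))

      clashes : (ℕ → ℕ) → St → ℕ
      clashes a σ = eqn (a (vr σ vK ∸ 1)) 1 + eqn (a (vr σ vK ∸ 1)) (vr σ vBS)

      chosenBit : St → ℕ
      chosenBit σ = choose (clashes (ar σ aA) σ) 1 (choose (clashes (ar σ aB) σ) 0 (ltn 0 (vr σ vBQ)))

      record AssignRun (σ σ″ : St) : Set where
        field
          k″    : vr σ″ vK ≡ ar σ Next (vr σ vK ∸ 1)
          q″    : vr σ″ vBQ ≡ choose (clashes (ar σ aA) σ) (vr σ vBQ) (choose (clashes (ar σ aB) σ) (vr σ vBQ) (vr σ vBQ ∸ 1))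
          opt″  : ∀ j → ar σ″ Opt j ≡ upd (ar σ Opt) (vr σ vK ∸ 1) (chosenBit σ) j
          forb″ : ∀ j → ar σ″ Forb j ≡ upd (ar σ Forb) (vr σ vK ∸ 1) (ar σ Same (vr σ vK ∸ 1) * vr σ vBS) j
          io″   : ∀ j → ar σ″ IO j ≡ upd (ar σ IO) (1 + ar σ Pe (vr σ vK ∸ 1)) (chosenBit σ) j

      assign-run : ∀ σ → AssignRun σ (run assignBody σ)
      assign-run σ = record { k″ = refl ; q″ = refl ; opt″ = λ _ → refl ; forb″ = λ _ → refl ; io″ = λ _ → refl }

      module WithForest (F : Forest n m r X Y) where
        open Forest F

        κ : ℕ → ℕ → ℕ
        κ v J = key n (d v) J

        2≤κ : ∀ v J → 2 ≤ κ v J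
        2≤κ v J = s≤s (s≤s z≤n)

        open DP κ 2≤κ hp d same hp≤1 same≤1 kids public

        Static : St → Set
        Static = StaticFor F

        module Static {σ : St} (s : Static σ) = StaticFor s

        len≤n : ∀ v → length (kids v) ≤ n
        len≤n v = ≤-trans (≤-trans (m≤m+n _ (hp v)) (≤-reflexive (sym (degree v)))) (d≤n v)

        record Codes (σ : St) : Set where
          field
            lowA  : ∀ k → ar σ aA k < st
            lowB  : ∀ k → ar σ aB k < st
            lowZ  : ∀ k → ar σ aZ k < st
            zeroA : ∀ x → ar σ TA x ≡ 0
            zeroB : ∀ x → ar σ TB x ≡ 0
            zeroZ : ∀ x → ar σ TZ x ≡ 0

        small-kids : ∀ {A B Z} v → (∀ k → A k < st) → (∀ k → B k < st) → (∀ k → Z k < st) → Small A B Z (kids v)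
        small-kids v a b z = record { kids< = λ k∈ → <-trans (kid<n k∈) n<st ; smallA = a ; smallB = b ; smallZ = z ; short = ≤-<-trans (len≤n v) n<st }

        fillCost clearCost : ℕ → ℕ
        fillCost  u = sumOver (kids u) (λ _ → costB fillBody + overhead (var vK)) + overhead (var vK)
        clearCost u = sumOver (kids u) (λ _ → costB clearBody + overhead (var vK)) + overhead (var vK)

        cnt-cong : ∀ {f g} ks x → (∀ k → f k ≡ g k) → cnt f ks x ≡ cnt g ks x
        cnt-cong ks x e = sumOver-cong ks λ {k} _ → cong (λ z → eqn z x) (e k)

        double≤ : ∀ {f : ℕ → ℕ} {g} v → (∀ x → f x ≡ cnt g (kids v) x) → ∀ x → f x + f x ≤ st
        double≤ {f} {g} v e x = ≤-trans (+-mono-≤ len len) (<⇒≤ 2n<st)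
          where len : f x ≤ n
                len = ≤-trans (≤-reflexive (e x)) (≤-trans (cnt≤ g (kids v) x) (len≤n v))

        module _ (σ : St) (u : ℕ) (A B Z : ℕ → ℕ) (vd : vr σ vD ≡ d u) (vh : vr σ vH ≡ hp u) (vn : vr σ vN ≡ n)
                 (tA : ∀ x → ar σ TA x ≡ cnt A (kids u) x) (tB : ∀ x → ar σ TB x ≡ cnt B (kids u) x) (tZ : ∀ x → ar σ TZ x ≡ cnt Z (kids u) x) where

          scanPre : ScanPre σ
          scanPre = record
            { d≤n = subst₂ _≤_ (sym vd) (sym vn) (d≤n u) ; h≤1 = subst (_≤ 1) (sym vh) (hp≤1 u)
            ; N<st = subst (_< st) (sym vn) n<st
            ; keysN = subst (λ z → 2 + P * z + Q * z + R * z < st) (sym vn) keys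
            ; tA< = double≤ {g = A} u tA ; tB< = double≤ {g = B} u tB ; tZ< = double≤ {g = Z} u tZ }

          open Scan σ scanPre

          K≡κ : ∀ J → K J ≡ κ u J
          K≡κ J = cong₂ (λ a b → key a b J) vn vd

          tot≡ : ∀ {T : Arr} f → (∀ x → ar σ T x ≡ cnt f (kids u) x) → ∀ J → tot T J ≡ num f u (κ u J)
          tot≡ f e J = cong₂ _+_ (e 1) (trans (e (K J)) (cong (cnt f (kids u)) (K≡κ J)))

          feasS≡ : ∀ o J → feasS o J ≡ feas A B Z u o J
          feasS≡ o J = feasible-cong (tot≡ A tA J) (tot≡ B tB J) (tot≡ Z tZ J) vh vd (refl {x = o}) (refl {x = J})

        scan-cong₂ : ∀ {f g z y} N → (∀ J → f J ≡ g J) → (∀ J → z J ≡ y J) → scan f z N ≡ scan g y N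
        scan-cong₂ {y = y} zero h e = refl
        scan-cong₂ {f} {z = z} {y} (suc N) h e rewrite h N | e N | scan-cong₂ {z = z} N h e = refl

        scan<st : ∀ f z N → (∀ J → J < N → z J < st) → scan f z N < st
        scan<st f z zero    b = const≤ (s≤s (s≤s z≤n))
        scan<st f z (suc N) b = pick (f N) (pick (eqn s 1) (b N ≤-refl) (pick (eqn s (z N)) (b N ≤-refl) (const≤ (s≤s z≤n)))) ih
          where
          s = scan f z N
          ih = scan<st f z N (λ J l → b J (m<n⇒m<1+n l))
          pick : ∀ q {x y} → x < st → y < st → choose q x y < st
          pick zero    p q = q
          pick (suc _) p q = p

        κ<st : ∀ {v J} → J ≤ d v → κ v J < st
        κ<st {v} {J} l = ≤-<-trans (+-mono-≤ (+-mono-≤ (+-monoʳ-≤ 2 (*-monoʳ-≤ P (≤-trans (m∸n≤m (d v) J) (d≤n v))))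
              (*-monoʳ-≤ Q (≤-trans l (d≤n v)))) (*-monoʳ-≤ R (m∸n≤m n J))) keys

        ζ<st : ∀ {v J} → J < d v + 1 → ζ v J < st
        ζ<st {v} {J} l = ≤-<-trans (≤-trans (*-monoˡ-≤ (κ v J) (same≤1 v)) (≤-reflexive (+-identityʳ _))) (κ<st (s≤s⁻¹ (≤-trans l (≤-reflexive (+-comm (d v) 1)))))

        record UpInv (i : ℕ) (σ : St) : Set where
          field
            static : Static σ
            codes  : Codes σ
            i≡     : vr σ vI ≡ i
            specs  : ∀ {v} → v < n → rk v < i → Spec (ar σ aA) (ar σ aB) (ar σ aZ) v
            answer : (vr σ vAns ≡ 1 × (∀ {v} → v < n → rk v < i → ar σ aZ v ≢ 1)) ⊎
                     (vr σ vAns ≡ 0 × (∃[ v ] v < n × rk v < i × ar σ aZ v ≡ 1))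

        upCost : ℕ → ℕ
        upCost u = costB up₁ + (fillCost u + (costB up₂ + (sumTo (d u + 1) (λ _ → costB probe + costB decide + overhead tryJ) + overhead tryJ + (costB up₃ + (clearCost u + costB up₄)))))

        static-frame : ∀ {c σ σ′} → Frame c σ σ′ →
          (∀ {σ σ′} → Frame c σ σ′ → vr σ′ vN ≡ vr σ vN × vr σ′ vC ≡ vr σ vC × (∀ v → ar σ′ D₀ v ≡ ar σ D₀ v) × (∀ v → ar σ′ Hp v ≡ ar σ Hp v) ×
            (∀ v → ar σ′ Same v ≡ ar σ Same v) × (∀ v → ar σ′ Head v ≡ ar σ Head v) × (∀ v → ar σ′ Next v ≡ ar σ Next v) ×
            (∀ v → ar σ′ Ord v ≡ ar σ Ord v) × (∀ v → ar σ′ Pe v ≡ ar σ Pe v)) → Static σ → Static σ′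
        static-frame F k s with k F
        ... | a , b , e , f , g , h , i , j , l = record
          { n≡ = trans a n≡ ; c≡ = trans b c≡ ; d≡ = λ v → trans (e v) (d≡ v) ; hp≡ = λ v → trans (f v) (hp≡ v) ; same≡ = λ v → trans (g v) (same≡ v)
          ; head≡ = λ v → trans (h v) (head≡ v) ; next≡ = λ v → trans (i v) (next≡ v) ; ord≡ = λ v → trans (j v) (ord≡ v) ; pe≡ = λ v → trans (l v) (pe≡ v) }
          where open Static s

        up-static : ∀ {σ σ′} → Frame upBody σ σ′ → Static σ → Static σ′
        up-static F = static-frame F λ F → keepV F vN , keepV F vC , keepA F D₀ , keepA F Hp , keepA F Same , keepA F Head , keepA F Next , keepA F Ord , keepA F Pe

        first : ∀ {i v} → i < c → v < n → rk v < suc i → v ≢ ord i → rk v < i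
        first {i} {v} i<c v<n l v≢u = ≤∧≢⇒< (s≤s⁻¹ l) λ e → v≢u (trans (sym (proj₂ (ord-rk v<n))) (cong ord e))

        i<st : ∀ {i} → i < c → i < st
        i<st l = <-trans (<-≤-trans l c≤) 2n<st

        upStep : ∀ i σ → i < c → UpInv i σ → Tri upBody σ (upCost (ord i)) (UpInv (suc i))
        upStep i σ i<c inv = weaken ≤-refl (λ F q → q F)
          ( triB {Q = λ σ₁ → vr σ₁ vU ≡ u × vr σ₁ vK ≡ head u} (subst (_< st) (sym i≡) (i<st i<c) , subst (_< st) (sym u₀) u<st , tt) (u₀ , trans (head≡ _) (cong head u₀))
          thenT λ σ₁ F₁ (u₁ , k₁) →
            fillT σ₁ ks (small F₁ (keepA F₁ aA) (keepA F₁ aB) (keepA F₁ aZ)) (link σ₁ (keepA F₁ Next) k₁)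
              (λ x → trans (keepA F₁ TA x) (zeroA x)) (λ x → trans (keepA F₁ TB x) (zeroB x)) (λ x → trans (keepA F₁ TZ x) (zeroZ x))
          thenT λ σ₂ F₂ (tA , tB , tZ) → let G₂ = frame-seq F₁ F₂ ; u₂ = trans (keepV F₂ vU) u₁ ; u₂<st = subst (_< st) (sym u₂) u<st in
            triB {Q = λ σ₃ → vr σ₃ vD ≡ d u × vr σ₃ vH ≡ hp u × vr σ₃ vW ≡ same u × vr σ₃ vJ ≡ 0 × vr σ₃ vCA ≡ 1 × vr σ₃ vCB ≡ 1 × vr σ₃ vCZ ≡ 1}
              (u₂<st , u₂<st , u₂<st , tt)
              ( trans (keepA G₂ D₀ _) (trans (d≡ _) (cong d u₂)) , trans (keepA G₂ Hp _) (trans (hp≡ _) (cong hp u₂))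
              , trans (keepA G₂ Same _) (trans (same≡ _) (cong same u₂)) , refl , refl , refl , refl )
          thenT λ σ₃ F₃ (vd , vh , vw , vj , vca , vcb , vcz) → let
              G₃ = frame-seq G₂ F₃
              tA₃ = λ x → trans (keepA F₃ TA x) (trans (tA x) (cnt-cong ks x (keepA F₁ aA)))
              tB₃ = λ x → trans (keepA F₃ TB x) (trans (tB x) (cnt-cong ks x (keepA F₁ aB)))
              tZ₃ = λ x → trans (keepA F₃ TZ x) (trans (tZ x) (cnt-cong ks x (keepA F₁ aZ)))
              vn = trans (keepV G₃ vN) n≡
              w≤1 = subst (_≤ 1) (sym vw) (same≤1 u)
              pre = scanPre σ₃ u A B Z vd vh vn tA₃ tB₃ tZ₃
              K≡ = K≡κ σ₃ u A B Z vd vh vn tA₃ tB₃ tZ₃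
              feas≡ = feasS≡ σ₃ u A B Z vd vh vn tA₃ tB₃ tZ₃
              ζ≡ = λ J → cong₂ _*_ vw (K≡ J)
            in weaken {Q′ = λ σ₄ → vr σ₄ vCA ≡ scan (feas A B Z u 0) (ζ u) (d u + 1) × vr σ₄ vCB ≡ scan (feas A B Z u 1) (ζ u) (d u + 1) × vr σ₄ vCZ ≡ scan (any A B Z u) (ζ u) (d u + 1)}
                (≤-reflexive (cong (λ z → sumTo (z + 1) (λ _ → costB probe + costB decide + overhead tryJ) + overhead tryJ) vd))
                (λ _ (_ , a , b , z) → trans a (trans (cong (scan _ _) (cong (_+ 1) vd)) (scan-cong₂ (d u + 1) (feas≡ 0) ζ≡))
                                     , trans b (trans (cong (scan _ _) (cong (_+ 1) vd)) (scan-cong₂ (d u + 1) (feas≡ 1) ζ≡))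
                                     , trans z (trans (cong (scan _ _) (cong (_+ 1) vd)) (scan-cong₂ (d u + 1) (λ J → cong₂ _+_ (feas≡ 0 J) (feas≡ 1 J)) ζ≡)))
                (Scan.upScanT σ₃ pre w≤1 vj vca vcb vcz)
          thenT λ σ₄ F₄ (ca , cb , cz) → let G₄ = frame-seq G₃ F₄ ; u₄ = trans (keepV F₄ vU) (trans (keepV F₃ vU) u₂) in
            triB {Q = λ σ₅ → vr σ₅ vK ≡ head u} (subst (_< st) (sym u₄) u<st , tt) (trans (keepA G₄ Head _) (trans (head≡ _) (cong head u₄)))
          thenT λ σ₅ F₅ k₅ → let G₅ = frame-seq G₄ F₅ ; H = frame-seq F₃ (frame-seq F₄ F₅) ; H₁ = frame-seq F₂ H in
            clearT σ₅ ks (small G₅ (keepA G₅ aA) (keepA G₅ aB) (keepA G₅ aZ)) (link σ₅ (keepA G₅ Next) k₅)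
              (λ x → trans (keepA H TA x) (trans (tA x) (cnt-cong ks x λ k → sym (keepA H₁ aA k))))
              (λ x → trans (keepA H TB x) (trans (tB x) (cnt-cong ks x λ k → sym (keepA H₁ aB k))))
              (λ x → trans (keepA H TZ x) (trans (tZ x) (cnt-cong ks x λ k → sym (keepA H₁ aZ k))))
          thenT λ σ₆ F₆ (zA , zB , zZ) → let G₆ = frame-seq G₅ F₆ ; H = frame-seq F₅ F₆
                                             u₆ = trans (keepV H vU) u₄ ; u₆<st = subst (_< st) (sym u₆) u<st in
            triB {Q = λ σ₇ → Frame upBody σ σ₇ → UpInv (suc i) σ₇} (u₆<st , u₆<st , u₆<st , subst (λ z → z + 1 < M) (sym (trans (keepV G₆ vI) i≡)) (fits (sum₂ (<⇒≤ (i<st i<c)) (const≤ (s≤s z≤n)))) , tt)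
              λ F → finish σ₆ F u₆ (trans (keepV H vCA) ca) (trans (keepV H vCB) cb) (trans (keepV H vCZ) cz)
                 (keepA G₆ aA) (keepA G₆ aB) (keepA G₆ aZ) zA zB zZ (trans (keepV G₆ vI) i≡) (keepV G₆ vAns) )
          where
          open UpInv inv
          open Static static
          open Codes codes
          u : ℕ
          u = ord i
          ks = kids u
          A B Z : ℕ → ℕ
          A = ar σ aA
          B = ar σ aB
          Z = ar σ aZ
          u<n : u < n
          u<n = ord<n i<c
          u<st : u < st
          u<st = <-trans u<n n<st
          u₀ : ar σ Ord (vr σ vI) ≡ u
          u₀ = trans (ord≡ _) (cong ord i≡)
          link : ∀ σ₁ → (∀ x → ar σ₁ Next x ≡ ar σ Next x) → vr σ₁ vK ≡ head u → Linked (ar σ₁ Next) (vr σ₁ vK) ks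
          link σ₁ e k = subst (λ h → Linked (ar σ₁ Next) h ks) (sym k) (Linked-cong (λ x → sym (trans (e x) (next≡ x))) ks (linked u))
          small : ∀ {c σ₁} → Frame c σ σ₁ → (∀ x → ar σ₁ aA x ≡ A x) → (∀ x → ar σ₁ aB x ≡ B x) → (∀ x → ar σ₁ aZ x ≡ Z x) → Small (ar σ₁ aA) (ar σ₁ aB) (ar σ₁ aZ) ks
          small _ a b z = small-kids u (λ k → subst (_< st) (sym (a k)) (lowA k)) (λ k → subst (_< st) (sym (b k)) (lowB k)) (λ k → subst (_< st) (sym (z k)) (lowZ k))
          finish : ∀ σ₆ → Frame upBody σ (run up₄ σ₆) → vr σ₆ vU ≡ u →
            vr σ₆ vCA ≡ scan (feas A B Z u 0) (ζ u) (d u + 1) → vr σ₆ vCB ≡ scan (feas A B Z u 1) (ζ u) (d u + 1) → vr σ₆ vCZ ≡ scan (any A B Z u) (ζ u) (d u + 1) →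
            (∀ k → ar σ₆ aA k ≡ A k) → (∀ k → ar σ₆ aB k ≡ B k) → (∀ k → ar σ₆ aZ k ≡ Z k) →
            (∀ x → ar σ₆ TA x ≡ 0) → (∀ x → ar σ₆ TB x ≡ 0) → (∀ x → ar σ₆ TZ x ≡ 0) → vr σ₆ vI ≡ i → vr σ₆ vAns ≡ vr σ vAns → UpInv (suc i) (run up₄ σ₆)
          finish σ₆ F u₆ ca cb cz a b z zA zB zZ i₆ ans₆ = record
            { static = up-static F static
            ; codes = record { lowA = low a lowA ca ; lowB = low b lowB cb ; lowZ = low z lowZ cz ; zeroA = zA ; zeroB = zB ; zeroZ = zZ }
            ; i≡ = trans (cong (_+ 1) i₆) (+-comm i 1)
            ; specs = specs′
            ; answer = answer′ }
            where
            A′ B′ Z′ : ℕ → ℕ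
            A′ = upd (ar σ₆ aA) (vr σ₆ vU) (vr σ₆ vCA)
            B′ = upd (ar σ₆ aB) (vr σ₆ vU) (vr σ₆ vCB)
            Z′ = upd (ar σ₆ aZ) (vr σ₆ vU) (vr σ₆ vCZ)
            low : ∀ {f g : ℕ → ℕ} {h x} → (∀ k → f k ≡ g k) → (∀ k → g k < st) → x ≡ scan h (ζ u) (d u + 1) → ∀ k → upd f (vr σ₆ vU) x k < st
            low {f} {h = h} e l refl k with vr σ₆ vU ≟ k
            ... | yes p = subst (_< st) (sym (upd-at f p)) (scan<st h (ζ u) (d u + 1) λ J → ζ<st)
            ... | no  p = subst (_< st) (sym (trans (upd-off f p) (e k))) (l k)
            off : ∀ {k} → k ≢ u → A k ≡ A′ k × B k ≡ B′ k × Z k ≡ Z′ k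
            off {k} k≢u = sym (trans (upd-off (ar σ₆ aA) ne) (a k)) , sym (trans (upd-off (ar σ₆ aB) ne) (b k)) , sym (trans (upd-off (ar σ₆ aZ) ne) (z k))
              where ne : vr σ₆ vU ≢ k
                    ne e = k≢u (trans (sym e) u₆)
            not-u : ∀ {v k} → v < n → rk v ≤ i → k ∈ kids v → k ≢ u
            not-u v<n l k∈ refl = <⇒≱ (<-≤-trans (rk-kid v<n k∈) l) (≤-reflexive (sym (rk-ord i<c)))
            own : Spec A′ B′ Z′ u
            own = record
              { specA = trans (upd-at (ar σ₆ aA) u₆) (trans ca (scan-cong (d u + 1) (fc 0)))
              ; specB = trans (upd-at (ar σ₆ aB) u₆) (trans cb (scan-cong (d u + 1) (fc 1)))
              ; specZ = trans (upd-at (ar σ₆ aZ) u₆) (trans cz (scan-cong (d u + 1) λ J → cong₂ _+_ (fc 0 J) (fc 1 J))) }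
              where fc : ∀ o J → feas A B Z u o J ≡ feas A′ B′ Z′ u o J
                    fc = feas-cong λ k∈ → off (not-u u<n (≤-reflexive (rk-ord i<c)) k∈)
            specs′ : ∀ {v} → v < n → rk v < suc i → Spec A′ B′ Z′ v
            specs′ {v} v<n l with v ≟ u
            ... | yes refl = own
            ... | no  v≢u = spec-cong (λ k∈ → off (not-u v<n (s≤s⁻¹ l) k∈)) (off v≢u) (specs v<n (first i<c v<n l v≢u))
            Z≡ : Z′ u ≡ vr σ₆ vCZ
            Z≡ = upd-at (ar σ₆ aZ) u₆
            ans′ : ℕ
            ans′ = choose (eqn (vr σ₆ vCZ) 1) 0 (vr σ₆ vAns)
            rk-u : rk u < suc i
            rk-u = ≤-reflexive (cong suc (rk-ord i<c))
            answer′ : (ans′ ≡ 1 × (∀ {v} → v < n → rk v < suc i → Z′ v ≢ 1)) ⊎ (ans′ ≡ 0 × (∃[ v ] v < n × rk v < suc i × Z′ v ≡ 1))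
            answer′ with vr σ₆ vCZ ≟ 1
            ... | yes e = inj₂ (trans (cong (λ y → choose (eqn y 1) 0 (vr σ₆ vAns)) e) refl , u , u<n , rk-u , trans Z≡ e)
            answer′ | no ne with answer
            ... | inj₁ (a₁ , h) = inj₁ (trans (choose-≡0 (eqn-≢ ne)) (trans ans₆ a₁) , good)
              where good : ∀ {v} → v < n → rk v < suc i → Z′ v ≢ 1
                    good {v} v<n l with v ≟ u
                    ... | yes refl = λ e → ne (trans (sym Z≡) e)
                    ... | no  v≢u = λ e → h v<n (first i<c v<n l v≢u) (trans (proj₂ (proj₂ (off v≢u))) e)
            ... | inj₂ (a₀ , v , v<n , l , e) = inj₂ (trans (choose-≡0 (eqn-≢ ne)) (trans ans₆ a₀) , v , v<n , m<n⇒m<1+n l , trans (sym (proj₂ (proj₂ (off v≢u)))) e)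
              where v≢u : v ≢ u
                    v≢u refl = <⇒≢ l (rk-ord i<c)

        upT : ∀ {σ} → UpInv 0 σ → Tri up σ (sumTo c (λ i → upCost (ord i) + overhead (lt (var vI) (var vC))) + overhead (lt (var vI) (var vC))) (UpInv c)
        upT inv = upLoop c (λ i → upCost (ord i)) UpInv
          (λ i σ l F inv → iter tt (λ z → contradiction (trans (sym (trans (cong₂ ltn (UpInv.i≡ inv) (Static.c≡ (UpInv.static inv))) (ltn-< l))) z) λ ()) (upStep i σ l inv))
          (λ σ F inv → exit tt (trans (cong₂ ltn (UpInv.i≡ inv) (Static.c≡ (UpInv.static inv))) (ltn-≥ (≤-refl {c})))) inv

        d≡deg : ∀ v → d v ≡ deg₀ v
        d≡deg v = trans (degree v) (trans (sym (cong₂ _+_ (trans (sumOver-const (kids v) 1) (*-identityʳ _)) (*-identityʳ (hp v))))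
          (trans (sym (count-β (λ _ → 1) v)) (sumTo-cong m λ e _ → *-identityʳ (inc v e))))

        kid-clash : ∀ {β v k} → k ∈ kids v → same k ≡ 1 → κ k (heavyAt β k) ≡ κ v (heavyAt β v) → Clash β k v
        kid-clash {β} {v} {k} k∈ s e = trans (cong (r *_) (sym (d≡deg k))) (trans (eqn-≢0 λ z → contradiction (trans (sym s) (trans (kid-same k∈) z)) λ ()) (cong (r *_) (d≡deg v)))
          , subst₂ (λ a b → key n a (heavyAt β k) ≡ key n b (heavyAt β v)) (d≡deg k) (d≡deg v) e

        clash-kid : ∀ {β v k} → k ∈ kids v → Clash β k v → same k ≡ 1 × κ k (heavyAt β k) ≡ κ v (heavyAt β v)
        clash-kid {β} {v} {k} k∈ (a , b) = trans (kid-same k∈) (trans (cong (λ z → eqn z (r * d v)) (trans (cong (r *_) (d≡deg k)) (trans a (cong (r *_) (sym (d≡deg v)))))) (eqn-refl (r * d v)))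
          , subst₂ (λ a b → key n a (heavyAt β k) ≡ key n b (heavyAt β v)) (sym (d≡deg k)) (sym (d≡deg v)) b

        clash-sym : ∀ {β u v} → Clash β u v → Clash β v u
        clash-sym (a , b) = sym a , sym b

        kid-proper : ∀ {β v k} → ProperN β → k ∈ kids v → ¬ Clash β k v
        kid-proper {β} pr k∈ cl = case proj₂ (kid-edge k∈) of λ
          { (inj₁ (a , b)) → pr _ (proj₁ (kid-edge k∈)) (subst₂ (Clash β) (sym a) (sym b) cl)
          ; (inj₂ (a , b)) → pr _ (proj₁ (kid-edge k∈)) (subst₂ (Clash β) (sym a) (sym b) (clash-sym {β} cl)) }

        degree-sum : sumTo c (λ i → d (ord i)) ≤ n + n
        degree-sum = ≤-trans (≤-reflexive (trans (sumTo-cong c λ i _ → d≡deg (ord i)) (sumTo-swap c m (λ i → inc (ord i)))))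
          (≤-trans (sumTo-mono m λ e e< → ≤-trans (≤-reflexive (sumTo-+ c (λ i → eqn (X e) (ord i)) (λ i → eqn (Y e) (ord i)))) (+-mono-≤ (once (X e)) (once (Y e))))
            (≤-trans (≤-reflexive (trans (sumTo-const m 2) (trans (*-comm m 2) (cong (m +_) (+-identityʳ m))))) (+-mono-≤ m≤n m≤n)))
          where
          once : ∀ x → sumTo c (λ i → eqn x (ord i)) ≤ 1
          once x = sumTo-once c _ (rk x) (λ i _ → b2n≤1 (x ≡ᵇ ord i)) λ i l ne → trans (sym (rk-ord l)) (cong rk (sym (eqn-≢0 ne)))

        len≤d : ∀ u → length (kids u) ≤ 1 * suc (d u)
        len≤d u = ≤-trans (≤-trans (m≤m+n _ (hp u)) (≤-reflexive (sym (degree u)))) (≤-trans (n≤1+n _) (≤-reflexive (sym (*-identityˡ _))))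

        loop≤ : ∀ x o u → sumOver (kids u) (λ _ → x) + o ≤ (1 * x + o) * suc (d u)
        loop≤ x o u = sum≤ (1 * x) o (suc (d u)) (≤-trans (≤-reflexive (sumOver-const (kids u) x)) (times≤ x {t = 1} (len≤d u))) (const≤* o (s≤s z≤n))

        scan≤ : ∀ x o u → sumTo (d u + 1) (λ _ → x) + o ≤ (1 * x + o) * suc (d u)
        scan≤ x o u = sum≤ (1 * x) o (suc (d u)) (≤-trans (≤-reflexive (sumTo-const (d u + 1) x)) (times≤ x {t = 1} (≤-reflexive (trans (+-comm (d u) 1) (sym (*-identityˡ _)))))) (const≤* o (s≤s z≤n))

        k≤ : ∀ x u → x ≤ x * suc (d u)
        k≤ x u = const≤* x (s≤s z≤n)

        fill≤ : ∀ u → fillCost u ≤ fillC * suc (d u)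
        fill≤ = loop≤ (costB fillBody + over (var vK)) (over (var vK))

        clear≤ : ∀ u → clearCost u ≤ clearC * suc (d u)
        clear≤ = loop≤ (costB clearBody + over (var vK)) (over (var vK))

        up≤ : ∀ u → upCost u ≤ upC * suc (d u)
        up≤ u = seven≤ (costB up₁) fillC (costB up₂) upScanC (costB up₃) clearC (costB up₄) (suc (d u))
          (k≤ (costB up₁) u) (fill≤ u) (k≤ (costB up₂) u) (scan≤ (costB probe + costB decide + over tryJ) (over tryJ) u) (k≤ (costB up₃) u) (clear≤ u) (k≤ (costB up₄) u)

        vertices≤ : ∀ x o (f : ℕ → ℕ) → (∀ u → f u ≤ x * suc (d u)) → sumTo c (λ i → f (ord i) + o) + o ≤ ((x + o) * 4 + o) * n
        vertices≤ x o f h = sum≤ ((x + o) * 4) o n (≤-trans (sumTo-mono c λ i _ → sum≤ x o (suc (d (ord i))) (h (ord i)) (k≤ o (ord i)))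
            (≤-trans (≤-reflexive (sumTo-* c (x + o) (λ i → suc (d (ord i))))) (≤-trans (*-monoʳ-≤ (x + o) all≤) (≤-reflexive (sym (*-assoc (x + o) 4 n))))))
          (const≤* o 1≤n)
          where
          all≤ : sumTo c (λ i → suc (d (ord i))) ≤ 4 * n
          all≤ = ≤-trans (≤-reflexive (trans (sumTo-+ c (λ _ → 1) (λ i → d (ord i))) (cong (_+ sumTo c (λ i → d (ord i))) (trans (sumTo-const c 1) (*-identityʳ c)))))
            (≤-trans (+-mono-≤ c≤ degree-sum) (≤-reflexive (trans (+-assoc n n (n + n)) (cong (λ z → n + (n + (n + z))) (sym (+-identityʳ n))))))

        upT′ : ∀ {σ} → UpInv 0 σ → Tri up σ (upAll * n) (UpInv c)
        upT′ inv = weaken (vertices≤ upC (over (lt (var vI) (var vC))) upCost up≤) (λ _ q → q) (upT inv)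

        edge-inj : ∀ {k k′ v v′} → v < n → v′ < n → k ∈ kids v → k′ ∈ kids v′ → pe k ≡ pe k′ → k ≡ k′
        edge-inj {k} {k′} {v} {v′} v<n v′<n k∈ k′∈ e with proj₂ (kid-edge k∈) | proj₂ (kid-edge k′∈)
        ... | inj₁ (a , b) | inj₁ (a′ , b′) = trans (sym a) (trans (cong X e) a′)
        ... | inj₂ (a , b) | inj₂ (a′ , b′) = trans (sym b) (trans (cong Y e) b′)
        ... | inj₁ (a , b) | inj₂ (a′ , b′) = contradiction (rk-kid v′<n k′∈) (<-asym (subst₂ (λ x y → rk x < rk y) (trans (sym a) (trans (cong X e) a′)) (trans (sym b) (trans (cong Y e) b′)) (rk-kid v<n k∈)))
        ... | inj₂ (a , b) | inj₁ (a′ , b′) = contradiction (rk-kid v′<n k′∈) (<-asym (subst₂ (λ x y → rk x < rk y) (trans (sym b) (trans (cong Y e) b′)) (trans (sym a) (trans (cong X e) a′)) (rk-kid v<n k∈)))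

        module Down (A B Z : ℕ → ℕ) (lowA : ∀ k → A k < st) (lowB : ∀ k → B k < st) (lowZ : ∀ k → Z k < st)
                    (specs : ∀ {v} → v < n → Spec A B Z v) where

          open Solve A B Z

          record Kid (s : ℕ) (opt forb io : ℕ → ℕ) (k : ℕ) : Set where
            field
              bit   : opt k ≤ 1
              not1  : code (opt k) k ≢ 1
              notS  : code (opt k) k ≢ s
              forb≡ : forb k ≡ same k * s
              io≡   : io (1 + pe k) ≡ opt k

          record AInv (u s q₀ : ℕ) (σ : St) (rem : List ℕ) (σ′ : St) : Set where
            field
              link  : Linked next (vr σ′ vK) rem
              pre   : List ℕ
              pre⊆  : ∀ {k} → k ∈ pre → k ∈ kids u
              rem⊆  : ∀ {k} → k ∈ rem → k ∈ kids u
              cases : ∀ {k} → k ∈ kids u → k ∈ pre ⊎ k ∈ rem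
              apart : ∀ {k} → k ∈ pre → k ∉ rem
              uniq  : Unique rem
              sums  : ∀ f → sumOver (kids u) f ≡ sumOver pre f + sumOver rem f
              total : sumOver pre (ar σ′ Opt) + (sumOver rem (clash A s) + vr σ′ vBQ) ≡ sumOver (kids u) (clash A s) + q₀
              space : vr σ′ vBQ + sumOver rem (λ k → clash A s k + clash B s k) ≤ length rem
              good  : ∀ {k} → k ∈ pre → Kid s (ar σ′ Opt) (ar σ′ Forb) (ar σ′ IO) k
              opt≡  : ∀ {k} → k ∉ pre → ar σ′ Opt k ≡ ar σ Opt k
              forb≡ : ∀ {k} → k ∉ pre → ar σ′ Forb k ≡ ar σ Forb k
              IO≡   : ∀ {j} → (∀ {k} → k ∈ pre → 1 + pe k ≢ j) → ar σ′ IO j ≡ ar σ IO j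

          record Moved (s k o q′ : ℕ) (σ′ σ″ : St) : Set where
            field
              link≡  : vr σ″ vK ≡ next k
              quota≡ : vr σ″ vBQ ≡ q′
              opt′   : ∀ j → ar σ″ Opt j ≡ upd (ar σ′ Opt) k o j
              forb′  : ∀ j → ar σ″ Forb j ≡ upd (ar σ′ Forb) k (same k * s) j
              io′    : ∀ j → ar σ″ IO j ≡ upd (ar σ′ IO) (1 + pe k) o j

          module Assign (u : ℕ) (u<n : u < n) (s q₀ : ℕ) (2≤s : 2 ≤ s) (s<st : s < st)
                        (nz : ∀ {k} → k ∈ kids u → clash Z s k ≡ 0) where

            either : ∀ {k} → k ∈ kids u → clash A s k ≡ 0 ⊎ clash B s k ≡ 0
            either k∈ = clash-either (specs (kid<n k∈)) (2≤⇒≢0 2≤s) (nz k∈)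

            both≤1 : ∀ {k} → k ∈ kids u → clash A s k + clash B s k ≤ 1
            both≤1 {k} k∈ = one-zero (clash≤1 A k (2≤⇒≢1 2≤s)) (clash≤1 B k (2≤⇒≢1 2≤s)) (either k∈)

            bit-of quota-of : ℕ → ℕ → ℕ
            bit-of   k q = choose (clash A s k) 1 (choose (clash B s k) 0 (ltn 0 q))
            quota-of k q = choose (clash A s k) q (choose (clash B s k) q (q ∸ 1))

            allow : ∀ o k → o ≤ 1 → (o ≡ 0 → clash A s k ≡ 0) → (o ≡ 1 → clash B s k ≡ 0) → code o k ≢ 1 × code o k ≢ s
            allow _ k z≤n       l h = clash-0 A s (l refl)
            allow _ k (s≤s z≤n) l h = clash-0 B s (h refl)

            module _ {σ : St} (k : ℕ) (rem : List ℕ) (σ′ σ″ : St) (inv : AInv u s q₀ σ (k ∷ rem) σ′)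
                     (mv : Moved s k (bit-of k (vr σ′ vBQ)) (quota-of k (vr σ′ vBQ)) σ′ σ″) where
              open AInv inv
              open Moved mv
              private
                q o q′ : ℕ
                q  = vr σ′ vBQ
                o  = bit-of k q
                q′ = quota-of k q
                k∈ks : k ∈ kids u
                k∈ks = rem⊆ (here refl)
                k∉rem : k ∉ rem
                k∉rem = head∉ uniq
                pre≢k : ∀ {j} → j ∈ pre → j ≢ k
                pre≢k p refl = apart p (here refl)
                as : Assigned (clash A s k) (clash B s k) q (sumOver rem (λ k → clash A s k + clash B s k)) (length rem) o q′
                as = assigned (clash≤1 A k (2≤⇒≢1 2≤s)) (clash≤1 B k (2≤⇒≢1 2≤s)) (either k∈ks)
                       (sumOver-length rem λ k∈ → both≤1 (rem⊆ (there k∈))) space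
                opt-k : ar σ″ Opt k ≡ o
                opt-k = trans (opt′ k) (upd-same (ar σ′ Opt) k o)
                opt-j : ∀ {j} → j ≢ k → ar σ″ Opt j ≡ ar σ′ Opt j
                opt-j ne = trans (opt′ _) (upd-off (ar σ′ Opt) (ne ∘ sym))
                forb-j : ∀ {j} → j ≢ k → ar σ″ Forb j ≡ ar σ′ Forb j
                forb-j ne = trans (forb′ _) (upd-off (ar σ′ Forb) (ne ∘ sym))
                al : code o k ≢ 1 × code o k ≢ s
                al = allow o k (Assigned.bit as) (Assigned.light as) (Assigned.heavier as)
                pre-good : ∀ {j} → j ∈ pre → Kid s (ar σ″ Opt) (ar σ″ Forb) (ar σ″ IO) j
                pre-good {j} p = record
                  { bit = subst (_≤ 1) (sym o≡) (Kid.bit g)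
                  ; not1 = λ e → Kid.not1 g (trans (cong (λ z → code z j) (sym o≡)) e)
                  ; notS = λ e → Kid.notS g (trans (cong (λ z → code z j) (sym o≡)) e)
                  ; forb≡ = trans (forb-j (pre≢k p)) (Kid.forb≡ g)
                  ; io≡ = trans (io′ _) (trans (upd-off (ar σ′ IO) (λ e → pre≢k p (sym (edge-inj u<n u<n k∈ks (pre⊆ p) (suc-injective e)))))
                            (trans (Kid.io≡ g) (sym o≡))) }
                  where g = good p
                        o≡ = opt-j (pre≢k p)
                own : Kid s (ar σ″ Opt) (ar σ″ Forb) (ar σ″ IO) k
                own = record
                  { bit = subst (_≤ 1) (sym opt-k) (Assigned.bit as)
                  ; not1 = λ e → proj₁ al (trans (cong (λ z → code z k) (sym opt-k)) e)
                  ; notS = λ e → proj₂ al (trans (cong (λ z → code z k) (sym opt-k)) e)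
                  ; forb≡ = trans (forb′ k) (upd-same (ar σ′ Forb) k _)
                  ; io≡ = trans (io′ _) (trans (upd-same (ar σ′ IO) (1 + pe k) o) (sym opt-k)) }
                total′ : sumOver (k ∷ pre) (ar σ″ Opt) + (sumOver rem (clash A s) + vr σ″ vBQ) ≡ sumOver (kids u) (clash A s) + q₀
                total′ = begin
                  ar σ″ Opt k + sumOver pre (ar σ″ Opt) + (c₁ + vr σ″ vBQ)
                    ≡⟨ cong₂ _+_ (cong₂ _+_ opt-k (sumOver-cong pre λ p → opt-j (pre≢k p))) (cong (c₁ +_) quota≡) ⟩
                  o + p₁ + (c₁ + q′) ≡⟨ cong (_+ (c₁ + q′)) (+-comm o p₁) ⟩
                  p₁ + o + (c₁ + q′) ≡⟨ +-assoc p₁ o _ ⟩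
                  p₁ + (o + (c₁ + q′)) ≡⟨ cong (p₁ +_) (trans (cong (o +_) (+-comm c₁ q′)) (trans (sym (+-assoc o q′ c₁)) (cong (_+ c₁) (Assigned.balance as)))) ⟩
                  p₁ + (clash A s k + q + c₁) ≡⟨ cong (p₁ +_) (+-swapʳ (clash A s k) q c₁) ⟩
                  p₁ + (clash A s k + c₁ + q) ≡⟨ total ⟩
                  sumOver (kids u) (clash A s) + q₀ ∎
                  where open ≡-Reasoning
                        p₁ = sumOver pre (ar σ′ Opt)
                        c₁ = sumOver rem (clash A s)
                good′ : ∀ {j} → j ∈ k ∷ pre → Kid s (ar σ″ Opt) (ar σ″ Forb) (ar σ″ IO) j
                good′ (here refl) = own
                good′ (there p)   = pre-good p
                opt≡′ : ∀ {j} → j ∉ k ∷ pre → ar σ″ Opt j ≡ ar σ Opt j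
                opt≡′ {j} ∉ = trans (opt-j {j} (λ e → ∉ (here e))) (opt≡ {j} (λ p → ∉ (there p)))
                forb≡′ : ∀ {j} → j ∉ k ∷ pre → ar σ″ Forb j ≡ ar σ Forb j
                forb≡′ {j} ∉ = trans (forb-j {j} (λ e → ∉ (here e))) (forb≡ {j} (λ p → ∉ (there p)))
                IO≡′ : ∀ {j} → (∀ {i} → i ∈ k ∷ pre → 1 + pe i ≢ j) → ar σ″ IO j ≡ ar σ IO j
                IO≡′ {j} h = trans (io′ j) (trans (upd-off (ar σ′ IO) {1 + pe k} {j} {o} (h {k} (here refl))) (IO≡ {j} (λ {i} p → h {i} (there p))))

              move : AInv u s q₀ σ rem σ″
              move = record
                { link = subst (λ h → Linked next h rem) (sym link≡) (proj₂ link)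
                ; pre = k ∷ pre
                ; pre⊆ = ∈-∷ k∈ks pre⊆
                ; rem⊆ = rem⊆ ∘ there
                ; cases = λ k∈ → move-head (cases k∈)
                ; apart = ∈-∷ k∉rem (λ p → apart p ∘ there)
                ; uniq = uniq-tail uniq
                ; sums = λ f → trans (sums f) (trans (sym (+-assoc (sumOver pre f) (f k) (sumOver rem f))) (cong (_+ sumOver rem f) (+-comm (sumOver pre f) (f k))))
                ; total = total′
                ; space = subst (λ q → q + sumOver rem (λ k → clash A s k + clash B s k) ≤ length rem) (sym quota≡) (Assigned.slack as)
                ; good = good′
                ; opt≡ = opt≡′
                ; forb≡ = forb≡′
                ; IO≡ = IO≡′ }

            module _ (σ : St) (st≡ : Static σ) (a≡ : ∀ k → ar σ aA k ≡ A k) (b≡ : ∀ k → ar σ aB k ≡ B k) (s≡ : vr σ vBS ≡ s) where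
              open Static st≡

              module _ (k : ℕ) (rem : List ℕ) (σ′ : St) (F : Frame (block assignBody) σ σ′) (inv : AInv u s q₀ σ (k ∷ rem) σ′) where
                open AInv inv using (link; rem⊆)
                private
                  k≡ : vr σ′ vK ∸ 1 ≡ k
                  k≡ = cong (_∸ 1) (proj₁ link)
                  k∈ks : k ∈ kids u
                  k∈ks = rem⊆ (here refl)
                  k<st : vr σ′ vK ∸ 1 < st
                  k<st = subst (_< st) (sym k≡) (<-trans (kid<n k∈ks) n<st)
                  1<st : 1 < st
                  1<st = const≤ (s≤s (s≤s z≤n))
                  bits< : ∀ a → eqn a 1 + eqn a (vr σ′ vBS) < M
                  bits< a = fits (sum₂ (≤-trans (b2n≤1 (a ≡ᵇ 1)) (<⇒≤ 1<st)) (≤-trans (b2n≤1 (a ≡ᵇ vr σ′ vBS)) (<⇒≤ 1<st)))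
                  bs : vr σ′ vBS ≡ s
                  bs = trans (keepV F vBS) s≡
                  same′ : ar σ′ Same (vr σ′ vK ∸ 1) ≡ same k
                  same′ = trans (keepA F Same _) (trans (same≡ _) (cong same k≡))
                  pe≡′ : ar σ′ Pe (vr σ′ vK ∸ 1) ≡ pe k
                  pe≡′ = trans (keepA F Pe _) (trans (pe≡ _) (cong pe k≡))
                  pe<st : suc (ar σ′ Pe (vr σ′ vK ∸ 1)) < st
                  pe<st = subst (λ z → suc z < st) (sym pe≡′) (≤-<-trans (<-≤-trans (proj₁ (kid-edge k∈ks)) m≤n) n<st)
                  q : ℕ
                  q = vr σ′ vBQ
                  fa≡ : eqn (ar σ′ aA (vr σ′ vK ∸ 1)) 1 + eqn (ar σ′ aA (vr σ′ vK ∸ 1)) (vr σ′ vBS) ≡ clash A s k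
                  fa≡ = cong₂ (λ a s → eqn a 1 + eqn a s) (trans (keepA F aA _) (trans (a≡ _) (cong A k≡))) bs
                  fb≡ : eqn (ar σ′ aB (vr σ′ vK ∸ 1)) 1 + eqn (ar σ′ aB (vr σ′ vK ∸ 1)) (vr σ′ vBS) ≡ clash B s k
                  fb≡ = cong₂ (λ a s → eqn a 1 + eqn a s) (trans (keepA F aB _) (trans (b≡ _) (cong B k≡))) bs
                  o≡ : chosenBit σ′ ≡ bit-of k q
                  o≡ = cong₂ (λ a b → choose a 1 (choose b 0 (ltn 0 q))) fa≡ fb≡
                  safe : OkB assignBody σ′ ⊤
                  safe = k<st , k<st , bits< (ar σ′ aA (vr σ′ vK ∸ 1)) , k<st , k<st , bits< (ar σ′ aB (vr σ′ vK ∸ 1)) , k<st , k<st , k<st ,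
                         fitsˣ (≤-<-trans (subst (_≤ 1) (sym same′) (same≤1 k)) 1<st) (subst (_< st) (sym bs) s<st) ,
                         k<st , fits (≤-trans (<⇒≤ pe<st) (m≤n*m st 32)) , pe<st , k<st , tt
                  moved : ∀ σ″ → AssignRun σ′ σ″ → Moved s k (bit-of k q) (quota-of k q) σ′ σ″
                  moved σ″ ran = record
                    { link≡ = trans (AssignRun.k″ ran) (trans (keepA F Next _) (trans (next≡ _) (cong next k≡)))
                    ; quota≡ = trans (AssignRun.q″ ran) (cong₂ (λ a b → choose a q (choose b q (q ∸ 1))) fa≡ fb≡)
                    ; opt′ = λ j → trans (AssignRun.opt″ ran j) (cong₂ (λ a b → upd (ar σ′ Opt) a b j) k≡ o≡)
                    ; forb′ = λ j → trans (AssignRun.forb″ ran j) (cong₂ (λ a b → upd (ar σ′ Forb) a b j) k≡ (cong₂ _*_ same′ bs))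
                    ; io′ = λ j → trans (AssignRun.io″ ran j) (cong₂ (λ a b → upd (ar σ′ IO) (1 + a) b j) pe≡′ o≡) }

                bd : Iter (var vK) (block assignBody) σ′ (costB assignBody) (AInv u s q₀ σ rem)
                bd = iter tt (λ e → suc≢0 (trans (sym (proj₁ link)) e)) (triB {Q = AInv u s q₀ σ rem} safe (move k rem σ′ (run assignBody σ′) inv (moved (run assignBody σ′) (assign-run σ′))))

              assignT : Linked next (vr σ vK) (kids u) → vr σ vBQ ≡ q₀ → q₀ + sumOver (kids u) (λ k → clash A s k + clash B s k) ≤ length (kids u) →
                Tri assign σ (sumOver (kids u) (λ _ → costB assignBody + overhead (var vK)) + overhead (var vK)) (AInv u s q₀ σ [])
              assignT l q≡ sp = listLoop (λ _ → costB assignBody) (AInv u s q₀ σ) (λ k rem σ′ F inv → bd k rem σ′ F inv) (λ σ′ _ inv → exit tt (AInv.link inv)) (kids u) σ frame-refl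
                record { link = l ; pre = [] ; pre⊆ = λ () ; rem⊆ = λ z → z ; cases = inj₂ ; apart = λ () ; uniq = unique u ; sums = λ f → refl
                       ; total = cong (sumOver (kids u) (clash A s) +_) q≡ ; space = subst (λ z → z + _ ≤ length (kids u)) (sym q≡) sp
                       ; good = λ () ; opt≡ = λ _ → refl ; forb≡ = λ _ → refl ; IO≡ = λ _ → refl }

          record DownInv (i : ℕ) (σ : St) : Set where
            field
              static : Static σ
              i≡     : vr σ vI ≡ i
              a≡     : ∀ k → ar σ aA k ≡ A k
              b≡     : ∀ k → ar σ aB k ≡ B k
              z≡     : ∀ k → ar σ aZ k ≡ Z k
              zeroA  : ∀ x → ar σ TA x ≡ 0
              zeroB  : ∀ x → ar σ TB x ≡ 0
              zeroZ  : ∀ x → ar σ TZ x ≡ 0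
              bits   : ∀ v → ar σ Opt v ≤ 1
              ready  : ∀ {v} → v < n → rk v < i → hp v ≡ 0 ⊎ i ≤ rk (par v) →
                       ∃[ J ] J ≤ d v × feas A B Z v (ar σ Opt v) J ≢ 0 × κ v J ≢ ar σ Forb v
              apart  : ∀ {v} → v < n → i ≤ rk v → κ v (heavy (ar σ Opt) v) ≢ ar σ Forb v
              told   : ∀ {v} → v < n → i ≤ rk v → ∀ {k} → k ∈ kids v →
                       ar σ Forb k ≡ same k * κ v (heavy (ar σ Opt) v) × ar σ IO (1 + pe k) ≡ ar σ Opt k

          downScanCost assignCost downCost : ℕ → ℕ
          downScanCost d = sumTo (d + 1) (λ _ → costB probe + costB choice + overhead tryJ) + overhead tryJ
          assignCost u = sumOver (kids u) (λ _ → costB assignBody + overhead (var vK)) + overhead (var vK)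
          downCost u = costB down₁ + (fillCost u + (costB down₂ + (downScanCost (d u) + (costB up₃ + (clearCost u + (costB up₃ + assignCost u))))))

          module Step (i : ℕ) (i<c : i < c) (σ : St) (inv : DownInv (suc i) σ) where
            open DownInv inv
            open Static static

            u : ℕ
            u = ord i
            ks : List ℕ
            ks = kids u
            opt forb : ℕ → ℕ
            opt  = ar σ Opt
            forb = ar σ Forb
            u<n : u < n
            u<n = ord<n i<c
            u<st : u < st
            u<st = <-trans u<n n<st
            rk-u : rk u ≡ i
            rk-u = rk-ord i<c

            u∉ : ∀ {k} → k ∈ ks → k ≢ u
            u∉ k∈ refl = <-irrefl refl (rk-kid u<n k∈)

            finish : ∀ J (J≤d : J ≤ d u) → feas A B Z u (opt u) J ≢ 0 → κ u J ≢ forb u → ∀ σ₇ σ₈ →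
              (∀ x → ar σ₇ Opt x ≡ opt x) → (∀ x → ar σ₇ Forb x ≡ forb x) → (∀ x → ar σ₇ IO x ≡ ar σ IO x) →
              AInv u (κ u J) (J ∸ (num A u (κ u J) + hp u * opt u)) σ₇ [] σ₈ →
              vr σ₈ vI ≡ i → Static σ₈ → (∀ k → ar σ₈ aA k ≡ A k) → (∀ k → ar σ₈ aB k ≡ B k) → (∀ k → ar σ₈ aZ k ≡ Z k) →
              (∀ x → ar σ₈ TA x ≡ 0) → (∀ x → ar σ₈ TB x ≡ 0) → (∀ x → ar σ₈ TZ x ≡ 0) → DownInv i σ₈
            finish J J≤d f κ≢ σ₇ σ₈ opt₇ forb₇ io₇ as i₈ static₈ a₈ b₈ z₈ zA zB zZ = record
              { static = static₈ ; i≡ = i₈ ; a≡ = a₈ ; b≡ = b₈ ; z≡ = z₈ ; zeroA = zA ; zeroB = zB ; zeroZ = zZ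
              ; bits = λ v → by-cases v ks (Kid.bit ∘ kid) (λ v∉ → subst (_≤ 1) (sym (opt-off v∉)) (bits v))
              ; ready = λ {v} v<n l h → by-cases v ks (ready-kid v<n) (λ v∉ → ready-old v<n l h v∉)
              ; apart = λ {v} v<n l → by-equality v u
                  (λ { refl → λ e → κ≢ (trans (sym (cong (κ u) heavy-u)) (trans e (forb-off u∉ks))) })
                  (λ v≢u e → apart v<n (later v<n l v≢u) (trans (cong (κ v) (sym (heavy-off v<n l v≢u))) (trans e (forb-off (not-kid v<n l)))))
              ; told = λ {v} v<n l {k} k∈ → by-equality v u
                  (λ { refl → trans (Kid.forb≡ (kid k∈)) (cong (λ z → same k * κ u z) (sym heavy-u)) , Kid.io≡ (kid k∈) })
                  (λ v≢u → let k∉ = foreign v≢u k∈ ; t = told v<n (later v<n l v≢u) k∈ in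
                     trans (forb-off k∉) (trans (proj₁ t) (cong (λ z → same k * κ v z) (sym (heavy-off v<n l v≢u))))
                   , trans (io-off v<n v≢u k∈) (trans (proj₂ t) (sym (opt-off k∉)))) }
              where
              open AInv as using (pre; pre⊆; cases; sums; total; space; good)
              s = κ u J
              q₀ = J ∸ (num A u s + hp u * opt u)
              opt″ forb″ : ℕ → ℕ
              opt″  = ar σ₈ Opt
              forb″ = ar σ₈ Forb
              kid : ∀ {k} → k ∈ ks → Kid s opt″ forb″ (ar σ₈ IO) k
              kid k∈ = case cases k∈ of λ { (inj₁ p) → good p ; (inj₂ ()) }
              opt-off : ∀ {k} → k ∉ ks → opt″ k ≡ opt k
              opt-off k∉ = trans (AInv.opt≡ as (k∉ ∘ pre⊆)) (opt₇ _)
              forb-off : ∀ {k} → k ∉ ks → forb″ k ≡ forb k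
              forb-off k∉ = trans (AInv.forb≡ as (k∉ ∘ pre⊆)) (forb₇ _)
              foreign : ∀ {v k} → v ≢ u → k ∈ kids v → k ∉ ks
              foreign v≢u k∈ k∈′ = v≢u (trans (sym (kid-par k∈)) (kid-par k∈′))
              io-off : ∀ {v k} → v < n → v ≢ u → k ∈ kids v → ar σ₈ IO (1 + pe k) ≡ ar σ IO (1 + pe k)
              io-off v<n v≢u k∈ = trans (AInv.IO≡ as λ p e → foreign v≢u k∈ (subst (_∈ ks) (edge-inj u<n v<n (pre⊆ p) k∈ (suc-injective e)) (pre⊆ p))) (io₇ _)
              not-kid : ∀ {v} → v < n → i ≤ rk v → v ∉ ks
              not-kid v<n l v∈ = <⇒≱ (<-≤-trans (rk-kid u<n v∈) (≤-reflexive rk-u)) l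
              u∉ks : u ∉ ks
              u∉ks u∈ = u∉ u∈ refl
              same-rank : ∀ {v} → v < n → rk v ≡ i → v ≡ u
              same-rank v<n e = trans (sym (proj₂ (ord-rk v<n))) (cong ord e)
              later : ∀ {v} → v < n → i ≤ rk v → v ≢ u → suc i ≤ rk v
              later v<n l v≢u = ≤∧≢⇒< l λ e → v≢u (same-rank v<n (sym e))
              heavy-off : ∀ {v} → v < n → i ≤ rk v → v ≢ u → heavy opt″ v ≡ heavy opt v
              heavy-off {v} v<n l v≢u = cong₂ _+_ (sumOver-cong (kids v) λ k∈ → opt-off (foreign v≢u k∈)) (cong (hp v *_) (opt-off (not-kid v<n l)))
              fs : num Z u s ≡ 0 × num A u s + hp u * opt u ≤ J × num B u s + hp u * (1 ∸ opt u) + J ≤ d u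
              fs = feasible-≢0 {num A u s} {num B u s} {num Z u s} {hp u} {d u} {opt u} f
              heavy-u : heavy opt″ u ≡ J
              heavy-u = begin
                sumOver ks opt″ + hp u * opt″ u                       ≡⟨ cong₂ _+_ (trans (sums opt″) (+-identityʳ _)) (cong (hp u *_) (opt-off u∉ks)) ⟩
                sumOver pre opt″ + hp u * opt u                       ≡⟨ cong (_+ hp u * opt u) (trans (sym (+-identityʳ _)) (cong (sumOver pre opt″ +_) (sym q-end))) ⟩
                sumOver pre opt″ + vr σ₈ vBQ + hp u * opt u           ≡⟨ cong (_+ hp u * opt u) total ⟩
                sumOver ks (clash A s) + q₀ + hp u * opt u            ≡⟨ cong (λ z → z + q₀ + hp u * opt u) (sym (cnt-clash A s ks)) ⟩
                num A u s + q₀ + hp u * opt u                         ≡⟨ +-swapʳ (num A u s) q₀ (hp u * opt u) ⟩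
                num A u s + hp u * opt u + q₀                         ≡⟨ m+[n∸m]≡n (proj₁ (proj₂ fs)) ⟩
                J                                                     ∎
                where open ≡-Reasoning
                      q-end : vr σ₈ vBQ ≡ 0
                      q-end = n≤0⇒n≡0 (≤-trans (m≤m+n _ 0) space)
              ready-kid : ∀ {v} → v < n → v ∈ ks → ∃[ J ] J ≤ d v × feas A B Z v (opt″ v) J ≢ 0 × κ v J ≢ forb″ v
              ready-kid {v} v<n v∈ = let k = kid v∈
                                         J′ , J′≤ , f′ , ζ≢ = pick (Kid.bit k) (specs v<n) (2≤⇒≢0 (2≤κ u J)) (Kid.not1 k) (Kid.notS k)
                in J′ , J′≤ , f′ , λ e → separate (same≤1 v) (2≤⇒≢0 (2≤κ v J′)) ζ≢ (trans e (Kid.forb≡ k))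
              ready-old : ∀ {v} → v < n → rk v < i → hp v ≡ 0 ⊎ i ≤ rk (par v) → v ∉ ks → ∃[ J ] J ≤ d v × feas A B Z v (opt″ v) J ≢ 0 × κ v J ≢ forb″ v
              ready-old {v} v<n l h v∉ = subst₂ (λ a b → ∃[ J ] J ≤ d v × feas A B Z v a J ≢ 0 × κ v J ≢ b) (sym (opt-off v∉)) (sym (forb-off v∉))
                (ready v<n (m<n⇒m<1+n l) (by-equality (hp v) 0 inj₁ λ hp≢0 → case h of λ
                  { (inj₁ e) → contradiction e hp≢0
                  ; (inj₂ i≤) → inj₂ (≤∧≢⇒< i≤ λ e → v∉ (subst (λ z → v ∈ kids z) (same-rank (proj₂ (parent v<n hp≢0)) (sym e)) (proj₁ (parent v<n hp≢0)))) }))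

            link : ∀ σ₁ → (∀ x → ar σ₁ Next x ≡ ar σ Next x) → vr σ₁ vK ≡ head u → Linked (ar σ₁ Next) (vr σ₁ vK) ks
            link σ₁ e k = subst (λ h → Linked (ar σ₁ Next) h ks) (sym k) (Linked-cong (λ x → sym (trans (e x) (next≡ x))) ks (linked u))

            small : ∀ {A′ B′ Z′ : ℕ → ℕ} → (∀ x → A′ x ≡ A x) → (∀ x → B′ x ≡ B x) → (∀ x → Z′ x ≡ Z x) → Small A′ B′ Z′ ks
            small a b z = small-kids u (λ k → subst (_< st) (sym (a k)) (lowA k)) (λ k → subst (_< st) (sym (b k)) (lowB k)) (λ k → subst (_< st) (sym (z k)) (lowZ k))

            down-static : ∀ {σ′} → Frame downBody σ σ′ → Static σ′
            down-static F = static-frame F (λ F → keepV F vN , keepV F vC , keepA F D₀ , keepA F Hp , keepA F Same , keepA F Head , keepA F Next , keepA F Ord , keepA F Pe) static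

            Picked : St → ℕ → Set
            Picked σ′ J = J ≤ d u × feas A B Z u (opt u) J ≢ 0 × κ u J ≢ forb u × vr σ′ vBS ≡ κ u J × vr σ′ vBQ ≡ J ∸ (num A u (κ u J) + hp u * opt u)

            scanT : ∀ σ₃ → vr σ₃ vD ≡ d u → vr σ₃ vH ≡ hp u → vr σ₃ vN ≡ n → vr σ₃ vJ ≡ 0 → vr σ₃ vO ≡ opt u → vr σ₃ vForb ≡ forb u →
              (∀ x → ar σ₃ TA x ≡ cnt A ks x) → (∀ x → ar σ₃ TB x ≡ cnt B ks x) → (∀ x → ar σ₃ TZ x ≡ cnt Z ks x) →
              (∃[ J ] J ≤ d u × feas A B Z u (opt u) J ≢ 0 × κ u J ≢ forb u) →
              Tri downScan σ₃ (downScanCost (d u)) (λ σ₄ → ∃[ J ] Picked σ₄ J)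
            scanT σ₃ vd vh vn vj vo vf tA tB tZ (J , J≤ , f , κ≢) = weaken (≤-reflexive (cong downScanCost vd))
              (λ _ (I , I≤ , (g , ne) , bs , bq) → I , subst (I ≤_) vd I≤ , (λ e → g (trans (feas-o I) e)) , (λ e → ne (trans (K≡ I) (trans e (sym vf))))
                , trans bs (K≡ I) , trans bq (cong₂ (λ a b → I ∸ (a + b)) (totA I) (cong₂ _*_ vh vo)))
              (Scan.downScanT σ₃ pre vj (subst (_≤ 1) (sym vo) (bits u))
                (J , subst (J ≤_) (sym vd) J≤ , (λ e → f (trans (sym (feas-o J)) e)) , λ e → κ≢ (trans (sym (K≡ J)) (trans e vf))))
              where
              pre = scanPre σ₃ u A B Z vd vh vn tA tB tZ
              K≡ = K≡κ σ₃ u A B Z vd vh vn tA tB tZ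
              totA : ∀ I → Scan.tot σ₃ pre TA I ≡ num A u (κ u I)
              totA = tot≡ σ₃ u A B Z vd vh vn tA tB tZ A tA
              feas-o : ∀ I → Scan.feasS σ₃ pre (vr σ₃ vO) I ≡ feas A B Z u (opt u) I
              feas-o I = trans (feasS≡ σ₃ u A B Z vd vh vn tA tB tZ (vr σ₃ vO) I) (cong (λ o → feas A B Z u o I) vo)

            assignStep : ∀ J σ₇ → Static σ₇ → (∀ k → ar σ₇ aA k ≡ A k) → (∀ k → ar σ₇ aB k ≡ B k) → Picked σ₇ J → Linked (ar σ₇ Next) (vr σ₇ vK) ks →
              Tri assign σ₇ (assignCost u) (AInv u (κ u J) (J ∸ (num A u (κ u J) + hp u * opt u)) σ₇ [])
            assignStep J σ₇ st₇ a₇ b₇ (J≤ , f , _ , bs , bq) l = Assign.assignT u u<n s _ (2≤κ u J) (κ<st J≤)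
                (λ k∈ → sumOver-≡0 ks (trans (sym (cnt-clash Z s ks)) (proj₁ fs)) k∈) σ₇ st₇ a₇ b₇ bs
                (Linked-cong (Static.next≡ st₇) ks l) bq
                (subst (λ z → J ∸ (num A u s + hp u * opt u) + z ≤ length ks) (trans (cong₂ _+_ (cnt-clash A s ks) (cnt-clash B s ks)) (sym (sumOver-+ ks (clash A s) (clash B s))))
                  (room-left (length ks) (bits u) (proj₁ (proj₂ fs)) (proj₂ (proj₂ fs)) (degree u)))
              where
              s = κ u J
              fs : num Z u s ≡ 0 × num A u s + hp u * opt u ≤ J × num B u s + hp u * (1 ∸ opt u) + J ≤ d u
              fs = feasible-≢0 {num A u s} {num B u s} {num Z u s} {hp u} {d u} {opt u} f

            ready-u : ∃[ J ] J ≤ d u × feas A B Z u (opt u) J ≢ 0 × κ u J ≢ forb u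
            ready-u = ready u<n (s≤s (≤-reflexive rk-u)) (by-equality (hp u) 0 inj₁ λ h → inj₂ (≤-trans (≤-reflexive (cong suc (sym rk-u))) (rk-kid (proj₂ (parent u<n h)) (proj₁ (parent u<n h)))))

            downStep : Tri downBody σ (downCost u) (DownInv i)
            downStep = weaken ≤-refl (λ F q → q F)
              ( triB {Q = λ σ₁ → vr σ₁ vI ≡ i × vr σ₁ vU ≡ u × vr σ₁ vK ≡ head u}
                  (subst (_< st) (sym i₀) (i<st i<c) , subst (_< st) (sym u₀) u<st , tt) (i₀ , u₀ , trans (head≡ _) (cong head u₀))
              thenT λ σ₁ F₁ (i₁ , u₁ , k₁) →
                fillT σ₁ ks (small (λ x → trans (keepA F₁ aA x) (a≡ x)) (λ x → trans (keepA F₁ aB x) (b≡ x)) (λ x → trans (keepA F₁ aZ x) (z≡ x))) (link σ₁ (keepA F₁ Next) k₁)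
                  (λ x → trans (keepA F₁ TA x) (zeroA x)) (λ x → trans (keepA F₁ TB x) (zeroB x)) (λ x → trans (keepA F₁ TZ x) (zeroZ x))
              thenT λ σ₂ F₂ (tA , tB , tZ) → let G₂ = frame-seq F₁ F₂ ; u₂ = trans (keepV F₂ vU) u₁ ; u₂<st = subst (_< st) (sym u₂) u<st in
                triB {Q = λ σ₃ → vr σ₃ vD ≡ d u × vr σ₃ vH ≡ hp u × vr σ₃ vJ ≡ 0 × vr σ₃ vO ≡ opt u × vr σ₃ vForb ≡ forb u}
                  (u₂<st , u₂<st , u₂<st , u₂<st , tt)
                  ( trans (keepA G₂ D₀ _) (trans (d≡ _) (cong d u₂)) , trans (keepA G₂ Hp _) (trans (hp≡ _) (cong hp u₂)) , refl
                  , trans (keepA G₂ Opt _) (cong opt u₂) , trans (keepA G₂ Forb _) (cong forb u₂) )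
              thenT λ σ₃ F₃ (vd , vh , vj , vo , vf) → let
                  G₃ = frame-seq G₂ F₃
                  tA₃ = λ x → trans (keepA F₃ TA x) (trans (tA x) (cnt-cong ks x λ k → trans (keepA F₁ aA k) (a≡ k)))
                  tB₃ = λ x → trans (keepA F₃ TB x) (trans (tB x) (cnt-cong ks x λ k → trans (keepA F₁ aB k) (b≡ k)))
                  tZ₃ = λ x → trans (keepA F₃ TZ x) (trans (tZ x) (cnt-cong ks x λ k → trans (keepA F₁ aZ k) (z≡ k)))
                in scanT σ₃ vd vh (trans (keepV G₃ vN) n≡) vj vo vf tA₃ tB₃ tZ₃ ready-u
              thenT λ σ₄ F₄ (J , pk) → let G₄ = frame-seq G₃ F₄ ; u₄ = trans (keepV F₄ vU) (trans (keepV F₃ vU) u₂) in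
                triB {Q = λ σ₅ → vr σ₅ vK ≡ head u} (subst (_< st) (sym u₄) u<st , tt) (trans (keepA G₄ Head _) (trans (head≡ _) (cong head u₄)))
              thenT λ σ₅ F₅ k₅ → let G₅ = frame-seq G₄ F₅ ; H = frame-seq F₃ (frame-seq F₄ F₅) ; H₁ = frame-seq F₂ H in
                clearT σ₅ ks (small (λ x → trans (keepA G₅ aA x) (a≡ x)) (λ x → trans (keepA G₅ aB x) (b≡ x)) (λ x → trans (keepA G₅ aZ x) (z≡ x))) (link σ₅ (keepA G₅ Next) k₅)
                  (λ x → trans (keepA H TA x) (trans (tA x) (cnt-cong ks x λ k → sym (keepA H₁ aA k))))
                  (λ x → trans (keepA H TB x) (trans (tB x) (cnt-cong ks x λ k → sym (keepA H₁ aB k))))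
                  (λ x → trans (keepA H TZ x) (trans (tZ x) (cnt-cong ks x λ k → sym (keepA H₁ aZ k))))
              thenT λ σ₆ F₆ (zA , zB , zZ) → let G₆ = frame-seq G₅ F₆ ; u₆ = trans (keepV F₆ vU) (trans (keepV F₅ vU) u₄) in
                triB {Q = λ σ₇ → vr σ₇ vK ≡ head u} (subst (_< st) (sym u₆) u<st , tt) (trans (keepA G₆ Head _) (trans (head≡ _) (cong head u₆)))
              thenT λ σ₇ F₇ k₇ → let
                  G₇ = frame-seq G₆ F₇
                  H = frame-seq F₅ (frame-seq F₆ F₇)
                  J≤ , f , κ≢ , bs , bq = pk
                  static₇ = static-frame G₇ (λ F → keepV F vN , keepV F vC , keepA F D₀ , keepA F Hp , keepA F Same , keepA F Head , keepA F Next , keepA F Ord , keepA F Pe) static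
                in weaken {Q′ = λ σ₈ → Frame downBody σ σ₈ → DownInv i σ₈} ≤-refl
                  (λ {σ₈} F₈ as F → finish J J≤ f κ≢ σ₇ σ₈ (keepA G₇ Opt) (keepA G₇ Forb) (keepA G₇ IO) as
                    (trans (keepV F₈ vI) (trans (keepV H vI) (trans (keepV F₄ vI) (trans (keepV F₃ vI) (trans (keepV F₂ vI) i₁)))))
                    (down-static F) (λ k → trans (keepA F aA k) (a≡ k)) (λ k → trans (keepA F aB k) (b≡ k)) (λ k → trans (keepA F aZ k) (z≡ k))
                    (λ x → trans (keepA F₈ TA x) (trans (keepA F₇ TA x) (zA x))) (λ x → trans (keepA F₈ TB x) (trans (keepA F₇ TB x) (zB x))) (λ x → trans (keepA F₈ TZ x) (trans (keepA F₇ TZ x) (zZ x))))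
                  (assignStep J σ₇ static₇ (λ k → trans (keepA G₇ aA k) (a≡ k)) (λ k → trans (keepA G₇ aB k) (b≡ k)) (J≤ , f , κ≢ , trans (keepV H vBS) bs , trans (keepV H vBQ) bq) (link σ₇ (keepA G₇ Next) k₇)) )
              where
              i₀ : vr σ vI ∸ 1 ≡ i
              i₀ = cong (_∸ 1) i≡
              u₀ : ar σ Ord (vr σ vI ∸ 1) ≡ u
              u₀ = trans (ord≡ _) (cong ord i₀)

          downTotal : ℕ → ℕ
          downTotal k = sumOver (downFrom k) (λ i → downCost (ord i) + overhead (lt (con 0) (var vI))) + overhead (lt (con 0) (var vI))

          downT : ∀ k → k ≤ c → ∀ {σ} → DownInv k σ → Tri down σ (downTotal k) (DownInv 0)
          downT zero    k≤c inv = exit-loop (exit tt (cong (ltn 0) (DownInv.i≡ inv))) inv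
          downT (suc k) k≤c {σ} inv = weaken (≤-reflexive (sym (+-assoc (downCost (ord k) + overhead (lt (con 0) (var vI))) _ _))) (λ _ q → q)
            (iterate (iter tt (λ z → contradiction (trans (sym (cong (ltn 0) (DownInv.i≡ inv))) z) λ ()) (Step.downStep k k≤c σ inv)) λ σ′ _ inv′ → downT k (<⇒≤ k≤c) inv′)

          complete : ∀ β → (∀ e → β e ≤ 1) → ProperN β → ∀ {v} → v < n → Z v ≢ 1
          complete β β≤1 pr = Complete.Z≢1 n rk (λ _ → kid<n) rk-kid (λ {v} _ → degree v) specs (β ∘ pe) (λ k → β≤1 (pe k))
            λ {v} {k} _ k∈ e → kid-proper {β} pr k∈ (proper′ v k k∈ (subst₂ (λ a b → ζ k a ≡ κ v b) (sym (count-β β k)) (sym (count-β β v)) e))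
            where
            proper′ : ∀ v k → k ∈ kids v → ζ k (heavyAt β k) ≡ κ v (heavyAt β v) → Clash β k v
            proper′ v k k∈ e = case ≡0⊎≡1 (same≤1 k) of λ
              { (inj₁ s) → contradiction (trans (sym e) (cong (_* κ k (heavyAt β k)) s)) λ ()
              ; (inj₂ s) → kid-clash {β} k∈ s (trans (sym (trans (cong (_* κ k (heavyAt β k)) s) (*-identityˡ _))) e) }

          sound : ∀ {σ} → DownInv 0 σ → (∀ e → e < m → ar σ IO (1 + e) ≤ 1) × ProperN (λ e → ar σ IO (1 + e))
          sound {σ} inv = (λ e l → bit e (cover l)) , λ e l cl → refute e cl (cover l)
            where
            open DownInv inv
            opt β : ℕ → ℕ
            opt = ar σ Opt
            β e = ar σ IO (1 + e)
            bit : ∀ e → (∃[ v ] ∃[ k ] v < n × k ∈ kids v × pe k ≡ e) → β e ≤ 1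
            bit _ (v , k , v< , k∈ , refl) = ≤-trans (≤-reflexive (proj₂ (told v< z≤n k∈))) (bits k)
            own : ∀ v → v < n → hp v * β (pe v) ≡ hp v * opt v
            own v v< = by-equality (hp v) 0 (λ z → trans (cong (_* β (pe v)) z) (sym (cong (_* opt v) z)))
              λ h → cong (hp v *_) (proj₂ (told (proj₂ (parent v< h)) z≤n (proj₁ (parent v< h))))
            heavy≡ : ∀ v → v < n → heavyAt β v ≡ heavy opt v
            heavy≡ v v< = trans (count-β β v) (cong₂ _+_ (sumOver-cong (kids v) λ k∈ → proj₂ (told v< z≤n k∈)) (own v v<))
            apart-kid : ∀ v k → v < n → k ∈ kids v → ¬ Clash β k v
            apart-kid v k v< k∈ cl = let s , e = clash-kid {β} k∈ cl in apart (kid<n k∈) z≤n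
              (trans (cong (κ k) (sym (heavy≡ k (kid<n k∈)))) (trans e (trans (cong (κ v) (heavy≡ v v<))
                (sym (trans (proj₁ (told v< z≤n k∈)) (trans (cong (_* κ v (heavy opt v)) s) (*-identityˡ _)))))))
            refute : ∀ e → Clash β (X e) (Y e) → (∃[ v ] ∃[ k ] v < n × k ∈ kids v × pe k ≡ e) → ⊥
            refute _ cl (v , k , v< , k∈ , refl) = case proj₂ (kid-edge k∈) of λ
              { (inj₁ (a , b)) → apart-kid v k v< k∈ (subst₂ (Clash β) a b cl)
              ; (inj₂ (a , b)) → apart-kid v k v< k∈ (clash-sym {β} (subst₂ (Clash β) a b cl)) }

          start-down : ∀ {σ} → Static σ → vr σ vI ≡ c → (∀ k → ar σ aA k ≡ A k) → (∀ k → ar σ aB k ≡ B k) → (∀ k → ar σ aZ k ≡ Z k) →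
            (∀ x → ar σ TA x ≡ 0) → (∀ x → ar σ TB x ≡ 0) → (∀ x → ar σ TZ x ≡ 0) → (∀ v → ar σ Opt v ≡ 0) → (∀ v → ar σ Forb v ≡ 0) →
            (∀ {v} → v < n → Z v ≢ 1) → DownInv c σ
          start-down {σ} s i≡ a b z ta tb tz o0 f0 Z≢1 = record
            { static = s ; i≡ = i≡ ; a≡ = a ; b≡ = b ; z≡ = z ; zeroA = ta ; zeroB = tb ; zeroZ = tz
            ; bits = λ v → ≤-trans (≤-reflexive (o0 v)) z≤n
            ; ready = λ {v} v< _ h → root v v< (case h of λ
                { (inj₁ h0) → h0
                ; (inj₂ c≤rk) → by-equality (hp v) 0 (λ z → z) λ hp≢0 → contradiction c≤rk (<⇒≱ (proj₁ (ord-rk (proj₂ (parent v< hp≢0))))) })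
            ; apart = λ v< c≤ → contradiction c≤ (<⇒≱ (proj₁ (ord-rk v<)))
            ; told = λ v< c≤ → contradiction c≤ (<⇒≱ (proj₁ (ord-rk v<))) }
            where
            root : ∀ v → v < n → hp v ≡ 0 → ∃[ J ] J ≤ d v × feas A B Z v (ar σ Opt v) J ≢ 0 × κ v J ≢ ar σ Forb v
            root v v< h0 = let o , J , _ , J≤ , f , _ = pickZ {t = suc (Z v)} (specs v<) (λ ()) (Z≢1 v<) (m≢1+m+n (Z v) ∘ λ e → trans e (cong suc (sym (+-identityʳ (Z v))))) in
              J , J≤ , (λ z → f (trans (feas-root o (ar σ Opt v) J) z)) , λ e → contradiction (trans e (f0 v)) λ ()
              where
              feas-root : ∀ o o′ J → feas A B Z v o J ≡ feas A B Z v o′ J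
              feas-root o o′ J = subst (λ h → feasible (num A v (κ v J)) (num B v (κ v J)) (num Z v (κ v J)) h (d v) o J
                ≡ feasible (num A v (κ v J)) (num B v (κ v J)) (num Z v (κ v J)) h (d v) o′ J) (sym h0) refl

          down≤ : ∀ u → downCost u ≤ downC * suc (d u)
          down≤ u = seven≤ (costB down₁) fillC (costB down₂) downScanC (costB up₃) clearC (costB up₃ + assignC) (suc (d u))
            (k≤ (costB down₁) u) (fill≤ u) (k≤ (costB down₂) u) (scan≤ (costB probe + costB choice + over tryJ) (over tryJ) u) (k≤ (costB up₃) u) (clear≤ u)
            (sum≤ (costB up₃) assignC (suc (d u)) (k≤ (costB up₃) u) (loop≤ (costB assignBody + over (var vK)) (over (var vK)) u))

          downT′ : ∀ {σ} → DownInv c σ → Tri down σ (downAll * n) (DownInv 0)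
          downT′ inv = weaken (≤-trans (≤-reflexive (cong (_+ over (lt (con 0) (var vI))) (sumOver-downFrom c _))) (vertices≤ downC (over (lt (con 0) (var vI))) downCost down≤)) (λ _ q → q) (downT c ≤-refl inv)

        skip : ∀ σ → vr σ vI ≡ 0 → Tri down σ (downAll * n) (λ _ → ⊤)
        skip σ i≡ = weaken {Q = λ _ → ⊤} {Q′ = λ _ → ⊤} idle≤ (λ _ _ → tt) (exit-loop (exit tt (cong (ltn 0) i≡)) tt)
          where
          idle≤ : over (lt (con 0) (var vI)) ≤ downAll * n
          idle≤ = ≤-trans (m≤n+m (over (lt (con 0) (var vI))) ((downC + over (lt (con 0) (var vI))) * 4)) (const≤* downAll 1≤n)

        module Finish {σ : St} where
          answerT : UpInv c σ → (∀ v → ar σ Opt v ≡ 0) → (∀ v → ar σ Forb v ≡ 0) →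
            Tri (block prep₅ ⨟ down ⨟ block ((IO ⟦ con 0 ⟧≔ var vAns) ∷ [])) σ (costB prep₅ + (downAll * n + costB ((IO ⟦ con 0 ⟧≔ var vAns) ∷ []))) Answer
          answerT inv o0 f0 = case answer of λ { (inj₁ x) → yes-case x ; (inj₂ y) → no-case y }
            where
            open UpInv inv
            open Codes codes
            open Static static
            A B Z : ℕ → ℕ
            A = ar σ aA
            B = ar σ aB
            Z = ar σ aZ
            all-specs : ∀ {v} → v < n → Spec A B Z v
            all-specs v< = specs v< (proj₁ (ord-rk v<))
            yes-case : vr σ vAns ≡ 1 × (∀ {v} → v < n → rk v < c → Z v ≢ 1) → Tri (block prep₅ ⨟ down ⨟ block ((IO ⟦ con 0 ⟧≔ var vAns) ∷ [])) σ (costB prep₅ + (downAll * n + costB ((IO ⟦ con 0 ⟧≔ var vAns) ∷ []))) Answer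
            yes-case (a1 , good) =
              triB {Q = λ σ₁ → vr σ₁ vI ≡ c} tt (trans (cong (λ z → choose z (vr σ vC) 0) a1) c≡)
              thenT λ σ₁ F₁ i₁ → Down.downT′ A B Z lowA lowB lowZ all-specs
                (Down.start-down A B Z lowA lowB lowZ all-specs (static-frame F₁ (λ F → keepV F vN , keepV F vC , keepA F D₀ , keepA F Hp , keepA F Same , keepA F Head , keepA F Next , keepA F Ord , keepA F Pe) static) i₁
                  (keepA F₁ aA) (keepA F₁ aB) (keepA F₁ aZ) (λ x → trans (keepA F₁ TA x) (zeroA x)) (λ x → trans (keepA F₁ TB x) (zeroB x)) (λ x → trans (keepA F₁ TZ x) (zeroZ x))
                  (λ v → trans (keepA F₁ Opt v) (o0 v)) (λ v → trans (keepA F₁ Forb v) (f0 v)) (λ v< → good v< (proj₁ (ord-rk v<))))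
              thenT λ σ₂ F₂ inv₂ → triB (0<st , tt) (inj₁ (trans (keepV F₂ vAns) (trans (keepV F₁ vAns) a1) , Down.sound A B Z lowA lowB lowZ all-specs inv₂))
            no-case : vr σ vAns ≡ 0 × (∃[ v ] v < n × rk v < c × Z v ≡ 1) → Tri (block prep₅ ⨟ down ⨟ block ((IO ⟦ con 0 ⟧≔ var vAns) ∷ [])) σ (costB prep₅ + (downAll * n + costB ((IO ⟦ con 0 ⟧≔ var vAns) ∷ []))) Answer
            no-case (a0 , v , v< , _ , z1) =
              triB {Q = λ σ₁ → vr σ₁ vI ≡ 0} tt (cong (λ z → choose z (vr σ vC) 0) a0)
              thenT λ σ₁ F₁ i₁ → skip σ₁ i₁
              thenT λ σ₂ F₂ _ → triB (0<st , tt) (inj₂ (trans (keepV F₂ vAns) (trans (keepV F₁ vAns) a0) ,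
                λ β β≤1 pr → Down.complete A B Z lowA lowB lowZ all-specs β β≤1 pr v< z1))

          start-up : StaticFor F σ → vr σ vI ≡ 0 → vr σ vAns ≡ 1 → (∀ k → k ≢ IO → k ≡ aA ⊎ k ≡ aB ⊎ k ≡ aZ ⊎ k ≡ TA ⊎ k ≡ TB ⊎ k ≡ TZ → ∀ x → ar σ k x ≡ 0) → UpInv 0 σ
          start-up s i0 a1 z = record
            { static = s ; i≡ = i0 ; specs = λ _ () ; answer = inj₁ (a1 , λ _ ())
            ; codes = record
              { lowA = λ k → subst (_< st) (sym (z aA (λ ()) (inj₁ refl) k)) 0<st
              ; lowB = λ k → subst (_< st) (sym (z aB (λ ()) (inj₂ (inj₁ refl)) k)) 0<st
              ; lowZ = λ k → subst (_< st) (sym (z aZ (λ ()) (inj₂ (inj₂ (inj₁ refl))) k)) 0<st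
              ; zeroA = z TA (λ ()) (inj₂ (inj₂ (inj₂ (inj₁ refl))))
              ; zeroB = z TB (λ ()) (inj₂ (inj₂ (inj₂ (inj₂ (inj₁ refl)))))
              ; zeroZ = z TZ (λ ()) (inj₂ (inj₂ (inj₂ (inj₂ (inj₂ refl))))) } }

      record Start (σ : St) : Set where
        field
          var≡0 : ∀ v → vr σ v ≡ 0
          arr≡0 : ∀ k → k ≢ IO → ∀ x → ar σ k x ≡ 0
          n-in  : ar σ IO 0 ≡ n
          m-in  : ar σ IO 1 ≡ m
          X-in  : ∀ e → ar σ IO (2 + (e + e)) ≡ X e
          Y-in  : ∀ e → ar σ IO (3 + (e + e)) ≡ Y e

      algorithmT : ∀ σ → Start σ → Tri algorithm σ (allC * n) Answer
      algorithmT σ start = weaken budget (λ _ q → q)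
        ( triB {Q = λ σ₁ → vr σ₁ vN ≡ n × vr σ₁ vM ≡ m} (0<st , const≤ (s≤s (s≤s z≤n)) , tt) (n-in , m-in)
        thenT λ σ₁ F₁ (n₁ , m₁) →
          Count.countT σ₁ m₁ (λ e → trans (keepA F₁ IO _) (X-in e)) (λ e → trans (keepA F₁ IO _) (Y-in e)) (trans (keepV F₁ vE) (var≡0 vE))
            (λ v → trans (keepA F₁ Deg v) (arr≡0 Deg (λ ()) v)) (λ v → trans (keepA F₁ D₀ v) (arr≡0 D₀ (λ ()) v)) (λ v → trans (keepA F₁ Es v) (arr≡0 Es (λ ()) v))
        thenT λ σ₂ F₂ (_ , dg₂ , d0₂ , es₂) → let G₂ = frame-seq F₁ F₂ in
          triB {Q = λ σ₃ → vr σ₃ vI ≡ 0 × vr σ₃ vU ≡ 0 × vr σ₃ vC ≡ 0} tt (refl , refl , refl)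
        thenT λ σ₃ F₃ (i₃ , u₃ , c₃) → let
            G₃ = frame-seq G₂ F₃
            n₃ = trans (keepV F₃ vN) (trans (keepV F₂ vN) n₁)
            x₃ = λ e → trans (keepA G₃ IO _) (X-in e)
            y₃ = λ e → trans (keepA G₃ IO _) (Y-in e)
            d₃ = λ v → trans (keepA F₃ D₀ v) (d0₂ v)
          in Strip.stripT σ₃ n₃ x₃ y₃ d₃ (λ v → trans (keepA F₃ Deg v) (dg₂ v)) (λ v → trans (keepA F₃ Es v) (es₂ v))
            (λ v → trans (keepA G₃ Hp v) (arr≡0 Hp (λ ()) v)) (λ v → trans (keepA G₃ Same v) (arr≡0 Same (λ ()) v)) (λ v → trans (keepA G₃ Head v) (arr≡0 Head (λ ()) v)) c₃ i₃ u₃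
        thenT λ σ₄ F₄ stripped₄ → let open Strip.Stripped stripped₄ ; G₄ = frame-seq G₃ F₄ in
          triB {Q = λ σ₅ → vr σ₅ vV ≡ 0 × Elim S kids par rk σ₅} tt (refl , record { Elim elim })
        thenT λ σ₅ F₅ (v₅ , elim₅) → let G₅ = frame-seq G₄ F₅ in
          Roots.rootsT σ₅ (trans (keepV F₅ vN) (trans (keepV F₄ vN) n₃)) (λ v → trans (keepA F₅ D₀ v) (trans (keepA F₄ D₀ v) (d₃ v))) elim₅
            (no-leaf S (Elim.R≤1 elim) λ v v<n → let i≡ , u≡ = Strip.at-end σ₃ n₃ x₃ y₃ d₃ σ₄ stripped₄ in
              clean (≤-trans (<⇒≤ v<n) (≤-reflexive (sym i≡))) v<n (<⇒≢ (<-≤-trans v<n (≤-reflexive (sym u≡))))) v₅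
        thenT λ σ₆ F₆ (F , static₆) → let G₆ = frame-seq G₅ F₆ in
          triB {Q = λ σ₇ → StaticFor F σ₇ × vr σ₇ vI ≡ 0 × vr σ₇ vAns ≡ 1} tt (record { StaticFor static₆ } , refl , refl)
        thenT λ σ₇ F₇ (static₇ , i₇ , a₇) → let G₇ = frame-seq G₆ F₇ in
          WithForest.upT′ F (WithForest.Finish.start-up F static₇ i₇ a₇ λ k k≢ → λ
            { (inj₁ refl) x → trans (keepA G₇ aA x) (arr≡0 aA k≢ x)
            ; (inj₂ (inj₁ refl)) x → trans (keepA G₇ aB x) (arr≡0 aB k≢ x)
            ; (inj₂ (inj₂ (inj₁ refl))) x → trans (keepA G₇ aZ x) (arr≡0 aZ k≢ x)
            ; (inj₂ (inj₂ (inj₂ (inj₁ refl)))) x → trans (keepA G₇ TA x) (arr≡0 TA k≢ x)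
            ; (inj₂ (inj₂ (inj₂ (inj₂ (inj₁ refl))))) x → trans (keepA G₇ TB x) (arr≡0 TB k≢ x)
            ; (inj₂ (inj₂ (inj₂ (inj₂ (inj₂ refl))))) x → trans (keepA G₇ TZ x) (arr≡0 TZ k≢ x) })
        thenT λ σ₈ F₈ inv₈ → let G₈ = frame-seq G₇ F₈ in
          WithForest.Finish.answerT F inv₈ (λ v → trans (keepA G₈ Opt v) (arr≡0 Opt (λ ()) v)) (λ v → trans (keepA G₈ Forb v) (arr≡0 Forb (λ ()) v)) )
        where
        open Start start
        k≤n : ∀ x → x ≤ x * n
        k≤n x = const≤* x 1≤n
        loops : ∀ t x o {k} → k ≤ t * n → sumTo k (λ _ → x) + o ≤ (t * x + o) * n
        loops t x o {k} h = sum≤ (t * x) o n (≤-trans (≤-reflexive (sumTo-const k x)) (times≤ x {t = t} h)) (k≤n o)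
        n+m≤ : n + m ≤ 2 * n
        n+m≤ = +-monoʳ-≤ n (≤-trans m≤n (≤-reflexive (sym (+-identityʳ n))))
        last : ℕ
        last = costB ((IO ⟦ con 0 ⟧≔ var vAns) ∷ [])
        count-cost strip-cost roots-cost : ℕ
        count-cost = sumTo m (λ _ → costB countBody + over (lt (var vE) (var vM))) + over (lt (var vE) (var vM))
        strip-cost = sumTo (n + m) (λ _ → costE {7} (eq (get Deg (var vU)) (con 1)) + (3 + (costB locate + costB prune + costB advance)) + over (lt (var vI) (var vN))) + over (lt (var vI) (var vN))
        roots-cost = sumTo n (λ _ → costB rootsBody + over (lt (var vV) (var vN))) + over (lt (var vV) (var vN))
        budget : costB read + (count-cost + (costB prep₂ + (strip-cost + (costB prep₃ + (roots-cost + (costB prep₄ + (upAll * n + (costB prep₅ + (downAll * n + last))))))))) ≤ allC * n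
        budget = eleven≤ (costB read) countC (costB prep₂) stripC (costB prep₃) rootsC (costB prep₄) upAll (costB prep₅) downAll last n
          (k≤n (costB read)) (loops 1 (costB countBody + over (lt (var vE) (var vM))) (over (lt (var vE) (var vM))) (≤-trans m≤n (≤-reflexive (sym (*-identityˡ n)))))
          (k≤n (costB prep₂)) (loops 2 (costE {7} (eq (get Deg (var vU)) (con 1)) + (3 + (costB locate + costB prune + costB advance)) + over (lt (var vI) (var vN))) (over (lt (var vI) (var vN))) n+m≤)
          (k≤n (costB prep₃)) (loops 1 (costB rootsBody + over (lt (var vV) (var vN))) (over (lt (var vV) (var vN))) (≤-reflexive (sym (*-identityˡ n))))
          (k≤n (costB prep₄)) ≤-refl (k≤n (costB prep₅)) ≤-refl (k≤n last)

  module IntegerRelations where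

    open import Defs
    open import Level using (0ℓ)
    open import Axiom.ExcludedMiddle using (ExcludedMiddle)
    open ProgramLogic using (sumOver)
    open import Data.List.Base using (List; []; _∷_; foldr; map)
    open import Data.Nat.Base as ℕ using (ℕ; zero; suc; _≤_; _∸_; _⊔_)
    import Data.Nat.Properties as ℕ
    open import Data.Rational.Base using (ℚ; 0ℚ; 1ℚ; ½; ∣_∣; _+_; _*_; _-_; -_; _<_; positive; nonNegative; Positive; NonZero; ≢-nonZero; 1/_)
    open import Data.Rational.Properties
    open import Data.Rational.Solver using (module +-*-Solver)
    open +-*-Solver
    import Data.Nat.Solver
    module ℕS = Data.Nat.Solver.+-*-Solver

    Null : (ℕ → ℚ) → Set
    Null f = ∀ ε → 0ℚ < ε → ∃[ N ] (∀ n → N ≤ n → ∣ f n ∣ < ε)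

    null-ext : ∀ {f g} → (∀ n → f n ≡ g n) → Null f → Null g
    null-ext e h ε 0<ε with h ε 0<ε
    ... | N , k = N , λ n l → subst (λ z → ∣ z ∣ < ε) (e n) (k n l)

    half-pos : ∀ {ε} → 0ℚ < ε → 0ℚ < ½ * ε
    half-pos {ε} 0<ε = subst (_< ½ * ε) (*-zeroʳ ½) (*-monoʳ-<-pos ½ 0<ε)

    null-+ : ∀ {f g} → Null f → Null g → Null (λ n → f n + g n)
    null-+ {f} {g} F G ε 0<ε with F (½ * ε) (half-pos 0<ε) | G (½ * ε) (half-pos 0<ε)
    ... | M , F′ | N , G′ = M ⊔ N , λ n l → ≤-<-trans (∣p+q∣≤∣p∣+∣q∣ (f n) (g n))
      (subst (∣ f n ∣ + ∣ g n ∣ <_) (trans (sym (*-distribʳ-+ ε ½ ½)) (*-identityˡ ε))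
        (+-mono-< (F′ n (ℕ.m⊔n≤o⇒m≤o M N l)) (G′ n (ℕ.m⊔n≤o⇒n≤o M N l))))

    null-* : ∀ c {f} → Null f → Null (λ n → c * f n)
    null-* c {f} F ε 0<ε = N , λ n l → ≤-<-trans (≤-trans (≤-reflexive (∣p*q∣≡∣p∣*∣q∣ c (f n)))
        (*-monoʳ-≤-nonNeg ∣ f n ∣ ⦃ nonNegative (0≤∣p∣ (f n)) ⦄ (≤-trans (≤-reflexive (sym (+-identityʳ ∣ c ∣))) (+-monoʳ-≤ ∣ c ∣ (<⇒≤ 0<1)))))
        (subst (δ * ∣ f n ∣ <_) cancel (*-monoʳ-<-pos δ ⦃ δ⁺ ⦄ (h n l)))
      where
      0<1 : 0ℚ < 1ℚ
      0<1 = positive⁻¹ 1ℚ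
      δ : ℚ
      δ = ∣ c ∣ + 1ℚ
      δ⁺ : Positive δ
      δ⁺ = positive (<-≤-trans 0<1 (≤-trans (≤-reflexive (sym (+-identityˡ 1ℚ))) (+-monoˡ-≤ 1ℚ (0≤∣p∣ c))))
      instance
        δ≢0 : NonZero δ
        δ≢0 = pos⇒nonZero δ ⦃ δ⁺ ⦄
      η : ℚ
      η = 1/ δ * ε
      cancel : δ * η ≡ ε
      cancel = trans (sym (*-assoc δ (1/ δ) ε)) (trans (cong (_* ε) (*-inverseʳ δ)) (*-identityˡ ε))
      0<η : 0ℚ < η
      0<η = subst (_< η) (*-zeroʳ (1/ δ)) (*-monoʳ-<-pos (1/ δ) ⦃ 1/pos⇒pos δ ⦃ δ⁺ ⦄ ⦄ 0<ε)
      N = proj₁ (F η 0<η)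
      h = proj₂ (F η 0<η)

    null-cancel : ∀ {c f} → c ≢ 0ℚ → Null (λ n → c * f n) → Null f
    null-cancel {c} {f} c≢0 F = null-ext (λ n → trans (sym (*-assoc (1/ c) c (f n))) (trans (cong (_* f n) (*-inverseˡ c)) (*-identityˡ (f n)))) (null-* (1/ c) F)
      where instance nz : NonZero c
                     nz = ≢-nonZero c≢0

    ι : ℕ → ℚ
    ι zero    = 0ℚ
    ι (suc n) = 1ℚ + ι n

    ι-+ : ∀ m n → ι (m ℕ.+ n) ≡ ι m + ι n
    ι-+ zero    n = sym (+-identityˡ (ι n))
    ι-+ (suc m) n = trans (cong (1ℚ +_) (ι-+ m n)) (sym (+-assoc 1ℚ (ι m) (ι n)))

    ι-* : ∀ m n → ι (m ℕ.* n) ≡ ι m * ι n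
    ι-* zero    n = sym (*-zeroˡ (ι n))
    ι-* (suc m) n = trans (ι-+ n (m ℕ.* n)) (trans (cong₂ _+_ (sym (*-identityˡ (ι n))) (ι-* m n)) (sym (*-distribʳ-+ (ι n) 1ℚ (ι m))))

    0≤ι : ∀ n → Data.Rational.Base._≤_ 0ℚ (ι n)
    0≤ι zero    = ≤-refl
    0≤ι (suc n) = ≤-trans (<⇒≤ (positive⁻¹ 1ℚ)) (≤-trans (≤-reflexive (sym (+-identityʳ 1ℚ))) (+-monoʳ-≤ 1ℚ (0≤ι n)))

    ι-suc≢0 : ∀ n → ι (suc n) ≢ 0ℚ
    ι-suc≢0 n e = <⇒≢ (<-≤-trans (positive⁻¹ 1ℚ) (≤-trans (≤-reflexive (sym (+-identityʳ 1ℚ))) (+-monoʳ-≤ 1ℚ (0≤ι n)))) (sym e)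

    ι-inj : ∀ {m n} → ι m ≡ ι n → m ≡ n
    ι-inj {zero}  {zero}  e = refl
    ι-inj {zero}  {suc n} e = contradiction (sym e) (ι-suc≢0 n)
    ι-inj {suc m} {zero}  e = contradiction e (ι-suc≢0 m)
    ι-inj {suc m} {suc n} e = cong suc (ι-inj (trans (sym (cancel (ι m))) (trans (cong (- 1ℚ +_) e) (cancel (ι n)))))
      where cancel : ∀ x → - 1ℚ + (1ℚ + x) ≡ x
            cancel x = trans (sym (+-assoc (- 1ℚ) 1ℚ x)) (+-identityˡ x)

    ι-∸ : ∀ {m n} → n ≤ m → ι m - ι n ≡ ι (m ∸ n)
    ι-∸ {m} {n} l = trans (cong (λ z → ι z - ι n) (sym (ℕ.m∸n+n≡m l))) (trans (cong (_- ι n) (ι-+ (m ∸ n) n))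
      (solve 2 (λ x y → (x :+ y) :- y := x) refl (ι (m ∸ n)) (ι n)))

    x≡y⇒x-y≡0 : ∀ {x y} → x ≡ y → x - y ≡ 0ℚ
    x≡y⇒x-y≡0 {x} refl = +-inverseʳ x

    x-y≡0⇒x≡y : ∀ {x y} → x - y ≡ 0ℚ → x ≡ y
    x-y≡0⇒x≡y {x} {y} e = trans (solve 2 (λ x y → x := (x :- y) :+ y) refl x y) (trans (cong (_+ y) e) (+-identityˡ y))

    module Combinations (a b : ℝ) (a≉b : a ≉ b) where

      -- The rational p, q with p a + q b = 0; as a ≠ b they form a space of dimension at most 1.
      record Λ (p q : ℚ) : Set where
        constructor relation
        field null : Null (λ n → p * seq a n + q * seq b n)
      open Λ

      Λ-+ : ∀ {p q p′ q′} → Λ p q → Λ p′ q′ → Λ (p + p′) (q + q′)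
      Λ-+ {p} {q} {p′} {q′} h k = relation (null-ext (λ n → solve 6 (λ p q p′ q′ x y → (p :* x :+ q :* y) :+ (p′ :* x :+ q′ :* y) := (p :+ p′) :* x :+ (q :+ q′) :* y)
        refl p q p′ q′ (seq a n) (seq b n)) (null-+ (null h) (null k)))

      Λ-* : ∀ c {p q} → Λ p q → Λ (c * p) (c * q)
      Λ-* c {p} {q} h = relation (null-ext (λ n → solve 5 (λ c p q x y → c :* (p :* x :+ q :* y) := c :* p :* x :+ c :* q :* y) refl c p q (seq a n) (seq b n)) (null-* c (null h)))

      Λ-cancel : ∀ {c p q} → c ≢ 0ℚ → Λ (c * p) (c * q) → Λ p q
      Λ-cancel {c} {p} {q} c≢0 h = relation (null-cancel c≢0 (null-ext (λ n → solve 5 (λ c p q x y → c :* p :* x :+ c :* q :* y := c :* (p :* x :+ q :* y)) refl c p q (seq a n) (seq b n)) (null h)))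

      Λ-cong : ∀ {p q p′ q′} → p ≡ p′ → q ≡ q′ → Λ p q → Λ p′ q′
      Λ-cong refl refl h = h

      Λ-0 : Λ 0ℚ 0ℚ
      Λ-0 = relation λ ε 0<ε → 0 , λ n _ → subst (λ z → ∣ z ∣ < ε) (sym (trans (cong₂ _+_ (*-zeroˡ (seq a n)) (*-zeroˡ (seq b n))) (+-identityˡ 0ℚ))) 0<ε

      Λ-det : ∀ {p q p′ q′} → Λ p q → Λ p′ q′ → p * q′ ≡ p′ * q
      Λ-det {p} {q} {p′} {q′} h k with (p * q′ - p′ * q) ≟ 0ℚ
      ... | yes e = x-y≡0⇒x≡y e
      ... | no  n = contradiction (null-ext (λ i → solve 2 (λ x y → con 1ℚ :* x :+ con (- 1ℚ) :* y := x :- y) refl (seq a i) (seq b i))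
          (null (Λ-cancel {p * q′ - p′ * q} {1ℚ} { - 1ℚ} n (Λ-cong
            (solve 4 (λ p q p′ q′ → (q′ :+ p′) :* p :+ (:- (q :+ p)) :* p′ := (p :* q′ :- p′ :* q) :* con 1ℚ) refl p q p′ q′)
            (solve 4 (λ p q p′ q′ → (q′ :+ p′) :* q :+ (:- (q :+ p)) :* q′ := (p :* q′ :- p′ :* q) :* con (- 1ℚ)) refl p q p′ q′)
            (Λ-+ (Λ-* (q′ + p′) h) (Λ-* (- (q + p)) k)))))) a≉b

      Λ-proportional : ∀ {p q p′ q′} → p ≢ 0ℚ ⊎ q ≢ 0ℚ → Λ p q → p * q′ ≡ p′ * q → Λ p′ q′
      Λ-proportional {p} {q} {p′} {q′} (inj₁ p≢0) h e = Λ-cancel p≢0 (Λ-cong (*-comm p′ p) (sym e) (Λ-* p′ h))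
      Λ-proportional {p} {q} {p′} {q′} (inj₂ q≢0) h e = Λ-cancel q≢0 (Λ-cong (trans (*-comm q′ p) (trans e (*-comm p′ q))) (*-comm q′ q) (Λ-* q′ h))

      Λ-neg : ∀ {p q} → Λ p q → Λ (- p) (- q)
      Λ-neg {p} {q} h = Λ-cong (solve 1 (λ x → con (- 1ℚ) :* x := :- x) refl p) (solve 1 (λ x → con (- 1ℚ) :* x := :- x) refl q) (Λ-* (- 1ℚ) h)

      Apart : ℕ → ℕ → ℕ → ℕ → Set
      Apart x y x′ y′ = Λ (ι x - ι x′) (ι y - ι y′)

      record Key (P Q R r : ℕ) : Set where
        field
          sound : ∀ n {x y x′ y′} → y ≤ n → y′ ≤ n → r ℕ.* (x ℕ.+ y) ≡ r ℕ.* (x′ ℕ.+ y′) →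
            2 ℕ.+ P ℕ.* x ℕ.+ Q ℕ.* y ℕ.+ R ℕ.* (n ∸ y) ≡ 2 ℕ.+ P ℕ.* x′ ℕ.+ Q ℕ.* y′ ℕ.+ R ℕ.* (n ∸ y′) → Apart x y x′ y′
          complete : ∀ n {x y x′ y′} → y ≤ n → y′ ≤ n → Apart x y x′ y′ →
            r ℕ.* (x ℕ.+ y) ≡ r ℕ.* (x′ ℕ.+ y′) × 2 ℕ.+ P ℕ.* x ℕ.+ Q ℕ.* y ℕ.+ R ℕ.* (n ∸ y) ≡ 2 ℕ.+ P ℕ.* x′ ℕ.+ Q ℕ.* y′ ℕ.+ R ℕ.* (n ∸ y′)

      Relation⁺ Relation⁻ : Set
      Relation⁺ = ∃[ p ] ∃[ q ] (p ≢ 0 ⊎ q ≢ 0) × Λ (ι p) (ι q)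
      Relation⁻ = ∃[ p ] ∃[ q ] (p ≢ 0 ⊎ q ≢ 0) × Λ (ι p) (- ι q)

      ι≢0 : ∀ {p} → p ≢ 0 → ι p ≢ 0ℚ
      ι≢0 n e = n (ι-inj e)

      -‿≢0 : ∀ {x} → x ≢ 0ℚ → - x ≢ 0ℚ
      -‿≢0 {x} n e = n (trans (sym (neg-involutive x)) (cong -_ e))
        where neg-involutive : ∀ x → - - x ≡ x
              neg-involutive x = solve 1 (λ x → :- (:- x) := x) refl x

      cross : ∀ p q x y x′ y′ → q ℕ.* x ℕ.+ p ℕ.* y ≡ q ℕ.* x′ ℕ.+ p ℕ.* y′ → ι q * ι x + ι p * ι y ≡ ι q * ι x′ + ι p * ι y′
      cross p q x y x′ y′ e = trans (sym (lin x y)) (trans (cong ι e) (lin x′ y′))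
        where lin : ∀ x y → ι (q ℕ.* x ℕ.+ p ℕ.* y) ≡ ι q * ι x + ι p * ι y
              lin x y = trans (ι-+ (q ℕ.* x) (p ℕ.* y)) (cong₂ _+_ (ι-* q x) (ι-* p y))

      uncross : ∀ p q x y x′ y′ → ι q * ι x + ι p * ι y ≡ ι q * ι x′ + ι p * ι y′ → q ℕ.* x ℕ.+ p ℕ.* y ≡ q ℕ.* x′ ℕ.+ p ℕ.* y′
      uncross p q x y x′ y′ e = ι-inj (trans (lin x y) (trans e (sym (lin x′ y′))))
        where lin : ∀ x y → ι (q ℕ.* x ℕ.+ p ℕ.* y) ≡ ι q * ι x + ι p * ι y
              lin x y = trans (ι-+ (q ℕ.* x) (p ℕ.* y)) (cong₂ _+_ (ι-* q x) (ι-* p y))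

      key⁻ : ∀ {p q} → p ≢ 0 ⊎ q ≢ 0 → Λ (ι p) (- ι q) → Key q p 0 0
      key⁻ {p} {q} nz h = record
        { sound = λ n {x} {y} {x′} {y′} _ _ _ e → Λ-proportional (case nz of λ { (inj₁ u) → inj₁ (ι≢0 u) ; (inj₂ u) → inj₂ (-‿≢0 (ι≢0 u)) }) h
            (x-y≡0⇒x≡y (trans (rearrange (ι p) (ι q) (ι x) (ι y) (ι x′) (ι y′)) (x≡y⇒x-y≡0 (cross p q x y x′ y′ (strip′ x y x′ y′ e)))))
        ; complete = λ n {x} {y} {x′} {y′} _ _ k → refl , cong (λ z → 2 ℕ.+ z ℕ.+ 0) (uncross p q x y x′ y′
            (x-y≡0⇒x≡y (trans (sym (rearrange (ι p) (ι q) (ι x) (ι y) (ι x′) (ι y′))) (x≡y⇒x-y≡0 (Λ-det h k))))) }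
        where
        rearrange : ∀ p q x y x′ y′ → p * (y - y′) - (x - x′) * (- q) ≡ (q * x + p * y) - (q * x′ + p * y′)
        rearrange p q x y x′ y′ = solve 6 (λ p q x y x′ y′ → p :* (y :- y′) :- (x :- x′) :* (:- q) := (q :* x :+ p :* y) :- (q :* x′ :+ p :* y′)) refl p q x y x′ y′
        strip′ : ∀ x y x′ y′ → 2 ℕ.+ q ℕ.* x ℕ.+ p ℕ.* y ℕ.+ 0 ≡ 2 ℕ.+ q ℕ.* x′ ℕ.+ p ℕ.* y′ ℕ.+ 0 → q ℕ.* x ℕ.+ p ℕ.* y ≡ q ℕ.* x′ ℕ.+ p ℕ.* y′
        strip′ x y x′ y′ e = ℕ.suc-injective (ℕ.suc-injective (trans (sym (ℕ.+-identityʳ _)) (trans e (ℕ.+-identityʳ _))))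

      key⁺ : ∀ {p q} → p ≢ 0 ⊎ q ≢ 0 → Λ (ι p) (ι q) → Key q 0 p 0
      key⁺ {p} {q} nz h = record
        { sound = λ n {x} {y} {x′} {y′} y≤ y′≤ _ e → Λ-proportional (case nz of λ { (inj₁ u) → inj₁ (ι≢0 u) ; (inj₂ u) → inj₂ (ι≢0 u) }) h
            (x-y≡0⇒x≡y (trans (rearrange (ι p) (ι q) (ι x) (ι y) (ι x′) (ι y′)) (x≡y⇒x-y≡0 (cross p q x′ y x y′ (sym (to n x y x′ y′ y≤ y′≤ e))))))
        ; complete = λ n {x} {y} {x′} {y′} y≤ y′≤ k → refl , from n x y x′ y′ y≤ y′≤ (sym (uncross p q x′ y x y′
            (x-y≡0⇒x≡y (trans (sym (rearrange (ι p) (ι q) (ι x) (ι y) (ι x′) (ι y′))) (x≡y⇒x-y≡0 (Λ-det h k)))))) }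
        where
        rearrange : ∀ p q x y x′ y′ → p * (y - y′) - (x - x′) * q ≡ (q * x′ + p * y) - (q * x + p * y′)
        rearrange p q x y x′ y′ = solve 6 (λ p q x y x′ y′ → p :* (y :- y′) :- (x :- x′) :* q := (q :* x′ :+ p :* y) :- (q :* x :+ p :* y′)) refl p q x y x′ y′
        weigh : ℕ → ℕ → ℕ → ℕ
        weigh n x y = 2 ℕ.+ q ℕ.* x ℕ.+ 0 ℕ.+ p ℕ.* (n ∸ y)
        shift : ∀ n x y z → y ≤ n → weigh n x y ℕ.+ (p ℕ.* y ℕ.+ z) ≡ 2 ℕ.+ p ℕ.* n ℕ.+ (q ℕ.* x ℕ.+ z)
        shift n x y z l = trans (ℕS.solve 5 (λ p k y u z → ℕS.con 2 ℕS.:+ u ℕS.:+ ℕS.con 0 ℕS.:+ p ℕS.:* k ℕS.:+ (p ℕS.:* y ℕS.:+ z)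
            ℕS.:= ℕS.con 2 ℕS.:+ p ℕS.:* (k ℕS.:+ y) ℕS.:+ (u ℕS.:+ z)) refl p (n ∸ y) y (q ℕ.* x) z)
          (cong (λ w → 2 ℕ.+ p ℕ.* w ℕ.+ (q ℕ.* x ℕ.+ z)) (ℕ.m∸n+n≡m l))
        to : ∀ n x y x′ y′ → y ≤ n → y′ ≤ n → 2 ℕ.+ q ℕ.* x ℕ.+ 0 ℕ.+ p ℕ.* (n ∸ y) ≡ 2 ℕ.+ q ℕ.* x′ ℕ.+ 0 ℕ.+ p ℕ.* (n ∸ y′) → q ℕ.* x ℕ.+ p ℕ.* y′ ≡ q ℕ.* x′ ℕ.+ p ℕ.* y
        to n x y x′ y′ l l′ e = ℕ.+-cancelˡ-≡ (2 ℕ.+ p ℕ.* n) _ _ (trans (sym (shift n x y (p ℕ.* y′) l))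
          (trans (cong₂ ℕ._+_ e (ℕ.+-comm (p ℕ.* y) (p ℕ.* y′))) (shift n x′ y′ (p ℕ.* y) l′)))
        from : ∀ n x y x′ y′ → y ≤ n → y′ ≤ n → q ℕ.* x ℕ.+ p ℕ.* y′ ≡ q ℕ.* x′ ℕ.+ p ℕ.* y → 2 ℕ.+ q ℕ.* x ℕ.+ 0 ℕ.+ p ℕ.* (n ∸ y) ≡ 2 ℕ.+ q ℕ.* x′ ℕ.+ 0 ℕ.+ p ℕ.* (n ∸ y′)
        from n x y x′ y′ l l′ e = ℕ.+-cancelʳ-≡ (p ℕ.* y ℕ.+ p ℕ.* y′) _ _ (trans (shift n x y (p ℕ.* y′) l)
          (trans (cong (2 ℕ.+ p ℕ.* n ℕ.+_) e) (trans (sym (shift n x′ y′ (p ℕ.* y) l′)) (cong (weigh n x′ y′ ℕ.+_) (ℕ.+-comm (p ℕ.* y′) (p ℕ.* y))))))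

      key⁰ : ¬ Relation⁺ → ¬ Relation⁻ → Key 0 1 0 1
      key⁰ no⁺ no⁻ = record
        { sound = λ n {x} {y} {x′} {y′} _ _ d e → let y≡ = y-eq y y′ e ; x≡ = ℕ.+-cancelʳ-≡ y x x′ (trans (unit d) (cong (x′ ℕ.+_) (sym y≡))) in
            Λ-cong (sym (x≡y⇒x-y≡0 (cong ι x≡))) (sym (x≡y⇒x-y≡0 (cong ι y≡))) Λ-0
        ; complete = λ n {x} {y} {x′} {y′} _ _ k → let x≡ , y≡ = equal x y x′ y′ k in cong₂ (λ x y → 1 ℕ.* (x ℕ.+ y)) x≡ y≡ , cong (λ y → 2 ℕ.+ (1 ℕ.* y) ℕ.+ 0) y≡ }
        where
        unit : ∀ {x y} → 1 ℕ.* x ≡ 1 ℕ.* y → x ≡ y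
        unit {x} {y} e = trans (sym (ℕ.*-identityˡ x)) (trans e (ℕ.*-identityˡ y))
        y-eq : ∀ y y′ → 2 ℕ.+ (1 ℕ.* y) ℕ.+ 0 ≡ 2 ℕ.+ (1 ℕ.* y′) ℕ.+ 0 → y ≡ y′
        y-eq y y′ e = unit (ℕ.suc-injective (ℕ.suc-injective (trans (sym (ℕ.+-identityʳ _)) (trans e (ℕ.+-identityʳ _)))))
        flip : ∀ x y → - (x - y) ≡ y - x
        flip = solve 2 (λ x y → :- (x :- y) := y :- x) refl
        none⁺ : ∀ p q → Λ (ι p) (ι q) → p ≡ 0 × q ≡ 0
        none⁺ zero    zero    k = refl , refl
        none⁺ (suc p) q       k = contradiction (suc p , q , inj₁ (λ ()) , k) no⁺
        none⁺ zero    (suc q) k = contradiction (zero , suc q , inj₂ (λ ()) , k) no⁺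
        none⁻ : ∀ p q → Λ (ι p) (- ι q) → p ≡ 0 × q ≡ 0
        none⁻ zero    zero    k = refl , refl
        none⁻ (suc p) q       k = contradiction (suc p , q , inj₁ (λ ()) , k) no⁻
        none⁻ zero    (suc q) k = contradiction (zero , suc q , inj₂ (λ ()) , k) no⁻
        equal′ : ∀ x y x′ y′ → x′ ≤ x → Apart x y x′ y′ → x ≡ x′ × y ≡ y′
        equal′ x y x′ y′ x′≤x k with ℕ.≤-total y′ y
        ... | inj₁ y′≤y = let u , v = none⁺ (x ∸ x′) (y ∸ y′) (Λ-cong (ι-∸ x′≤x) (ι-∸ y′≤y) k) in ℕ.≤-antisym (ℕ.m∸n≡0⇒m≤n u) x′≤x , ℕ.≤-antisym (ℕ.m∸n≡0⇒m≤n v) y′≤y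
        ... | inj₂ y≤y′ = let u , v = none⁻ (x ∸ x′) (y′ ∸ y) (Λ-cong (ι-∸ x′≤x) (trans (sym (flip (ι y′) (ι y))) (cong -_ (ι-∸ y≤y′))) k) in ℕ.≤-antisym (ℕ.m∸n≡0⇒m≤n u) x′≤x , ℕ.≤-antisym y≤y′ (ℕ.m∸n≡0⇒m≤n v)
        equal : ∀ x y x′ y′ → Apart x y x′ y′ → x ≡ x′ × y ≡ y′
        equal x y x′ y′ k with ℕ.≤-total x′ x
        ... | inj₁ l = equal′ x y x′ y′ l k
        ... | inj₂ l = let u , v = equal′ x′ y′ x y l (Λ-cong (flip (ι x) (ι x′)) (flip (ι y) (ι y′)) (Λ-neg k)) in sym u , sym v

      key : ExcludedMiddle 0ℓ → ∃[ P ] ∃[ Q ] ∃[ R ] ∃[ r ] Key P Q R r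
      key em with em {Relation⁺} | em {Relation⁻}
      ... | yes (p , q , nz , h) | _                    = q , 0 , p , 0 , key⁺ nz h
      ... | no _                 | yes (p , q , nz , h) = q , p , 0 , 0 , key⁻ nz h
      ... | no no⁺               | no no⁻               = 0 , 1 , 0 , 1 , key⁰ no⁺ no⁻

      weight : ⟨ a , b ⟩ → ℕ
      weight = encode a b

      total : ∀ {E : Set} → (E → ⟨ a , b ⟩) → List E → ℝ
      total ω es = foldr _⊕_ 0ℝ (map (proj₁ ∘ ω) es)

      total-null : ∀ {E : Set} (ω : E → ⟨ a , b ⟩) es →
        Null (λ n → seq (total ω es) n - (ι (sumOver es (λ e → 1 ∸ weight (ω e))) * seq a n + ι (sumOver es (weight ∘ ω)) * seq b n))
      total-null ω [] ε 0<ε = 0 , λ n _ → subst (λ z → ∣ z ∣ < ε) (sym (solve 2 (λ x y → con 0ℚ :- (con 0ℚ :* x :+ con 0ℚ :* y) := con 0ℚ) refl (seq a n) (seq b n))) 0<ε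
      total-null ω (e ∷ es) = add-edge (ω e)
        where
        l = sumOver es (λ e → 1 ∸ weight (ω e))
        h = sumOver es (weight ∘ ω)
        add-edge : (z : ⟨ a , b ⟩) → Null (λ n → (seq (proj₁ z) n + seq (total ω es) n) - (ι ((1 ∸ weight z) ℕ.+ l) * seq a n + ι (weight z ℕ.+ h) * seq b n))
        add-edge (x , inj₁ x≈a) = null-ext (λ n → solve 6 (λ x s a b l h → (x :- a) :+ (s :- (l :* a :+ h :* b)) := (x :+ s) :- ((con 1ℚ :+ l) :* a :+ h :* b))
          refl (seq x n) (seq (total ω es) n) (seq a n) (seq b n) (ι l) (ι h)) (null-+ x≈a (total-null ω es))
        add-edge (x , inj₂ x≈b) = null-ext (λ n → solve 6 (λ x s a b l h → (x :- b) :+ (s :- (l :* a :+ h :* b)) := (x :+ s) :- (l :* a :+ (con 1ℚ :+ h) :* b))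
          refl (seq x n) (seq (total ω es) n) (seq a n) (seq b n) (ι l) (ι h)) (null-+ x≈b (total-null ω es))

      module _ {E : Set} (ω : E → ⟨ a , b ⟩) (es fs : List E) where
        private
          light heavy : List E → ℕ
          light es = sumOver es (λ e → 1 ∸ weight (ω e))
          heavy es = sumOver es (weight ∘ ω)

        equal-totals : Apart (light es) (heavy es) (light fs) (heavy fs) → total ω es ≈ total ω fs
        equal-totals k = null-ext (λ n → solve 8 (λ s t a b l h l′ h′ → ((s :- (l :* a :+ h :* b)) :+ con (- 1ℚ) :* (t :- (l′ :* a :+ h′ :* b))) :+ ((l :- l′) :* a :+ (h :- h′) :* b) := s :- t) refl
            (seq (total ω es) n) (seq (total ω fs) n) (seq a n) (seq b n) (ι (light es)) (ι (heavy es)) (ι (light fs)) (ι (heavy fs)))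
          (null-+ (null-+ (total-null ω es) (null-* (- 1ℚ) (total-null ω fs))) (null k))

        totals-equal : total ω es ≈ total ω fs → Apart (light es) (heavy es) (light fs) (heavy fs)
        totals-equal k = relation (null-ext (λ n → solve 8 (λ s t a b l h l′ h′ → (con (- 1ℚ) :* (s :- (l :* a :+ h :* b)) :+ (t :- (l′ :* a :+ h′ :* b))) :+ (s :- t) := (l :- l′) :* a :+ (h :- h′) :* b) refl
            (seq (total ω es) n) (seq (total ω fs) n) (seq a n) (seq b n) (ι (light es)) (ι (heavy es)) (ι (light fs)) (ι (heavy fs)))
          (null-+ (null-+ (null-* (- 1ℚ) (total-null ω es)) (total-null ω fs)) k))

  module AcyclicGraphs where

    open import Defs
    open StructuredPrograms using (eqn; ltn; upd; b2n)
    open ProgramLogic using (sumTo; sumOver)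
    open Sums
    open AlgorithmCorrectness using (incidence; module Graphs)
    open import Data.Empty using (⊥)
    open import Data.Fin.Base using (Fin; zero; suc; toℕ; fromℕ<)
    open import Data.Fin.Properties using (toℕ<n; toℕ-injective; toℕ-fromℕ<; injective⇒≤) renaming (_≟_ to _≟ᶠ_)
    open import Data.List.Base using (List; []; _∷_; _∷ʳ_; length; lookup; take; concatMap; tabulate)
    open import Data.List.Membership.Propositional using (_∈_)
    open import Data.List.Membership.Propositional.Properties using (∈-lookup)
    import Data.List.Membership.DecPropositional as DecMembership
    open import Data.List.Relation.Unary.All using (All; []; _∷_) renaming (lookup to lookupAll)
    open import Data.List.Relation.Unary.All.Properties using (¬Any⇒All¬)
    open import Data.List.Relation.Unary.Any using (here; there)
    open import Data.List.Relation.Unary.AllPairs using ([]; _∷_)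
    open import Data.List.Relation.Unary.Linked using (Linked; []; [-]; _∷_) renaming (map to mapLinked)
    open import Data.List.Relation.Unary.Unique.Propositional using (Unique)
    open import Data.List.Relation.Unary.Unique.Propositional.Properties using (take⁺)
    open import Data.Maybe.Base using (just; fromMaybe)
    open import Data.Nat.Base
    open import Data.Nat.Properties

    lookup-injective : ∀ {A : Set} {xs : List A} → Unique xs → ∀ i j → lookup xs i ≡ lookup xs j → i ≡ j
    lookup-injective (a ∷ u) zero    zero    e = refl
    lookup-injective (a ∷ u) zero    (suc j) e = contradiction e (lookupAll a (∈-lookup j))
    lookup-injective (a ∷ u) (suc i) zero    e = contradiction (sym e) (lookupAll a (∈-lookup i))
    lookup-injective (a ∷ u) (suc i) (suc j) e = cong suc (lookup-injective u i j e)

    unique-length : ∀ {n} (xs : List (Fin n)) → Unique xs → length xs ≤ n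
    unique-length xs u = injective⇒≤ (lookup-injective u _ _)

    -- The part of the path up to v, closed by an edge to u.
    cut : ∀ {V : Set} {_~_ : V → V → Set} {x xs v u} → Linked _~_ (x ∷ xs) → v ∈ xs → v ~ u →
      ∃[ j ] Linked _~_ (x ∷ take (suc j) xs ∷ʳ u) × 1 ≤ length (take (suc j) xs)
    cut (r ∷ l) (here refl) s = 0 , r ∷ s ∷ [-] , s≤s z≤n
    cut (r ∷ l) (there v∈) s with cut l v∈ s
    ... | j , l′ , _ = suc j , r ∷ l′ , s≤s z≤n

    module FromGraph {n : ℕ} (G : Graph n) where

      cell : ℕ → ℕ
      cell i = fromMaybe 0 (nth (input G) i)

      X Y : ℕ → ℕ
      X e = cell (2 + (e + e))
      Y e = cell (3 + (e + e))

      private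
        pair : Edge G → List ℕ
        pair e = toℕ (proj₁ (ends G e)) ∷ toℕ (proj₂ (ends G e)) ∷ []

        nth-pair : ∀ {k} (h : Fin k → Edge G) (i : Fin k) →
          nth (concatMap pair (tabulate h)) (toℕ i + toℕ i) ≡ just (toℕ (proj₁ (ends G (h i)))) ×
          nth (concatMap pair (tabulate h)) (1 + (toℕ i + toℕ i)) ≡ just (toℕ (proj₂ (ends G (h i))))
        nth-pair h zero    = refl , refl
        nth-pair h (suc i) rewrite +-suc (toℕ i) (toℕ i) = nth-pair (h ∘ suc) i

      X≡ : ∀ e → X (toℕ e) ≡ toℕ (proj₁ (ends G e))
      X≡ e = cong (fromMaybe 0) (proj₁ (nth-pair (λ i → i) e))

      Y≡ : ∀ e → Y (toℕ e) ≡ toℕ (proj₂ (ends G e))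
      Y≡ e = cong (fromMaybe 0) (proj₂ (nth-pair (λ i → i) e))

      m : ℕ
      m = size G

      at-edge : ∀ (A : ℕ → Set) → (∀ (e : Edge G) → A (toℕ e)) → ∀ {e} → e < m → A e
      at-edge A f l = subst A (toℕ-fromℕ< l) (f (fromℕ< l))

      X<n : ∀ {e} → e < m → X e < n
      X<n = at-edge (λ e → X e < n) λ e → subst (_< n) (sym (X≡ e)) (toℕ<n _)

      Y<n : ∀ {e} → e < m → Y e < n
      Y<n = at-edge (λ e → Y e < n) λ e → subst (_< n) (sym (Y≡ e)) (toℕ<n _)

      X≢Y : ∀ {e} → e < m → X e ≢ Y e
      X≢Y = at-edge (λ e → X e ≢ Y e) λ e eq → loopless G e (toℕ-injective (trans (sym (X≡ e)) (trans eq (Y≡ e))))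

      open Graphs n m 0 X Y X<n Y<n X≢Y using (inc; Ends; inc-end; other-end; remDeg; leaf; module Leaf; ends-≢; ends-<; ends-swap)

      Joins : Edge G → Fin n → Fin n → Set
      Joins e u v = ends G e ≡ (u , v) ⊎ ends G e ≡ (v , u)

      joins⇒ends : ∀ {e u v} → Joins e u v → Ends (toℕ e) (toℕ u) (toℕ v)
      joins⇒ends {e} (inj₁ eq) = inj₁ (trans (X≡ e) (cong (toℕ ∘ proj₁) eq) , trans (Y≡ e) (cong (toℕ ∘ proj₂) eq))
      joins⇒ends {e} (inj₂ eq) = inj₂ (trans (X≡ e) (cong (toℕ ∘ proj₁) eq) , trans (Y≡ e) (cong (toℕ ∘ proj₂) eq))

      ends⇒joins : ∀ {e : Edge G} {u v : Fin n} → Ends (toℕ e) (toℕ u) (toℕ v) → Joins e u v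
      ends⇒joins {e} (inj₁ (a , b)) = inj₁ (cong₂ _,_ (toℕ-injective (trans (sym (X≡ e)) a)) (toℕ-injective (trans (sym (Y≡ e)) b)))
      ends⇒joins {e} (inj₂ (a , b)) = inj₂ (cong₂ _,_ (toℕ-injective (trans (sym (X≡ e)) a)) (toℕ-injective (trans (sym (Y≡ e)) b)))

      joins-unique : ∀ {e f u v} → Joins e u v → Joins f u v → e ≡ f
      joins-unique {e} {f} (inj₁ a) (inj₁ b) = simple G e f (inj₁ (trans a (sym b)))
      joins-unique {e} {f} (inj₂ a) (inj₂ b) = simple G e f (inj₁ (trans a (sym b)))
      joins-unique {e} {f} (inj₁ a) (inj₂ b) = simple G e f (inj₂ (trans a (sym (cong Data.Product.Base.swap b))))
      joins-unique {e} {f} (inj₂ a) (inj₁ b) = simple G e f (inj₂ (trans a (sym (cong Data.Product.Base.swap b))))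

      module Stuck (acyclic : Acyclic G) (S : ℕ → ℕ) (S≤1 : ∀ e → S e ≤ 1) (no-leaf : ∀ v → v < n → remDeg S v ≢ 1) where

        _~_ : Fin n → Fin n → Set
        u ~ v = ∃[ e ] S (toℕ e) ≢ 0 × Joins e u v

        ~⇒adjacent : ∀ {u v} → u ~ v → Adjacent G u v
        ~⇒adjacent (e , _ , j) = e , j

        ~-sym : ∀ {u v} → u ~ v → v ~ u
        ~-sym (e , s , inj₁ j) = e , s , inj₂ j
        ~-sym (e , s , inj₂ j) = e , s , inj₁ j

        ~-irrefl : ∀ {u v} → u ~ v → u ≢ v
        ~-irrefl (e , _ , inj₁ j) refl = loopless G e (trans (cong proj₁ j) (sym (cong proj₂ j)))
        ~-irrefl (e , _ , inj₂ j) refl = loopless G e (trans (cong proj₁ j) (sym (cong proj₂ j)))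

        another : ∀ {u v} → u ~ v → ∃[ w ] w ≢ v × u ~ w
        another {u} {v} (e , s , j) with find m (λ i → (1 ∸ eqn i (toℕ e)) * (S i * inc (toℕ u) i))
        ... | inj₂ none = contradiction only (no-leaf (toℕ u) (toℕ<n u))
          where
          only : remDeg S (toℕ u) ≡ 1
          only = trans (sumTo-single m {e = toℕ e} (toℕ<n e) λ i l ne → trans (sym (*-identityˡ _)) (trans (cong (λ z → (1 ∸ z) * (S i * inc (toℕ u) i)) (sym (eqn-≢ ne))) (none i l)))
            (cong₂ _*_ (≤-antisym (S≤1 (toℕ e)) (n≢0⇒n>0 s)) (inc-end (toℕ<n e) (joins⇒ends j)))
        ... | inj₁ (i , l , ne) with *-≢0 {1 ∸ eqn i (toℕ e)} ne
        ...   | i≢ , ne′ with *-≢0 {S i} ne′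
        ...     | Si≢0 , inc≢0 = w , w≢v , f , subst (λ z → S z ≢ 0) (sym f≡) Si≢0 , fw
          where
          f : Edge G
          f = fromℕ< l
          f≡ : toℕ f ≡ i
          f≡ = toℕ-fromℕ< l
          en : Ends i (toℕ u) (X i + Y i ∸ toℕ u)
          en = other-end l inc≢0
          w<n : X i + Y i ∸ toℕ u < n
          w<n = ends-< {i} l (ends-swap {i} en)
          w : Fin n
          w = fromℕ< w<n
          fw : Joins f u w
          fw = ends⇒joins (subst₂ (λ a b → Ends a (toℕ u) b) (sym f≡) (sym (toℕ-fromℕ< w<n)) en)
          w≢v : w ≢ v
          w≢v w≡v = i≢ (cong (1 ∸_) (trans (cong (λ z → eqn z (toℕ e)) (trans (sym f≡) (cong toℕ (joins-unique (subst (Joins f u) w≡v fw) j)))) (eqn-refl (toℕ e))))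

        open DecMembership (_≟ᶠ_ {n}) using (_∈?_)

        grow : ∀ k u v rest → n < k + length (u ∷ v ∷ rest) → Unique (u ∷ v ∷ rest) → Linked _~_ (u ∷ v ∷ rest) → ⊥
        grow zero    u v rest l uq path = <⇒≱ l (unique-length _ uq)
        grow (suc k) u v rest l uq path@(u~v ∷ tail) with another u~v
        ... | w , w≢v , u~w with w ∈? rest
        ...   | yes w∈ = let j , closed , len = cut tail w∈ (~-sym u~w) in
                  acyclic u (v ∷ take (suc j) rest) (s≤s len , take⁺ (3 + j) uq , mapLinked ~⇒adjacent (u~v ∷ closed))
        ...   | no  w∉ = grow k w u (v ∷ rest) (≤-trans l (≤-reflexive (sym (+-suc k _)))) (fresh ∷ uq) (~-sym u~w ∷ path)
          where fresh : All (w ≢_) (u ∷ v ∷ rest)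
                fresh = (~-irrefl u~w ∘ sym) ∷ w≢v ∷ ¬Any⇒All¬ rest w∉

        empty : ∀ e → e < m → S e ≡ 0
        empty e l = by-equality (S e) 0 (λ z → z) λ ne → let
            f = fromℕ< l
            j : Joins f (proj₁ (ends G f)) (proj₂ (ends G f))
            j = inj₁ refl
            r = f , subst (λ z → S z ≢ 0) (sym (toℕ-fromℕ< l)) ne , j
          in contradiction (r ∷ [-]) (grow n _ _ [] (≤-trans (≤-reflexive (+-comm 1 n)) (+-monoʳ-≤ n (s≤s z≤n))) ((~-irrefl r ∷ []) ∷ [] ∷ []))

      module _ (acyclic : Acyclic G) where

        no-leaf : ∀ (S : ℕ → ℕ) → (∀ e → S e ≤ 1) → (∀ v → v < n → remDeg S v ≢ 1) → ∀ e → e < m → S e ≡ 0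
        no-leaf S S≤1 h = Stuck.empty acyclic S S≤1 h

        private
          touched : (ℕ → ℕ) → ℕ
          touched S = sumTo n (λ v → ltn 0 (remDeg S v))

          ltn-mono : ∀ {x y} → x ≤ y → ltn 0 x ≤ ltn 0 y
          ltn-mono z≤n     = z≤n
          ltn-mono (s≤s _) = ≤-refl

          size≤touched : ∀ k S → (∀ e → S e ≤ 1) → sumTo m S ≡ k → k ≤ touched S
          size≤touched zero    S S≤1 eq = z≤n
          size≤touched (suc k) S S≤1 eq with find n (λ v → eqn (remDeg S v) 1)
          ... | inj₂ none = contradiction (trans (sym eq) (sumTo-zero m (no-leaf S S≤1 λ v l → eqn-≡0 (none v l)))) λ ()
          ... | inj₁ (u , u<n , one) with leaf S (eqn-≢0 {remDeg S u} one)
          ...   | e , L = ≤-trans (s≤s (size≤touched k S′ S′≤1 size′)) (sumTo-strict n (λ v _ → ltn-mono (shrink v)) u<n strict)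
            where
            open Leaf L
            one≡ : remDeg S u ≡ 1
            one≡ = eqn-≢0 one
            S′ : ℕ → ℕ
            S′ = upd S e 0
            S′≤1 : ∀ i → S′ i ≤ 1
            S′≤1 i = by-equality e i (λ { refl → ≤-trans (≤-reflexive (upd-same S e 0)) z≤n }) (λ ne → ≤-trans (≤-reflexive (upd-other S 0 ne)) (S≤1 i))
            remove : ∀ (g : ℕ → ℕ) → sumTo m (λ i → S′ i * g i) + g e ≡ sumTo m (λ i → S i * g i)
            remove g = trans (cong (sumTo m (λ i → S′ i * g i) +_) (sym (trans (cong (_* g e) R≡1) (*-identityˡ (g e))))) (sumTo-upd m S g e<m)
            shrink : ∀ v → remDeg S′ v ≤ remDeg S v
            shrink v = ≤-trans (m≤m+n _ (inc v e)) (≤-reflexive (remove (inc v)))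
            size′ : sumTo m S′ ≡ k
            size′ = suc-injective (trans (trans (+-comm 1 _) (trans (cong (_+ 1) (sumTo-cong m λ i _ → sym (*-identityʳ (S′ i)))) (trans (remove (λ _ → 1)) (sumTo-cong m λ i _ → *-identityʳ (S i))))) eq)
            gone : remDeg S′ u ≡ 0
            gone = +-cancelʳ-≡ 1 _ 0 (trans (cong (remDeg S′ u +_) (sym inc≡1)) (trans (remove (inc u)) one≡))
            strict : ltn 0 (remDeg S′ u) < ltn 0 (remDeg S u)
            strict = subst₂ _<_ (cong (ltn 0) (sym gone)) (cong (ltn 0) (sym one≡)) (s≤s z≤n)

        m≤n : m ≤ n
        m≤n = ≤-trans (size≤touched m (λ _ → 1) (λ _ → ≤-refl) (trans (sumTo-const m 1) (*-identityʳ m)))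
          (≤-trans (sumTo-mono n λ v _ → b2n≤1 (0 <ᵇ remDeg (λ _ → 1) v)) (≤-reflexive (trans (sumTo-const n 1) (*-identityʳ n))))

  module Weightings where

    open import Defs
    open StructuredPrograms
    open ProgramLogic
    open Sums
    open Algorithm
    open AlgorithmCorrectness using (incidence; module Graphs)
    open IntegerRelations
    open AcyclicGraphs
    open import Data.Bool.Base using (true; false; _∨_)
    open import Data.Fin.Base using (Fin; zero; suc; toℕ; fromℕ<)
    open import Data.Fin.Properties using (toℕ<n; toℕ-injective; fromℕ<-toℕ) renaming (_≟_ to _≟ᶠ_)
    open import Data.List.Base using (List; []; _∷_; filter; tabulate; allFin)
    open import Data.List.Relation.Unary.All using ([]; _∷_)
    open import Data.Nat.Base
    open import Data.Nat.Induction using (<-rec)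
    open import Data.Nat.Logarithm using (⌊log₂_⌋; ⌊log₂⌋-mono-≤; ⌊log₂⌊n/2⌋⌋≡⌊log₂n⌋∸1; ⌊log₂[2^n]⌋≡n)
    open import Data.Nat.Properties

    n≤2⌊n/2⌋+1 : ∀ n → n ≤ suc (⌊ n /2⌋ + ⌊ n /2⌋)
    n≤2⌊n/2⌋+1 zero          = z≤n
    n≤2⌊n/2⌋+1 (suc zero)    = ≤-refl
    n≤2⌊n/2⌋+1 (suc (suc n)) = s≤s (s≤s (≤-trans (n≤2⌊n/2⌋+1 n) (≤-reflexive (sym (+-suc ⌊ n /2⌋ ⌊ n /2⌋)))))

    n<2^log : ∀ n → n < 2 ^ suc ⌊log₂ n ⌋
    n<2^log = <-rec _ go
      where
      go : ∀ n → (∀ {k} → k < n → k < 2 ^ suc ⌊log₂ k ⌋) → n < 2 ^ suc ⌊log₂ n ⌋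
      go zero       ih = s≤s z≤n
      go (suc zero) ih = s≤s (s≤s z≤n)
      go n@(suc (suc i)) ih = ≤-trans (s≤s (n≤2⌊n/2⌋+1 n)) (≤-trans (≤-reflexive (sym (cong suc (+-suc ⌊ n /2⌋ ⌊ n /2⌋))))
          (≤-trans (+-mono-≤ half half) (≤-reflexive (cong (2 ^ ⌊log₂ n ⌋ +_) (sym (+-identityʳ _))))))
        where
        1≤log : 1 ≤ ⌊log₂ n ⌋
        1≤log = ≤-trans (≤-reflexive (sym (⌊log₂[2^n]⌋≡n 1))) (⌊log₂⌋-mono-≤ {2} {n} (s≤s (s≤s z≤n)))
        half : ⌊ n /2⌋ < 2 ^ ⌊log₂ n ⌋
        half = subst (λ z → ⌊ n /2⌋ < 2 ^ z) (trans (cong suc (⌊log₂⌊n/2⌋⌋≡⌊log₂n⌋∸1 n)) (m+[n∸m]≡n 1≤log)) (ih (⌊n/2⌋<n (suc i)))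

    k<2^k : ∀ k → k < 2 ^ k
    k<2^k zero    = s≤s z≤n
    k<2^k (suc k) = ≤-trans (s≤s (k<2^k k)) (≤-trans (+-monoˡ-≤ (2 ^ k) (m^n>0 2 k)) (≤-reflexive (cong (2 ^ k +_) (sym (+-identityʳ _)))))

    enough-bits : ∀ j n w → (2 + j) * suc ⌊log₂ n ⌋ ≤ w → n * n * j ≤ 2 ^ w
    enough-bits j n w h = begin
      n * n * j                      ≤⟨ *-mono-≤ (*-mono-≤ n≤ n≤) (<⇒≤ (k<2^k j)) ⟩
      B * B * 2 ^ j                  ≤⟨ *-monoʳ-≤ (B * B) (^-monoʳ-≤ 2 (≤-trans (≤-reflexive (sym (*-identityʳ j))) (*-monoʳ-≤ j (s≤s z≤n)))) ⟩
      B * B * 2 ^ (j * L)            ≡⟨ cong (_* 2 ^ (j * L)) (^-distribˡ-+-* 2 L L) ⟨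
      2 ^ (L + L) * 2 ^ (j * L)      ≡⟨ ^-distribˡ-+-* 2 (L + L) (j * L) ⟨
      2 ^ (L + L + j * L)            ≤⟨ ^-monoʳ-≤ 2 (≤-trans (≤-reflexive (+-assoc L L (j * L))) h) ⟩
      2 ^ w                          ∎
      where
      open ≤-Reasoning
      L = suc ⌊log₂ n ⌋
      B = 2 ^ L
      n≤ : n ≤ B
      n≤ = <⇒≤ (n<2^log n)

    sumTo-front : ∀ k f → sumTo (suc k) f ≡ f 0 + sumTo k (f ∘ suc)
    sumTo-front zero    f = +-comm 0 (f 0)
    sumTo-front (suc k) f = trans (cong (_+ f (suc k)) (sumTo-front k f)) (+-assoc (f 0) _ _)

    sumOver-tabulate : ∀ {A : Set} k (h : Fin k → A) (f : A → ℕ) g → (∀ i → g (toℕ i) ≡ f (h i)) → sumOver (tabulate h) f ≡ sumTo k g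
    sumOver-tabulate zero    h f g e = refl
    sumOver-tabulate (suc k) h f g e = trans (cong₂ _+_ (sym (e zero)) (sumOver-tabulate k (h ∘ suc) f (g ∘ suc) (e ∘ suc))) (sym (sumTo-front k g))

    sumOver-filter : ∀ {A : Set} {P : A → Set} (P? : ∀ x → Dec (P x)) xs (f : A → ℕ) → sumOver (filter P? xs) f ≡ sumOver xs (λ x → b2n (does (P? x)) * f x)
    sumOver-filter P? []       f = refl
    sumOver-filter P? (x ∷ xs) f with does (P? x)
    ... | true  = cong₂ _+_ (sym (+-identityʳ (f x))) (sumOver-filter P? xs f)
    ... | false = sumOver-filter P? xs f

    extend : ∀ {m} → (Fin m → ℕ) → ℕ → ℕ
    extend {m} f i with i <? m
    ... | yes l = f (fromℕ< l)
    ... | no _  = 0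

    extend-≤ : ∀ {m b} (f : Fin m → ℕ) → (∀ i → f i ≤ b) → ∀ i → extend f i ≤ b
    extend-≤ {m} f h i with i <? m
    ... | yes l = h (fromℕ< l)
    ... | no _  = z≤n

    extend-≡ : ∀ {m} (f : Fin m → ℕ) i → extend f (toℕ i) ≡ f i
    extend-≡ {m} f i with toℕ i <? m
    ... | yes l = cong f (fromℕ<-toℕ i l)
    ... | no ¬l = contradiction (toℕ<n i) ¬l

    module Boundary (a b : ℝ) (a≉b : a ≉ b) {n : ℕ} (G : Graph n) {P Q R r : ℕ} (K : Combinations.Key a b a≉b P Q R r)
                    (m≤n : size G ≤ n) where
      open FromGraph G hiding (m≤n; no-leaf)
      open Combinations a b a≉b
      open Graphs n m r X Y X<n Y<n X≢Y using (inc; deg₀; inc-end)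

      keyOf : ℕ → ℕ → ℕ
      keyOf d J = 2 + P * (d ∸ J) + Q * J + R * (n ∸ J)

      heavyAt : (ℕ → ℕ) → ℕ → ℕ
      heavyAt β v = sumTo m (λ e → inc v e * β e)

      Clash : (ℕ → ℕ) → ℕ → ℕ → Set
      Clash β u v = r * deg₀ u ≡ r * deg₀ v × keyOf (deg₀ u) (heavyAt β u) ≡ keyOf (deg₀ v) (heavyAt β v)

      eqn-≟ : ∀ (u v : Fin n) {x} → x ≡ toℕ v → eqn x (toℕ u) ≡ b2n (does (u ≟ᶠ v))
      eqn-≟ u v refl with u ≟ᶠ v
      ... | yes refl = eqn-refl (toℕ u)
      ... | no  u≢v  = eqn-≢ (λ e → u≢v (toℕ-injective (sym e)))

      incident-inc : ∀ v e → b2n (does (incident? G v e)) ≡ inc (toℕ v) (toℕ e)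
      incident-inc v e = sym (trans (cong₂ _+_ (eqn-≟ v (proj₁ (ends G e)) (X≡ e)) (eqn-≟ v (proj₂ (ends G e)) (Y≡ e))) (exclusive (v ≟ᶠ proj₁ (ends G e)) (v ≟ᶠ proj₂ (ends G e))))
        where
        exclusive : (p : Dec (v ≡ proj₁ (ends G e))) (q : Dec (v ≡ proj₂ (ends G e))) → b2n (does p) + b2n (does q) ≡ b2n (does p ∨ does q)
        exclusive (yes p) (yes q) = contradiction (trans (sym p) q) (loopless G e)
        exclusive (yes p) (no q)  = refl
        exclusive (no p)  q       = refl

      incident-sum : ∀ v (f : Edge G → ℕ) (g : ℕ → ℕ) → (∀ e → g (toℕ e) ≡ f e) →
        sumOver (filter (incident? G v) (allFin m)) f ≡ sumTo m (λ e → inc (toℕ v) e * g e)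
      incident-sum v f g h = trans (sumOver-filter (incident? G v) (allFin m) f)
        (sumOver-tabulate m (λ i → i) (λ e → b2n (does (incident? G v e)) * f e) (λ e → inc (toℕ v) e * g e) λ e → cong₂ _*_ (sym (incident-inc v e)) (h e))

      module _ (ω : EdgeWeighting a b G) (β : ℕ → ℕ) (β≡ : ∀ (e : Edge G) → β (toℕ e) ≡ weight (ω e)) (β≤1 : ∀ (e : Edge G) → β (toℕ e) ≤ 1) where
        private
          es : Fin n → List (Edge G)
          es v = filter (incident? G v) (allFin m)

          light heavy : Fin n → ℕ
          light v = sumOver (es v) (λ e → 1 ∸ weight (ω e))
          heavy v = sumOver (es v) (weight ∘ ω)

          heavy≡ : ∀ v → heavy v ≡ heavyAt β (toℕ v)
          heavy≡ v = incident-sum v (weight ∘ ω) β β≡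

          light+heavy : ∀ v → light v + heavy v ≡ deg₀ (toℕ v)
          light+heavy v = trans (cong₂ _+_ (incident-sum v (λ e → 1 ∸ weight (ω e)) (λ e → 1 ∸ β e) λ e → cong (1 ∸_) (β≡ e)) (heavy≡ v))
            (trans (sym (sumTo-+ m _ _)) (sumTo-cong m λ e l → at-edge (λ e → inc (toℕ v) e * (1 ∸ β e) + inc (toℕ v) e * β e ≡ inc (toℕ v) e)
              (λ e → trans (sym (*-distribˡ-+ (inc (toℕ v) (toℕ e)) (1 ∸ β (toℕ e)) (β (toℕ e)))) (trans (cong (inc (toℕ v) (toℕ e) *_) (m∸n+n≡m (β≤1 e))) (*-identityʳ _))) l))

          light≡ : ∀ v → deg₀ (toℕ v) ∸ heavyAt β (toℕ v) ≡ light v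
          light≡ v = trans (cong₂ _∸_ (sym (light+heavy v)) (sym (heavy≡ v))) (m+n∸n≡m (light v) (heavy v))

          inc≤1 : ∀ v {e} → e < m → inc v e ≤ 1
          inc≤1 v {e} l = by-equality (X e) v
            (λ { refl → ≤-reflexive (inc-end l (inj₁ (refl , refl))) })
            (λ ne → ≤-trans (≤-reflexive (cong (_+ eqn (Y e) v) (eqn-≢ ne))) (b2n≤1 (Y e ≡ᵇ v)))

          heavy≤n : ∀ v → heavy v ≤ n
          heavy≤n v = ≤-trans (≤-trans (m≤n+m (heavy v) (light v)) (≤-reflexive (light+heavy v)))
            (≤-trans (sumTo-mono m λ e l → inc≤1 (toℕ v) l) (≤-trans (≤-reflexive (trans (sumTo-const m 1) (*-identityʳ m))) m≤n))

          key≡ : ∀ v → 2 + P * light v + Q * heavy v + R * (n ∸ heavy v) ≡ keyOf (deg₀ (toℕ v)) (heavyAt β (toℕ v))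
          key≡ v = cong₂ (λ x y → 2 + P * x + Q * y + R * (n ∸ y)) (sym (light≡ v)) (heavy≡ v)

        clash⇒≈ : ∀ u v → Clash β (toℕ u) (toℕ v) → weightedDegree a b G ω u ≈ weightedDegree a b G ω v
        clash⇒≈ u v (d , k) = equal-totals ω (es u) (es v) (Key.sound K n (heavy≤n u) (heavy≤n v)
          (trans (cong (r *_) (light+heavy u)) (trans d (cong (r *_) (sym (light+heavy v))))) (trans (key≡ u) (trans k (sym (key≡ v)))))

        ≈⇒clash : ∀ u v → weightedDegree a b G ω u ≈ weightedDegree a b G ω v → Clash β (toℕ u) (toℕ v)
        ≈⇒clash u v h = let d , k = Key.complete K n (heavy≤n u) (heavy≤n v) (totals-equal ω (es u) (es v) h) in
          trans (cong (r *_) (sym (light+heavy u))) (trans d (cong (r *_) (light+heavy v))) , trans (sym (key≡ u)) (trans k (key≡ v))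

      ProperG : (ℕ → ℕ) → Set
      ProperG β = ∀ e → e < m → ¬ Clash β (X e) (Y e)

      pickWeight : ℕ → ⟨ a , b ⟩
      pickWeight zero    = a , inj₁ (null-ext (λ n → sym (x≡y⇒x-y≡0 {seq a n} refl)) λ ε 0<ε → 0 , λ _ _ → 0<ε)
      pickWeight (suc _) = b , inj₂ (null-ext (λ n → sym (x≡y⇒x-y≡0 {seq b n} refl)) λ ε 0<ε → 0 , λ _ _ → 0<ε)

      weight-pick : ∀ {x} → x ≤ 1 → x ≡ weight (pickWeight x)
      weight-pick z≤n       = refl
      weight-pick (s≤s z≤n) = refl

      to-weighting : (β : ℕ → ℕ) → (∀ e → e < m → β e ≤ 1) → ProperG β → Σ (EdgeWeighting a b G) λ ω → Proper a b G ω × (∀ e → β (toℕ e) ≡ encode a b (ω e))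
      to-weighting β β≤1 pr = ω , proper , β≡
        where
        ω : EdgeWeighting a b G
        ω e = pickWeight (β (toℕ e))
        bits : ∀ e → β (toℕ e) ≤ 1
        bits e = β≤1 (toℕ e) (toℕ<n e)
        β≡ : ∀ e → β (toℕ e) ≡ weight (ω e)
        β≡ e = weight-pick (bits e)
        at : ∀ e {u v} → ends G e ≡ (u , v) → X (toℕ e) ≡ toℕ u × Y (toℕ e) ≡ toℕ v
        at e eq = trans (X≡ e) (cong (toℕ ∘ proj₁) eq) , trans (Y≡ e) (cong (toℕ ∘ proj₂) eq)
        proper : Proper a b G ω
        proper u v (e , inj₁ eq) h = pr (toℕ e) (toℕ<n e) (subst₂ (Clash β) (sym (proj₁ (at e eq))) (sym (proj₂ (at e eq))) (≈⇒clash ω β β≡ bits u v h))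
        proper u v (e , inj₂ eq) h = let x , y = ≈⇒clash ω β β≡ bits u v h in
          pr (toℕ e) (toℕ<n e) (subst₂ (Clash β) (sym (proj₁ (at e eq))) (sym (proj₂ (at e eq))) (sym x , sym y))

      from-weighting : (ω : EdgeWeighting a b G) → Proper a b G ω → Σ (ℕ → ℕ) λ β → (∀ e → β e ≤ 1) × ProperG β
      from-weighting ω pr = β , β≤1 , λ e l cl → at-edge (λ e → ¬ Clash β (X e) (Y e)) (λ e cl → pr (proj₁ (ends G e)) (proj₂ (ends G e)) (e , inj₁ refl)
          (clash⇒≈ ω β β≡ (λ e → β≤1 (toℕ e)) _ _ (subst₂ (Clash β) (X≡ e) (Y≡ e) cl))) l cl
        where
        weight≤1 : ∀ z → weight z ≤ 1
        weight≤1 (_ , inj₁ _) = z≤n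
        weight≤1 (_ , inj₂ _) = ≤-refl
        β : ℕ → ℕ
        β = extend (weight ∘ ω)
        β≤1 : ∀ i → β i ≤ 1
        β≤1 = extend-≤ (weight ∘ ω) (weight≤1 ∘ ω)
        β≡ : ∀ e → β (toℕ e) ≡ weight (ω e)
        β≡ = extend-≡ (weight ∘ ω)

  module Machines where

    open import Defs
    open import Level using (0ℓ)
    open import Axiom.ExcludedMiddle using (ExcludedMiddle)
    open StructuredPrograms
    open ProgramLogic
    open Sums
    open Algorithm
    open AlgorithmCorrectness using (Setting; sum≤; module Verification)
    open IntegerRelations
    open AcyclicGraphs
    open Weightings
    open import Data.Fin.Base using (Fin; zero; suc; toℕ)
    open import Data.Fin.Properties using (toℕ<n; toℕ-injective)
    open import Data.List.Base using (List; []; _∷_; length; concatMap; tabulate)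
    open import Data.List.Relation.Unary.All using (All; []; _∷_)
    open import Data.Maybe.Base using (nothing; fromMaybe)
    open import Data.Nat.Base
    open import Data.Nat.Logarithm using (⌊log₂_⌋)
    open import Data.Nat.Properties
    open import Data.Nat.Solver using (module +-*-Solver)

    nth-beyond : ∀ {A : Set} (xs : List A) {i} → length xs ≤ i → nth xs i ≡ nothing
    nth-beyond []       l       = refl
    nth-beyond (x ∷ xs) (s≤s l) = nth-beyond xs l

    nth-bound : ∀ {b} (xs : List ℕ) → All (_≤ b) xs → ∀ i → fromMaybe 0 (nth xs i) ≤ b
    nth-bound []       []       i       = z≤n
    nth-bound (x ∷ xs) (p ∷ ps) zero    = p
    nth-bound (x ∷ xs) (p ∷ ps) (suc i) = nth-bound xs ps i

    module _ {n : ℕ} (G : Graph n) where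

      input-length : length (input G) ≡ 2 + (size G + size G)
      input-length = cong (2 +_) (pairs (size G) (λ i → i))
        where
        pairs : ∀ k (h : Fin k → Edge G) → length (concatMap (λ e → toℕ (proj₁ (ends G e)) ∷ toℕ (proj₂ (ends G e)) ∷ []) (tabulate h)) ≡ k + k
        pairs zero    h = refl
        pairs (suc k) h = trans (cong (2 +_) (pairs k (h ∘ suc))) (cong suc (sym (+-suc k k)))

      input-≤ : size G ≤ n → All (_≤ n) (input G)
      input-≤ m≤n = ≤-refl ∷ m≤n ∷ pairs (size G) (λ i → i)
        where
        pairs : ∀ k (h : Fin k → Edge G) → All (_≤ n) (concatMap (λ e → toℕ (proj₁ (ends G e)) ∷ toℕ (proj₂ (ends G e)) ∷ []) (tabulate h))
        pairs zero    h = []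
        pairs (suc k) h = <⇒≤ (toℕ<n _) ∷ <⇒≤ (toℕ<n _) ∷ pairs k (h ∘ suc)

    loaded : Cmd → ℕ → Program
    loaded c factor = program #r (load (tmp 7 p7) (tmp 7 p7) ∷ set scr factor ∷ arith mul str (tmp 7 p7) scr ∷ codeC c 3)

    module Launch (c : Cmd) (factor n : ℕ) (G : Graph n) (w S : ℕ) (m≤n : size G ≤ n) (9≤st : 9 ≤ n * factor)
                  (n<st : n < n * factor) (short : 2 + (size G + size G) ≤ n * factor) (factor<M : factor < 2 ^ w)
                  (cells<M : 18 * (n * factor) ≤ 2 ^ w) (cells<S : 18 * (n * factor) ≤ S) where
        open FromGraph G hiding (m≤n)

        st M : ℕ
        st = n * factor
        M  = 2 ^ w

        1≤st : 1 ≤ st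
        1≤st = ≤-trans (s≤s z≤n) 9≤st

        st<M : st < M
        st<M = <-≤-trans (m<m+n st (≤-trans 1≤st (m≤m+n st (16 * st)))) cells<M

        machine : Program
        machine = loaded c factor

        open Simulation w st S (code machine) (≤-trans (≤-trans (n≤1+n 8) 9≤st) (<⇒≤ st<M)) cells<M cells<S public
        open Semantics M st using (Exec)

        σ₀ : St
        σ₀ = ⟨ (λ _ → 0) ∣ (λ { zero x → cell x ; (suc _) x → 0 }) ⟩

        s₀ s₁ s₂ s₃ : State w #r
        s₀ = initial w #r G
        s₁ = exec (load (tmp 7 p7) (tmp 7 p7)) s₀
        s₂ = exec (set scr factor) s₁
        s₃ = exec (arith mul str (tmp 7 p7) scr) s₂

        zero-word : toℕ (word w 0) ≡ 0
        zero-word = toℕ-word 0<M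

        cell≤n : ∀ x → cell x ≤ n
        cell≤n = nth-bound (input G) (input-≤ G m≤n)

        memory : ∀ i → toℕ (mem s₀ i) ≡ cell (toℕ i)
        memory i = toℕ-word (≤-<-trans (cell≤n (toℕ i)) (<-trans n<st st<M))

        setup : Steps 3 s₀ s₃
        setup = one refl (subst (_< S) (sym zero-word) (<-≤-trans 1≤st (≤-trans (m≤m+n st (17 * st)) cells<S))) (one refl tt (one refl tt []))

        tmp-n : toℕ (reg s₂ (tmp 7 p7)) ≡ n
        tmp-n = trans (cong toℕ (here (reg s₀) (tmp 7 p7))) (trans (memory (word w 0)) (cong cell zero-word))

        start-rel : Rel σ₀ s₃
        start-rel = rel
          (λ v → trans (cong toℕ (there (reg s₀) {r = tmp 7 p7} {r′ = vreg v} {mem s₀ (reg s₀ (tmp 7 p7))} (proj₂ (tmp-free 7 p7) v))) zero-word)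
          (trans (cong toℕ (here (reg s₂) str)) (trans (cong (λ z → toℕ (word w z)) (cong₂ _*_ tmp-n (trans (cong toℕ (here (reg s₁) scr)) (toℕ-word factor<M)))) (toℕ-word st<M)))
          cells₀
          where
          cells₀ : ∀ (i : Word w) (k : Arr) x → x < st → toℕ i ≡ toℕ k * st + x → toℕ (mem s₀ i) ≡ ar σ₀ k x
          cells₀ i zero    x x< eq = trans (memory i) (cong cell eq)
          cells₀ i (suc k) x x< eq = trans (memory i) (cong (fromMaybe 0) (nth-beyond (input G) (≤-trans (≤-reflexive (input-length G))
            (≤-trans short (≤-trans (≤-trans (m≤m+n st (toℕ k * st)) (m≤m+n _ x)) (≤-reflexive (sym eq)))))))

        at-nth : ∀ is o → (∀ j → nth (code machine) (o + j) ≡ nth is j) → At o is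
        at-nth []       o h = tt
        at-nth (i ∷ is) o h = trans (cong (nth (code machine)) (sym (+-identityʳ o))) (h 0)
          , at-nth is (suc o) λ j → trans (cong (nth (code machine)) (sym (+-suc o j))) (h (suc j))

        module _ {t : ℕ} {σ′ : St} (ex : Exec c σ₀ t σ′) where

          finished : Done t (endC c 3) σ′ s₃
          finished = simulate ex (at-nth (codeC c 3) 3 (λ j → refl)) refl start-rel

          halted : nth (code machine) (pc (Done.fin finished)) ≡ nothing
          halted = nth-beyond (code machine) (≤-reflexive (trans (+-comm 3 (length (codeC c 3))) (trans (lenC c 3) (sym (Done.pcEnd finished)))))

          launched : Run machine S (3 + t) s₀ (Done.fin finished)
          launched = steps⇒run (setup ▹ Done.path finished) halted

          word-cell : ∀ x → x < st → toℕ (mem (Done.fin finished) (word w x)) ≡ ar σ′ IO x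
          word-cell x l = Rel.cells (Done.relEnd finished) (word w x) zero x l (toℕ-word (<-trans l st<M))

          word-≡ : ∀ x {y} → x < st → y ≤ 1 → ar σ′ IO x ≡ y → mem (Done.fin finished) (word w x) ≡ word w y
          word-≡ x l y≤1 e = toℕ-injective (trans (word-cell x l) (trans e (sym (toℕ-word (≤-<-trans y≤1 1<M)))))

    module Machine (P Q R r : ℕ) where
      open Weights P Q R r

      factor : ℕ
      factor = 10 + (P + Q + R + r)

      machine : Program
      machine = loaded algorithm factor

      bits space-and-time : ℕ
      bits = 2 + 32 * (factor * factor)
      space-and-time = 3 + allC + 18 * factor

      module Correct (a b : ℝ) (a≉b : a ≉ b) (K : Combinations.Key a b a≉b P Q R r)
                     (n : ℕ) (1≤n : 1 ≤ n) (G : Graph n) (acyclic : Acyclic G) (w : ℕ) (enough : bits * suc ⌊log₂ n ⌋ ≤ w) where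
        open FromGraph G hiding (m≤n)

        m≤n : m ≤ n
        m≤n = FromGraph.m≤n G acyclic

        st M S : ℕ
        st = n * factor
        M  = 2 ^ w
        S  = space-and-time * n

        room : 32 * (st * st) ≤ M
        room = ≤-trans (≤-reflexive (solve 2 (λ n f → con 32 :* ((n :* f) :* (n :* f)) := n :* n :* (con 32 :* (f :* f))) refl n factor)) (enough-bits (32 * (factor * factor)) n w enough)
          where open +-*-Solver

        part : ∀ {x} → x < factor → x < st
        part l = <-≤-trans l (≤-trans (≤-reflexive (sym (*-identityˡ factor))) (*-monoˡ-≤ factor 1≤n))

        9≤st : 9 ≤ st
        9≤st = <⇒≤ (part (s≤s (m≤m+n 9 _)))

        io<st : 4 + (n + n + (n + n)) < st
        io<st = <-≤-trans (s≤s (+-mono-≤ (*-monoʳ-≤ 4 1≤n) ≤-refl)) (≤-trans (≤-trans (+-monoˡ-≤ _ 1≤n) (≤-reflexive (solve 1 (λ n → n :+ (con 4 :* n :+ (n :+ n :+ (n :+ n))) := n :* con 9) refl n))) (*-monoʳ-≤ n (m≤m+n 9 _)))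
          where open +-*-Solver

        keys : 2 + P * n + Q * n + R * n < st
        keys = <-≤-trans (s≤s (≤-trans (≤-reflexive (solve 4 (λ p q r n → con 2 :+ p :* n :+ q :* n :+ r :* n := con 2 :+ (p :+ q :+ r) :* n) refl P Q R n)) (+-monoˡ-≤ _ (*-monoʳ-≤ 2 1≤n))))
          (≤-trans (+-monoˡ-≤ _ 1≤n) (≤-trans (≤-reflexive (solve 2 (λ s n → n :+ (con 2 :* n :+ s :* n) := n :* (con 3 :+ s)) refl (P + Q + R) n)) (*-monoʳ-≤ n (+-mono-≤ {3} {10} (m≤m+n 3 7) (m≤m+n (P + Q + R) r)))))
          where open +-*-Solver

        P<st : P < st
        P<st = part (s≤s (≤-trans (≤-trans (m≤m+n P Q) (≤-trans (m≤m+n (P + Q) R) (m≤m+n (P + Q + R) r))) (m≤n+m _ 9)))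
        Q<st : Q < st
        Q<st = part (s≤s (≤-trans (≤-trans (m≤n+m Q P) (≤-trans (m≤m+n (P + Q) R) (m≤m+n (P + Q + R) r))) (m≤n+m _ 9)))
        R<st : R < st
        R<st = part (s≤s (≤-trans (≤-trans (m≤n+m R (P + Q)) (m≤m+n (P + Q + R) r)) (m≤n+m _ 9)))
        r<st : r < st
        r<st = part (s≤s (≤-trans (m≤n+m r (P + Q + R)) (m≤n+m _ 9)))

        1≤st : 1 ≤ st
        1≤st = ≤-trans (s≤s z≤n) 9≤st

        st²≤ : ∀ {x} → x ≤ 32 → x * st ≤ M
        st²≤ l = ≤-trans (*-mono-≤ l (m≤m*n st st ⦃ >-nonZero 1≤st ⦄)) room

        cells<S : 18 * st ≤ S
        cells<S = ≤-trans (≤-reflexive (trans (cong (18 *_) (*-comm n factor)) (sym (*-assoc 18 factor n)))) (*-monoˡ-≤ n (m≤n+m (18 * factor) (3 + allC)))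

        n<st : n < st
        n<st = ≤-<-trans (≤-trans (≤-trans (m≤m+n n n) (m≤m+n (n + n) (n + n))) (m≤n+m _ 4)) io<st

        factor<M : factor < M
        factor<M = ≤-trans (≤-trans (+-mono-≤ (≤-trans 1≤st (≤-reflexive refl)) (≤-trans (≤-reflexive (sym (*-identityˡ factor))) (*-monoˡ-≤ factor 1≤n)))
          (≤-reflexive (cong (st +_) (sym (+-identityʳ st))))) (st²≤ {2} (s≤s (s≤s z≤n)))

        open Launch algorithm factor n G w S m≤n 9≤st n<st
          (≤-trans (+-mono-≤ (m≤m+n 2 2) (≤-trans (+-mono-≤ m≤n m≤n) (m≤m+n (n + n) (n + n)))) (<⇒≤ io<st)) factor<M (st²≤ (m≤m+n 18 14)) cells<S
          using (σ₀; s₀; module Done; finished; launched; word-≡)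
        setting : Setting
        setting = record
          { M = M ; st = st ; P = P ; Q = Q ; R = R ; r = r ; n = n ; m = m ; X = X ; Y = Y
          ; 9≤st = 9≤st ; room = room ; P<st = P<st ; Q<st = Q<st ; R<st = R<st ; r<st = r<st ; keys = keys ; io<st = io<st
          ; X<n = X<n ; Y<n = Y<n ; X≢Y = X≢Y ; 1≤n = 1≤n ; m≤n = m≤n ; no-leaf = FromGraph.no-leaf G acyclic }

        Answer : St → Set
        Answer = Verification.Answer setting

        open Boundary a b a≉b G K m≤n using (to-weighting; from-weighting)

        start : Verification.Start setting σ₀
        start = record
          { var≡0 = λ _ → refl ; arr≡0 = λ { zero k≢ → contradiction refl k≢ ; (suc _) _ _ → refl }
          ; n-in = refl ; m-in = refl ; X-in = λ _ → refl ; Y-in = λ _ → refl }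

        open Triples M st using (Tri; module Tri)

        module _ (run-main : Tri algorithm σ₀ (allC * n) Answer) where
          final : State w #r
          final = Done.fin (finished (Tri.exec′ run-main))

          output : Answer (Tri.fin run-main) → CorrectOutput a b G final
          output (inj₁ (yes1 , bits≤1 , pr)) = inj₁ (word-≡ (Tri.exec′ run-main) 0 1≤st ≤-refl yes1 ,
            let ω , proper , β≡ = to-weighting (λ e → ar (Tri.fin run-main) IO (1 + e)) bits≤1 pr in
            ω , proper , λ e → word-≡ (Tri.exec′ run-main) (1 + toℕ e) (≤-<-trans (≤-trans (toℕ<n e) m≤n) n<st) (≤-trans (≤-reflexive (sym (β≡ e))) (bits≤1 (toℕ e) (toℕ<n e))) (β≡ e))
          output (inj₂ (no0 , none)) = inj₂ (word-≡ (Tri.exec′ run-main) 0 1≤st z≤n no0 , λ { (ω , proper) → let β , β≤1 , pr = from-weighting ω proper in none β β≤1 pr })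

          within : 3 + Tri.time run-main ≤ space-and-time * n
          within = ≤-trans (sum≤ 3 allC n (*-monoʳ-≤ 3 1≤n) (Tri.bound run-main)) (*-monoˡ-≤ n (m≤m+n (3 + allC) (18 * factor)))

          result : ∃[ t ] ∃[ s ] (t ≤ space-and-time * n × Run machine (space-and-time * n) t s₀ s × CorrectOutput a b G s)
          result = 3 + Tri.time run-main , final , within , launched (Tri.exec′ run-main) , output (Tri.post run-main)

        correct : ∃[ t ] ∃[ s ] (t ≤ space-and-time * n × Run machine (space-and-time * n) t (initial w (registers machine) G) s × CorrectOutput a b G s)
        correct = result (Verification.algorithmT setting σ₀ start)

    Solved : ℝ → ℝ → Set
    Solved a b = Σ Program λ P → ∃[ k ] ∃[ c ]
      (∀ (n : ℕ) (T : Graph n) → IsTree T →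
       ∀ (w : ℕ) → k * suc ⌊log₂ n ⌋ ≤ w →
       ∃[ t ] ∃[ final ]
         (t ≤ c * n × Run P (c * n) t (initial w (registers P) T) final × CorrectOutput a b T final))

open IntegerRelations using (module Combinations)
open Machines using (module Machine; Solved)

open import Defs
open import Level using (0ℓ)
open import Axiom.ExcludedMiddle using (ExcludedMiddle)
open import Data.Nat.Base using (ℕ; suc; _*_; _≤_; >-nonZero⁻¹)
open import Data.Nat.Logarithm using (⌊log₂_⌋)

corollary15 : ExcludedMiddle 0ℓ →
    (a b : ℝ) → a ≉ b →
    Σ Program λ P → ∃[ k ] ∃[ c ]
    (∀ (n : ℕ) (T : Graph n) → IsTree T →
    ∀ (w : ℕ) → k * suc ⌊log₂ n ⌋ ≤ w →
    ∃[ t ] ∃[ final ]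
    (t ≤ c * n ×
    Run P (c * n) t (initial w (registers P) T) final ×
    CorrectOutput a b T final))
corollary15 em a b a≉b = machine-for (Combinations.key a b a≉b em)
  where
  machine-for : (∃[ P ] ∃[ Q ] ∃[ R ] ∃[ r ] Combinations.Key a b a≉b P Q R r) → Solved a b
  machine-for (P , Q , R , r , K) = Machine.machine P Q R r , Machine.bits P Q R r , Machine.space-and-time P Q R r ,
    λ n T (n≢0 , _ , acyclic) w enough → Machine.Correct.correct P Q R r a b a≉b K n (>-nonZero⁻¹ n ⦃ n≢0 ⦄) T acyclic w enough
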